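{- For every odd prime number $p$, there is an infinite set $S(p)$ of prime numbers $q$ such that, for each $q \in S(p)$, $2q$ does not lie in the image of $\phi$ and $p$ divides $2q+1$.
   Context: $\mathbb{N}^*$ denotes the set of positive integers. $\phi$ is Euler's totient function: for $n \in \mathbb{N}^*$, $\phi(n)$ is the number of integers $x$ with $1 \le x \le n$ and $\gcd(x,n) = 1$. The image of $\phi$ is $\{\phi(n) : n \in \mathbb{N}^*\}$. -}

module Defs where

open import Data.Nat using (ℕ; zero; suc; _+_; _*_; _≤_)
open import Data.Nat.GCD using (gcd)
open import Data.List using (List; length; filter; upTo; map)
open import Data.Product using (∃-syntax; _×_)
open import Relation.Binary.PropositionalEquality using (_≡_)
open import Data.Nat.Properties using (_≟_)

φ : ℕ → ℕ
φ n = length (filter (λ x → gcd x n ≟ 1) (map suc (upTo n)))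

InImageφ : ℕ → Set
InImageφ m = ∃[ n ] (1 ≤ n × φ n ≡ m)

{-# OPTIONS --safe #-}
module Submission where

-- If φ(n) = 2q with q > 3 prime, then 2q + 1 is prime.  So it suffices to find infinitely many primes
-- q ≡ (p - 1)/2 mod p: then p is a proper divisor of 2q + 1.  This is Dirichlet's theorem for the prime modulus
-- k = p, proved effectively over ℚ along the lines of Selberg's elementary proof.  On 1, …, X the logarithm is
-- replaced by a rational completely additive function f that increases like log.
--
-- Put P_u(t) = Σ Λ(n)/n over n ≤ 2^t, n ≡ u.  Since Λ₂ = Λ·log + Λ*Λ is the Möbius inverse of log², the sum of
-- Λ₂(n)/n over n ≤ x, n ≡ l is independent of l up to O(log x), hence equal to log²x/(k-1) + O(log x).  So
-- P_u(t) ≤ 2t/(k-1) + o(t), and whenever a class l = uw is light (P_l = o(t)), either u is light or w is full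
-- (P_w nearly maximal); if l is full and l = g², then g is light.
--
-- Suppose the class a contains no large prime, so that a is light.  From a = 1·a the class 1 is light.  Let r = g²
-- not be light.  From a = r·(a/r), used twice, r is full; so g is light; from g = r·g⁻¹ the class g⁻¹ is full; and
-- 1 = g⁻¹·g contradicts that 1 and g are light.  Finally, some r = g² is not light because L(1, χ) ≠ 0 for the
-- Legendre symbol χ, which bounds Σ χ(n)Λ(n)/n.

-- Selberg's formula has a parity obstacle: every relation drawn from it stays consistent if the
-- whole mass lies, doubled, on the non-squares while the squares receive their share of Λ₂ from
-- products of two such primes. This is why a square class of known weight has to be supplied from
-- outside, and why it must be a square. Exact additivity of f is essential because 1 * Λ = f and 1
-- * Λ₂ = f² are used as identities; for sizes it is enough that f(n+1) - f(n) lies between 0 and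
-- 2/n. The argument is finite. A putative gap up to X = 2^T* is refuted for one explicit T* = M².
-- Upper bounds for the growth of a class carry an error O(M), obtained by balancing T*/M against M;
-- the relations between classes have size T*² = M⁴ and error O(M³), so a relative error of order
-- 1/M remains and a large M contradicts fixed numerical inequalities. A relation l = uw at scale 2t
-- speaks about u and w at scale t, so the chain of relations descends through T*, T*/2, T*/4, T*/8.

-- Rational arithmetic: inequalities, reciprocals, powers

module Rationals where

  open import Data.Nat as ℕ using (ℕ; zero; suc)
  import Data.Nat.Properties as ℕₚ
  import Data.Integer as ℤ
  open import Data.Rational
  open import Data.Rational.Properties
  open import Data.Sum using (inj₁; inj₂)
  open import Data.Empty using (⊥-elim)
  open import Data.List using ([]; _∷_)
  open import Relation.Nullary using (yes; no)
  open import Relation.Nullary.Decidable using (dec⇒maybe)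
  open import Relation.Binary.PropositionalEquality
  open import Level using (0ℓ)
  open import Tactic.RingSolver using (solve; solve-∀)
  open import Tactic.RingSolver.Core.AlmostCommutativeRing using (AlmostCommutativeRing; fromCommutativeRing)

  ring : AlmostCommutativeRing 0ℓ 0ℓ
  ring = fromCommutativeRing +-*-commutativeRing λ x → dec⇒maybe (0ℚ ≟ x)

  2ℚ : ℚ
  2ℚ = ℤ.+ 2 / 1

  infixl 6 _⊕_
  infixl 7 _⊗_

  _⊕_ : ∀ {a b} → 0ℚ ≤ a → 0ℚ ≤ b → 0ℚ ≤ a + b
  _⊕_ {a} {b} p q = nonNegative⁻¹ (a + b) {{nonNeg+nonNeg⇒nonNeg a {{nonNegative p}} b {{nonNegative q}}}}

  _⊗_ : ∀ {a b} → 0ℚ ≤ a → 0ℚ ≤ b → 0ℚ ≤ a * b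
  _⊗_ {a} {b} p q = nonNegative⁻¹ (a * b) {{nonNeg*nonNeg⇒nonNeg a {{nonNegative p}} b {{nonNegative q}}}}

  Δ : ∀ {a b} → a ≤ b → 0ℚ ≤ b - a
  Δ {a} {b} p = subst (_≤ b - a) (+-inverseʳ a) (+-monoˡ-≤ (- a) p)

  from-Δ : ∀ {a b} → 0ℚ ≤ b - a → a ≤ b
  from-Δ {a} {b} p = subst₂ _≤_ (+-identityˡ a) (lemma a b) (+-monoˡ-≤ a p)
    where
    lemma : ∀ a b → b - a + a ≡ b
    lemma = solve-∀ ring

  -- A linear-arithmetic certificate: a nonnegative combination of the hypotheses, and the ring identity.
  by : ∀ {a b c} → 0ℚ ≤ c → c ≡ b - a → a ≤ b
  by p eq = from-Δ (subst (0ℚ ≤_) eq p)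

  0≤1 : 0ℚ ≤ 1ℚ
  0≤1 = nonNegative⁻¹ 1ℚ

  0<1 : 0ℚ < 1ℚ
  0<1 = positive⁻¹ 1ℚ

  ≡⇒≤ : ∀ {a b} → a ≡ b → a ≤ b
  ≡⇒≤ = ≤-reflexive

  *-monoˡ : ∀ {a b} c → 0ℚ ≤ c → a ≤ b → c * a ≤ c * b
  *-monoˡ c p = *-monoˡ-≤-nonNeg c {{nonNegative p}}

  *-monoʳ : ∀ {a b} c → 0ℚ ≤ c → a ≤ b → a * c ≤ b * c
  *-monoʳ c p = *-monoʳ-≤-nonNeg c {{nonNegative p}}

  *-mono : ∀ {a b c d} → 0ℚ ≤ a → 0ℚ ≤ d → a ≤ b → c ≤ d → a * c ≤ b * d
  *-mono {a} {b} {c} {d} p q r s = ≤-trans (*-monoˡ a p s) (*-monoʳ d q r)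

  *-cancel : ∀ {a b} c → 0ℚ < c → c * a ≤ c * b → a ≤ b
  *-cancel c p = *-cancelˡ-≤-pos c {{positive p}}

  *-pos : ∀ {a b} → 0ℚ < a → 0ℚ < b → 0ℚ < a * b
  *-pos {a} {b} p q = positive⁻¹ (a * b) {{pos*pos⇒pos a {{positive p}} b {{positive q}}}}

  +-pos : ∀ {a b} → 0ℚ < a → 0ℚ ≤ b → 0ℚ < a + b
  +-pos {a} {b} p q = positive⁻¹ (a + b) {{pos+nonNeg⇒pos a {{positive p}} b {{nonNegative q}}}}

  abs≤ : ∀ {a b} → a ≤ b → - b ≤ a → ∣ a ∣ ≤ b
  abs≤ {a} {b} p q with ∣p∣≡p∨∣p∣≡-p a
  ... | inj₁ e = subst (_≤ b) (sym e) p
  ... | inj₂ e = subst (_≤ b) (sym e) (by (Δ q) (solve (a ∷ b ∷ []) ring))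

  ≤abs : ∀ a → a ≤ ∣ a ∣
  ≤abs a with ≤-total 0ℚ a
  ... | inj₁ p = ≡⇒≤ (sym (0≤p⇒∣p∣≡p p))
  ... | inj₂ p = ≤-trans p (0≤∣p∣ a)

  -abs≤ : ∀ a → - ∣ a ∣ ≤ a
  -abs≤ a = subst₂ _≤_ (cong -_ (∣-p∣≡∣p∣ a)) (lemma a) (neg-antimono-≤ (≤abs (- a)))
    where
    lemma : ∀ a → - (- a) ≡ a
    lemma = solve-∀ ring

  ≤-abs : ∀ {a b} → ∣ a ∣ ≤ b → a ≤ b
  ≤-abs {a} = ≤-trans (≤abs a)

  -≤abs : ∀ {a b} → ∣ a ∣ ≤ b → - b ≤ a
  -≤abs {a} p = ≤-trans (neg-antimono-≤ p) (-abs≤ a)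

  abs+ : ∀ {a b c d} → ∣ a ∣ ≤ c → ∣ b ∣ ≤ d → ∣ a + b ∣ ≤ c + d
  abs+ {a} {b} p q = ≤-trans (∣p+q∣≤∣p∣+∣q∣ a b) (+-mono-≤ p q)

  abs* : ∀ {a b c d} → ∣ a ∣ ≤ c → ∣ b ∣ ≤ d → ∣ a * b ∣ ≤ c * d
  abs* {a} {b} {c} {d} p q = ≤-trans (≡⇒≤ (∣p*q∣≡∣p∣*∣q∣ a b))
    (*-mono (0≤∣p∣ a) (≤-trans (0≤∣p∣ b) q) p q)

  0≤² : ∀ a → 0ℚ ≤ a * a
  0≤² a with ≤-total 0ℚ a
  ... | inj₁ p = p ⊗ p
  ... | inj₂ p = subst (0ℚ ≤_) (lemma a) (Δ p ⊗ Δ p)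
    where
    lemma : ∀ a → (0ℚ - a) * (0ℚ - a) ≡ a * a
    lemma = solve-∀ ring

  -- Defined by recursion, not through ℤ, so that `ι (suc n)` unfolds to `1ℚ + ι n` and identities
  -- between consecutive integers fall to the ring solver.
  ι : ℕ → ℚ
  ι zero    = 0ℚ
  ι (suc n) = 1ℚ + ι n

  0≤ι : ∀ n → 0ℚ ≤ ι n
  0≤ι zero    = ≤-refl
  0≤ι (suc n) = 0≤1 ⊕ 0≤ι n

  0<ι : ∀ n → .{{ℕ.NonZero n}} → 0ℚ < ι n
  0<ι (suc n) = +-pos 0<1 (0≤ι n)

  ι-+ : ∀ m n → ι (m ℕ.+ n) ≡ ι m + ι n
  ι-+ zero    n = sym (+-identityˡ (ι n))
  ι-+ (suc m) n = trans (cong (1ℚ +_) (ι-+ m n)) (sym (+-assoc 1ℚ (ι m) (ι n)))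

  ι-* : ∀ m n → ι (m ℕ.* n) ≡ ι m * ι n
  ι-* zero    n = sym (*-zeroˡ (ι n))
  ι-* (suc m) n = trans (ι-+ n (m ℕ.* n)) (trans (cong (ι n +_) (ι-* m n)) (lemma (ι m) (ι n)))
    where
    lemma : ∀ a b → b + a * b ≡ (1ℚ + a) * b
    lemma = solve-∀ ring

  ι-mono : ∀ {m n} → m ℕ.≤ n → ι m ≤ ι n
  ι-mono {n = n} ℕ.z≤n = 0≤ι n
  ι-mono (ℕ.s≤s p) = +-monoʳ-≤ 1ℚ (ι-mono p)

  -- Total reciprocal: rc 0 = 0.
  opaque
    rc : ℚ → ℚ
    rc p with p ≟ 0ℚ
    ... | yes _ = 0ℚ
    ... | no  q = (1/ p) {{≢-nonZero q}}

    rc-inv : ∀ {p} → 0ℚ < p → p * rc p ≡ 1ℚ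
    rc-inv {p} pos with p ≟ 0ℚ
    ... | yes refl = ⊥-elim (<-irrefl refl pos)
    ... | no  q    = *-inverseʳ p {{≢-nonZero q}}

  rc-pos : ∀ {p} → 0ℚ < p → 0ℚ < rc p
  rc-pos {p} pos with 0ℚ <? rc p
  ... | yes q = q
  ... | no  q = ⊥-elim (<-irrefl refl (<-≤-trans 0<1
    (subst₂ _≤_ (rc-inv pos) (*-zeroʳ p) (*-monoˡ p (<⇒≤ pos) (≮⇒≥ q)))))

  rc-unique : ∀ {p q} → 0ℚ < p → p * q ≡ 1ℚ → q ≡ rc p
  rc-unique {p} {q} pos e = begin
    q              ≡⟨ solve (q ∷ []) ring ⟩
    1ℚ * q         ≡⟨ cong (_* q) (sym (rc-inv pos)) ⟩
    p * rc p * q   ≡⟨ lemma p (rc p) q ⟩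
    p * q * rc p   ≡⟨ cong (_* rc p) e ⟩
    1ℚ * rc p      ≡⟨ *-identityˡ (rc p) ⟩
    rc p ∎
    where
    open ≡-Reasoning
    lemma : ∀ p r q → p * r * q ≡ p * q * r
    lemma = solve-∀ ring

  v : ℕ → ℚ
  v n = rc (ι n)

  ι*v : ∀ n → .{{ℕ.NonZero n}} → ι n * v n ≡ 1ℚ
  ι*v n = rc-inv (0<ι n)

  0<v : ∀ n → .{{ℕ.NonZero n}} → 0ℚ < v n
  0<v n = rc-pos (0<ι n)

  0≤v : ∀ n → .{{ℕ.NonZero n}} → 0ℚ ≤ v n
  0≤v n = <⇒≤ (0<v n)

  v1 : v 1 ≡ 1ℚ
  v1 = sym (rc-unique (0<ι 1) refl)

  v-* : ∀ m n → .{{ℕ.NonZero m}} → .{{ℕ.NonZero n}} → v (m ℕ.* n) ≡ v m * v n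
  v-* m n = sym (rc-unique (0<ι (m ℕ.* n) {{ℕₚ.m*n≢0 m n}}) (begin
    ι (m ℕ.* n) * (v m * v n)   ≡⟨ cong (_* (v m * v n)) (ι-* m n) ⟩
    ι m * ι n * (v m * v n)     ≡⟨ lemma (ι m) (ι n) (v m) (v n) ⟩
    ι m * v m * (ι n * v n)     ≡⟨ cong₂ _*_ (ι*v m) (ι*v n) ⟩
    1ℚ ∎))
    where
    open ≡-Reasoning
    lemma : ∀ a b c d → a * b * (c * d) ≡ a * c * (b * d)
    lemma = solve-∀ ring

  ≤v : ∀ n {x c} → .{{ℕ.NonZero n}} → ι n * x ≤ c → x ≤ c * v n
  ≤v n {x} {c} p = *-cancel (ι n) (0<ι n) (≤-trans p (≡⇒≤ (begin
    c                 ≡⟨ sym (*-identityʳ c) ⟩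
    c * 1ℚ            ≡⟨ cong (c *_) (sym (ι*v n)) ⟩
    c * (ι n * v n)   ≡⟨ lemma c (ι n) (v n) ⟩
    ι n * (c * v n)   ∎)))
    where
    open ≡-Reasoning
    lemma : ∀ c a b → c * (a * b) ≡ a * (c * b)
    lemma = solve-∀ ring

  v≤ : ∀ n {x c} → .{{ℕ.NonZero n}} → c ≤ ι n * x → c * v n ≤ x
  v≤ n {x} {c} p = *-cancel (ι n) (0<ι n) (≤-trans (≡⇒≤ (sym (begin
    c                 ≡⟨ sym (*-identityʳ c) ⟩
    c * 1ℚ            ≡⟨ cong (c *_) (sym (ι*v n)) ⟩
    c * (ι n * v n)   ≡⟨ lemma c (ι n) (v n) ⟩
    ι n * (c * v n)   ∎))) p)
    where
    open ≡-Reasoning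
    lemma : ∀ c a b → c * (a * b) ≡ a * (c * b)
    lemma = solve-∀ ring

  v-anti : ∀ {m n} → .{{ℕ.NonZero m}} → m ℕ.≤ n → v n ≤ v m
  v-anti {suc m} {suc n} p = subst (_≤ v (suc m)) (*-identityˡ (v (suc n)))
    (v≤ (suc n) (≤-trans (≡⇒≤ (sym (ι*v (suc m)))) (*-monoʳ (v (suc m)) (0≤v (suc m)) (ι-mono p))))

  v≤1 : ∀ n → .{{ℕ.NonZero n}} → v n ≤ 1ℚ
  v≤1 (suc n) = subst (v (suc n) ≤_) v1 (v-anti (ℕ.s≤s (ℕ.z≤n {n})))

  -- The value 1/(n(n + 1)) as a difference. It is what makes potentials with denominator n
  -- telescope in the summations by parts.
  v-step : ∀ n → .{{ℕ.NonZero n}} → v n * v (suc n) ≡ v n - v (suc n)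
  v-step n = begin
    v n * v (suc n)                                                  ≡⟨ lemma (ι n) (v n) (v (suc n)) ⟩
    v n * ((1ℚ + ι n) * v (suc n)) - (ι n * v n) * v (suc n)         ≡⟨ cong₂ (λ a b → v n * a - b * v (suc n)) (ι*v (suc n)) (ι*v n) ⟩
    v n * 1ℚ - 1ℚ * v (suc n)                                        ≡⟨ lemma₂ (v n) (v (suc n)) ⟩
    v n - v (suc n) ∎
    where
    open ≡-Reasoning
    lemma : ∀ a b c → b * c ≡ b * ((1ℚ + a) * c) - (a * b) * c
    lemma = solve-∀ ring
    lemma₂ : ∀ b c → b * 1ℚ - 1ℚ * c ≡ b - c
    lemma₂ = solve-∀ ring

  infixr 8 _^_

  _^_ : ℚ → ℕ → ℚ
  x ^ zero  = 1ℚ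
  x ^ suc n = x * x ^ n

  ^-+ : ∀ x m n → x ^ (m ℕ.+ n) ≡ x ^ m * x ^ n
  ^-+ x zero    n = sym (*-identityˡ (x ^ n))
  ^-+ x (suc m) n = trans (cong (x *_) (^-+ x m n)) (sym (*-assoc x (x ^ m) (x ^ n)))

  ^-nonneg : ∀ {x} n → 0ℚ ≤ x → 0ℚ ≤ x ^ n
  ^-nonneg zero    p = 0≤1
  ^-nonneg (suc n) p = p ⊗ ^-nonneg n p

-- Finite sums, indicators and summation by parts

module Sums where

  open import Data.Nat as ℕ using (ℕ; zero; suc)
  import Data.Nat.Properties as ℕₚ
  open import Data.Nat.Divisibility using (_∣_; _∣?_; ∣⇒≤; ∣m+n∣m⇒∣n; ∣m∣n⇒∣m+n; m∣m*n; ∣-refl)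
  open import Data.Rational
  open import Data.Rational.Properties
  open import Data.Bool using (if_then_else_)
  open import Data.Empty using (⊥-elim)
  open import Function using (_∘_)
  open import Relation.Nullary using (¬_; yes; no; Dec; does)
  open import Relation.Binary.PropositionalEquality
  open import Tactic.RingSolver using (solve-∀)
  open Rationals

  opaque
    -- Conditions on summation indices are carried as factors 0 or 1, so that sums run over full
    -- intervals and can be exchanged without tracking dependent ranges.
    ⟦_⟧ : ∀ {ℓ} {P : Set ℓ} → Dec P → ℚ
    ⟦ d ⟧ = if does d then 1ℚ else 0ℚ

    ⟦yes⟧ : ∀ {ℓ} {P : Set ℓ} (d : Dec P) → P → ⟦ d ⟧ ≡ 1ℚ
    ⟦yes⟧ (yes _) _ = refl
    ⟦yes⟧ (no q)  p = ⊥-elim (q p)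

    ⟦no⟧ : ∀ {ℓ} {P : Set ℓ} (d : Dec P) → ¬ P → ⟦ d ⟧ ≡ 0ℚ
    ⟦no⟧ (yes p) q = ⊥-elim (q p)
    ⟦no⟧ (no _)  _ = refl

  ⟦⟧-case : ∀ {ℓ ℓ′} {P : Set ℓ} (d : Dec P) (Q : ℚ → Set ℓ′) → (P → Q 1ℚ) → (¬ P → Q 0ℚ) → Q ⟦ d ⟧
  ⟦⟧-case d@(yes p) Q f g = subst Q (sym (⟦yes⟧ d p)) (f p)
  ⟦⟧-case d@(no p)  Q f g = subst Q (sym (⟦no⟧ d p)) (g p)

  ⟦⟧-cong : ∀ {ℓ ℓ′} {P : Set ℓ} {Q : Set ℓ′} (d : Dec P) (e : Dec Q) → (P → Q) → (Q → P) → ⟦ d ⟧ ≡ ⟦ e ⟧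
  ⟦⟧-cong d e f g = ⟦⟧-case d (_≡ ⟦ e ⟧) (λ p → sym (⟦yes⟧ e (f p))) (λ p → sym (⟦no⟧ e (p ∘ g)))

  0≤⟦⟧ : ∀ {ℓ} {P : Set ℓ} (d : Dec P) → 0ℚ ≤ ⟦ d ⟧
  0≤⟦⟧ d = ⟦⟧-case d (0ℚ ≤_) (λ _ → 0≤1) (λ _ → ≤-refl)

  ⟦⟧≤1 : ∀ {ℓ} {P : Set ℓ} (d : Dec P) → ⟦ d ⟧ ≤ 1ℚ
  ⟦⟧≤1 d = ⟦⟧-case d (_≤ 1ℚ) (λ _ → ≤-refl) (λ _ → 0≤1)

  ⟦⟧-elim : ∀ {ℓ} {P : Set ℓ} (d : Dec P) {x y : ℚ} → (P → x ≡ y) → (¬ P → 0ℚ ≡ y) → ⟦ d ⟧ * x ≡ y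
  ⟦⟧-elim d {x} {y} h₁ h₂ = ⟦⟧-case d (λ c → c * x ≡ y) (λ p → trans (*-identityˡ x) (h₁ p)) (λ p → trans (*-zeroˡ x) (h₂ p))

  ⟦⟧-* : ∀ {ℓ} {P : Set ℓ} (d : Dec P) {x y : ℚ} → (P → x ≡ y) → ⟦ d ⟧ * x ≡ ⟦ d ⟧ * y
  ⟦⟧-* d {x} {y} h = ⟦⟧-case d (λ c → c * x ≡ c * y) (λ p → cong (1ℚ *_) (h p)) (λ p → trans (*-zeroˡ x) (sym (*-zeroˡ y)))

  ⟦⟧-≤ : ∀ {ℓ ℓ′} {P : Set ℓ} {Q : Set ℓ′} (d : Dec P) (e : Dec Q) → (P → Q) → ⟦ d ⟧ ≤ ⟦ e ⟧
  ⟦⟧-≤ d e f = ⟦⟧-case d (_≤ ⟦ e ⟧) (λ p → ≡⇒≤ (sym (⟦yes⟧ e (f p)))) (λ _ → 0≤⟦⟧ e)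

  sum : ℕ → (ℕ → ℚ) → ℚ
  sum zero    f = 0ℚ
  sum (suc n) f = sum n f + f n

  sum-cong : ∀ n {f g} → (∀ i → i ℕ.< n → f i ≡ g i) → sum n f ≡ sum n g
  sum-cong zero    h = refl
  sum-cong (suc n) h = cong₂ _+_ (sum-cong n λ i p → h i (ℕₚ.m<n⇒m<1+n p)) (h n (ℕₚ.n<1+n n))

  sum-mono : ∀ n {f g} → (∀ i → i ℕ.< n → f i ≤ g i) → sum n f ≤ sum n g
  sum-mono zero    h = ≤-refl
  sum-mono (suc n) h = +-mono-≤ (sum-mono n λ i p → h i (ℕₚ.m<n⇒m<1+n p)) (h n (ℕₚ.n<1+n n))

  sum-0 : ∀ n → sum n (λ _ → 0ℚ) ≡ 0ℚ
  sum-0 zero    = refl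
  sum-0 (suc n) = trans (+-identityʳ _) (sum-0 n)

  sum-zero : ∀ n {f} → (∀ i → i ℕ.< n → f i ≡ 0ℚ) → sum n f ≡ 0ℚ
  sum-zero n h = trans (sum-cong n h) (sum-0 n)

  sum-nonneg : ∀ n {f} → (∀ i → i ℕ.< n → 0ℚ ≤ f i) → 0ℚ ≤ sum n f
  sum-nonneg n h = ≤-trans (≡⇒≤ (sym (sum-0 n))) (sum-mono n h)

  sum-+ : ∀ n f g → sum n (λ i → f i + g i) ≡ sum n f + sum n g
  sum-+ zero    f g = refl
  sum-+ (suc n) f g = trans (cong (_+ (f n + g n)) (sum-+ n f g)) (lemma (sum n f) (sum n g) (f n) (g n))
    where
    lemma : ∀ a b c d → a + b + (c + d) ≡ a + c + (b + d)
    lemma = solve-∀ ring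

  sum-*ˡ : ∀ n c f → sum n (λ i → c * f i) ≡ c * sum n f
  sum-*ˡ zero    c f = sym (*-zeroʳ c)
  sum-*ˡ (suc n) c f = trans (cong (_+ c * f n) (sum-*ˡ n c f)) (sym (*-distribˡ-+ c (sum n f) (f n)))

  sum-*ʳ : ∀ n c f → sum n (λ i → f i * c) ≡ sum n f * c
  sum-*ʳ n c f = trans (sum-cong n λ i _ → *-comm (f i) c) (trans (sum-*ˡ n c f) (*-comm c (sum n f)))

  sum-- : ∀ n f g → sum n (λ i → f i - g i) ≡ sum n f - sum n g
  sum-- zero    f g = refl
  sum-- (suc n) f g = trans (cong (_+ (f n - g n)) (sum-- n f g)) (lemma (sum n f) (sum n g) (f n) (g n))
    where
    lemma : ∀ a b c d → a - b + (c - d) ≡ a + c - (b + d)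
    lemma = solve-∀ ring

  sum-swap : ∀ m n (f : ℕ → ℕ → ℚ) → sum m (λ i → sum n (f i)) ≡ sum n (λ j → sum m (λ i → f i j))
  sum-swap zero    n f = sym (sum-0 n)
  sum-swap (suc m) n f = trans (cong (_+ sum n (f m)) (sum-swap m n f)) (sym (sum-+ n _ (f m)))

  sum-const : ∀ n c → sum n (λ _ → c) ≡ ι n * c
  sum-const zero    c = sym (*-zeroˡ c)
  sum-const (suc n) c = trans (cong (_+ c) (sum-const n c)) (lemma (ι n) c)
    where
    lemma : ∀ a c → a * c + c ≡ (1ℚ + a) * c
    lemma = solve-∀ ring

  sum-abs : ∀ n {f g} → (∀ i → i ℕ.< n → ∣ f i ∣ ≤ g i) → ∣ sum n f ∣ ≤ sum n g
  sum-abs zero    h = ≤-refl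
  sum-abs (suc n) h = abs+ (sum-abs n λ i p → h i (ℕₚ.m<n⇒m<1+n p)) (h n (ℕₚ.n<1+n n))

  sum-split : ∀ m n f → sum (m ℕ.+ n) f ≡ sum m f + sum n (λ i → f (m ℕ.+ i))
  sum-split m zero    f = trans (cong (λ x → sum x f) (ℕₚ.+-identityʳ m)) (sym (+-identityʳ _))
  sum-split m (suc n) f = trans (cong (λ x → sum x f) (ℕₚ.+-suc m n))
    (trans (cong (_+ f (m ℕ.+ n)) (sum-split m n f)) (+-assoc (sum m f) _ _))

  sum-head : ∀ n f → sum (suc n) f ≡ f 0 + sum n (f ∘ suc)
  sum-head n f = trans (sum-split 1 n f) (cong (_+ sum n (f ∘ suc)) (+-identityˡ (f 0)))

  sum-single : ∀ n j f → j ℕ.< n → (∀ i → i ℕ.< n → i ≢ j → f i ≡ 0ℚ) → sum n f ≡ f j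
  sum-single (suc n) j f p h with j ℕ.≟ n
  ... | yes refl = trans (cong (_+ f n) (sum-zero n λ i q → h i (ℕₚ.m<n⇒m<1+n q) (ℕₚ.<⇒≢ q))) (+-identityˡ (f n))
  ... | no  q    = trans (cong₂ _+_ (sum-single n j f (ℕₚ.≤∧≢⇒< (ℕₚ.≤-pred p) q) λ i r → h i (ℕₚ.m<n⇒m<1+n r))
                                    (h n (ℕₚ.n<1+n n) (q ∘ sym))) (+-identityʳ (f j))

  infix 4 _∈1‥_
  record _∈1‥_ (n y : ℕ) : Set where
    constructor _﹐_
    field
      lo : 1 ℕ.≤ n
      hi : n ℕ.≤ y
  open _∈1‥_ public

  private
    ∈suc : ∀ {i y} → i ℕ.< y → suc i ∈1‥ y
    ∈suc p = ℕ.s≤s ℕ.z≤n ﹐ p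

  -- Σ₁ y g is the sum of g over 1, …, y.
  opaque
    Σ₁ : ℕ → (ℕ → ℚ) → ℚ
    Σ₁ y g = sum y (λ i → g (suc i))

    Σ₁-cong : ∀ y {f g} → (∀ n → n ∈1‥ y → f n ≡ g n) → Σ₁ y f ≡ Σ₁ y g
    Σ₁-cong y h = sum-cong y λ i p → h (suc i) (∈suc p)

    Σ₁-mono : ∀ y {f g} → (∀ n → n ∈1‥ y → f n ≤ g n) → Σ₁ y f ≤ Σ₁ y g
    Σ₁-mono y h = sum-mono y λ i p → h (suc i) (∈suc p)

    Σ₁-zero : ∀ y {f} → (∀ n → n ∈1‥ y → f n ≡ 0ℚ) → Σ₁ y f ≡ 0ℚ
    Σ₁-zero y h = sum-zero y λ i p → h (suc i) (∈suc p)

    Σ₁-nonneg : ∀ y {f} → (∀ n → n ∈1‥ y → 0ℚ ≤ f n) → 0ℚ ≤ Σ₁ y f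
    Σ₁-nonneg y h = sum-nonneg y λ i p → h (suc i) (∈suc p)

    Σ₁-abs : ∀ y {f g} → (∀ n → n ∈1‥ y → ∣ f n ∣ ≤ g n) → ∣ Σ₁ y f ∣ ≤ Σ₁ y g
    Σ₁-abs y h = sum-abs y λ i p → h (suc i) (∈suc p)

    Σ₁-+ : ∀ y f g → Σ₁ y (λ n → f n + g n) ≡ Σ₁ y f + Σ₁ y g
    Σ₁-+ y f g = sum-+ y (f ∘ suc) (g ∘ suc)

    Σ₁-- : ∀ y f g → Σ₁ y (λ n → f n - g n) ≡ Σ₁ y f - Σ₁ y g
    Σ₁-- y f g = sum-- y (f ∘ suc) (g ∘ suc)

    Σ₁-*ˡ : ∀ y c f → Σ₁ y (λ n → c * f n) ≡ c * Σ₁ y f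
    Σ₁-*ˡ y c f = sum-*ˡ y c (f ∘ suc)

    Σ₁-*ʳ : ∀ y c f → Σ₁ y (λ n → f n * c) ≡ Σ₁ y f * c
    Σ₁-*ʳ y c f = sum-*ʳ y c (f ∘ suc)

    Σ₁-swap : ∀ x y (f : ℕ → ℕ → ℚ) → Σ₁ x (λ a → Σ₁ y (f a)) ≡ Σ₁ y (λ b → Σ₁ x (λ a → f a b))
    Σ₁-swap x y f = sum-swap x y (λ i j → f (suc i) (suc j))

    Σ₁-single : ∀ y m f → m ∈1‥ y → (∀ n → n ∈1‥ y → n ≢ m → f n ≡ 0ℚ) → Σ₁ y f ≡ f m
    Σ₁-single y (suc m) f (p ﹐ q) h = sum-single y m (f ∘ suc) q λ i r s → h (suc i) (∈suc r) (s ∘ ℕₚ.suc-injective)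

    Σ₁-split : ∀ m n f → Σ₁ (m ℕ.+ n) f ≡ Σ₁ m f + Σ₁ n (λ i → f (m ℕ.+ i))
    Σ₁-split m n f = trans (sum-split m n (f ∘ suc))
      (cong (Σ₁ m f +_) (sum-cong n λ i _ → cong f (sym (ℕₚ.+-suc m i))))

    Σ₁≡sum : ∀ y f → Σ₁ y f ≡ sum y (f ∘ suc)
    Σ₁≡sum y f = refl

    Σ₁-suc : ∀ y f → Σ₁ (suc y) f ≡ Σ₁ y f + f (suc y)
    Σ₁-suc y f = refl

    Σ₁-0 : ∀ f → Σ₁ 0 f ≡ 0ℚ
    Σ₁-0 f = refl

  Σ₁-δ : ∀ y m (f : ℕ → ℚ) → 1 ℕ.≤ m → Σ₁ y (λ n → ⟦ m ℕ.≟ n ⟧ * f n) ≡ ⟦ m ℕ.≤? y ⟧ * f m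
  Σ₁-δ y m f p = sym (⟦⟧-elim (m ℕ.≤? y)
    (λ q → sym (trans (Σ₁-single y m _ (p ﹐ q) λ n _ r → trans (cong (_* f n) (⟦no⟧ (m ℕ.≟ n) (r ∘ sym))) (*-zeroˡ (f n)))
                      (trans (cong (_* f m) (⟦yes⟧ (m ℕ.≟ m) refl)) (*-identityˡ (f m)))))
    (λ q → sym (Σ₁-zero y λ n r → trans (cong (_* f n) (⟦no⟧ (m ℕ.≟ n) λ { refl → q (hi r) })) (*-zeroˡ (f n)))))

  Σ₁-restrict : ∀ X y f → y ℕ.≤ X → Σ₁ X (λ n → ⟦ n ℕ.≤? y ⟧ * f n) ≡ Σ₁ y f
  Σ₁-restrict X y f p = begin
    Σ₁ X g                                              ≡⟨ cong (λ x → Σ₁ x g) (sym (ℕₚ.m+[n∸m]≡n p)) ⟩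
    Σ₁ (y ℕ.+ (X ℕ.∸ y)) g                              ≡⟨ Σ₁-split y (X ℕ.∸ y) g ⟩
    Σ₁ y g + Σ₁ (X ℕ.∸ y) (λ i → g (y ℕ.+ i))           ≡⟨ cong₂ _+_ (Σ₁-cong y λ n q → trans (cong (_* f n) (⟦yes⟧ (n ℕ.≤? y) (hi q))) (*-identityˡ (f n)))
                                                              (Σ₁-zero (X ℕ.∸ y) λ n q → trans (cong (_* f (y ℕ.+ n)) (⟦no⟧ (y ℕ.+ n ℕ.≤? y) (beyond n (lo q)))) (*-zeroˡ (f (y ℕ.+ n)))) ⟩
    Σ₁ y f + 0ℚ                                         ≡⟨ +-identityʳ (Σ₁ y f) ⟩
    Σ₁ y f ∎
    where
    open ≡-Reasoning
    g = λ n → ⟦ n ℕ.≤? y ⟧ * f n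
    beyond : ∀ n → 1 ℕ.≤ n → ¬ (y ℕ.+ n ℕ.≤ y)
    beyond n q r = ℕₚ.<-irrefl refl (ℕₚ.<-≤-trans (ℕₚ.m<m+n y q) r)

  Σ₁-extend : ∀ X y f → y ℕ.≤ X → (∀ n → n ∈1‥ X → y ℕ.< n → f n ≡ 0ℚ) → Σ₁ X f ≡ Σ₁ y f
  Σ₁-extend X y f p h = trans (Σ₁-cong X λ n q → sym (⟦⟧-elim (n ℕ.≤? y) (λ _ → refl) (λ r → sym (h n q (ℕₚ.≰⇒> r)))))
                              (Σ₁-restrict X y f p)

  Σ₁-≤ : ∀ y z f → y ℕ.≤ z → (∀ n → n ∈1‥ z → 0ℚ ≤ f n) → Σ₁ y f ≤ Σ₁ z f
  Σ₁-≤ y z f p h = ≤-trans (≡⇒≤ (sym (Σ₁-restrict z y f p))) (Σ₁-mono z λ n q →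
    ≤-trans (*-monoʳ (f n) (h n q) (⟦⟧≤1 (n ℕ.≤? y))) (≡⇒≤ (*-identityˡ (f n))))

  Σ₁-term : ∀ y m f → m ∈1‥ y → (∀ n → n ∈1‥ y → 0ℚ ≤ f n) → f m ≤ Σ₁ y f
  Σ₁-term y m f p h = ≤-trans (≡⇒≤ (trans (sym (*-identityˡ (f m))) (trans (cong (_* f m) (sym (⟦yes⟧ (m ℕ.≤? y) (hi p)))) (sym (Σ₁-δ y m f (lo p))))))
    (Σ₁-mono y λ n q → ≤-trans (*-monoʳ (f n) (h n q) (⟦⟧≤1 (m ℕ.≟ n))) (≡⇒≤ (*-identityˡ (f n))))

  -- Summation by parts for a weight `w` that may fail to be monotone: the decrease of `pot`
  -- dominates the variation of `w`, and `pot n` its last value, so all contributions telescope to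
  -- `pot 0`.
  abel : ∀ n (e w pot : ℕ → ℚ) E → 0ℚ ≤ E →
    (∀ i → i ℕ.≤ suc n → ∣ sum i e ∣ ≤ E) →
    (∀ i → i ℕ.< n → ∣ w (suc i) - w i ∣ ≤ pot i - pot (suc i)) →
    ∣ w n ∣ ≤ pot n →
    ∣ sum (suc n) (λ i → e i * w i) ∣ ≤ E * pot 0
  abel n e w pot E 0≤E hS hw hn = ≤-trans
    (≡⇒≤ (cong ∣_∣ (lemma (sum (suc n) (λ i → e i * w i)) (sum (suc n) e * w n))))
    (≤-trans (abs+ (go n ℕₚ.≤-refl) (abs* (hS (suc n) ℕₚ.≤-refl) hn)) (≡⇒≤ (lemma₂ E (pot 0) (pot n))))
    where
    lemma : ∀ a b → a ≡ a - b + b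
    lemma = solve-∀ ring
    lemma₂ : ∀ E a b → E * (a - b) + E * b ≡ E * a
    lemma₂ = solve-∀ ring
    lemma₃ : ∀ s S e w w′ → s + e * w′ - (S + e) * w′ ≡ s - S * w + S * (w - w′)
    lemma₃ = solve-∀ ring
    lemma₄ : ∀ E a b c → E * (a - b) + E * (b - c) ≡ E * (a - c)
    lemma₄ = solve-∀ ring
    lemma₅ : ∀ e w → 0ℚ + e * w - (0ℚ + e) * w ≡ 0ℚ
    lemma₅ = solve-∀ ring
    lemma₆ : ∀ E a → E * (a - a) ≡ 0ℚ
    lemma₆ = solve-∀ ring
    lemma₇ : ∀ a b → - (a - b) ≡ b - a
    lemma₇ = solve-∀ ring
    -- Once the boundary term is removed, what is left is a sum of partial sums of `e` times
    -- differences of `w`, bounded by `E` times the decrease of `pot` so far.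
    go : ∀ m → m ℕ.≤ n → ∣ sum (suc m) (λ i → e i * w i) - sum (suc m) e * w m ∣ ≤ E * (pot 0 - pot m)
    go zero    _ = ≡⇒≤ (trans (cong ∣_∣ (lemma₅ (e 0) (w 0))) (sym (lemma₆ E (pot 0))))
    go (suc m) p = ≤-trans (≡⇒≤ (cong ∣_∣ (lemma₃ (sum (suc m) (λ i → e i * w i)) (sum (suc m) e) (e (suc m)) (w m) (w (suc m)))))
      (≤-trans (abs+ (go m (ℕₚ.<⇒≤ p)) (abs* (hS (suc m) (ℕₚ.m≤n⇒m≤1+n p))
        (subst (_≤ pot m - pot (suc m)) (trans (sym (∣-p∣≡∣p∣ (w (suc m) - w m))) (cong ∣_∣ (lemma₇ (w (suc m)) (w m)))) (hw m p))))
        (≡⇒≤ (lemma₄ E (pot 0) (pot m) (pot (suc m)))))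

  module Periodic (k : ℕ) (e : ℕ → ℚ) (e≤1 : ∀ i → ∣ e i ∣ ≤ 1ℚ)
                  (per : ∀ i → e (k ℕ.+ i) ≡ e i) (zero-sum : sum k e ≡ 0ℚ) where

    private
      drop : ∀ n → sum (k ℕ.+ n) e ≡ sum n e
      drop n = trans (sum-split k n e) (trans (cong₂ _+_ zero-sum (sum-cong n λ i _ → per i)) (+-identityˡ (sum n e)))

      small : ∀ n → n ℕ.≤ k → ∣ sum n e ∣ ≤ ι k
      small n p = ≤-trans (sum-abs n {g = λ _ → 1ℚ} (λ i _ → e≤1 i))
        (≤-trans (≡⇒≤ (trans (sum-const n 1ℚ) (*-identityʳ (ι n)))) (ι-mono p))

      go : ∀ fuel n → n ℕ.≤ fuel → .{{ℕ.NonZero k}} → ∣ sum n e ∣ ≤ ι k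
      go zero       .zero ℕ.z≤n = small 0 ℕ.z≤n
      go (suc fuel) n q with n ℕ.≤? k
      ... | yes p = small n p
      ... | no  p = subst (λ s → ∣ s ∣ ≤ ι k) (trans (sym (drop (n ℕ.∸ k))) (cong (λ m → sum m e) (ℕₚ.m+[n∸m]≡n (ℕₚ.<⇒≤ (ℕₚ.≰⇒> p)))))
        (go fuel (n ℕ.∸ k) (ℕₚ.≤-trans (ℕₚ.∸-monoʳ-≤ n (ℕ.>-nonZero⁻¹ k)) (ℕₚ.≤-trans (ℕₚ.∸-monoˡ-≤ 1 q) ℕₚ.≤-refl)))

    -- Complete periods contribute nothing, so at most `k` terms of absolute value at most 1
    -- survive.
    partial : .{{ℕ.NonZero k}} → ∀ n → ∣ sum n e ∣ ≤ ι k
    partial n = go n n ℕₚ.≤-refl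

    partial-from : .{{ℕ.NonZero k}} → ∀ m n → ∣ sum n (λ i → e (m ℕ.+ i)) ∣ ≤ ι k + ι k
    partial-from m n = subst (λ s → ∣ s ∣ ≤ ι k + ι k) (trans (cong (_- sum m e) (sum-split m n e)) (lemma (sum m e) _))
      (≤-trans (∣p-q∣≤∣p∣+∣q∣ (sum (m ℕ.+ n) e) (sum m e)) (+-mono-≤ (partial (m ℕ.+ n)) (partial m)))
      where
      lemma : ∀ a b → a + b - a ≡ b
      lemma = solve-∀ ring

  Σ₁-abel : ∀ Y (e w pot : ℕ → ℚ) E → 0ℚ ≤ E → 0ℚ ≤ pot 1 →
    (∀ n → ∣ sum n (e ∘ suc) ∣ ≤ E) →
    (∀ m → 1 ℕ.≤ m → m ℕ.< Y → ∣ w (suc m) - w m ∣ ≤ pot m - pot (suc m)) →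
    (∀ m → m ∈1‥ Y → ∣ w m ∣ ≤ pot m) →
    ∣ Σ₁ Y (λ m → e m * w m) ∣ ≤ E * pot 1
  Σ₁-abel zero    e w pot E 0≤E 0≤pot hS hw hn = subst (λ s → ∣ s ∣ ≤ E * pot 1) (sym (Σ₁-0 _)) (0≤E ⊗ 0≤pot)
  Σ₁-abel (suc n) e w pot E 0≤E 0≤pot hS hw hn = subst (λ s → ∣ s ∣ ≤ E * pot 1) (sym (Σ₁≡sum (suc n) _))
    (abel n (e ∘ suc) (w ∘ suc) (pot ∘ suc) E 0≤E (λ i _ → hS i) (λ i p → hw (suc i) (ℕ.s≤s ℕ.z≤n) (ℕ.s≤s p)) (hn (suc n) (ℕ.s≤s ℕ.z≤n ﹐ ℕₚ.≤-refl)))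

  -- Lets identities between counts be proved for rational sums, where subtraction is unrestricted,
  -- and be carried back to ℕ.
  ι-injective : ∀ {m n} → ι m ≡ ι n → m ≡ n
  ι-injective {m} {n} e = ℕₚ.≤-antisym (bound e) (bound (sym e))
    where
    strict : ∀ {m n} → m ℕ.< n → ι m ≢ ι n
    strict {m} {n} p e = <-irrefl e (<-≤-trans (subst (_< 1ℚ + ι m) (+-identityˡ (ι m)) (+-monoˡ-< (ι m) 0<1)) (ι-mono p))
    bound : ∀ {m n} → ι m ≡ ι n → m ℕ.≤ n
    bound e = ℕₚ.≮⇒≥ λ p → strict p (sym e)

  -- Each run of `r` consecutive integers that ends at a multiple of `r` contains no other multiple,
  -- so every induction step contributes a single term.
  Σ₁-multiples : ∀ r m (g : ℕ → ℚ) → 1 ℕ.≤ r → Σ₁ (r ℕ.* m) (λ x → ⟦ r ∣? x ⟧ * g x) ≡ Σ₁ m (λ y → g (r ℕ.* y))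
  Σ₁-multiples r zero    g p = trans (cong (λ z → Σ₁ z (λ x → ⟦ r ∣? x ⟧ * g x)) (ℕₚ.*-zeroʳ r)) (trans (Σ₁-0 _) (sym (Σ₁-0 _)))
  Σ₁-multiples r (suc m) g p = trans (cong (λ z → Σ₁ z (λ x → ⟦ r ∣? x ⟧ * g x)) (trans (ℕₚ.*-suc r m) (ℕₚ.+-comm r (r ℕ.* m))))
    (trans (Σ₁-split (r ℕ.* m) r _) (trans (cong₂ _+_ (Σ₁-multiples r m g p) last) (sym (Σ₁-suc m _))))
    where
    last : Σ₁ r (λ i → ⟦ r ∣? r ℕ.* m ℕ.+ i ⟧ * g (r ℕ.* m ℕ.+ i)) ≡ g (r ℕ.* suc m)
    last = trans (Σ₁-single r r _ (p ﹐ ℕₚ.≤-refl) λ i q ne → trans (cong (_* g (r ℕ.* m ℕ.+ i)) (⟦no⟧ (r ∣? r ℕ.* m ℕ.+ i) λ d →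
        ne (ℕₚ.≤-antisym (hi q) (∣⇒≤ {{ℕ.>-nonZero (lo q)}} (∣m+n∣m⇒∣n d (m∣m*n m)))))) (*-zeroˡ (g (r ℕ.* m ℕ.+ i))))
      (trans (cong (_* g (r ℕ.* m ℕ.+ r)) (⟦yes⟧ (r ∣? r ℕ.* m ℕ.+ r) (∣m∣n⇒∣m+n (m∣m*n m) ∣-refl))) (trans (*-identityˡ (g (r ℕ.* m ℕ.+ r))) (cong g (trans (ℕₚ.+-comm (r ℕ.* m) r) (sym (ℕₚ.*-suc r m))))))

-- Dirichlet convolution and Möbius inversion on 1, ..., X

module Convolution where

  open import Data.Nat as ℕ using (ℕ; zero; suc)
  import Data.Nat.Properties as ℕₚ
  open import Data.Nat.Divisibility using (_∣_; _∣?_; divides; ∣-trans; ∣⇒≤; n∣m*n; m∣m*n)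
  open import Data.Nat.DivMod using (m/n*n≤m; m<n⇒m/n≡0; m≡m%n+[m/n]*n; m%n<n)
  open import Data.Nat.Primality using (Prime; prime?; euclidsLemma; prime⇒irreducible; prime⇒nonZero; prime⇒nonTrivial)
  open import Data.Nat.Primality.Factorisation using (factorise)
  open import Data.Rational hiding (_÷_)
  open import Data.Rational.Properties
  open import Data.Product using (_,_; _×_; ∃; proj₁; proj₂)
  open import Data.Sum using (inj₁; inj₂; _⊎_)
  open import Data.Empty using (⊥; ⊥-elim)
  open import Data.List using ([]; _∷_)
  open import Data.List.Relation.Unary.All using ([]; _∷_)
  open import Function using (_∘_)
  open import Relation.Nullary using (¬_; yes; no; Dec)
  open import Relation.Binary.PropositionalEquality
  open import Tactic.RingSolver using (solve-∀)
  open Rationals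
  open Sums

  *-in : ∀ {a b n X} → 1 ℕ.≤ a → 1 ℕ.≤ b → a ℕ.* b ≡ n → n ℕ.≤ X → a ∈1‥ X
  *-in {a} {suc b} p q refl r = p ﹐ ℕₚ.≤-trans (ℕₚ.m≤m*n a (suc b)) r

  *-in′ : ∀ {a b n X} → 1 ℕ.≤ a → 1 ℕ.≤ b → a ℕ.* b ≡ n → n ℕ.≤ X → b ∈1‥ X
  *-in′ {a} {b} p q e r = *-in q p (trans (ℕₚ.*-comm b a) e) r

  1≤* : ∀ {a b} → 1 ℕ.≤ a → 1 ℕ.≤ b → 1 ℕ.≤ a ℕ.* b
  1≤* = ℕₚ.*-mono-≤

  ∣-prime⇒≡ : ∀ {p q} → Prime p → Prime q → p ∣ q → p ≡ q
  ∣-prime⇒≡ pp pq d with prime⇒irreducible pq d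
  ... | inj₁ refl = ⊥-elim (ℕ.nonTrivial⇒≢1 {{prime⇒nonTrivial pp}} refl)
  ... | inj₂ e    = e

  prime-factor : ∀ n → 2 ℕ.≤ n → ∃ λ q → Prime q × q ∣ n
  prime-factor n@(suc _) p with factorise n
  ... | record { factors = [] ; isFactorisation = e } = ⊥-elim (ℕₚ.<-irrefl (sym e) p)
  ... | record { factors = q ∷ qs ; isFactorisation = e ; factorsPrime = pq ∷ _ } = q , pq , subst (q ∣_) (sym e) (m∣m*n _)

  -- Total floor division, with junk value y ÷ 0 = 0.
  _÷_ : ℕ → ℕ → ℕ
  y ÷ zero    = 0
  y ÷ (suc a) = y ℕ./ suc a

  infixl 7 _÷_

  ÷-≤ : ∀ y a → a ℕ.* (y ÷ a) ℕ.≤ y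
  ÷-≤ y zero    = ℕ.z≤n
  ÷-≤ y (suc a) = subst (ℕ._≤ y) (ℕₚ.*-comm (y ℕ./ suc a) (suc a)) (m/n*n≤m y (suc a))

  ÷-> : ∀ y a → 1 ℕ.≤ a → y ℕ.< a ℕ.* suc (y ÷ a)
  ÷-> y (suc a) _ = subst (y ℕ.<_) (ℕₚ.*-comm (suc (y ℕ./ suc a)) (suc a)) (ℕₚ.≤-<-trans (ℕₚ.≤-reflexive (m≡m%n+[m/n]*n y (suc a))) (ℕₚ.+-monoˡ-< (y ℕ./ suc a ℕ.* suc a) (m%n<n y (suc a))))

  ÷-adjoint : ∀ y a b → 1 ℕ.≤ a → b ℕ.≤ y ÷ a → a ℕ.* b ℕ.≤ y
  ÷-adjoint y a b p q = ℕₚ.≤-trans (ℕₚ.*-monoʳ-≤ a q) (÷-≤ y a)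

  ÷-adjoint′ : ∀ y a b → 1 ℕ.≤ a → a ℕ.* b ℕ.≤ y → b ℕ.≤ y ÷ a
  ÷-adjoint′ y a b p q = ℕₚ.≤-pred (ℕₚ.*-cancelˡ-< a b (suc (y ÷ a)) (ℕₚ.≤-<-trans q (÷-> y a p)))

  ÷-≤y : ∀ y a → 1 ℕ.≤ a → y ÷ a ℕ.≤ y
  ÷-≤y y a@(suc _) p = ℕₚ.≤-trans (ℕₚ.m≤n*m (y ÷ a) a) (÷-≤ y a)

  ÷-big : ∀ {y a} → y ℕ.< a → y ÷ a ≡ 0
  ÷-big {y} {suc a} p = m<n⇒m/n≡0 p

  hyperbola : ∀ X y a (g : ℕ → ℚ) → 1 ℕ.≤ a → y ℕ.≤ X → Σ₁ X (λ b → ⟦ a ℕ.* b ℕ.≤? y ⟧ * g b) ≡ Σ₁ (y ÷ a) g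
  hyperbola X y a g p q = trans
    (Σ₁-cong X λ b _ → cong (_* g b) (⟦⟧-cong (a ℕ.* b ℕ.≤? y) (b ℕ.≤? y ÷ a) (÷-adjoint′ y a b p) (÷-adjoint y a b p)))
    (Σ₁-restrict X (y ÷ a) g (ℕₚ.≤-trans (÷-≤y y a p) q))

  module Dirichlet (X : ℕ) where

    -- Both factors range over all of 1, ..., X, and an indicator selects the factorisations of `n`.
    -- For `n` up to `X` none is lost, and commutativity is an exchange of sums.
    conv : (ℕ → ℚ) → (ℕ → ℚ) → ℕ → ℚ
    conv u w n = Σ₁ X λ a → Σ₁ X λ b → ⟦ a ℕ.* b ℕ.≟ n ⟧ * (u a * w b)

    conv-cong : ∀ {u u′ w w′} n → (∀ m → m ∈1‥ X → u m ≡ u′ m) → (∀ m → m ∈1‥ X → w m ≡ w′ m) → conv u w n ≡ conv u′ w′ n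
    conv-cong n h h′ = Σ₁-cong X λ a p → Σ₁-cong X λ b q → cong (⟦ a ℕ.* b ℕ.≟ n ⟧ *_) (cong₂ _*_ (h a p) (h′ b q))

    conv-comm : ∀ u w n → conv u w n ≡ conv w u n
    conv-comm u w n = trans (Σ₁-swap X X _) (Σ₁-cong X λ b _ → Σ₁-cong X λ a _ →
      cong₂ _*_ (cong (λ m → ⟦ m ℕ.≟ n ⟧) (ℕₚ.*-comm a b)) (*-comm (u a) (w b)))

    conv-- : ∀ u w w′ n → conv u (λ b → w b - w′ b) n ≡ conv u w n - conv u w′ n
    conv-- u w w′ n = trans (Σ₁-cong X λ a _ → trans (Σ₁-cong X λ b _ → lemma ⟦ a ℕ.* b ℕ.≟ n ⟧ (u a) (w b) (w′ b)) (Σ₁-- X _ _)) (Σ₁-- X _ _)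
      where
      lemma : ∀ i a b c → i * (a * (b - c)) ≡ i * (a * b) - i * (a * c)
      lemma = solve-∀ ring

    conv-+ : ∀ u w w′ n → conv u (λ b → w b + w′ b) n ≡ conv u w n + conv u w′ n
    conv-+ u w w′ n = trans (Σ₁-cong X λ a _ → trans (Σ₁-cong X λ b _ → lemma ⟦ a ℕ.* b ℕ.≟ n ⟧ (u a) (w b) (w′ b)) (Σ₁-+ X _ _)) (Σ₁-+ X _ _)
      where
      lemma : ∀ i a b c → i * (a * (b + c)) ≡ i * (a * b) + i * (a * c)
      lemma = solve-∀ ring

    conv-*ʳ : ∀ c u w n → conv u (λ b → c * w b) n ≡ c * conv u w n
    conv-*ʳ c u w n = trans (Σ₁-cong X λ a _ → trans (Σ₁-cong X λ b _ → lemma ⟦ a ℕ.* b ℕ.≟ n ⟧ (u a) (w b) c) (Σ₁-*ˡ X c _)) (Σ₁-*ˡ X c _)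
      where
      lemma : ∀ i a b c → i * (a * (c * b)) ≡ c * (i * (a * b))
      lemma = solve-∀ ring

    sum-conv : ∀ y (h u w : ℕ → ℚ) → y ℕ.≤ X →
      Σ₁ y (λ n → h n * conv u w n) ≡ Σ₁ X λ a → Σ₁ X λ b → ⟦ a ℕ.* b ℕ.≤? y ⟧ * (h (a ℕ.* b) * (u a * w b))
    sum-conv y h u w p = begin
      Σ₁ y (λ n → h n * conv u w n)
        ≡⟨ (Σ₁-cong y λ n _ → trans (sym (Σ₁-*ˡ X (h n) _)) (Σ₁-cong X λ a _ → sym (Σ₁-*ˡ X (h n) _))) ⟩
      Σ₁ y (λ n → Σ₁ X λ a → Σ₁ X λ b → h n * (⟦ a ℕ.* b ℕ.≟ n ⟧ * (u a * w b)))
        ≡⟨ Σ₁-swap y X _ ⟩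
      Σ₁ X (λ a → Σ₁ y λ n → Σ₁ X λ b → h n * (⟦ a ℕ.* b ℕ.≟ n ⟧ * (u a * w b)))
        ≡⟨ (Σ₁-cong X λ a _ → Σ₁-swap y X _) ⟩
      Σ₁ X (λ a → Σ₁ X λ b → Σ₁ y λ n → h n * (⟦ a ℕ.* b ℕ.≟ n ⟧ * (u a * w b)))
        ≡⟨ (Σ₁-cong X λ a q → Σ₁-cong X λ b r → trans (Σ₁-cong y λ n _ → lemma (h n) ⟦ a ℕ.* b ℕ.≟ n ⟧ (u a * w b))
              (Σ₁-δ y (a ℕ.* b) (λ n → h n * (u a * w b)) (1≤* (lo q) (lo r)))) ⟩
      Σ₁ X (λ a → Σ₁ X λ b → ⟦ a ℕ.* b ℕ.≤? y ⟧ * (h (a ℕ.* b) * (u a * w b))) ∎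
      where
      open ≡-Reasoning
      lemma : ∀ a b c → a * (b * c) ≡ b * (a * c)
      lemma = solve-∀ ring

    conv-𝟏 : ∀ u n → n ∈1‥ X → conv (λ _ → 1ℚ) u n ≡ Σ₁ X λ b → ⟦ b ∣? n ⟧ * u b
    conv-𝟏 u n p = trans (Σ₁-swap X X _) (Σ₁-cong X λ b q → trans (Σ₁-*ʳ X (1ℚ * u b) (λ a → ⟦ a ℕ.* b ℕ.≟ n ⟧))
      (cong₂ _*_ (count b q (b ∣? n)) (*-identityˡ (u b))))
      where
      count : ∀ b → b ∈1‥ X → Dec (b ∣ n) → Σ₁ X (λ a → ⟦ a ℕ.* b ℕ.≟ n ⟧) ≡ ⟦ b ∣? n ⟧
      count b q (no d) = trans (Σ₁-zero X λ a _ → ⟦no⟧ (a ℕ.* b ℕ.≟ n) λ e → d (divides a (sym e))) (sym (⟦no⟧ (b ∣? n) d))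
      count b q (yes (divides zero refl)) = ⊥-elim (ℕₚ.<-irrefl refl (lo p))
      count b q (yes d@(divides a@(suc _) e)) = trans
        (Σ₁-single X a _ (*-in (ℕ.s≤s ℕ.z≤n) (lo q) (sym e) (hi p)) λ a′ _ r → ⟦no⟧ (a′ ℕ.* b ℕ.≟ n) λ e′ → r (ℕₚ.*-cancelʳ-≡ a′ a b {{ℕ.>-nonZero (lo q)}} (trans e′ e)))
        (trans (⟦yes⟧ (a ℕ.* b ℕ.≟ n) (sym e)) (sym (⟦yes⟧ (b ∣? n) d)))

    sum-conv′ : ∀ y (h u w : ℕ → ℚ) → y ℕ.≤ X →
      Σ₁ y (λ n → h n * conv u w n) ≡ Σ₁ y λ a → Σ₁ (y ÷ a) λ b → h (a ℕ.* b) * (u a * w b)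
    sum-conv′ y h u w p = trans (sum-conv y h u w p) (trans
      (Σ₁-cong X λ a q → hyperbola X y a _ (lo q) p)
      (Σ₁-extend X y _ p λ a q r → trans (cong (λ z → Σ₁ z (λ b → h (a ℕ.* b) * (u a * w b))) (÷-big r)) (Σ₁-0 (λ b → h (a ℕ.* b) * (u a * w b)))))

    private
      triple : ∀ u w z n →
        conv u (conv w z) n ≡ Σ₁ X λ a → Σ₁ X λ b → Σ₁ X λ c → ⟦ b ℕ.* c ℕ.≤? X ⟧ * (⟦ a ℕ.* (b ℕ.* c) ℕ.≟ n ⟧ * u a * (w b * z c))
      triple u w z n = Σ₁-cong X λ a _ → trans (Σ₁-cong X λ m _ → sym (*-assoc ⟦ a ℕ.* m ℕ.≟ n ⟧ (u a) (conv w z m)))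
        (sum-conv X (λ m → ⟦ a ℕ.* m ℕ.≟ n ⟧ * u a) w z ℕₚ.≤-refl)

      drop : ∀ {a m n} x → 1 ℕ.≤ a → 1 ℕ.≤ m → n ℕ.≤ X → ⟦ m ℕ.≤? X ⟧ * (⟦ a ℕ.* m ℕ.≟ n ⟧ * x) ≡ ⟦ a ℕ.* m ℕ.≟ n ⟧ * x
      drop {a} {m} {n} x p q r = ⟦⟧-elim (m ℕ.≤? X) (λ _ → refl)
        λ s → sym (trans (cong (_* x) (⟦no⟧ (a ℕ.* m ℕ.≟ n) λ e → s (hi (*-in′ p q e r)))) (*-zeroˡ x))

    -- Expanding the inner convolution introduces a cutoff at `X` on the product of two of the three
    -- factors. The hypothesis on `n` makes it automatic: that product divides `n`.
    conv-assoc : ∀ u w z n → n ℕ.≤ X → conv u (conv w z) n ≡ conv (conv u w) z n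
    conv-assoc u w z n r = trans (triple u w z n) (trans (Σ₁-cong X λ a p → trans (Σ₁-cong X λ b q → Σ₁-cong X λ c s → term a b c p q s) (Σ₁-swap X X _))
      (trans (trans (Σ₁-swap X X _) (Σ₁-cong X λ c _ → refl)) (sym (trans (conv-comm (conv u w) z n) (triple z u w n)))))
      where
      lemma : ∀ i a b c → i * a * (b * c) ≡ i * (c * (a * b))
      lemma = solve-∀ ring
      term : ∀ a b c → a ∈1‥ X → b ∈1‥ X → c ∈1‥ X →
        ⟦ b ℕ.* c ℕ.≤? X ⟧ * (⟦ a ℕ.* (b ℕ.* c) ℕ.≟ n ⟧ * u a * (w b * z c)) ≡ ⟦ a ℕ.* b ℕ.≤? X ⟧ * (⟦ c ℕ.* (a ℕ.* b) ℕ.≟ n ⟧ * z c * (u a * w b))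
      term a b c p q s = begin
        ⟦ b ℕ.* c ℕ.≤? X ⟧ * (⟦ a ℕ.* (b ℕ.* c) ℕ.≟ n ⟧ * u a * (w b * z c))
          ≡⟨ cong (⟦ b ℕ.* c ℕ.≤? X ⟧ *_) (lemma ⟦ a ℕ.* (b ℕ.* c) ℕ.≟ n ⟧ (u a) (w b) (z c)) ⟩
        ⟦ b ℕ.* c ℕ.≤? X ⟧ * (⟦ a ℕ.* (b ℕ.* c) ℕ.≟ n ⟧ * (z c * (u a * w b)))
          ≡⟨ drop _ (lo p) (1≤* (lo q) (lo s)) r ⟩
        ⟦ a ℕ.* (b ℕ.* c) ℕ.≟ n ⟧ * (z c * (u a * w b))
          ≡⟨ cong (λ m → ⟦ m ℕ.≟ n ⟧ * (z c * (u a * w b))) (trans (sym (ℕₚ.*-assoc a b c)) (ℕₚ.*-comm (a ℕ.* b) c)) ⟩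
        ⟦ c ℕ.* (a ℕ.* b) ℕ.≟ n ⟧ * (z c * (u a * w b))
          ≡⟨ sym (drop _ (lo s) (1≤* (lo p) (lo q)) r) ⟩
        ⟦ a ℕ.* b ℕ.≤? X ⟧ * (⟦ c ℕ.* (a ℕ.* b) ℕ.≟ n ⟧ * (z c * (u a * w b)))
          ≡⟨ cong (⟦ a ℕ.* b ℕ.≤? X ⟧ *_) (sym (*-assoc ⟦ c ℕ.* (a ℕ.* b) ℕ.≟ n ⟧ (z c) (u a * w b))) ⟩
        ⟦ a ℕ.* b ℕ.≤? X ⟧ * (⟦ c ℕ.* (a ℕ.* b) ℕ.≟ n ⟧ * z c * (u a * w b)) ∎
        where open ≡-Reasoning

    δ : ℕ → ℕ → ℚ
    δ q n = ⟦ q ℕ.≟ n ⟧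

    𝟏 : ℕ → ℚ
    𝟏 _ = 1ℚ

    private
      conv-δ : ∀ q u n → q ∈1‥ X → conv (δ q) u n ≡ Σ₁ X λ b → ⟦ q ℕ.* b ℕ.≟ n ⟧ * u b
      conv-δ q u n p = trans (Σ₁-cong X λ a _ → trans (Σ₁-cong X λ b _ → lemma ⟦ a ℕ.* b ℕ.≟ n ⟧ ⟦ q ℕ.≟ a ⟧ (u b)) (Σ₁-*ˡ X ⟦ q ℕ.≟ a ⟧ _))
        (trans (Σ₁-δ X q _ (lo p)) (⟦⟧-elim (q ℕ.≤? X) (λ _ → refl) λ r → ⊥-elim (r (hi p))))
        where
        lemma : ∀ i j x → i * (j * x) ≡ j * (i * x)
        lemma = solve-∀ ring

    conv-δ-∣ : ∀ {q m n} u → q ∈1‥ X → m ∈1‥ X → q ℕ.* m ≡ n → conv (δ q) u n ≡ u m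
    conv-δ-∣ {q} {m} {n} u p r e = trans (conv-δ q u n p) (trans
      (Σ₁-single X m _ r λ b s t → trans (cong (_* u b) (⟦no⟧ (q ℕ.* b ℕ.≟ n) λ e′ → t (ℕₚ.*-cancelˡ-≡ b m q {{ℕ.>-nonZero (lo p)}} (trans e′ (sym e))))) (*-zeroˡ (u b)))
      (trans (cong (_* u m) (⟦yes⟧ (q ℕ.* m ℕ.≟ n) e)) (*-identityˡ (u m))))

    conv-δ-∤ : ∀ {q n} u → q ∈1‥ X → ¬ q ∣ n → conv (δ q) u n ≡ 0ℚ
    conv-δ-∤ {q} {n} u p r = trans (conv-δ q u n p) (Σ₁-zero X λ b s →
      trans (cong (_* u b) (⟦no⟧ (q ℕ.* b ℕ.≟ n) λ { refl → r (m∣m*n b) })) (*-zeroˡ (u b)))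

    conv-ε : ∀ u n → n ∈1‥ X → conv (δ 1) u n ≡ u n
    conv-ε u n p = conv-δ-∣ u (ℕₚ.≤-refl ﹐ ℕₚ.≤-trans (lo p) (hi p)) p (ℕₚ.*-identityˡ n)

    -- μ j is the Möbius function restricted to integers all of whose prime factors are below j.
    μ : ℕ → ℕ → ℚ
    μ zero    n = δ 1 n
    μ (suc j) n = μ j n - ⟦ prime? j ⟧ * conv (δ j) (μ j) n

    private
      Rough : ℕ → ℕ → Set
      Rough j n = ∀ q → q ℕ.< j → Prime q → ¬ q ∣ n

      rough? : ∀ j n → Rough j n ⊎ ∃ λ q → q ℕ.< j × Prime q × q ∣ n
      rough? zero    n = inj₁ λ _ ()
      rough? (suc j) n with rough? j n
      ... | inj₂ (q , p , r) = inj₂ (q , ℕₚ.m<n⇒m<1+n p , r)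
      ... | inj₁ h with prime? j | j ∣? n
      ...   | yes pj | yes d = inj₂ (j , ℕₚ.n<1+n j , pj , d)
      ...   | yes _  | no d  = inj₁ λ q p pq d′ → case q p pq d′
        where
        case : ∀ q → q ℕ.< suc j → Prime q → q ∣ n → ⊥
        case q p pq d′ with q ℕ.≟ j
        ... | yes refl = d d′
        ... | no e     = h q (ℕₚ.≤∧≢⇒< (ℕₚ.≤-pred p) e) pq d′
      ...   | no ¬pj | _ = inj₁ λ q p pq d′ → case q p pq d′
        where
        case : ∀ q → q ℕ.< suc j → Prime q → q ∣ n → ⊥
        case q p pq d′ with q ℕ.≟ j
        ... | yes refl = ¬pj pq
        ... | no e     = h q (ℕₚ.≤∧≢⇒< (ℕₚ.≤-pred p) e) pq d′

      -- The sieve of Eratosthenes after all primes below `j` have been sifted: `c-value` shows that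
      -- it is 1 on integers free of such primes and 0 on the others.
      c : ℕ → ℕ → ℚ
      c j = conv 𝟏 (μ j)

      -- Convolution with `𝟏` commutes with convolution with `δ j`, so the recursion of `μ` passes
      -- to `c`: sifting by a prime j replaces c(n) by c(n) - c(n/j).
      c-step : ∀ j n → n ℕ.≤ X → c (suc j) n ≡ c j n - ⟦ prime? j ⟧ * conv (δ j) (c j) n
      c-step j n p = trans (conv-- 𝟏 (μ j) _ n) (cong (λ x → c j n - x) (trans (conv-*ʳ ⟦ prime? j ⟧ 𝟏 (conv (δ j) (μ j)) n)
        (cong (⟦ prime? j ⟧ *_) (trans (conv-assoc 𝟏 (δ j) (μ j) n p) (trans (conv-cong n (λ m q → conv-comm 𝟏 (δ j) m) (λ _ _ → refl))
          (sym (conv-assoc (δ j) 𝟏 (μ j) n p)))))))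

      prime∈ : ∀ {j n} → Prime j → n ∈1‥ X → (d : j ∣ n) → j ∈1‥ X × _∣_.quotient d ∈1‥ X × j ℕ.* _∣_.quotient d ≡ n
      prime∈ {j} {n} pj r (divides zero refl) = ⊥-elim (ℕₚ.<-irrefl refl (lo r))
      prime∈ {j} {n} pj r (divides (suc m) e) = *-in 1≤j (ℕ.s≤s ℕ.z≤n) e′ (hi r) , *-in′ 1≤j (ℕ.s≤s ℕ.z≤n) e′ (hi r) , e′
        where
        e′ = trans (ℕₚ.*-comm j (suc m)) (sym e)
        1≤j = ℕ.>-nonZero⁻¹ j {{prime⇒nonZero pj}}

      Value : ℕ → Set
      Value j = (∀ n → n ∈1‥ X → Rough j n → c j n ≡ 1ℚ) × (∀ n → n ∈1‥ X → ∀ q → q ℕ.< j → Prime q → q ∣ n → c j n ≡ 0ℚ)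

      value-step : ∀ j → Dec (Prime j) → Value j → Value (suc j)
      value-step j (no ¬pj) IH = (λ n p h → trans (unchanged n p) (proj₁ IH n p λ q r → h q (ℕₚ.m<n⇒m<1+n r)))
                   , (λ n p q r pq d → trans (unchanged n p) (proj₂ IH n p q (ℕₚ.≤∧≢⇒< (ℕₚ.≤-pred r) λ { refl → ¬pj pq }) pq d))
        where
        unchanged : ∀ n → n ∈1‥ X → c (suc j) n ≡ c j n
        unchanged n p = trans (c-step j n (hi p)) (trans (cong (λ i → c j n - i * conv (δ j) (c j) n) (⟦no⟧ (prime? j) ¬pj)) (lemma (c j n) (conv (δ j) (c j) n)))
          where
          lemma : ∀ a b → a - 0ℚ * b ≡ a
          lemma = solve-∀ ring
      value-step j (yes pj) IH = rough , smooth
        where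
        step : ∀ n → n ∈1‥ X → c (suc j) n ≡ c j n - conv (δ j) (c j) n
        step n p = trans (c-step j n (hi p)) (cong (λ x → c j n - x) (trans (cong (_* conv (δ j) (c j) n) (⟦yes⟧ (prime? j) pj)) (*-identityˡ _)))
        coprime-case : ∀ n → n ∈1‥ X → ¬ j ∣ n → j ∈1‥ X → c (suc j) n ≡ c j n
        coprime-case n p d r = trans (step n p) (trans (cong (λ x → c j n - x) (conv-δ-∤ (c j) r d)) (lemma (c j n)))
          where
          lemma : ∀ a → a - 0ℚ ≡ a
          lemma = solve-∀ ring
        large-case : ∀ n → n ∈1‥ X → ¬ j ∈1‥ X → c (suc j) n ≡ c j n
        large-case n p r = trans (step n p) (trans (cong (λ x → c j n - x) zero-conv) (lemma (c j n)))
          where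
          lemma : ∀ a → a - 0ℚ ≡ a
          lemma = solve-∀ ring
          zero-conv : conv (δ j) (c j) n ≡ 0ℚ
          zero-conv = Σ₁-zero X λ a p → Σ₁-zero X λ b q →
            trans (cong (⟦ a ℕ.* b ℕ.≟ n ⟧ *_) (trans (cong (_* c j b) (⟦no⟧ (j ℕ.≟ a) λ { refl → r p })) (*-zeroˡ (c j b)))) (*-zeroʳ ⟦ a ℕ.* b ℕ.≟ n ⟧)
        free : ∀ n → n ∈1‥ X → ¬ j ∣ n → c (suc j) n ≡ c j n
        free n p d with j ℕ.≤? X
        ... | yes r = coprime-case n p d (ℕ.>-nonZero⁻¹ j {{prime⇒nonZero pj}} ﹐ r)
        ... | no r  = large-case n p (r ∘ hi)
        rough : ∀ n → n ∈1‥ X → Rough (suc j) n → c (suc j) n ≡ 1ℚ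
        rough n p h = trans (free n p (h j (ℕₚ.n<1+n j) pj)) (proj₁ IH n p λ q r → h q (ℕₚ.m<n⇒m<1+n r))
        multiple : ∀ n → n ∈1‥ X → j ∣ n → c (suc j) n ≡ 0ℚ
        multiple n p d with prime∈ pj p d
        ... | j∈ , m∈ , e = trans (step n p) (trans (cong (λ x → c j n - x) (conv-δ-∣ (c j) j∈ m∈ e)) (trans (cong (_- c j m) same) (+-inverseʳ (c j m))))
          where
          m = _∣_.quotient d
          -- Here n = j·m, and a prime below `j` divides n exactly when it divides m. So n and m
          -- have the same status in the sieve so far, and the two terms cancel.
          same : c j n ≡ c j m
          same with rough? j n
          ... | inj₁ h = trans (proj₁ IH n p h) (sym (proj₁ IH m m∈ λ q r pq d′ → h q r pq (subst (q ∣_) e (∣-trans d′ (n∣m*n j)))))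
          ... | inj₂ (q , r , pq , d′) = trans (proj₂ IH n p q r pq d′) (sym (proj₂ IH m m∈ q r pq q∣m))
            where
            q∣m : q ∣ m
            q∣m with euclidsLemma j m pq (subst (q ∣_) (sym e) d′)
            ... | inj₂ s = s
            ... | inj₁ s = ⊥-elim (ℕₚ.<⇒≢ r (∣-prime⇒≡ pq pj s))
        smooth : ∀ n → n ∈1‥ X → ∀ q → q ℕ.< suc j → Prime q → q ∣ n → c (suc j) n ≡ 0ℚ
        smooth n p q r pq d with j ∣? n
        ... | yes d′ = multiple n p d′
        ... | no d′  = trans (free n p d′) (proj₂ IH n p q (ℕₚ.≤∧≢⇒< (ℕₚ.≤-pred r) λ { refl → d′ d }) pq d)

      c-value : ∀ j → Value j
      c-value zero    = (λ n p _ → trans (conv-comm 𝟏 (δ 1) n) (conv-ε 𝟏 n p)) , λ n p q ()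
      c-value (suc j) = value-step j (prime? j) (c-value j)

    -- All primes up to `X` have been processed, hence every prime factor of every argument in 1,
    -- ..., X.
    Möbius : ℕ → ℚ
    Möbius = μ (suc X)

    conv-𝟏-Möbius : ∀ n → n ∈1‥ X → conv 𝟏 Möbius n ≡ δ 1 n
    conv-𝟏-Möbius n p with n ℕ.≟ 1
    ... | yes refl = trans (proj₁ (c-value (suc X)) 1 p λ q r pq d → ℕₚ.<⇒≱ (ℕ.nonTrivial⇒n>1 q {{prime⇒nonTrivial pq}}) (∣⇒≤ d)) (sym (⟦yes⟧ (1 ℕ.≟ 1) refl))
    ... | no e with prime-factor n (ℕₚ.≤∧≢⇒< (lo p) (e ∘ sym))
    ...   | q , pq , d = trans (proj₂ (c-value (suc X)) n p q (ℕ.s≤s (ℕₚ.≤-trans (∣⇒≤ {{ℕ.>-nonZero (lo p)}} d) (hi p))) pq d) (sym (⟦no⟧ (1 ℕ.≟ n) (e ∘ sym)))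

    private
      -- The two claims need each other. As `μ j` vanishes on multiples of primes not yet processed,
      -- the new value at n = j·m is -`μ j m` rather than a difference of two nonzero terms, and the
      -- bound 1 persists.
      μ-bound : ∀ j → (∀ n → n ∈1‥ X → ∣ μ j n ∣ ≤ 1ℚ) × (∀ n → n ∈1‥ X → ∀ q → j ℕ.≤ q → Prime q → q ∣ n → μ j n ≡ 0ℚ)
      μ-bound zero = (λ n p → abs≤ (⟦⟧≤1 (1 ℕ.≟ n)) (≤-trans (nonPositive⁻¹ (- 1ℚ)) (0≤⟦⟧ (1 ℕ.≟ n))))
                   , λ n p q _ pq d → ⟦no⟧ (1 ℕ.≟ n) λ { refl → ℕₚ.<⇒≱ (ℕ.nonTrivial⇒n>1 q {{prime⇒nonTrivial pq}}) (∣⇒≤ d) }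
      μ-bound (suc j) = bound , support
        where
        IH = μ-bound j
        lemma : ∀ a b → a - 0ℚ * b ≡ a
        lemma = solve-∀ ring
        lemma₂ : ∀ a → a - 1ℚ * 0ℚ ≡ a
        lemma₂ = solve-∀ ring
        cases : Dec (Prime j) → ∀ n → n ∈1‥ X → (μ (suc j) n ≡ μ j n) ⊎ (Prime j × ∃ λ m → m ∈1‥ X × j ℕ.* m ≡ n × μ (suc j) n ≡ μ j n - μ j m)
        cases (no ¬pj) n p = inj₁ (trans (cong (λ i → μ j n - i * conv (δ j) (μ j) n) (⟦no⟧ (prime? j) ¬pj)) (lemma (μ j n) (conv (δ j) (μ j) n)))
        cases (yes pj) n p with j ∣? n
        ... | yes d with prime∈ pj p d
        ...   | j∈ , m∈ , e = inj₂ (pj , _ , m∈ , e , cong (λ x → μ j n - x) (trans (cong₂ _*_ (⟦yes⟧ (prime? j) pj) (conv-δ-∣ (μ j) j∈ m∈ e)) (*-identityˡ (μ j _))))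
        cases (yes pj) n p | no d = inj₁ (trans (cong₂ (λ i x → μ j n - i * x) (⟦yes⟧ (prime? j) pj) vanish) (lemma₂ (μ j n)))
          where
          vanish : conv (δ j) (μ j) n ≡ 0ℚ
          vanish = Σ₁-zero X λ a p → Σ₁-zero X λ b q → ⟦⟧-elim (a ℕ.* b ℕ.≟ n)
            (λ e → trans (cong (_* μ j b) (⟦no⟧ (j ℕ.≟ a) λ { refl → d (divides b (trans (sym e) (ℕₚ.*-comm a b))) })) (*-zeroˡ (μ j b))) (λ _ → refl)
        bound : ∀ n → n ∈1‥ X → ∣ μ (suc j) n ∣ ≤ 1ℚ
        bound n p with cases (prime? j) n p
        ... | inj₁ e = subst (λ x → ∣ x ∣ ≤ 1ℚ) (sym e) (proj₁ IH n p)
        ... | inj₂ (pj , m , m∈ , e , e′) = subst (_≤ 1ℚ) (sym (begin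
          ∣ μ (suc j) n ∣     ≡⟨ cong ∣_∣ e′ ⟩
          ∣ μ j n - μ j m ∣   ≡⟨ cong (λ x → ∣ x - μ j m ∣) (proj₂ IH n p j ℕₚ.≤-refl pj (subst (j ∣_) e (m∣m*n m))) ⟩
          ∣ 0ℚ - μ j m ∣      ≡⟨ cong ∣_∣ (+-identityˡ (- μ j m)) ⟩
          ∣ - μ j m ∣         ≡⟨ ∣-p∣≡∣p∣ (μ j m) ⟩
          ∣ μ j m ∣ ∎)) (proj₁ IH m m∈)
          where open ≡-Reasoning
        support : ∀ n → n ∈1‥ X → ∀ q → suc j ℕ.≤ q → Prime q → q ∣ n → μ (suc j) n ≡ 0ℚ
        support n p q r pq d with cases (prime? j) n p
        ... | inj₁ e = trans e (proj₂ IH n p q (ℕₚ.<⇒≤ r) pq d)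
        ... | inj₂ (pj , m , m∈ , e , e′) = trans e′ (cong₂ _-_ (proj₂ IH n p q (ℕₚ.<⇒≤ r) pq d) (proj₂ IH m m∈ q (ℕₚ.<⇒≤ r) pq q∣m))
          where
          q∣m : q ∣ m
          q∣m with euclidsLemma j m pq (subst (q ∣_) (sym e) d)
          ... | inj₂ s = s
          ... | inj₁ s = ⊥-elim (ℕₚ.<⇒≢ r (sym (∣-prime⇒≡ pq pj s)))

    Möbius-bound : ∀ n → n ∈1‥ X → ∣ Möbius n ∣ ≤ 1ℚ
    Möbius-bound = proj₁ (μ-bound (suc X))

    Möbius-inversion : ∀ u w → (∀ n → n ∈1‥ X → conv 𝟏 u n ≡ w n) → ∀ n → n ∈1‥ X → u n ≡ conv Möbius w n
    Möbius-inversion u w h n p = sym (begin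
      conv Möbius w n               ≡⟨ conv-cong {Möbius} {Möbius} n (λ _ _ → refl) (λ m q → sym (h m q)) ⟩
      conv Möbius (conv 𝟏 u) n      ≡⟨ conv-assoc Möbius 𝟏 u n (hi p) ⟩
      conv (conv Möbius 𝟏) u n      ≡⟨ conv-cong n (λ m q → trans (conv-comm Möbius 𝟏 m) (conv-𝟏-Möbius m q)) (λ _ _ → refl) ⟩
      conv (δ 1) u n                ≡⟨ conv-ε u n p ⟩
      u n ∎)
      where open ≡-Reasoning

-- The von Mangoldt function; Chebyshev and Mertens bounds

module Mangoldt where

  open import Data.Nat as ℕ using (ℕ; zero; suc)
  import Data.Nat.Properties as ℕₚ
  open import Data.Nat.Divisibility using (_∣_; _∣?_; divides; ∣-trans; ∣⇒≤; n∣m*n; m∣m*n; *-cancelˡ-∣; *-monoʳ-∣; 1∣_)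
  open import Data.Nat.Primality using (Prime; prime?; euclidsLemma; prime⇒nonZero; prime⇒nonTrivial)
  open import Data.Nat.Primality.Factorisation using (factorise)
  open import Data.Nat.ListAction using (product)
  import Data.Integer as ℤ
  open import Data.Rational hiding (_÷_)
  open import Data.Rational.Properties
  open import Data.Product using (_,_; _×_)
  open import Data.Sum using (inj₁; inj₂)
  open import Data.Empty using (⊥-elim)
  open import Data.List using ([]; _∷_)
  open import Data.List.Relation.Unary.All as All using (All)
  open import Function using (_∘_)
  open import Relation.Nullary using (¬_; yes; no; Dec)
  open import Relation.Binary.PropositionalEquality
  open import Tactic.RingSolver using (solve; solve-∀)
  open Rationals
  open Sums
  open Convolution

  -- A rational stand-in for the binary logarithm, accurate enough on 1, …, X.
  record Log (X : ℕ) : Set where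
    field
      f      : ℕ → ℚ
      f-*    : ∀ {m n} → 1 ℕ.≤ m → 1 ℕ.≤ n → f (m ℕ.* n) ≡ f m + f n
      f-2    : f 2 ≡ 1ℚ
      f-mono : ∀ n → 1 ℕ.≤ n → n ℕ.< X → f n ≤ f (suc n)
      f-step : ∀ n → 1 ℕ.≤ n → n ℕ.< X → f (suc n) - f n ≤ 2ℚ * v n

  module LogLemmas {X : ℕ} (L : Log X) where
    open Log L

    f-1 : f 1 ≡ 0ℚ
    f-1 = trans (lemma (f 1)) (trans (cong (_- f 1) (sym (f-* {1} {1} ℕₚ.≤-refl ℕₚ.≤-refl))) (+-inverseʳ (f 1)))
      where
      lemma : ∀ a → a ≡ a + a - a
      lemma = solve-∀ ring

    f-≤ : ∀ {m n} → 1 ℕ.≤ m → m ℕ.≤ n → n ℕ.≤ X → f m ≤ f n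
    f-≤ {m} p q r = go (ℕₚ.≤⇒≤′ q) r
      where
      go : ∀ {n} → m ℕ.≤′ n → n ℕ.≤ X → f m ≤ f n
      go (ℕ.≤′-reflexive refl) r = ≤-refl
      go (ℕ.≤′-step {n} q) r     = ≤-trans (go q (ℕₚ.<⇒≤ r)) (f-mono n (ℕₚ.≤-trans p (ℕₚ.≤′⇒≤ q)) r)

    f-nonneg : ∀ {n} → n ∈1‥ X → 0ℚ ≤ f n
    f-nonneg p = ≤-trans (≡⇒≤ (sym f-1)) (f-≤ ℕₚ.≤-refl (lo p) (hi p))

    f-linear : ∀ n → n ∈1‥ X → f n ≤ 2ℚ * ι n
    f-linear 1             p = ≤-trans (≡⇒≤ f-1) (nonNegative⁻¹ (2ℚ * ι 1))
    f-linear (suc n@(suc _)) p = lemma (f n) (f (suc n)) (ι n) (v n) (f-linear n (ℕ.s≤s ℕ.z≤n ﹐ ℕₚ.<⇒≤ (hi p))) (f-step n (ℕ.s≤s ℕ.z≤n) (hi p)) (v≤1 n)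
      where
      lemma : ∀ a b c d → a ≤ 2ℚ * c → b - a ≤ 2ℚ * d → d ≤ 1ℚ → b ≤ 2ℚ * (1ℚ + c)
      lemma a b c d h₁ h₂ h₃ = by (Δ h₁ ⊕ Δ h₂ ⊕ nonNegative⁻¹ 2ℚ ⊗ Δ h₃) (solve (a ∷ b ∷ c ∷ d ∷ []) ring)

    f-2^ : ∀ t → f (2 ℕ.^ t) ≡ ι t
    f-2^ zero    = f-1
    f-2^ (suc t) = trans (f-* {2} {2 ℕ.^ t} (ℕ.s≤s ℕ.z≤n) (ℕₚ.m^n>0 2 t)) (cong₂ _+_ f-2 (f-2^ t))

    sum-f-upper : ∀ y → y ∈1‥ X → Σ₁ y f ≤ ι y * f y
    sum-f-upper 1 p = ≤-trans (≡⇒≤ (trans (Σ₁-suc 0 f) (trans (cong (_+ f 1) (Σ₁-0 f)) (lemma (f 1))))) ≤-refl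
      where
      lemma : ∀ a → 0ℚ + a ≡ (1ℚ + 0ℚ) * a
      lemma = solve-∀ ring
    sum-f-upper (suc y@(suc _)) p = subst (_≤ ι (suc y) * f (suc y)) (sym (Σ₁-suc y f))
      (lemma (sum-f-upper y (ℕ.s≤s ℕ.z≤n ﹐ ℕₚ.<⇒≤ (hi p))) (0≤ι y) (f-mono y (ℕ.s≤s ℕ.z≤n) (hi p)))
      where
      lemma : ∀ {s y a b} → s ≤ y * a → 0ℚ ≤ y → a ≤ b → s + b ≤ (1ℚ + y) * b
      lemma {s} {y} {a} {b} h₁ h₂ h₃ = by (Δ h₁ ⊕ h₂ ⊗ Δ h₃) (solve (s ∷ y ∷ a ∷ b ∷ []) ring)

    -- A crude Stirling formula. Passing from y to y + 1 costs y(f(y+1) - f(y)), which is at most 2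
    -- by `f-step`.
    sum-f-lower : ∀ y → y ∈1‥ X → ι y * f y - 2ℚ * ι y ≤ Σ₁ y f
    sum-f-lower 1 p = subst (_≤ Σ₁ 1 f) (cong (λ a → ι 1 * a - 2ℚ * ι 1) (sym f-1))
      (≤-trans (nonPositive⁻¹ (ι 1 * 0ℚ - 2ℚ * ι 1)) (Σ₁-nonneg 1 λ n q → f-nonneg (lo q ﹐ ℕₚ.≤-trans (hi q) (hi p))))
    sum-f-lower (suc y@(suc _)) p = subst (ι (suc y) * f (suc y) - 2ℚ * ι (suc y) ≤_) (sym (Σ₁-suc y f))
      (lemma (sum-f-lower y (ℕ.s≤s ℕ.z≤n ﹐ ℕₚ.<⇒≤ (hi p))) (0≤ι y) (f-step y (ℕ.s≤s ℕ.z≤n) (hi p)) (ι*v y))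
      where
      lemma : ∀ {s y a b w} → y * a - 2ℚ * y ≤ s → 0ℚ ≤ y → b - a ≤ 2ℚ * w → y * w ≡ 1ℚ → (1ℚ + y) * b - 2ℚ * (1ℚ + y) ≤ s + b
      lemma {s} {y} {a} {b} {w} h₁ h₂ h₃ e = by (Δ h₁ ⊕ h₂ ⊗ Δ h₃ ⊕ nonNegative⁻¹ 2ℚ ⊗ Δ (≡⇒≤ e)) (solve (s ∷ y ∷ a ∷ b ∷ w ∷ []) ring)

  n<r^n : ∀ r n → 2 ℕ.≤ r → n ℕ.< r ℕ.^ n
  n<r^n r zero    p = ℕₚ.≤-refl
  n<r^n r (suc n) p = ℕₚ.≤-trans (ℕ.s≤s (n<r^n r n p)) (ℕₚ.≤-trans
    (ℕₚ.+-mono-≤ {1} {r ℕ.^ n} (ℕₚ.≤-trans (ℕ.s≤s ℕ.z≤n) (n<r^n r n p)) (ℕₚ.≤-reflexive (sym (ℕₚ.+-identityʳ (r ℕ.^ n)))))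
    (ℕₚ.*-monoˡ-≤ (r ℕ.^ n) p))

  prime≥2 : ∀ {q} → Prime q → 2 ℕ.≤ q
  prime≥2 {q} pq = ℕ.nonTrivial⇒n>1 q {{prime⇒nonTrivial pq}}

  prime≥1 : ∀ {q} → Prime q → 1 ℕ.≤ q
  prime≥1 pq = ℕₚ.<⇒≤ (prime≥2 pq)

  prime∣^ : ∀ {p q} j → Prime p → p ∣ q ℕ.^ j → p ∣ q
  prime∣^ {p} {q} zero    pp d = ⊥-elim (ℕₚ.<⇒≱ (prime≥2 pp) (∣⇒≤ d))
  prime∣^ {p} {q} (suc j) pp d with euclidsLemma q (q ℕ.^ j) pp d
  ... | inj₁ e = e
  ... | inj₂ e = prime∣^ j pp e

  module vonMangoldt {X : ℕ} (L : Log X) where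
    open Log L
    open LogLemmas L
    open Dirichlet X

    -- The von Mangoldt function with `f` as logarithm: the inner sum is 1 when `n` is a positive
    -- power of `q`. Exponents up to `X` are enough, as j < q^j ≤ X.
    Λ : ℕ → ℚ
    Λ n = Σ₁ X λ q → ⟦ prime? q ⟧ * (f q * Σ₁ X λ j → ⟦ q ℕ.^ j ℕ.≟ n ⟧)

    Λ-nonneg : ∀ n → 0ℚ ≤ Λ n
    Λ-nonneg n = Σ₁-nonneg X λ q p → 0≤⟦⟧ (prime? q) ⊗ (f-nonneg p ⊗ Σ₁-nonneg X λ j _ → 0≤⟦⟧ (q ℕ.^ j ℕ.≟ n))

    sum-Λ : ∀ y (h : ℕ → ℚ) →
      Σ₁ y (λ n → h n * Λ n) ≡ Σ₁ X λ q → ⟦ prime? q ⟧ * (f q * Σ₁ X λ j → ⟦ q ℕ.^ j ℕ.≤? y ⟧ * h (q ℕ.^ j))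
    sum-Λ y h = begin
      Σ₁ y (λ n → h n * Λ n)
        ≡⟨ (Σ₁-cong y λ n _ → trans (sym (Σ₁-*ˡ X (h n) _)) (Σ₁-cong X λ q _ →
              trans (lemma (h n) ⟦ prime? q ⟧ (f q) (Σ₁ X λ j → ⟦ q ℕ.^ j ℕ.≟ n ⟧)) (cong (λ s → ⟦ prime? q ⟧ * (f q * s)) (sym (Σ₁-*ʳ X (h n) _))))) ⟩
      Σ₁ y (λ n → Σ₁ X λ q → ⟦ prime? q ⟧ * (f q * Σ₁ X λ j → ⟦ q ℕ.^ j ℕ.≟ n ⟧ * h n))
        ≡⟨ Σ₁-swap y X _ ⟩
      Σ₁ X (λ q → Σ₁ y λ n → ⟦ prime? q ⟧ * (f q * Σ₁ X λ j → ⟦ q ℕ.^ j ℕ.≟ n ⟧ * h n))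
        ≡⟨ (Σ₁-cong X λ q p → trans (Σ₁-*ˡ y ⟦ prime? q ⟧ _) (cong (⟦ prime? q ⟧ *_) (trans (Σ₁-*ˡ y (f q) _) (cong (f q *_) (trans (Σ₁-swap y X _)
              (Σ₁-cong X λ j _ → Σ₁-δ y (q ℕ.^ j) h (ℕₚ.m^n>0 q {{ℕ.>-nonZero (lo p)}} j))))))) ⟩
      Σ₁ X (λ q → ⟦ prime? q ⟧ * (f q * Σ₁ X λ j → ⟦ q ℕ.^ j ℕ.≤? y ⟧ * h (q ℕ.^ j))) ∎
      where
      open ≡-Reasoning
      lemma : ∀ h i a s → h * (i * (a * s)) ≡ i * (a * (s * h))
      lemma = solve-∀ ring

    private
      -- For prime `q` and `n` in 1, ..., X this is the exponent of `q` in `n`, since q^X exceeds X.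
      ν : ℕ → ℕ → ℚ
      ν q n = Σ₁ X λ j → ⟦ q ℕ.^ j ∣? n ⟧

      G : ℕ → ℚ
      G n = Σ₁ X λ q → ⟦ prime? q ⟧ * (f q * ν q n)

      conv-G : ∀ n → n ∈1‥ X → conv 𝟏 Λ n ≡ G n
      conv-G n p = trans (conv-𝟏 Λ n p) (trans (sum-Λ X λ b → ⟦ b ∣? n ⟧) (Σ₁-cong X λ q r →
        cong (λ s → ⟦ prime? q ⟧ * (f q * s)) (Σ₁-cong X λ j _ → ⟦⟧-elim (q ℕ.^ j ℕ.≤? X) (λ _ → refl)
          λ s → sym (⟦no⟧ (q ℕ.^ j ∣? n) λ d → s (ℕₚ.≤-trans (∣⇒≤ {{ℕ.>-nonZero (lo p)}} d) (hi p))))))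

      G-1 : G 1 ≡ 0ℚ
      G-1 = Σ₁-zero X λ q p → ⟦⟧-elim (prime? q) (λ pq → trans (cong (f q *_) (Σ₁-zero X λ j r → ⟦no⟧ (q ℕ.^ j ∣? 1) λ d →
        ℕₚ.<⇒≱ (ℕₚ.≤-<-trans (lo r) (n<r^n q j (prime≥2 pq))) (∣⇒≤ d))) (*-zeroʳ (f q))) (λ _ → refl)

      ν-self : ∀ {r m} → Prime r → m ∈1‥ X → ν r (r ℕ.* m) ≡ ν r m + 1ℚ
      ν-self {r} {m} pr p = begin
        Σ₁ X (λ j → ⟦ r ℕ.^ j ∣? r ℕ.* m ⟧)             ≡⟨ Σ₁≡sum X _ ⟩
        sum X (λ i → ⟦ r ℕ.^ suc i ∣? r ℕ.* m ⟧)        ≡⟨ (sum-cong X λ i _ → ⟦⟧-cong (r ℕ.^ suc i ∣? r ℕ.* m) (r ℕ.^ i ∣? m)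
                                                              (*-cancelˡ-∣ r {{prime⇒nonZero pr}}) (*-monoʳ-∣ r)) ⟩
        -- The term with exponent `X` is zero because r^X > X ≥ m. Adding it makes room for the
        -- shift of the exponent by one, which yields the extra 1.
        sum X g                                         ≡⟨ sym (trans (cong (sum X g +_) (⟦no⟧ (r ℕ.^ X ∣? m) big)) (+-identityʳ (sum X g))) ⟩
        sum (suc X) g                                   ≡⟨ sum-head X g ⟩
        g 0 + sum X (g ∘ suc)                           ≡⟨ cong₂ _+_ (⟦yes⟧ (1 ∣? m) (1∣ m)) (sym (Σ₁≡sum X g)) ⟩
        1ℚ + ν r m                                      ≡⟨ +-comm 1ℚ (ν r m) ⟩
        ν r m + 1ℚ ∎
        where
        open ≡-Reasoning
        g : ℕ → ℚ
        g i = ⟦ r ℕ.^ i ∣? m ⟧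
        big : ¬ r ℕ.^ X ∣ m
        big d = ℕₚ.<⇒≱ (n<r^n r X (prime≥2 pr)) (ℕₚ.≤-trans (∣⇒≤ {{ℕ.>-nonZero (lo p)}} d) (hi p))

      ^-coprime : ∀ {q r m} j → Prime q → Prime r → q ≢ r → q ℕ.^ j ∣ r ℕ.* m → q ℕ.^ j ∣ m
      ^-coprime {q} {r} {m} zero    pq pr ne d = 1∣ m
      ^-coprime {q} {r} {m} (suc j) pq pr ne d with euclidsLemma r m pq (∣-trans (m∣m*n (q ℕ.^ j)) d)
      ... | inj₁ e = ⊥-elim (ne (∣-prime⇒≡ pq pr e))
      ... | inj₂ (divides c refl) = subst (q ℕ.* q ℕ.^ j ∣_) (ℕₚ.*-comm q c) (*-monoʳ-∣ q (^-coprime j pq pr ne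
            (*-cancelˡ-∣ q {{prime⇒nonZero pq}} (subst (q ℕ.* q ℕ.^ j ∣_) eq d))))
        where
        eq : r ℕ.* (c ℕ.* q) ≡ q ℕ.* (r ℕ.* c)
        eq = trans (sym (ℕₚ.*-assoc r c q)) (ℕₚ.*-comm (r ℕ.* c) q)

      ν-other : ∀ {q r m} → Prime q → Prime r → q ≢ r → ν q (r ℕ.* m) ≡ ν q m
      ν-other {q} {r} {m} pq pr ne = Σ₁-cong X λ j _ → ⟦⟧-cong (q ℕ.^ j ∣? r ℕ.* m) (q ℕ.^ j ∣? m) (^-coprime j pq pr ne) (λ d → ∣-trans d (n∣m*n r))

      ν-step : ∀ {q r m} → Prime q → Prime r → m ∈1‥ X → ν q (r ℕ.* m) ≡ ν q m + ⟦ r ℕ.≟ q ⟧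
      ν-step {q} {r} {m} pq pr p with q ℕ.≟ r
      ... | yes refl = trans (ν-self pr p) (cong (ν r m +_) (sym (⟦yes⟧ (r ℕ.≟ r) refl)))
      ... | no ne    = trans (ν-other pq pr ne) (trans (sym (+-identityʳ (ν q m))) (cong (ν q m +_) (sym (⟦no⟧ (r ℕ.≟ q) (ne ∘ sym)))))

      G-step : ∀ {r m} → Prime r → r ∈1‥ X → m ∈1‥ X → G (r ℕ.* m) ≡ f r + G m
      G-step {r} {m} pr r∈ p = begin
        G (r ℕ.* m)
          ≡⟨ (Σ₁-cong X λ q _ → trans (⟦⟧-* (prime? q) λ pq → cong (f q *_) (ν-step pq pr p)) (lemma ⟦ prime? q ⟧ (f q) (ν q m) ⟦ r ℕ.≟ q ⟧)) ⟩
        Σ₁ X (λ q → ⟦ prime? q ⟧ * (f q * ν q m) + ⟦ r ℕ.≟ q ⟧ * (⟦ prime? q ⟧ * f q))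
          ≡⟨ Σ₁-+ X _ _ ⟩
        G m + Σ₁ X (λ q → ⟦ r ℕ.≟ q ⟧ * (⟦ prime? q ⟧ * f q))
          ≡⟨ cong (G m +_) (trans (Σ₁-δ X r _ (lo r∈)) (trans (cong₂ (λ a b → a * (b * f r)) (⟦yes⟧ (r ℕ.≤? X) (hi r∈)) (⟦yes⟧ (prime? r) pr)) (lemma₂ (f r)))) ⟩
        G m + f r
          ≡⟨ +-comm (G m) (f r) ⟩
        f r + G m ∎
        where
        open ≡-Reasoning
        lemma : ∀ i a s d → i * (a * (s + d)) ≡ i * (a * s) + d * (i * a)
        lemma = solve-∀ ring
        lemma₂ : ∀ a → 1ℚ * (1ℚ * a) ≡ a
        lemma₂ = solve-∀ ring

      G-product : ∀ qs → All Prime qs → product qs ∈1‥ X → G (product qs) ≡ f (product qs)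
      G-product []       All.[]         p = trans G-1 (sym f-1)
      G-product (q ∷ qs) (pq All.∷ pqs) p = trans (G-step pq (*-in (prime≥1 pq) 1≤ refl (hi p)) m∈)
        (trans (cong (f q +_) (G-product qs pqs m∈)) (sym (f-* (prime≥1 pq) 1≤)))
        where
        1≤ : 1 ℕ.≤ product qs
        1≤ = product≥1 pqs
          where
          product≥1 : ∀ {qs} → All Prime qs → 1 ℕ.≤ product qs
          product≥1 All.[]         = ℕₚ.≤-refl
          product≥1 (pq All.∷ pqs) = 1≤* (prime≥1 pq) (product≥1 pqs)
        m∈ : product qs ∈1‥ X
        m∈ = *-in′ (prime≥1 pq) 1≤ refl (hi p)

    -- The left side is Σ f(q)·ν(q, n) over primes q. Multiplying n by a prime r raises only ν(r,
    -- n), by one, so this sum gains f(r), exactly as the additive `f` does.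
    conv-𝟏-Λ : ∀ n → n ∈1‥ X → conv 𝟏 Λ n ≡ f n
    conv-𝟏-Λ n@(suc _) p with factorise n
    ... | record { factors = qs ; isFactorisation = e ; factorsPrime = pqs } =
      trans (conv-G n p) (trans (cong G e) (trans (G-product qs pqs (subst (_∈1‥ X) e p)) (cong f (sym e))))

    ψ : ℕ → ℚ
    ψ y = Σ₁ y Λ

    private
      -- Legendre's formula for the logarithm of y!: sum f = Λ * 1 and count the multiples of each
      -- a.
      legendre : ∀ y → y ℕ.≤ X → Σ₁ y f ≡ Σ₁ X λ a → Λ a * ι (y ÷ a)
      legendre y p = begin
        Σ₁ y f
          ≡⟨ (Σ₁-cong y λ n q → sym (trans (*-identityˡ _) (trans (conv-comm Λ 𝟏 n) (conv-𝟏-Λ n (lo q ﹐ ℕₚ.≤-trans (hi q) p))))) ⟩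
        Σ₁ y (λ n → 1ℚ * conv Λ 𝟏 n)
          ≡⟨ sum-conv y (λ _ → 1ℚ) Λ 𝟏 p ⟩
        Σ₁ X (λ a → Σ₁ X λ b → ⟦ a ℕ.* b ℕ.≤? y ⟧ * (1ℚ * (Λ a * 1ℚ)))
          ≡⟨ (Σ₁-cong X λ a q → trans (hyperbola X y a (λ _ → 1ℚ * (Λ a * 1ℚ)) (lo q) p)
                (trans (Σ₁≡sum (y ÷ a) _) (trans (sum-const (y ÷ a) (1ℚ * (Λ a * 1ℚ))) (lemma (ι (y ÷ a)) (Λ a))))) ⟩
        Σ₁ X (λ a → Λ a * ι (y ÷ a)) ∎
        where
        open ≡-Reasoning
        lemma : ∀ i a → i * (1ℚ * (a * 1ℚ)) ≡ a * i
        lemma = solve-∀ ring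

      -- The second floor vanishes for y < a ≤ 2y while the first is at least 1; for a ≤ y the
      -- difference is nonnegative. This is Chebyshev's use of the central binomial coefficient.
      floor-gap : ∀ y a → 1 ℕ.≤ a → ⟦ a ℕ.≤? 2 ℕ.* y ⟧ - ⟦ a ℕ.≤? y ⟧ ≤ ι (2 ℕ.* y ÷ a) - 2ℚ * ι (y ÷ a)
      floor-gap y a p = cases (a ℕ.≤? y)
       where
       cases : Dec (a ℕ.≤ y) → ⟦ a ℕ.≤? 2 ℕ.* y ⟧ - ⟦ a ℕ.≤? y ⟧ ≤ ι (2 ℕ.* y ÷ a) - 2ℚ * ι (y ÷ a)
       cases (yes q) = ≤-trans (≡⇒≤ (cong₂ _-_ (⟦yes⟧ (a ℕ.≤? 2 ℕ.* y) (ℕₚ.≤-trans q (ℕₚ.m≤n*m y 2))) (⟦yes⟧ (a ℕ.≤? y) q)))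
        (Δ (≤-trans (≡⇒≤ (trans (cong (_* ι (y ÷ a)) two) (sym (ι-* 2 (y ÷ a))))) (ι-mono (÷-adjoint′ (2 ℕ.* y) a (2 ℕ.* (y ÷ a)) p
          (subst (ℕ._≤ 2 ℕ.* y) (trans (sym (ℕₚ.*-assoc 2 a (y ÷ a))) (trans (cong (ℕ._* (y ÷ a)) (ℕₚ.*-comm 2 a)) (ℕₚ.*-assoc a 2 (y ÷ a)))) (ℕₚ.*-monoʳ-≤ 2 (÷-≤ y a)))))))
        where
        two : 2ℚ ≡ ι 2
        two = refl
       cases (no q)  = ≤-trans (+-mono-≤ (step (a ℕ.≤? 2 ℕ.* y)) (≡⇒≤ (cong -_ (⟦no⟧ (a ℕ.≤? y) q))))
        (≡⇒≤ (cong (λ z → ι (2 ℕ.* y ÷ a) - 2ℚ * ι z) (sym (÷-big (ℕₚ.≰⇒> q)))))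
        where
        step : (d : Dec (a ℕ.≤ 2 ℕ.* y)) → ⟦ a ℕ.≤? 2 ℕ.* y ⟧ ≤ ι (2 ℕ.* y ÷ a)
        step (yes r) = ≤-trans (⟦⟧≤1 (a ℕ.≤? 2 ℕ.* y)) (ι-mono {1} (÷-adjoint′ (2 ℕ.* y) a 1 p (subst (ℕ._≤ 2 ℕ.* y) (sym (ℕₚ.*-identityʳ a)) r)))
        step (no r)  = ≤-trans (≡⇒≤ (⟦no⟧ (a ℕ.≤? 2 ℕ.* y) r)) (0≤ι (2 ℕ.* y ÷ a))

    -- The combination Σ f up to 2y minus twice Σ f up to y is the logarithm of a central binomial
    -- coefficient. The bounds on Σ f give 2y(1 + f(y)) - 2(y·f(y) - 2y) = 6y.
    chebyshev-step : ∀ y → 1 ℕ.≤ y → 2 ℕ.* y ℕ.≤ X → ψ (2 ℕ.* y) - ψ y ≤ (ℤ.+ 6 / 1) * ι y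
    chebyshev-step y p q = begin
      ψ (2 ℕ.* y) - ψ y
        ≡⟨ sym (cong₂ _-_ (Σ₁-restrict X (2 ℕ.* y) Λ q) (Σ₁-restrict X y Λ y≤X)) ⟩
      Σ₁ X (λ a → ⟦ a ℕ.≤? 2 ℕ.* y ⟧ * Λ a) - Σ₁ X (λ a → ⟦ a ℕ.≤? y ⟧ * Λ a)
        ≡⟨ sym (Σ₁-- X _ _) ⟩
      Σ₁ X (λ a → ⟦ a ℕ.≤? 2 ℕ.* y ⟧ * Λ a - ⟦ a ℕ.≤? y ⟧ * Λ a)
        ≤⟨ (Σ₁-mono X λ a r → subst₂ _≤_ (lemma ⟦ a ℕ.≤? 2 ℕ.* y ⟧ ⟦ a ℕ.≤? y ⟧ (Λ a)) (lemma₂ (Λ a) (ι (2 ℕ.* y ÷ a)) (ι (y ÷ a)))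
              (*-monoʳ (Λ a) (Λ-nonneg a) (floor-gap y a (lo r)))) ⟩
      Σ₁ X (λ a → Λ a * ι (2 ℕ.* y ÷ a) - 2ℚ * (Λ a * ι (y ÷ a)))
        ≡⟨ trans (Σ₁-- X _ _) (cong₂ _-_ (sym (legendre (2 ℕ.* y) q)) (trans (Σ₁-*ˡ X 2ℚ _) (cong (2ℚ *_) (sym (legendre y y≤X))))) ⟩
      Σ₁ (2 ℕ.* y) f - 2ℚ * Σ₁ y f
        ≤⟨ lemma₃ {y = ι y} {b = f y} (sum-f-upper (2 ℕ.* y) (1≤* {2} (ℕ.s≤s ℕ.z≤n) p ﹐ q)) (sum-f-lower y (p ﹐ y≤X)) (ι-* 2 y) (trans (f-* {2} (ℕ.s≤s ℕ.z≤n) p) (cong (_+ f y) f-2)) ⟩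
      (ℤ.+ 6 / 1) * ι y ∎
      where
      open ≤-Reasoning
      y≤X : y ℕ.≤ X
      y≤X = ℕₚ.≤-trans (ℕₚ.m≤n*m y 2) q
      lemma : ∀ a b c → (a - b) * c ≡ a * c - b * c
      lemma = solve-∀ ring
      lemma₂ : ∀ a b c → (b - 2ℚ * c) * a ≡ a * b - 2ℚ * (a * c)
      lemma₂ = solve-∀ ring
      lemma₃ : ∀ {s t n y a b} → s ≤ n * a → y * b - 2ℚ * y ≤ t → n ≡ 2ℚ * y → a ≡ 1ℚ + b → s - 2ℚ * t ≤ (ℤ.+ 6 / 1) * y
      lemma₃ {s} {t} {n} {y} {a} {b} h₁ h₂ refl refl = by (Δ h₁ ⊕ nonNegative⁻¹ 2ℚ ⊗ Δ h₂) (solve (s ∷ t ∷ y ∷ b ∷ []) ring)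

    private
      ψ-1 : 1 ℕ.≤ X → ψ 1 ≤ 0ℚ
      ψ-1 p = begin
        ψ 1                                        ≡⟨ sym (Σ₁-restrict X 1 Λ p) ⟩
        Σ₁ X (λ a → ⟦ a ℕ.≤? 1 ⟧ * Λ a)            ≤⟨ (Σ₁-mono X λ a r → ≤-trans (≡⇒≤ (*-comm ⟦ a ℕ.≤? 1 ⟧ (Λ a))) (*-monoˡ (Λ a) (Λ-nonneg a) (small a (lo r)))) ⟩
        Σ₁ X (λ a → Λ a * ι (1 ÷ a))               ≡⟨ sym (legendre 1 p) ⟩
        Σ₁ 1 f                                     ≤⟨ sum-f-upper 1 (ℕₚ.≤-refl ﹐ p) ⟩
        ι 1 * f 1                                  ≡⟨ cong (ι 1 *_) f-1 ⟩
        0ℚ ∎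
        where
        open ≤-Reasoning
        small : ∀ a → 1 ℕ.≤ a → ⟦ a ℕ.≤? 1 ⟧ ≤ ι (1 ÷ a)
        small a q = ⟦⟧-case (a ℕ.≤? 1) (_≤ ι (1 ÷ a)) (λ r → ι-mono {1} (÷-adjoint′ 1 a 1 q (subst (ℕ._≤ 1) (sym (ℕₚ.*-identityʳ a)) r))) (λ _ → 0≤ι (1 ÷ a))

    Λ-1 : 1 ℕ.≤ X → Λ 1 ≡ 0ℚ
    Λ-1 p = ≤-antisym (subst (_≤ 0ℚ) (trans (Σ₁-suc 0 Λ) (trans (cong (_+ Λ 1) (Σ₁-0 Λ)) (+-identityˡ (Λ 1)))) (ψ-1 p)) (Λ-nonneg 1)

    chebyshev : ∀ t → 2 ℕ.^ t ℕ.≤ X → ψ (2 ℕ.^ t) ≤ (ℤ.+ 6 / 1) * ι (2 ℕ.^ t)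
    chebyshev zero    p = ≤-trans (ψ-1 p) (nonNegative⁻¹ _)
    chebyshev (suc t) p = lemma {y = ι (2 ℕ.^ t)} (chebyshev t (ℕₚ.≤-trans (ℕₚ.m≤n*m (2 ℕ.^ t) 2) p)) (chebyshev-step (2 ℕ.^ t) (ℕₚ.m^n>0 2 t) p) (ι-* 2 (2 ℕ.^ t))
      where
      lemma : ∀ {a b y z} → a ≤ (ℤ.+ 6 / 1) * y → b - a ≤ (ℤ.+ 6 / 1) * y → z ≡ 2ℚ * y → b ≤ (ℤ.+ 6 / 1) * z
      lemma {a} {b} {y} h₁ h₂ refl = by (Δ h₁ ⊕ Δ h₂) (solve (a ∷ b ∷ y ∷ []) ring)

    M : ℕ → ℚ
    M y = Σ₁ y λ n → Λ n * v n

    private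
      M-scaled : ∀ y → y ℕ.≤ X → ι y * M y ≡ Σ₁ y λ a → Λ a * (ι y * v a)
      M-scaled y p = trans (sym (Σ₁-*ˡ y (ι y) _)) (Σ₁-cong y λ a _ → lemma (ι y) (Λ a) (v a))
        where
        lemma : ∀ a b c → a * (b * c) ≡ b * (a * c)
        lemma = solve-∀ ring

      legendre′ : ∀ y → y ℕ.≤ X → Σ₁ y f ≡ Σ₁ y λ a → Λ a * ι (y ÷ a)
      legendre′ y p = trans (legendre y p) (Σ₁-extend X y _ p λ a _ q → trans (cong (λ z → Λ a * ι z) (÷-big q)) (*-zeroʳ (Λ a)))

    mertens-lower : ∀ y → y ∈1‥ X → f y - 2ℚ ≤ M y
    mertens-lower y@(suc _) p = *-cancel (ι y) (0<ι y) (begin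
      ι y * (f y - 2ℚ)                       ≡⟨ lemma (ι y) (f y) ⟩
      ι y * f y - 2ℚ * ι y                   ≤⟨ sum-f-lower y p ⟩
      Σ₁ y f                                 ≡⟨ legendre′ y (hi p) ⟩
      Σ₁ y (λ a → Λ a * ι (y ÷ a))           ≤⟨ (Σ₁-mono y λ a q → *-monoˡ (Λ a) (Λ-nonneg a) (≤v a {{ℕ.>-nonZero (lo q)}}
                                                  (≤-trans (≡⇒≤ (sym (ι-* a (y ÷ a)))) (ι-mono (÷-≤ y a))))) ⟩
      Σ₁ y (λ a → Λ a * (ι y * v a))         ≡⟨ sym (M-scaled y (hi p)) ⟩
      ι y * M y ∎)
      where
      open ≤-Reasoning
      lemma : ∀ a b → a * (b - 2ℚ) ≡ a * b - 2ℚ * a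
      lemma = solve-∀ ring

    mertens-upper : ∀ y → y ∈1‥ X → ι y * M y ≤ ι y * f y + ψ y
    mertens-upper y p = begin
      ι y * M y                                    ≡⟨ M-scaled y (hi p) ⟩
      Σ₁ y (λ a → Λ a * (ι y * v a))               ≤⟨ (Σ₁-mono y λ a q → *-monoˡ (Λ a) (Λ-nonneg a) (v≤ a {{ℕ.>-nonZero (lo q)}}
                                                        (≤-trans (ι-mono (ℕₚ.<⇒≤ (÷-> y a (lo q)))) (≡⇒≤ (ι-* a (suc (y ÷ a))))))) ⟩
      Σ₁ y (λ a → Λ a * (1ℚ + ι (y ÷ a)))          ≡⟨ (Σ₁-cong y λ a _ → lemma (Λ a) (ι (y ÷ a))) ⟩
      Σ₁ y (λ a → Λ a * ι (y ÷ a) + Λ a)           ≡⟨ Σ₁-+ y _ _ ⟩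
      Σ₁ y (λ a → Λ a * ι (y ÷ a)) + ψ y           ≡⟨ cong (_+ ψ y) (sym (legendre′ y (hi p))) ⟩
      Σ₁ y f + ψ y                                 ≤⟨ +-monoˡ-≤ (ψ y) (sum-f-upper y p) ⟩
      ι y * f y + ψ y ∎
      where
      open ≤-Reasoning
      lemma : ∀ a b → a * (1ℚ + b) ≡ a * b + a
      lemma = solve-∀ ring

    -- In Legendre's formula, replacing y ÷ a by y/a costs at most ψ(y) ≤ 6y and has a definite
    -- sign. The 6 comes from there, the 2 from the lower bound for Σ f.
    mertens : ∀ t → 2 ℕ.^ t ℕ.≤ X → (ι t - 2ℚ ≤ M (2 ℕ.^ t)) × (M (2 ℕ.^ t) ≤ ι t + (ℤ.+ 6 / 1))
    mertens t p = subst (λ z → z - 2ℚ ≤ M (2 ℕ.^ t)) (f-2^ t) (mertens-lower (2 ℕ.^ t) (1≤2^ ﹐ p))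
      , *-cancel (ι (2 ℕ.^ t)) (0<ι (2 ℕ.^ t) {{ℕ.>-nonZero 1≤2^}}) (lemma {a = ι (2 ℕ.^ t)} {m = M (2 ℕ.^ t)} (mertens-upper (2 ℕ.^ t) (1≤2^ ﹐ p)) (f-2^ t) (chebyshev t p))
      where
      1≤2^ = ℕₚ.m^n>0 2 t
      lemma : ∀ {a m b s t} → a * m ≤ a * b + s → b ≡ t → s ≤ (ℤ.+ 6 / 1) * a → a * m ≤ a * (t + (ℤ.+ 6 / 1))
      lemma {a} {m} {b} {s} h₁ refl h₂ = by (Δ h₁ ⊕ Δ h₂) (solve (a ∷ m ∷ b ∷ s ∷ []) ring)

-- Arithmetic modulo a prime

module Residue where

  open import Data.Nat
  open import Data.Nat.Properties
  open import Data.Nat.DivMod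
  open import Data.Nat.Divisibility
  open import Data.Nat.GCD using (module Bézout)
  open import Data.Nat.Coprimality using (Coprime; coprime-Bézout; prime⇒coprime) renaming (sym to coprime-sym)
  open import Data.Nat.Primality using (Prime; prime⇒irreducible; prime⇒nonZero; prime⇒nonTrivial; euclidsLemma)
  open import Data.Product using (_,_; _×_; ∃)
  open import Data.Sum using (inj₁; inj₂)
  open import Data.Empty using (⊥-elim)
  open import Relation.Nullary using (¬_)
  open import Relation.Binary.PropositionalEquality

  module Mod (k : ℕ) (pk : Prime k) where

    instance
      k≢0 : NonZero k
      k≢0 = prime⇒nonZero pk

    1<k : 1 < k
    1<k = nonTrivial⇒n>1 k {{prime⇒nonTrivial pk}}

    infix 4 _≈_
    _≈_ : ℕ → ℕ → Set
    a ≈ b = a % k ≡ b % k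

    %≈ : ∀ a → a % k ≈ a
    %≈ a = m%n%n≡m%n a k

    *-cong : ∀ {a b c d} → a ≈ b → c ≈ d → a * c ≈ b * d
    *-cong {a} {b} {c} {d} p q = trans (%-distribˡ-* a c k) (trans (cong₂ (λ x y → (x * y) % k) p q) (sym (%-distribˡ-* b d k)))

    *-congˡ : ∀ a {c d} → c ≈ d → a * c ≈ a * d
    *-congˡ a = *-cong {a} {a} refl

    *-congʳ : ∀ c {a b} → a ≈ b → a * c ≈ b * c
    *-congʳ c p = *-cong p (refl {x = c % k})

    1%k : 1 % k ≡ 1
    1%k = m<n⇒m%n≡m 1<k

    ∣⇒%≡0 : ∀ {a} → k ∣ a → a % k ≡ 0
    ∣⇒%≡0 {a} d = n∣m⇒m%n≡0 a k d

    %≡0⇒∣ : ∀ {a} → a % k ≡ 0 → k ∣ a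
    %≡0⇒∣ {a} e = m%n≡0⇒n∣m a k e

    private
      coprime-k : ∀ {d} → ¬ k ∣ d → Coprime d k
      coprime-k {d} ¬k∣d {i} (i∣d , i∣k) with prime⇒irreducible pk i∣k
      ... | inj₁ e    = e
      ... | inj₂ refl = ⊥-elim (¬k∣d i∣d)

    inverse : ∀ {d} → ¬ k ∣ d → ∃ λ d′ → d * d′ ≈ 1
    inverse {d} ¬k∣d with coprime-Bézout (coprime-k ¬k∣d)
    ... | Bézout.+- x y eq = x , trans (cong (_% k) (trans (*-comm d x) (sym eq))) ([m+kn]%n≡m%n 1 y k)
    -- In this case x·d ≡ -1. Subtraction is avoided by squaring: (d·x)² ≡ 1 exhibits x·(d·x) as the
    -- inverse.
    ... | Bézout.-+ x y eq = x * (d * x) , (begin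
      (d * (x * (d * x))) % k            ≡⟨ cong (_% k) (sym (*-assoc d x (d * x))) ⟩
      (d * x * (d * x)) % k              ≡⟨ cong (λ z → (z * z) % k) (*-comm d x) ⟩
      (z * z) % k                        ≡⟨ sym ([m+kn]%n≡m%n (z * z) y k) ⟩
      (z * z + y * k) % k                ≡⟨ cong (λ w → (z * z + w) % k) (sym eq) ⟩
      (z * z + (1 + z)) % k              ≡⟨ cong (_% k) (trans (+-suc (z * z) z) (cong suc (trans (+-comm (z * z) z) (sym (*-suc z z))))) ⟩
      (1 + z * (1 + z)) % k              ≡⟨ cong (λ w → (1 + z * w) % k) eq ⟩
      (1 + z * (y * k)) % k              ≡⟨ cong (λ w → (1 + w) % k) (sym (*-assoc z y k)) ⟩
      (1 + z * y * k) % k                ≡⟨ [m+kn]%n≡m%n 1 (z * y) k ⟩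
      1 % k ∎)
      where
      open ≡-Reasoning
      z = x * d

    cancel : ∀ {d} a b → ¬ k ∣ d → d * a ≈ d * b → a ≈ b
    cancel {d} a b ¬k∣d p with inverse ¬k∣d
    ... | d′ , e = trans (sym (undo a)) (trans (*-congˡ d′ p) (undo b))
      where
      undo : ∀ a → d′ * (d * a) ≈ a
      undo a = trans (cong (_% k) (trans (sym (*-assoc d′ d a)) (cong (_* a) (*-comm d′ d)))) (trans (*-congʳ a e) (cong (_% k) (*-identityˡ a)))

    divide : ∀ {d} → ¬ k ∣ d → ∀ l → ∃ λ c → c < k × d * c ≈ l
    divide {d} ¬k∣d l with inverse ¬k∣d
    ... | d′ , e = (d′ * l) % k , m%n<n (d′ * l) k ,
      trans (*-congˡ d (%≈ (d′ * l))) (trans (cong (_% k) (sym (*-assoc d d′ l))) (trans (*-congʳ l e) (cong (_% k) (*-identityˡ l))))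

    ∤-* : ∀ {a b} → ¬ k ∣ a → ¬ k ∣ b → ¬ k ∣ a * b
    ∤-* {a} {b} p q d with euclidsLemma a b pk d
    ... | inj₁ e = p e
    ... | inj₂ e = q e

    unit : ∀ {l} → 1 ≤ l → l < k → ¬ k ∣ l
    unit {suc l} _ q d = <⇒≱ q (∣⇒≤ d)

    small : ∀ {l} → l < k → l % k ≡ l
    small = m<n⇒m%n≡m

    unit-≥1 : ∀ {a} → ¬ k ∣ a → 1 ≤ a % k
    unit-≥1 {a} p = n≢0⇒n>0 λ e → p (%≡0⇒∣ e)

-- Selberg's formula and the comparison of residue classes

module Selberg where

  open import Data.Nat as ℕ using (ℕ; zero; suc)
  import Data.Nat.Properties as ℕₚ
  open import Data.Nat.DivMod using ([m+kn]%n≡m%n; m%n<n)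
  open import Data.Nat.Divisibility using (_∣_; _∣?_; ∣m⇒∣m*n)
  open import Data.Nat.Primality using (Prime)
  import Data.Integer as ℤ
  open import Data.Rational hiding (_÷_)
  open import Data.Rational.Properties
  open import Data.Product using (_,_)
  open import Data.List using ([]; _∷_)
  open import Function using (_∘_)
  open import Relation.Nullary using (¬_; yes; no)
  open import Relation.Binary.PropositionalEquality
  open import Tactic.RingSolver using (solve; solve-∀)
  open Rationals
  open Sums
  open Convolution
  open Mangoldt
  open Residue

  8ℚ 24ℚ : ℚ
  8ℚ  = ℤ.+ 8 / 1
  24ℚ = ℤ.+ 24 / 1

  -- With a, b = f(m), f(m+1) and x, z = 1/m, 1/(m+1): the coefficients 8 and 24 are what makes (f² + 8f + 24)/m decrease at least as fast as f²/m varies.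
  potential² : ∀ a b x z → 0ℚ ≤ a → a ≤ b → b - a ≤ 2ℚ * x → 0ℚ ≤ z → 0ℚ ≤ x → x ≤ 1ℚ → x * z ≡ x - z →
    ∣ b * b * z - a * a * x ∣ ≤ (a * a + 8ℚ * a + 24ℚ) * x - (b * b + 8ℚ * b + 24ℚ) * z
  potential² a b x z 0≤a a≤b δ≤ 0≤z 0≤x x≤1 e = abs≤
    (by (0≤z ⊗ (nonNegative⁻¹ 2ℚ ⊗ (0≤a ⊗ 0≤a ⊗ 0≤x) ⊕ nonNegative⁻¹ 4ℚ ⊗ (0≤a ⊗ Δ δ≤) ⊕ nonNegative⁻¹ 8ℚ ⊗ Δ δ≤ ⊕ nonNegative⁻¹ 2ℚ ⊗ (Δ a≤b ⊗ Δ δ≤) ⊕ nonNegative⁻¹ 4ℚ ⊗ (0≤x ⊗ (Δ δ≤ ⊕ nonNegative⁻¹ 2ℚ ⊗ Δ x≤1)))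
         ⊕ (nonNegative⁻¹ 2ℚ ⊗ (0≤a ⊗ 0≤a) ⊕ nonNegative⁻¹ 8ℚ ⊗ 0≤a ⊕ nonNegative⁻¹ 24ℚ) ⊗ Δ (≡⇒≤ e)) (solve (a ∷ b ∷ x ∷ z ∷ []) ring))
    (by (0≤z ⊗ (nonNegative⁻¹ 8ℚ ⊗ (0≤a ⊗ 0≤x) ⊕ nonNegative⁻¹ 8ℚ ⊗ 0≤x ⊕ nonNegative⁻¹ 8ℚ ⊗ Δ δ≤) ⊕ (nonNegative⁻¹ 8ℚ ⊗ 0≤a ⊕ nonNegative⁻¹ 24ℚ) ⊗ Δ (≡⇒≤ e))
       (solve (a ∷ b ∷ x ∷ z ∷ []) ring))
    where
    4ℚ : ℚ
    4ℚ = ℤ.+ 4 / 1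

  -- The analogue for f(m)/m of the preceding potential. One has b·z - a·x ≤ (b - a)·z ≤ 2xz = 2(x -
  -- z), and the constant 4 is twice this 2.
  potential¹ : ∀ a b x z → 0ℚ ≤ a → b - a ≤ 2ℚ * x → 0ℚ ≤ z → 0ℚ ≤ x → z ≤ x → x * z ≡ x - z →
    ∣ b * z - a * x ∣ ≤ (a + (ℤ.+ 4 / 1)) * x - (b + (ℤ.+ 4 / 1)) * z
  potential¹ a b x z 0≤a δ≤ 0≤z 0≤x z≤x e = abs≤
    (by (0≤z ⊗ (nonNegative⁻¹ 2ℚ ⊗ (0≤a ⊗ 0≤x) ⊕ nonNegative⁻¹ 2ℚ ⊗ Δ δ≤) ⊕ (nonNegative⁻¹ 2ℚ ⊗ 0≤a ⊕ nonNegative⁻¹ (ℤ.+ 4 / 1)) ⊗ Δ (≡⇒≤ e)) (solve (a ∷ b ∷ x ∷ z ∷ []) ring))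
    (by (nonNegative⁻¹ (ℤ.+ 4 / 1) ⊗ Δ z≤x) (solve (a ∷ b ∷ x ∷ z ∷ []) ring))

  2^suc : ∀ t → 2 ℕ.^ suc t ≡ 2 ℕ.^ t ℕ.+ 2 ℕ.^ t
  2^suc t = cong (2 ℕ.^ t ℕ.+_) (ℕₚ.+-identityʳ (2 ℕ.^ t))

  harmonic : ∀ t → Σ₁ (2 ℕ.^ t) v ≤ ι t + 1ℚ
  harmonic zero    = ≡⇒≤ (trans (Σ₁-suc 0 v) (cong₂ _+_ (Σ₁-0 v) v1))
  harmonic (suc t) = begin
    Σ₁ (2 ℕ.^ suc t) v                                          ≡⟨ trans (cong (λ y → Σ₁ y v) (2^suc t)) (Σ₁-split (2 ℕ.^ t) (2 ℕ.^ t) v) ⟩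
    Σ₁ (2 ℕ.^ t) v + Σ₁ (2 ℕ.^ t) (λ i → v (2 ℕ.^ t ℕ.+ i))     ≤⟨ +-mono-≤ (harmonic t) (Σ₁-mono (2 ℕ.^ t) {g = λ _ → v (2 ℕ.^ t)} λ i _ → v-anti {{2^≢0}} (ℕₚ.m≤m+n (2 ℕ.^ t) i)) ⟩
    ι t + 1ℚ + Σ₁ (2 ℕ.^ t) (λ _ → v (2 ℕ.^ t))                 ≡⟨ cong (ι t + 1ℚ +_) (trans (Σ₁≡sum (2 ℕ.^ t) _) (trans (sum-const (2 ℕ.^ t) (v (2 ℕ.^ t))) (ι*v (2 ℕ.^ t) {{2^≢0}}))) ⟩
    ι t + 1ℚ + 1ℚ                                               ≡⟨ lemma (ι t) ⟩
    ι (suc t) + 1ℚ ∎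
    where
    open ≤-Reasoning
    2^≢0 : ℕ.NonZero (2 ℕ.^ t)
    2^≢0 = ℕₚ.m^n≢0 2 t
    lemma : ∀ a → a + 1ℚ + 1ℚ ≡ 1ℚ + a + 1ℚ
    lemma = solve-∀ ring

  module Residues (k : ℕ) (pk : Prime k) where
    open Mod k pk

    φk : ℕ
    φk = ℕ.pred k

    sucφk : suc φk ≡ k
    sucφk = ℕₚ.suc-pred k

    class< : ∀ {l} → l ∈1‥ φk → l ℕ.< k
    class< p = ℕₚ.≤-trans (ℕ.s≤s (hi p)) (ℕₚ.≤-reflexive sucφk)

    class-unit : ∀ {l} → l ∈1‥ φk → ¬ k ∣ l
    class-unit p = unit (lo p) (class< p)

    class-of : ∀ {a} → ¬ k ∣ a → a ℕ.% k ∈1‥ φk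
    class-of {a} p = unit-≥1 p ﹐ ℕₚ.≤-pred (ℕₚ.≤-trans (m%n<n a k) (ℕₚ.≤-reflexive (sym sucφk)))

    e : ℕ → ℕ → ℚ
    e l n = ⟦ n ℕ.% k ℕ.≟ l ⟧

    0≤e : ∀ l n → 0ℚ ≤ e l n
    0≤e l n = 0≤⟦⟧ (n ℕ.% k ℕ.≟ l)

    count : ∀ {d l} → ¬ k ∣ d → l ∈1‥ φk → sum k (λ m → e l (d ℕ.* m)) ≡ 1ℚ
    count {d} {l} ¬k∣d l∈ with divide ¬k∣d l
    ... | c , c<k , dc≈l = trans (sum-single k c _ c<k λ m m<k m≢c → ⟦no⟧ ((d ℕ.* m) ℕ.% k ℕ.≟ l)
              λ eq → m≢c (trans (sym (small m<k)) (trans (cancel m c ¬k∣d (trans eq (sym dc≡l))) (small c<k))))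
            (⟦yes⟧ ((d ℕ.* c) ℕ.% k ℕ.≟ l) dc≡l)
      where
      dc≡l : (d ℕ.* c) ℕ.% k ≡ l
      dc≡l = trans dc≈l (small (class< l∈))

    osc : ℕ → ℕ → ℕ → ℕ → ℚ
    osc d l l′ b = e l (d ℕ.* b) - e l′ (d ℕ.* b)

    private
      osc≤1 : ∀ d l l′ b → ∣ osc d l l′ b ∣ ≤ 1ℚ
      osc≤1 d l l′ b = lemma (e l (d ℕ.* b)) (e l′ (d ℕ.* b)) (0≤e l _) (0≤e l′ _) (⟦⟧≤1 ((d ℕ.* b) ℕ.% k ℕ.≟ l)) (⟦⟧≤1 ((d ℕ.* b) ℕ.% k ℕ.≟ l′))
        where
        lemma : ∀ a b → 0ℚ ≤ a → 0ℚ ≤ b → a ≤ 1ℚ → b ≤ 1ℚ → ∣ a - b ∣ ≤ 1ℚ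
        lemma a b h₁ h₂ h₃ h₄ = abs≤ (by (Δ h₃ ⊕ h₂) (solve (a ∷ b ∷ []) ring)) (by (Δ h₄ ⊕ h₁) (solve (a ∷ b ∷ []) ring))

      osc-periodic : ∀ d l l′ b → osc d l l′ (k ℕ.+ b) ≡ osc d l l′ b
      osc-periodic d l l′ b = cong₂ _-_ (shift l) (shift l′)
        where
        shift : ∀ l → e l (d ℕ.* (k ℕ.+ b)) ≡ e l (d ℕ.* b)
        shift l = cong (λ r → ⟦ r ℕ.≟ l ⟧) (trans (cong (ℕ._% k) (trans (ℕₚ.*-distribˡ-+ d k b) (ℕₚ.+-comm (d ℕ.* k) (d ℕ.* b)))) ([m+kn]%n≡m%n (d ℕ.* b) d k))

      osc-zero : ∀ d {l l′} → l ∈1‥ φk → l′ ∈1‥ φk → sum k (osc d l l′) ≡ 0ℚ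
      osc-zero d {l} {l′} p p′ with k ∣? d
      ... | no q  = trans (sum-- k _ _) (trans (cong₂ _-_ (count q p) (count q p′)) refl)
      ... | yes q = sum-zero k λ b _ → cong₂ _-_ (vanish l p b) (vanish l′ p′ b)
        where
        vanish : ∀ l → l ∈1‥ φk → ∀ b → e l (d ℕ.* b) ≡ 0ℚ
        vanish l p b = ⟦no⟧ ((d ℕ.* b) ℕ.% k ℕ.≟ l) λ eq → ℕₚ.<⇒≢ (lo p) (trans (sym (∣⇒%≡0 (∣m⇒∣m*n b q))) eq)

    -- If k divides d both indicators vanish; otherwise b ↦ d·b meets every class once per period.
    -- Either way `osc` is periodic in b with sum zero.
    osc-partial : ∀ d {l l′} → l ∈1‥ φk → l′ ∈1‥ φk → ∀ n → ∣ sum n (osc d l l′ ∘ suc) ∣ ≤ ι k + ι k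
    osc-partial d {l} {l′} p p′ = Periodic.partial-from k (osc d l l′) (osc≤1 d l l′) (osc-periodic d l l′) (osc-zero d p p′) 1

  module SelbergFormula {X : ℕ} (L : Log X) (k : ℕ) (pk : Prime k) where
    open Log L
    open LogLemmas L
    open vonMangoldt L
    open Dirichlet X
    open Residues k pk

    Λ₂ : ℕ → ℚ
    Λ₂ n = Λ n * f n + conv Λ Λ n

    -- Since 1 * Λ * Λ = f * Λ, the left side is a sum over a·b = n of (f(b) + f(a))·Λ(b).
    -- Additivity turns the bracket into f(n), leaving f(n)·(1 * Λ)(n).
    conv-𝟏-Λ₂ : ∀ n → n ∈1‥ X → conv 𝟏 Λ₂ n ≡ f n * f n
    conv-𝟏-Λ₂ n p = begin
      conv 𝟏 Λ₂ n                                           ≡⟨ conv-+ 𝟏 (λ b → Λ b * f b) (conv Λ Λ) n ⟩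
      conv 𝟏 (λ b → Λ b * f b) n + conv 𝟏 (conv Λ Λ) n      ≡⟨ cong (conv 𝟏 (λ b → Λ b * f b) n +_) (trans (conv-assoc 𝟏 Λ Λ n (hi p)) (conv-cong {conv 𝟏 Λ} {f} {Λ} {Λ} n conv-𝟏-Λ (λ _ _ → refl))) ⟩
      conv 𝟏 (λ b → Λ b * f b) n + conv f Λ n               ≡⟨ sym (Σ₁-+ X _ _) ⟩
      Σ₁ X (λ a → Σ₁ X (λ b → ⟦ a ℕ.* b ℕ.≟ n ⟧ * (1ℚ * (Λ b * f b))) + Σ₁ X (λ b → ⟦ a ℕ.* b ℕ.≟ n ⟧ * (f a * Λ b)))
        ≡⟨ (Σ₁-cong X λ a q → trans (sym (Σ₁-+ X _ _)) (Σ₁-cong X λ b r → term a b q r)) ⟩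
      Σ₁ X (λ a → Σ₁ X (λ b → f n * (⟦ a ℕ.* b ℕ.≟ n ⟧ * (1ℚ * Λ b))))
        ≡⟨ trans (Σ₁-cong X λ a _ → Σ₁-*ˡ X (f n) _) (Σ₁-*ˡ X (f n) _) ⟩
      f n * conv 𝟏 Λ n                                      ≡⟨ cong (f n *_) (conv-𝟏-Λ n p) ⟩
      f n * f n ∎
      where
      open ≡-Reasoning
      lemma : ∀ i a b l → i * (1ℚ * (l * b)) + i * (a * l) ≡ i * ((a + b) * l)
      lemma = solve-∀ ring
      lemma₂ : ∀ i c l → i * (c * l) ≡ c * (i * (1ℚ * l))
      lemma₂ = solve-∀ ring
      term : ∀ a b → a ∈1‥ X → b ∈1‥ X →
        ⟦ a ℕ.* b ℕ.≟ n ⟧ * (1ℚ * (Λ b * f b)) + ⟦ a ℕ.* b ℕ.≟ n ⟧ * (f a * Λ b) ≡ f n * (⟦ a ℕ.* b ℕ.≟ n ⟧ * (1ℚ * Λ b))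
      term a b q r = trans (lemma ⟦ a ℕ.* b ℕ.≟ n ⟧ (f a) (f b) (Λ b)) (trans
        (⟦⟧-* (a ℕ.* b ℕ.≟ n) λ eq → cong (_* Λ b) (trans (sym (f-* (lo q) (lo r))) (cong f eq))) (lemma₂ ⟦ a ℕ.* b ℕ.≟ n ⟧ (f n) (Λ b)))

    A : ℕ → ℕ → ℚ
    A l y = Σ₁ y λ n → (e l n * v n) * Λ₂ n

    private
      w : ℕ → ℚ
      w m = f m * f m * v m

      pot : ℕ → ℚ
      pot m = (f m * f m + 8ℚ * f m + 24ℚ) * v m

      -- Oscillating coefficients against the slowly varying weight f(m)²/m. The bound does not grow
      -- with `Y`, and 24 is the value of the potential at 1.
      inner-bound : ∀ d {l l′} Y → l ∈1‥ φk → l′ ∈1‥ φk → Y ℕ.≤ X →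
        ∣ Σ₁ Y (λ m → osc d l l′ m * w m) ∣ ≤ (ι k + ι k) * 24ℚ
      inner-bound d {l} {l′} Y p p′ q = subst (λ z → ∣ Σ₁ Y (λ m → osc d l l′ m * w m) ∣ ≤ (ι k + ι k) * z) pot1
        (Σ₁-abel Y (osc d l l′) w pot (ι k + ι k) (0≤ι k ⊕ 0≤ι k) (≤-trans (nonNegative⁻¹ 24ℚ) (≡⇒≤ (sym pot1))) (osc-partial d p p′)
          (λ { m@(suc _) 1≤m m<Y → potential² (f m) (f (suc m)) (v m) (v (suc m)) (f-nonneg (1≤m ﹐ ℕₚ.≤-trans (ℕₚ.<⇒≤ m<Y) q))
                 (f-mono m 1≤m (ℕₚ.<-≤-trans m<Y q)) (f-step m 1≤m (ℕₚ.<-≤-trans m<Y q)) (0≤v (suc m)) (0≤v m) (v≤1 m) (v-step m) })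
          (λ { m@(suc _) m∈ → dominate (f m) (v m) (f-nonneg (lo m∈ ﹐ ℕₚ.≤-trans (hi m∈) q)) (0≤v m) }))
        where
        pot1 : pot 1 ≡ 24ℚ
        pot1 = cong₂ (λ a b → (a * a + 8ℚ * a + 24ℚ) * b) f-1 v1
        dominate : ∀ a x → 0ℚ ≤ a → 0ℚ ≤ x → ∣ a * a * x ∣ ≤ (a * a + 8ℚ * a + 24ℚ) * x
        dominate a x 0≤a 0≤x = abs≤ (by ((nonNegative⁻¹ 8ℚ ⊗ 0≤a ⊕ nonNegative⁻¹ 24ℚ) ⊗ 0≤x) (solve (a ∷ x ∷ []) ring))
          (by ((nonNegative⁻¹ 2ℚ ⊗ (0≤a ⊗ 0≤a) ⊕ nonNegative⁻¹ 8ℚ ⊗ 0≤a ⊕ nonNegative⁻¹ 24ℚ) ⊗ 0≤x) (solve (a ∷ x ∷ []) ring))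

      A-expand : ∀ l y → y ℕ.≤ X → A l y ≡ Σ₁ y λ a → Möbius a * v a * Σ₁ (y ÷ a) λ b → e l (a ℕ.* b) * w b
      A-expand l y q = trans (Σ₁-cong y λ n p → cong ((e l n * v n) *_) (Möbius-inversion Λ₂ (λ n → f n * f n) conv-𝟏-Λ₂ n (lo p ﹐ ℕₚ.≤-trans (hi p) q)))
        (trans (sum-conv′ y (λ n → e l n * v n) Möbius (λ n → f n * f n) q) (Σ₁-cong y λ a p → trans (Σ₁-cong (y ÷ a) λ b r →
          trans (cong (λ z → e l (a ℕ.* b) * z * (Möbius a * (f b * f b))) (v-* a b {{ℕ.>-nonZero (lo p)}} {{ℕ.>-nonZero (lo r)}}))
            (lemma (e l (a ℕ.* b)) (v a) (v b) (Möbius a) (f b))) (Σ₁-*ˡ (y ÷ a) (Möbius a * v a) _)))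
        where
        lemma : ∀ i x z m c → i * (x * z) * (m * (c * c)) ≡ m * x * (i * (c * c * z))
        lemma = solve-∀ ring

    -- After Möbius inversion each inner sum compares two classes and is already O(1). The trivial
    -- bound |μ| ≤ 1 then leaves a harmonic sum, so the classes differ by O(t), one order below the
    -- main term t².
    A-compare : ∀ {l l′} t → l ∈1‥ φk → l′ ∈1‥ φk → 2 ℕ.^ t ℕ.≤ X →
      ∣ A l (2 ℕ.^ t) - A l′ (2 ℕ.^ t) ∣ ≤ (ι k + ι k) * 24ℚ * (ι t + 1ℚ)
    A-compare {l} {l′} t p p′ q = begin
      ∣ A l y - A l′ y ∣
        ≡⟨ cong ∣_∣ (trans (cong₂ _-_ (A-expand l y q) (A-expand l′ y q)) (trans (sym (Σ₁-- y _ _)) (Σ₁-cong y λ a _ →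
             trans (lemma (Möbius a * v a) (Σ₁ (y ÷ a) λ b → e l (a ℕ.* b) * w b) (Σ₁ (y ÷ a) λ b → e l′ (a ℕ.* b) * w b))
               (cong (Möbius a * v a *_) (trans (sym (Σ₁-- (y ÷ a) _ _)) (Σ₁-cong (y ÷ a) λ b _ → lemma₂ (e l (a ℕ.* b)) (e l′ (a ℕ.* b)) (w b))))))) ⟩
      ∣ Σ₁ y (λ a → Möbius a * v a * Σ₁ (y ÷ a) λ b → osc a l l′ b * w b) ∣
        ≤⟨ (Σ₁-abs y λ a r → abs* (abs* (Möbius-bound a (lo r ﹐ ℕₚ.≤-trans (hi r) q)) (≡⇒≤ (0≤p⇒∣p∣≡p (0≤v a {{ℕ.>-nonZero (lo r)}}))))
              (inner-bound a (y ÷ a) p p′ (ℕₚ.≤-trans (÷-≤y y a (lo r)) q))) ⟩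
      Σ₁ y (λ a → 1ℚ * v a * ((ι k + ι k) * 24ℚ))
        ≡⟨ trans (Σ₁-cong y λ a _ → lemma₃ (v a) ((ι k + ι k) * 24ℚ)) (Σ₁-*ˡ y ((ι k + ι k) * 24ℚ) v) ⟩
      (ι k + ι k) * 24ℚ * Σ₁ y v
        ≤⟨ *-monoˡ ((ι k + ι k) * 24ℚ) ((0≤ι k ⊕ 0≤ι k) ⊗ nonNegative⁻¹ 24ℚ) (harmonic t) ⟩
      (ι k + ι k) * 24ℚ * (ι t + 1ℚ) ∎
      where
      open ≤-Reasoning
      y = 2 ℕ.^ t
      lemma : ∀ c a b → c * a - c * b ≡ c * (a - b)
      lemma = solve-∀ ring
      lemma₂ : ∀ a b c → a * c - b * c ≡ (a - b) * c
      lemma₂ = solve-∀ ring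
      lemma₃ : ∀ a b → 1ℚ * a * b ≡ b * a
      lemma₃ = solve-∀ ring

-- The Tauberian argument on dyadic scales

module Tauberian where

  open import Data.Nat as ℕ using (ℕ; zero; suc)
  import Data.Nat.Properties as ℕₚ
  import Data.Integer as ℤ
  open import Data.Rational hiding (_÷_)
  open import Data.Rational.Properties
  open import Data.Product using (_,_; _×_; proj₁; proj₂)
  open import Data.Sum using (inj₁; inj₂)
  open import Data.Empty using (⊥; ⊥-elim)
  open import Data.List using ([]; _∷_)
  open import Function using (_∘_)
  open import Relation.Nullary using (yes; no)
  open import Relation.Binary.PropositionalEquality
  open import Tactic.RingSolver using (solve; solve-∀)
  open Rationals
  open Sums

  sum-by-parts : ∀ (q : ℕ → ℚ) T → sum T (λ t → ι t * q t) ≡ ι T * sum T q - sum T (λ t → sum (suc t) q)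
  sum-by-parts q zero    = refl
  sum-by-parts q (suc T) = trans (cong (_+ ι T * q T) (sum-by-parts q T)) (lemma (ι T) (sum T q) (sum T (λ t → sum (suc t) q)) (q T))
    where
    lemma : ∀ a p s x → a * p - s + a * x ≡ (1ℚ + a) * (p + x) - (s + (p + x))
    lemma = solve-∀ ring

  -- The right side is the double sum that `sum-by-parts` subtracts. In `main-total` the two cancel
  -- and only T times the total mass is left.
  sum-reversed : ∀ (q : ℕ → ℚ) T → sum T (λ i → q i * ι (T ℕ.∸ i)) ≡ sum T (λ t → sum (suc t) q)
  sum-reversed q zero    = refl
  sum-reversed q (suc T) = begin
    sum T (λ i → q i * ι (suc T ℕ.∸ i)) + q T * ι (suc T ℕ.∸ T)
      ≡⟨ cong₂ _+_ (sum-cong T λ i p → trans (cong (λ z → q i * ι z) (ℕₚ.+-∸-assoc 1 (ℕₚ.<⇒≤ p))) (lemma (q i) (ι (T ℕ.∸ i))))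
                   (cong (λ z → q T * ι z) (trans (ℕₚ.+-∸-assoc 1 (ℕₚ.≤-refl {T})) (cong suc (ℕₚ.n∸n≡0 T)))) ⟩
    sum T (λ i → q i * ι (T ℕ.∸ i) + q i) + q T * ι 1
      ≡⟨ cong₂ _+_ (trans (sum-+ T _ q) (cong (_+ sum T q) (sum-reversed q T))) (*-identityʳ (q T)) ⟩
    sum T (λ t → sum (suc t) q) + sum T q + q T
      ≡⟨ +-assoc (sum T (λ t → sum (suc t) q)) (sum T q) (q T) ⟩
    sum T (λ t → sum (suc t) q) + (sum T q + q T) ∎
    where
    open ≡-Reasoning
    lemma : ∀ a b → a * (1ℚ + b) ≡ a * b + a
    lemma = solve-∀ ring

  gauss : ∀ T → 2ℚ * sum T (λ t → ι (suc t)) ≡ ι T * ι T + ι T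
  gauss zero    = refl
  gauss (suc T) = trans (*-distribˡ-+ 2ℚ (sum T (λ t → ι (suc t))) (ι (suc T))) (trans (cong (_+ 2ℚ * ι (suc T)) (gauss T)) (lemma (ι T)))
    where
    lemma : ∀ a → a * a + a + 2ℚ * (1ℚ + a) ≡ (1ℚ + a) * (1ℚ + a) + (1ℚ + a)
    lemma = solve-∀ ring

  sum-≤ : ∀ m n f → m ℕ.≤ n → (∀ i → i ℕ.< n → 0ℚ ≤ f i) → sum m f ≤ sum n f
  sum-≤ m n f p h = subst (sum m f ≤_) (trans (sym (sum-split m (n ℕ.∸ m) f)) (cong (λ z → sum z f) (ℕₚ.m+[n∸m]≡n p)))
    (subst (_≤ sum m f + rest) (+-identityʳ (sum m f)) (+-monoʳ-≤ (sum m f) (sum-nonneg (n ℕ.∸ m) λ i q →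
      h (m ℕ.+ i) (ℕₚ.<-≤-trans (ℕₚ.+-monoʳ-< m q) (ℕₚ.≤-reflexive (ℕₚ.m+[n∸m]≡n p))))))
    where
    rest = sum (n ℕ.∸ m) (λ i → f (m ℕ.+ i))

  private
    4ℚ 8ℚ 16ℚ 32ℚ 128ℚ 256ℚ : ℚ
    4ℚ   = ℤ.+ 4 / 1
    8ℚ   = ℤ.+ 8 / 1
    16ℚ  = ℤ.+ 16 / 1
    32ℚ  = ℤ.+ 32 / 1
    128ℚ = ℤ.+ 128 / 1
    256ℚ = ℤ.+ 256 / 1

    impossible : ∀ {c} → c ≤ 0ℚ → 0ℚ < c → ⊥
    impossible p q = <-irrefl refl (<-≤-trans q p)

  -- The relations satisfied by the normalised masses of the classes a (empty), 1, r = g², b = a/r, g and i = g⁻¹ are inconsistent.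
  numeric : ∀ N η xa x₁ xr xr′ xb xg xg′ xi x₁′ → 1ℚ ≤ N → 0ℚ ≤ η → 256ℚ * (N * N * N * η) ≤ 1ℚ →
    0ℚ ≤ x₁ → 0ℚ ≤ xg → 0ℚ ≤ xr → 0ℚ ≤ xr′ → xa ≤ η → x₁′ ≤ x₁ → xg′ ≤ xg → 1ℚ ≤ 2ℚ * xr′ → xr′ ≤ xr →
    x₁ * (8ℚ - xa) ≤ η → xr * (8ℚ - xb) ≤ η → xb * (8ℚ - xr) ≤ η → xg * xg ≤ N * (4ℚ * (8ℚ - xr) + η) →
    xr′ * (2ℚ - xi) ≤ 2ℚ * (N * xg) + η → xi * (2ℚ - xg′) ≤ 2ℚ * (N * x₁′) + η → ⊥
  numeric N η xa x₁ xr xr′ xb xg xg′ xi x₁′ 1≤N 0≤η small 0≤x₁ 0≤xg 0≤xr 0≤xr′ xa≤η x₁′≤ xg′≤ r′≥ xr′≤ h₁ h₂ h₃ h₅ h₆ h₇ = contradiction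
    where
    0≤N : 0ℚ ≤ N
    0≤N = ≤-trans 0≤1 1≤N
    Nη-small : 8ℚ * (N * η) ≤ 1ℚ
    Nη-small = ≤-trans (lemma N η 1≤N 0≤N 0≤η) small
      where
      lemma : ∀ N η → 1ℚ ≤ N → 0ℚ ≤ N → 0ℚ ≤ η → 8ℚ * (N * η) ≤ 256ℚ * (N * N * N * η)
      lemma N η h₁ h₂ h₃ = by (nonNegative⁻¹ 8ℚ ⊗ (h₂ ⊗ (Δ h₁ ⊗ Δ h₁ ⊕ nonNegative⁻¹ 2ℚ ⊗ Δ h₁) ⊗ h₃) ⊕ nonNegative⁻¹ (ℤ.+ 248 / 1) ⊗ (h₂ ⊗ h₂ ⊗ h₂ ⊗ h₃)) (solve (N ∷ η ∷ []) ring)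
    η-small : 8ℚ * η ≤ 1ℚ
    η-small = ≤-trans (lemma N η 1≤N 0≤η) Nη-small
      where
      lemma : ∀ N η → 1ℚ ≤ N → 0ℚ ≤ η → 8ℚ * η ≤ 8ℚ * (N * η)
      lemma N η h₁ h₂ = by (nonNegative⁻¹ 8ℚ ⊗ (Δ h₁ ⊗ h₂)) (solve (N ∷ η ∷ []) ring)
    -- Masses are normalised so that a full class has 8 at the scale of `xr` and `xb`. Since xr ≥
    -- 1/2, a value xb ≤ 4 would make xr(8 - xb) at least 2, far above η.
    xb≥4 : 4ℚ ≤ xb
    xb≥4 with ≤-total 4ℚ xb
    ... | inj₁ p = p
    ... | inj₂ p = ⊥-elim (impossible (lemma xr xb η h₂ p r≥ 0≤xr η-small) (positive⁻¹ (ℤ.+ 15 / 1)))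
      where
      r≥ : 1ℚ ≤ 2ℚ * xr
      r≥ = ≤-trans r′≥ (*-monoˡ 2ℚ (nonNegative⁻¹ 2ℚ) xr′≤)
      lemma : ∀ r b e → r * (8ℚ - b) ≤ e → b ≤ 4ℚ → 1ℚ ≤ 2ℚ * r → 0ℚ ≤ r → 8ℚ * e ≤ 1ℚ → (ℤ.+ 15 / 1) ≤ 0ℚ
      lemma r b e h₁ h₂ h₃ h₄ h₅ = by (nonNegative⁻¹ 8ℚ ⊗ (Δ h₁ ⊕ h₄ ⊗ Δ h₂ ⊕ nonNegative⁻¹ 2ℚ ⊗ Δ h₃) ⊕ Δ h₅) (solve (r ∷ b ∷ e ∷ []) ring)
    -- The second use of a = r·b: the factor b is at least half full, so the deficit of r is at most
    -- η/4.
    r-full : 4ℚ * (8ℚ - xr) ≤ η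
    r-full with ≤-total 8ℚ xr
    ... | inj₁ p = ≤-trans (lemma xr p) 0≤η
      where
      lemma : ∀ r → 8ℚ ≤ r → 4ℚ * (8ℚ - r) ≤ 0ℚ
      lemma r h = by (nonNegative⁻¹ 4ℚ ⊗ Δ h) (solve (r ∷ []) ring)
    ... | inj₂ p = ≤-trans (*-monoʳ (8ℚ - xr) (Δ p) xb≥4) h₃
    -- From xg² ≤ 2Nη one gets (8N·xg)² ≤ 128N³η ≤ 1/2. The hypothesis with 256 is made for this.
    g-light : 8ℚ * (N * xg) ≤ 1ℚ
    g-light with ≤-total (8ℚ * (N * xg)) 1ℚ
    ... | inj₁ p = p
    ... | inj₂ p = ⊥-elim (impossible (lemma N η xg (4ℚ * (8ℚ - xr)) h₅ r-full 0≤N p small) 0<1)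
      where
      lemma : ∀ N η g r → g * g ≤ N * (r + η) → r ≤ η → 0ℚ ≤ N → 1ℚ ≤ 8ℚ * (N * g) → 256ℚ * (N * N * N * η) ≤ 1ℚ → 1ℚ ≤ 0ℚ
      lemma N η g r h₁ h₂ h₃ h₄ h₅ = by (nonNegative⁻¹ 128ℚ ⊗ (h₃ ⊗ h₃) ⊗ Δ h₁ ⊕ nonNegative⁻¹ 128ℚ ⊗ (h₃ ⊗ h₃ ⊗ h₃) ⊗ Δ h₂ ⊕ Δ h₅ ⊕ nonNegative⁻¹ 2ℚ ⊗ (Δ h₄ ⊗ Δ h₄ ⊕ nonNegative⁻¹ 2ℚ ⊗ Δ h₄))
        (solve (N ∷ η ∷ g ∷ r ∷ []) ring)
    -- With xr′ ≥ 1/2 and xi ≤ 1 the left side of the relation for g = r·i would be at least 1/2,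
    -- while the right side is at most 1/4 + 1/8.
    i-full : 1ℚ ≤ xi
    i-full with ≤-total 1ℚ xi
    ... | inj₁ p = p
    ... | inj₂ p = ⊥-elim (impossible (lemma (N * xg) η xr′ xi h₆ p r′≥ 0≤xr′ g-light η-small) 0<1)
      where
      lemma : ∀ G η r i → r * (2ℚ - i) ≤ 2ℚ * G + η → i ≤ 1ℚ → 1ℚ ≤ 2ℚ * r → 0ℚ ≤ r → 8ℚ * G ≤ 1ℚ → 8ℚ * η ≤ 1ℚ → 1ℚ ≤ 0ℚ
      lemma G η r i h₁ h₂ h₃ h₄ h₅ h₆ = by (nonNegative⁻¹ 8ℚ ⊗ (Δ h₁ ⊕ h₄ ⊗ Δ h₂) ⊕ nonNegative⁻¹ 4ℚ ⊗ Δ h₃ ⊕ nonNegative⁻¹ 2ℚ ⊗ Δ h₅ ⊕ Δ h₆)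
        (solve (G ∷ η ∷ r ∷ i ∷ []) ring)
    one-light : 4ℚ * x₁ ≤ η
    one-light = lemma x₁ xa η h₁ (≤-trans xa≤η (≤-trans (lemma₂ η 0≤η) η-small)) 0≤x₁
      where
      lemma : ∀ x a e → x * (8ℚ - a) ≤ e → a ≤ 1ℚ → 0ℚ ≤ x → 4ℚ * x ≤ e
      lemma x a e h₁ h₂ h₃ = by (Δ h₁ ⊕ h₃ ⊗ Δ h₂ ⊕ nonNegative⁻¹ (ℤ.+ 3 / 1) ⊗ h₃) (solve (x ∷ a ∷ e ∷ []) ring)
      lemma₂ : ∀ e → 0ℚ ≤ e → e ≤ 8ℚ * e
      lemma₂ e h = by (nonNegative⁻¹ (ℤ.+ 7 / 1) ⊗ h) (solve (e ∷ []) ring)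
    g′-light : xg′ ≤ 1ℚ
    g′-light = ≤-trans xg′≤ (lemma N xg 1≤N 0≤xg g-light)
      where
      lemma : ∀ N g → 1ℚ ≤ N → 0ℚ ≤ g → 8ℚ * (N * g) ≤ 1ℚ → g ≤ 1ℚ
      lemma N g h₁ h₂ h₃ = by (Δ h₃ ⊕ nonNegative⁻¹ 8ℚ ⊗ (Δ h₁ ⊗ h₂) ⊕ nonNegative⁻¹ (ℤ.+ 7 / 1) ⊗ h₂) (solve (N ∷ g ∷ []) ring)
    -- In the relation for 1 = i·g the left side is at least 1, because xi ≥ 1 and xg′ ≤ 1. The
    -- right side is at most Nη/2 + η ≤ 1/16 + 1/8.
    contradiction : ⊥
    contradiction = impossible (lemma N η x₁ x₁′ xg′ xi h₇ i-full g′-light x₁′≤ one-light 0≤N Nη-small η-small) (positive⁻¹ (ℤ.+ 13 / 1))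
      where
      lemma : ∀ N η x x′ g i → i * (2ℚ - g) ≤ 2ℚ * (N * x′) + η → 1ℚ ≤ i → g ≤ 1ℚ → x′ ≤ x → 4ℚ * x ≤ η → 0ℚ ≤ N → 8ℚ * (N * η) ≤ 1ℚ → 8ℚ * η ≤ 1ℚ → (ℤ.+ 13 / 1) ≤ 0ℚ
      lemma N η x x′ g i h₁ h₂ h₃ h₄ h₅ h₆ h₇ h₈ = by (nonNegative⁻¹ 16ℚ ⊗ (Δ h₁ ⊕ Δ h₂ ⊗ Δ h₃ ⊕ Δ h₂ ⊕ Δ h₃) ⊕ nonNegative⁻¹ 32ℚ ⊗ (h₆ ⊗ Δ h₄) ⊕ nonNegative⁻¹ 8ℚ ⊗ (h₆ ⊗ Δ h₅) ⊕ Δ h₇ ⊕ nonNegative⁻¹ 2ℚ ⊗ Δ h₈)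
        (solve (N ∷ η ∷ x ∷ x′ ∷ g ∷ i ∷ []) ring)

  -- q u i is the mass of the class u at scale i, and c the indicator of u w = l in a group of n elements.
  module Scales (n : ℕ) (q : ℕ → ℕ → ℚ) (c : ℕ → ℕ → ℕ → ℚ) (T* : ℕ) (B : ℚ)
    (0≤B : 0ℚ ≤ B)
    (0≤q : ∀ {u i} → u ∈1‥ n → i ℕ.< T* → 0ℚ ≤ q u i)
    (0≤c : ∀ u w l → 0ℚ ≤ c u w l)
    (c-sum-l : ∀ {u w} → u ∈1‥ n → w ∈1‥ n → Σ₁ n (λ l → c u w l) ≡ 1ℚ)
    (c-sum-w : ∀ {u l} → u ∈1‥ n → l ∈1‥ n → Σ₁ n (λ w → c u w l) ≡ 1ℚ) where

    P : ℕ → ℕ → ℚ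
    P u T = sum T (q u)

    Po : ℕ → ℚ
    Po T = Σ₁ n λ u → P u T

    qo : ℕ → ℚ
    qo i = Σ₁ n λ u → q u i

    -- Stands for Σ Λ(n)·f(n)/n over the class `l`, with f(n) replaced by the dyadic scale of n.
    τ : ℕ → ℕ → ℚ
    τ l T = sum T λ t → ι t * q l t

    -- Stands for Σ (Λ * Λ)(n)/n over the class `l`: a factor at scale i leaves the other the scales
    -- below T - i.
    K : ℕ → ℕ → ℚ
    K l T = sum T λ i → Σ₁ n λ u → Σ₁ n λ w → c u w l * (q u i * P w (T ℕ.∸ i))

    module _ (total : ∀ T → T ℕ.≤ T* → ∣ Po T - ι T ∣ ≤ B) where

      Σ₁-sum : ∀ T (g : ℕ → ℕ → ℚ) → Σ₁ n (λ u → sum T (g u)) ≡ sum T (λ i → Σ₁ n λ u → g u i)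
      Σ₁-sum T g = trans (Σ₁≡sum n _) (trans (sum-swap n T (λ u i → g (suc u) i)) (sum-cong T λ i _ → sym (Σ₁≡sum n _)))

      Po-sum : ∀ T → Po T ≡ sum T qo
      Po-sum T = Σ₁-sum T q

      0≤qo : ∀ {i} → i ℕ.< T* → 0ℚ ≤ qo i
      0≤qo p = Σ₁-nonneg n λ u r → 0≤q r p

      P-mono : ∀ {u S S′} → u ∈1‥ n → S ℕ.≤ S′ → S′ ℕ.≤ T* → P u S ≤ P u S′
      P-mono {u} r p p′ = sum-≤ _ _ (q u) p λ i s → 0≤q r (ℕₚ.<-≤-trans s p′)

      0≤P : ∀ {u S} → u ∈1‥ n → S ℕ.≤ T* → 0ℚ ≤ P u S
      0≤P {u} {S} r p = sum-nonneg S λ i s → 0≤q r (ℕₚ.<-≤-trans s p)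

      Po-upper : ∀ T → T ℕ.≤ T* → Po T ≤ ι T + B
      Po-upper T p = lemma (Po T) (ι T) B (≤-abs (total T p))
        where
        lemma : ∀ a b c → a - b ≤ c → a ≤ b + c
        lemma a b c h = by (Δ h) (solve (a ∷ b ∷ c ∷ []) ring)

      P≤Po : ∀ {u T} → u ∈1‥ n → T ℕ.≤ T* → P u T ≤ Po T
      P≤Po {u} {T} r p = Σ₁-term n u (λ u → P u T) r λ w s → 0≤P s p

      private
        τ-total : ∀ T → Σ₁ n (λ l → τ l T) ≡ ι T * Po T - sum T (λ t → Po (suc t))
        τ-total T = trans (Σ₁-sum T (λ l t → ι t * q l t)) (trans (sum-cong T λ t _ → Σ₁-*ˡ n (ι t) _)
          (trans (sum-by-parts qo T) (cong₂ (λ a b → ι T * a - b) (sym (Po-sum T)) (sum-cong T λ t _ → sym (Po-sum (suc t))))))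

        K-total : ∀ T → Σ₁ n (λ l → K l T) ≡ sum T (λ i → qo i * Po (T ℕ.∸ i))
        K-total T = trans (Σ₁-sum T _) (sum-cong T λ i p → begin
          Σ₁ n (λ l → Σ₁ n λ u → Σ₁ n λ w → c u w l * (q u i * P w (T ℕ.∸ i)))
            ≡⟨ Σ₁-swap n n _ ⟩
          Σ₁ n (λ u → Σ₁ n λ l → Σ₁ n λ w → c u w l * (q u i * P w (T ℕ.∸ i)))
            ≡⟨ (Σ₁-cong n λ u r → trans (Σ₁-swap n n _) (trans (Σ₁-cong n λ w s → trans (Σ₁-*ʳ n (q u i * P w (T ℕ.∸ i)) _)
                  (trans (cong (_* (q u i * P w (T ℕ.∸ i))) (c-sum-l r s)) (*-identityˡ _))) (Σ₁-*ˡ n (q u i) _))) ⟩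
          Σ₁ n (λ u → q u i * Po (T ℕ.∸ i))
            ≡⟨ Σ₁-*ʳ n (Po (T ℕ.∸ i)) _ ⟩
          qo i * Po (T ℕ.∸ i) ∎)
          where open ≡-Reasoning

        S-total : ∀ T → sum T (λ i → qo i * ι (T ℕ.∸ i)) ≡ sum T (λ t → Po (suc t))
        S-total T = trans (sum-reversed qo T) (sum-cong T λ t _ → sym (Po-sum (suc t)))

        K-error : ∀ T → T ℕ.≤ T* → ∣ sum T (λ i → qo i * Po (T ℕ.∸ i)) - sum T (λ t → Po (suc t)) ∣ ≤ Po T * B
        K-error T p = begin
          ∣ sum T (λ i → qo i * Po (T ℕ.∸ i)) - sum T (λ t → Po (suc t)) ∣
            ≡⟨ cong ∣_∣ (trans (cong (λ z → sum T (λ i → qo i * Po (T ℕ.∸ i)) - z) (sym (S-total T))) (trans (sym (sum-- T _ _))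
                  (sum-cong T λ i _ → lemma (qo i) (Po (T ℕ.∸ i)) (ι (T ℕ.∸ i))))) ⟩
          ∣ sum T (λ i → qo i * (Po (T ℕ.∸ i) - ι (T ℕ.∸ i))) ∣
            ≤⟨ (sum-abs T λ i r → abs* (≡⇒≤ (0≤p⇒∣p∣≡p (0≤qo (ℕₚ.<-≤-trans r p)))) (total (T ℕ.∸ i) (ℕₚ.≤-trans (ℕₚ.m∸n≤m T i) p))) ⟩
          sum T (λ i → qo i * B)
            ≡⟨ trans (sum-*ʳ T B qo) (cong (_* B) (sym (Po-sum T))) ⟩
          Po T * B ∎
          where
          open ≤-Reasoning
          lemma : ∀ a b c → a * b - a * c ≡ a * (b - c)
          lemma = solve-∀ ring

      -- Summed over classes, τ + K becomes T·Po(T) plus the error of replacing Po(T - i) by T - i;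
      -- both are controlled by `total`.
      main-total : ∀ T → T ℕ.≤ T* → ∣ Σ₁ n (λ l → τ l T + K l T) - ι T * ι T ∣ ≤ 2ℚ * B * ι T + B * B
      main-total T p = ≤-trans (≡⇒≤ (cong ∣_∣ (trans (cong (_- ι T * ι T) (trans (Σ₁-+ n _ _) (cong₂ _+_ (τ-total T) (K-total T))))
          (lemma (ι T) (Po T) (sum T (λ t → Po (suc t))) (sum T (λ i → qo i * Po (T ℕ.∸ i)))))))
        (≤-trans (abs+ (abs* (≡⇒≤ (0≤p⇒∣p∣≡p (0≤ι T))) (total T p)) (K-error T p)) (lemma₂ (ι T) (Po T) B 0≤B (Po-upper T p)))
        where
        lemma : ∀ t p s k → t * p - s + k - t * t ≡ t * (p - t) + (k - s)
        lemma = solve-∀ ring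
        lemma₂ : ∀ t p b → 0ℚ ≤ b → p ≤ t + b → t * b + p * b ≤ 2ℚ * b * t + b * b
        lemma₂ t p b h₁ h₂ = by (Δ h₂ ⊗ h₁) (solve (t ∷ p ∷ b ∷ []) ring)

      -- Averaging: n·Z(l) is the sum of all Z(l′) plus the sum of the differences Z(l) - Z(l′), and
      -- each difference is bounded by `compare`.
      main-each : (∀ {l l′} T → l ∈1‥ n → l′ ∈1‥ n → T ℕ.≤ T* → ∣ (τ l T + K l T) - (τ l′ T + K l′ T) ∣ ≤ B * (ι T + 1ℚ)) →
        ∀ {l} T → l ∈1‥ n → T ℕ.≤ T* → ∣ ι n * (τ l T + K l T) - ι T * ι T ∣ ≤ (2ℚ * B + B * B + ι n * B) * (ι T + 1ℚ)
      main-each compare {l} T r p = ≤-trans (≡⇒≤ (cong ∣_∣ (trans (cong (_- ι T * ι T) split) (lemma D (Σ₁ n Z) (ι T * ι T)))))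
        (≤-trans (abs+ D-bound (main-total T p)) (lemma₂ (ι n) B (ι T) 0≤B (0≤ι T)))
        where
        Z : ℕ → ℚ
        Z l = τ l T + K l T
        D : ℚ
        D = Σ₁ n (λ l′ → Z l - Z l′)
        split : ι n * Z l ≡ D + Σ₁ n Z
        split = trans (sym (trans (Σ₁≡sum n _) (sum-const n (Z l)))) (trans (Σ₁-cong n λ l′ _ → lemma₃ (Z l) (Z l′)) (Σ₁-+ n _ Z))
          where
          lemma₃ : ∀ a b → a ≡ a - b + b
          lemma₃ = solve-∀ ring
        D-bound : ∣ D ∣ ≤ ι n * (B * (ι T + 1ℚ))
        D-bound = ≤-trans (Σ₁-abs n {g = λ _ → B * (ι T + 1ℚ)} λ l′ s → compare T r s p) (≡⇒≤ (trans (Σ₁≡sum n _) (sum-const n (B * (ι T + 1ℚ)))))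
        lemma : ∀ d z t → d + z - t ≡ d + (z - t)
        lemma = solve-∀ ring
        lemma₂ : ∀ n b t → 0ℚ ≤ b → 0ℚ ≤ t → n * (b * (t + 1ℚ)) + (2ℚ * b * t + b * b) ≤ (2ℚ * b + b * b + n * b) * (t + 1ℚ)
        lemma₂ n b t h₁ h₂ = by (nonNegative⁻¹ 2ℚ ⊗ h₁ ⊕ h₁ ⊗ h₁ ⊗ h₂) (solve (n ∷ b ∷ t ∷ []) ring)

      module Main (D : ℚ) (0≤D : 0ℚ ≤ D)
        (main : ∀ {l} T → l ∈1‥ n → T ℕ.≤ T* → ∣ ι n * (τ l T + K l T) - ι T * ι T ∣ ≤ D * (ι T + 1ℚ))
        (M : ℕ) (1≤M : 1 ℕ.≤ M) (M≤T* : M ℕ.≤ T*) where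

        private
          K-mono : ∀ {l S S′} → l ∈1‥ n → S ℕ.≤ S′ → S′ ℕ.≤ T* → K l S ≤ K l S′
          K-mono {l} {S} {S′} r p p′ = ≤-trans
            (sum-mono S λ i s → Σ₁-mono n λ u u∈ → Σ₁-mono n λ w w∈ → *-monoˡ (c u w l) (0≤c u w l) (*-monoˡ (q u i) (0≤q u∈ (ℕₚ.<-≤-trans s (ℕₚ.≤-trans p p′)))
              (P-mono w∈ (ℕₚ.∸-monoˡ-≤ i p) (ℕₚ.≤-trans (ℕₚ.m∸n≤m S′ i) p′))))
            (sum-≤ S S′ _ p λ i s → Σ₁-nonneg n λ u u∈ → Σ₁-nonneg n λ w w∈ → 0≤c u w l ⊗ (0≤q u∈ (ℕₚ.<-≤-trans s p′) ⊗ 0≤P w∈ (ℕₚ.≤-trans (ℕₚ.m∸n≤m S′ i) p′)))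

        W : ℚ
        W = 2ℚ * (D * (ι T* + 1ℚ)) + ι T*

        0≤W : 0ℚ ≤ W
        0≤W = nonNegative⁻¹ 2ℚ ⊗ (0≤D ⊗ (0≤ι T* ⊕ 0≤1)) ⊕ 0≤ι T*

        private
          -- `K` does not decrease with the scale, so subtracting the main formula at S from the one
          -- at S′ bounds the increase of `τ` alone.
          τ-growth : ∀ {l S S′} → l ∈1‥ n → S ℕ.≤ S′ → S′ ℕ.≤ T* →
            ι n * (τ l S′ - τ l S) ≤ ι S′ * ι S′ - ι S * ι S + 2ℚ * (D * (ι T* + 1ℚ))
          τ-growth {l} {S} {S′} r p p′ = lemma (ι n) (τ l S) (τ l S′) (K l S) (K l S′) (ι S) (ι S′) D (ι T*) (0≤ι n) (K-mono r p p′) 0≤D (ι-mono (ℕₚ.≤-trans p p′)) (ι-mono p′)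
            (≤-abs (main S′ r p′)) (-≤abs (main S r (ℕₚ.≤-trans p p′)))
            where
            lemma : ∀ n a a′ k k′ s s′ D t → 0ℚ ≤ n → k ≤ k′ → 0ℚ ≤ D → s ≤ t → s′ ≤ t →
              n * (a′ + k′) - s′ * s′ ≤ D * (s′ + 1ℚ) → - (D * (s + 1ℚ)) ≤ n * (a + k) - s * s →
              n * (a′ - a) ≤ s′ * s′ - s * s + 2ℚ * (D * (t + 1ℚ))
            lemma n a a′ k k′ s s′ D t h₁ h₂ h₃ h₄ h₅ h₆ h₇ = by (h₁ ⊗ Δ h₂ ⊕ h₃ ⊗ Δ h₄ ⊕ h₃ ⊗ Δ h₅ ⊕ Δ h₆ ⊕ Δ h₇)
              (solve (n ∷ a ∷ a′ ∷ k ∷ k′ ∷ s ∷ s′ ∷ D ∷ t ∷ []) ring)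

          odd-sum : ∀ S d → 2ℚ * sum d (λ j → ι (j ℕ.+ S)) ≡ ι (d ℕ.+ S) * ι (d ℕ.+ S) - ι S * ι S - ι d
          odd-sum S zero    = sym (lemma (ι S))
            where
            lemma : ∀ a → a * a - a * a - 0ℚ ≡ 2ℚ * 0ℚ
            lemma = solve-∀ ring
          odd-sum S (suc d) = trans (*-distribˡ-+ 2ℚ (sum d (λ j → ι (j ℕ.+ S))) (ι (d ℕ.+ S))) (trans (cong (_+ 2ℚ * ι (d ℕ.+ S)) (odd-sum S d)) (lemma (ι (d ℕ.+ S)) (ι S) (ι d)))
            where
            lemma : ∀ x s d → x * x - s * s - d + 2ℚ * x ≡ (1ℚ + x) * (1ℚ + x) - s * s - (1ℚ + d)
            lemma = solve-∀ ring

          module Growth {l} (l∈ : l ∈1‥ n) (S : ℕ) (1≤S : 1 ℕ.≤ S) where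

            -- `G` and `F` measure by how much the growth of P and of τ beyond scale `S` exceeds
            -- twice the fair share of a class; `Γ` accumulates `G`, as summation by parts demands
            -- in `parts`.
            G F Γ : ℕ → ℚ
            G d = ι n * (P l (d ℕ.+ S) - P l S) - 2ℚ * ι d
            F d = ι n * (τ l (d ℕ.+ S) - τ l S) - 2ℚ * sum d (λ j → ι (j ℕ.+ S))
            Γ d = sum d (G ∘ suc)

            parts : ∀ d → ι (d ℕ.+ S) * G d ≡ F d + Γ d
            parts zero    = lemma (ι S) (ι n) (P l S) (τ l S)
              where
              lemma : ∀ s n p t → s * (n * (p - p) - 2ℚ * 0ℚ) ≡ n * (t - t) - 2ℚ * 0ℚ + 0ℚ
              lemma = solve-∀ ring
            parts (suc d) = trans (lemma₁ (ι n) x (P l (d ℕ.+ S)) (P l S) (q l (d ℕ.+ S)) (ι d))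
              (trans (cong (λ z → ι n * (P l (d ℕ.+ S) + q l (d ℕ.+ S) - P l S) - 2ℚ * (1ℚ + ι d) + (z + x * (ι n * q l (d ℕ.+ S)) - 2ℚ * x)) (parts d))
                (lemma₂ (ι n) x (q l (d ℕ.+ S)) (τ l (d ℕ.+ S)) (τ l S) (sum d (λ j → ι (j ℕ.+ S))) (Γ d) (G (suc d))))
              where
              x = ι (d ℕ.+ S)
              lemma₁ : ∀ n x p p₀ y d → (1ℚ + x) * (n * (p + y - p₀) - 2ℚ * (1ℚ + d)) ≡ n * (p + y - p₀) - 2ℚ * (1ℚ + d) + (x * (n * (p - p₀) - 2ℚ * d) + x * (n * y) - 2ℚ * x)
              lemma₁ = solve-∀ ring
              lemma₂ : ∀ n x y t t₀ s g g′ → g′ + (n * (t - t₀) - 2ℚ * s + g + x * (n * y) - 2ℚ * x) ≡ n * (t + x * y - t₀) - 2ℚ * (s + x) + (g + g′)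
              lemma₂ = solve-∀ ring

            F≤W : ∀ d → d ℕ.+ S ℕ.≤ T* → F d ≤ W
            F≤W d p = lemma (ι n * (τ l (d ℕ.+ S) - τ l S)) (2ℚ * sum d (λ j → ι (j ℕ.+ S))) (ι (d ℕ.+ S) * ι (d ℕ.+ S)) (ι S * ι S) (ι d) (ι T*) (2ℚ * (D * (ι T* + 1ℚ)))
              (τ-growth l∈ (ℕₚ.m≤n+m S d) p) (odd-sum S d) (ι-mono (ℕₚ.≤-trans (ℕₚ.m≤m+n d S) p))
              where
              lemma : ∀ a s x y d t w → a ≤ x - y + w → s ≡ x - y - d → d ≤ t → a - s ≤ w + t
              lemma a s x y d t w h₁ refl h₂ = by (Δ h₁ ⊕ Δ h₂) (solve (a ∷ x ∷ y ∷ d ∷ t ∷ w ∷ []) ring)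

            -- A discrete Gronwall argument. With x = d + S, `parts` reads x·G(d+1) = F(d+1) + Γ(d),
            -- and the right side is at most W + dW/S = xW/S by induction; hence S·G(d+1) ≤ W.
            bounds : ∀ d → d ℕ.+ S ℕ.≤ T* → ι S * Γ d ≤ ι d * W × (1 ℕ.≤ d → ι S * G d ≤ W)
            bounds zero    p = ≡⇒≤ (trans (*-zeroʳ (ι S)) (sym (*-zeroˡ W))) , λ ()
            bounds (suc d) p = ≤-trans (≡⇒≤ (*-distribˡ-+ (ι S) (Γ d) (G (suc d)))) (lemma (ι S * Γ d) (ι S * G (suc d)) (ι d) W (proj₁ IH) now) , λ _ → now
              where
              IH = bounds d (ℕₚ.<⇒≤ p)
              x = ι (d ℕ.+ S)
              lemma : ∀ a b d w → a ≤ d * w → b ≤ w → a + b ≤ (1ℚ + d) * w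
              lemma a b d w h₁ h₂ = by (Δ h₁ ⊕ Δ h₂) (solve (a ∷ b ∷ d ∷ w ∷ []) ring)
              lemma₂ : ∀ x g f s γ d w → (1ℚ + x) * g ≡ f + (γ + g) → f ≤ w → x ≡ d + s → s * γ ≤ d * w → 0ℚ ≤ s → x * (s * g) ≤ x * w
              lemma₂ x g f s γ d w h₁ h₂ refl h₄ h₅ = by (h₅ ⊗ Δ (≡⇒≤ h₁) ⊕ h₅ ⊗ Δ h₂ ⊕ Δ h₄) (solve (g ∷ f ∷ s ∷ γ ∷ d ∷ w ∷ []) ring)
              now : ι S * G (suc d) ≤ W
              now = *-cancel x (0<ι (d ℕ.+ S) {{ℕ.>-nonZero (ℕₚ.≤-trans 1≤S (ℕₚ.m≤n+m S d))}})
                (lemma₂ x (G (suc d)) (F (suc d)) (ι S) (Γ d) (ι d) W (parts (suc d)) (F≤W (suc d) p) (ι-+ d S) (proj₁ IH) (0≤ι S))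

        -- The first term is the excess beyond scale M given by `Growth`, the second the trivial
        -- bound below M. As W is of order T*, taking T* = M² makes both of order M.
        E′ : ℚ
        E′ = W * v M + ι n * (ι M + B)

        private
          instance
            M≢0 : ℕ.NonZero M
            M≢0 = ℕ.>-nonZero 1≤M

          0≤Wv : 0ℚ ≤ W * v M
          0≤Wv = 0≤W ⊗ 0≤v M

          0≤nMB : 0ℚ ≤ ι n * (ι M + B)
          0≤nMB = 0≤ι n ⊗ (0≤ι M ⊕ 0≤B)

        0≤E′ : 0ℚ ≤ E′
        0≤E′ = 0≤Wv ⊕ 0≤nMB

        private
          growth-large : ∀ {l S S′} → l ∈1‥ n → M ℕ.≤ S → S ℕ.≤ S′ → S′ ℕ.≤ T* → ι n * (P l S′ - P l S) ≤ 2ℚ * (ι S′ - ι S) + W * v M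
          growth-large {l} {S} {S′} l∈ p r s = subst (λ z → ι n * (P l z - P l S) ≤ 2ℚ * (ι z - ι S) + W * v M) (ℕₚ.m∸n+n≡m r) (go (S′ ℕ.∸ S) (ℕₚ.≤-trans (ℕₚ.≤-reflexive (ℕₚ.m∸n+n≡m r)) s))
            where
            open Growth l∈ S (ℕₚ.≤-trans 1≤M p)
            G≤ : ∀ d → d ℕ.+ S ℕ.≤ T* → ι M * G d ≤ W
            G≤ d t with ≤-total (G d) 0ℚ
            ... | inj₁ neg = ≤-trans (*-monoˡ (ι M) (0≤ι M) neg) (≤-trans (≡⇒≤ (*-zeroʳ (ι M))) 0≤W)
            G≤ zero    t | inj₂ pos = ≤-trans (≡⇒≤ (lemma (ι M) (ι n) (P l S))) 0≤W
              where
              lemma : ∀ m n p → m * (n * (p - p) - 2ℚ * 0ℚ) ≡ 0ℚ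
              lemma = solve-∀ ring
            G≤ (suc d) t | inj₂ pos = ≤-trans (*-monoʳ (G (suc d)) pos (ι-mono p)) (proj₂ (bounds (suc d) t) (ℕ.s≤s ℕ.z≤n))
            go : ∀ d → d ℕ.+ S ℕ.≤ T* → ι n * (P l (d ℕ.+ S) - P l S) ≤ 2ℚ * (ι (d ℕ.+ S) - ι S) + W * v M
            go d t = lemma (ι n * (P l (d ℕ.+ S) - P l S)) (ι d) (ι S) (ι (d ℕ.+ S)) (W * v M) (ι-+ d S) (≤v M (G≤ d t))
              where
              lemma : ∀ a d s x w → x ≡ d + s → a - 2ℚ * d ≤ w → a ≤ 2ℚ * (x - s) + w
              lemma a d s x w refl h = by (Δ h) (solve (a ∷ d ∷ s ∷ w ∷ []) ring)

          P-M : ∀ {l S} → l ∈1‥ n → S ℕ.≤ M → ι n * P l S ≤ ι n * (ι M + B)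
          P-M l∈ p = *-monoˡ (ι n) (0≤ι n) (≤-trans (P-mono l∈ p M≤T*) (≤-trans (P≤Po l∈ M≤T*) (Po-upper M M≤T*)))

        -- A bound of Brun-Titchmarsh type with factor 2, between arbitrary scales. The three cases
        -- are the positions of `M` relative to the interval.
        growth : ∀ {l S S′} → l ∈1‥ n → S ℕ.≤ S′ → S′ ℕ.≤ T* → ι n * (P l S′ - P l S) ≤ 2ℚ * (ι S′ - ι S) + E′
        growth {l} {S} {S′} l∈ p s with M ℕ.≤? S | M ℕ.≤? S′
        ... | yes r | _     = ≤-trans (growth-large l∈ r p s) (+-monoʳ-≤ (2ℚ * (ι S′ - ι S)) (by 0≤nMB (lemma (W * v M) (ι n * (ι M + B)))))
          where
          lemma : ∀ a b → b ≡ a + b - a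
          lemma = solve-∀ ring
        ... | no r  | yes t = lemma (ι n) (P l S) (P l S′) (P l M) (ι S) (ι S′) (ι M) (W * v M) (ι n * (ι M + B)) (growth-large l∈ ℕₚ.≤-refl t s) (P-M l∈ ℕₚ.≤-refl)
            (0≤ι n) (0≤P l∈ (ℕₚ.≤-trans p s)) (ι-mono (ℕₚ.<⇒≤ (ℕₚ.≰⇒> r)))
          where
          lemma : ∀ n a a′ b s s′ m w z → n * (a′ - b) ≤ 2ℚ * (s′ - m) + w → n * b ≤ z → 0ℚ ≤ n → 0ℚ ≤ a → s ≤ m → n * (a′ - a) ≤ 2ℚ * (s′ - s) + (w + z)
          lemma n a a′ b s s′ m w z h₁ h₂ h₃ h₄ h₅ = by (Δ h₁ ⊕ Δ h₂ ⊕ h₃ ⊗ h₄ ⊕ nonNegative⁻¹ 2ℚ ⊗ Δ h₅) (solve (n ∷ a ∷ a′ ∷ b ∷ s ∷ s′ ∷ m ∷ w ∷ z ∷ []) ring)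
        ... | no r  | no t  = lemma (ι n) (P l S) (P l S′) (ι S) (ι S′) (W * v M) (ι n * (ι M + B)) (P-M l∈ (ℕₚ.<⇒≤ (ℕₚ.≰⇒> t))) (0≤ι n) (0≤P l∈ (ℕₚ.≤-trans p s)) (ι-mono p) 0≤Wv
          where
          lemma : ∀ n a a′ s s′ w z → n * a′ ≤ z → 0ℚ ≤ n → 0ℚ ≤ a → s ≤ s′ → 0ℚ ≤ w → n * (a′ - a) ≤ 2ℚ * (s′ - s) + (w + z)
          lemma n a a′ s s′ w z h₁ h₂ h₃ h₄ h₅ = by (Δ h₁ ⊕ h₂ ⊗ h₃ ⊕ nonNegative⁻¹ 2ℚ ⊗ Δ h₄ ⊕ h₅) (solve (n ∷ a ∷ a′ ∷ s ∷ s′ ∷ w ∷ z ∷ []) ring)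

        Ω : ℚ
        Ω = ι T* + 2ℚ * (B * ι T*) + E′ * (ι T* + B) + D * (ι T* + 1ℚ)

        -- If the class l is light at scale S + y and u w = l, then u is light at scale S or w is nearly full at scale y.
        light : ∀ {u w l} S y → u ∈1‥ n → w ∈1‥ n → l ∈1‥ n → c u w l ≡ 1ℚ → S ℕ.+ y ℕ.≤ T* →
          P u S * (2ℚ * ι y - ι n * P w y) ≤ ι n * τ l (S ℕ.+ y) + Ω
        light {u} {w} {l} S y u∈ w∈ l∈ c≡1 p = ≤-trans lower (≤-trans (≡⇒≤ total-D) upper)
          where
          T = S ℕ.+ y
          -- The deficit of the class w at scale T - i, nonnegative by `growth`. A single pair (u,
          -- w) with scales i < S is bounded by the sum over all pairs with product l, which the
          -- main formula evaluates.
          d : ℕ → ℕ → ℚ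
          d w i = 2ℚ * ι (T ℕ.∸ i) + E′ - ι n * P w (T ℕ.∸ i)
          T∸≤ : ∀ i → T ℕ.∸ i ℕ.≤ T*
          T∸≤ i = ℕₚ.≤-trans (ℕₚ.m∸n≤m T i) p
          0≤d : ∀ {w} i → w ∈1‥ n → 0ℚ ≤ d w i
          0≤d {w} i r = lemma (ι n) (P w (T ℕ.∸ i)) (ι (T ℕ.∸ i)) E′ (growth r ℕ.z≤n (T∸≤ i))
            where
            lemma : ∀ n a s e → n * (a - 0ℚ) ≤ 2ℚ * (s - 0ℚ) + e → 0ℚ ≤ 2ℚ * s + e - n * a
            lemma n a s e h = by (Δ h) (solve (n ∷ a ∷ s ∷ e ∷ []) ring)
          term : ℕ → ℚ
          term i = Σ₁ n λ u → Σ₁ n λ w → c u w l * (q u i * d w i)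
          <T* : ∀ {i} → i ℕ.< T → i ℕ.< T*
          <T* r = ℕₚ.<-≤-trans r p
          0≤term : ∀ {i} → i ℕ.< T → ∀ {u} → u ∈1‥ n → 0ℚ ≤ Σ₁ n (λ w → c u w l * (q u i * d w i))
          0≤term {i} r {u} s = Σ₁-nonneg n λ w t → 0≤c u w l ⊗ (0≤q s (<T* r) ⊗ 0≤d i t)
          lower : P u S * (2ℚ * ι y - ι n * P w y) ≤ sum T term
          lower = begin
            P u S * (2ℚ * ι y - ι n * P w y)             ≡⟨ sym (sum-*ʳ S (2ℚ * ι y - ι n * P w y) (q u)) ⟩
            sum S (λ i → q u i * (2ℚ * ι y - ι n * P w y)) ≤⟨ (sum-mono S λ i r → *-monoˡ (q u i) (0≤q u∈ (<T* (ℕₚ.<-≤-trans r (ℕₚ.m≤m+n S y)))) (near i (ℕₚ.<⇒≤ r))) ⟩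
            sum S (λ i → q u i * d w i)                  ≤⟨ sum-≤ S T _ (ℕₚ.m≤m+n S y) (λ i r → 0≤q u∈ (<T* r) ⊗ 0≤d i w∈) ⟩
            sum T (λ i → q u i * d w i)                  ≤⟨ (sum-mono T λ i r → ≤-trans (≡⇒≤ (trans (sym (*-identityˡ _)) (cong (_* (q u i * d w i)) (sym c≡1))))
                                                                (≤-trans (Σ₁-term n w (λ w → c u w l * (q u i * d w i)) w∈ λ w t → 0≤c u w l ⊗ (0≤q u∈ (<T* r) ⊗ 0≤d i t))
                                                                  (Σ₁-term n u (λ u → Σ₁ n λ w → c u w l * (q u i * d w i)) u∈ λ u s → 0≤term r s))) ⟩
            sum T term ∎
            where
            open ≤-Reasoning
            near : ∀ i → i ℕ.≤ S → 2ℚ * ι y - ι n * P w y ≤ d w i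
            near i r = lemma (ι n) (P w y) (P w (T ℕ.∸ i)) (ι y) (ι (T ℕ.∸ i)) E′
              (growth w∈ (ℕₚ.≤-trans (ℕₚ.≤-reflexive (sym (ℕₚ.m+n∸m≡n S y))) (ℕₚ.∸-monoʳ-≤ T r)) (T∸≤ i))
              where
              lemma : ∀ n a a′ s s′ e → n * (a′ - a) ≤ 2ℚ * (s′ - s) + e → 2ℚ * s - n * a ≤ 2ℚ * s′ + e - n * a′
              lemma n a a′ s s′ e h = by (Δ h) (solve (n ∷ a ∷ a′ ∷ s ∷ s′ ∷ e ∷ []) ring)
          S₀ : ℚ
          S₀ = sum T (λ t → Po (suc t))
          total-D : sum T term ≡ 2ℚ * S₀ + E′ * Po T - ι n * K l T
          total-D = begin
            sum T term
              ≡⟨ (sum-cong T λ i _ → trans (Σ₁-cong n λ u s → trans (Σ₁-cong n λ w _ → lemma (c u w l) (q u i) (2ℚ * ι (T ℕ.∸ i) + E′) (ι n) (P w (T ℕ.∸ i)))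
                    (trans (Σ₁-- n _ _) (cong₂ _-_ (trans (Σ₁-*ʳ n (q u i * (2ℚ * ι (T ℕ.∸ i) + E′)) _) (trans (cong (_* (q u i * (2ℚ * ι (T ℕ.∸ i) + E′))) (c-sum-w s l∈)) (*-identityˡ (q u i * (2ℚ * ι (T ℕ.∸ i) + E′)))))
                       (Σ₁-*ˡ n (ι n) _)))) (trans (Σ₁-- n _ _) (cong₂ _-_ (Σ₁-*ʳ n (2ℚ * ι (T ℕ.∸ i) + E′) _) (Σ₁-*ˡ n (ι n) _)))) ⟩
            sum T (λ i → qo i * (2ℚ * ι (T ℕ.∸ i) + E′) - ι n * Σ₁ n (λ u → Σ₁ n λ w → c u w l * (q u i * P w (T ℕ.∸ i))))
              ≡⟨ trans (sum-- T _ _) (cong₂ _-_ (trans (sum-cong T λ i _ → lemma₂ (qo i) (ι (T ℕ.∸ i)) E′) (sum-+ T _ _)) (sum-*ˡ T (ι n) _)) ⟩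
            sum T (λ i → 2ℚ * (qo i * ι (T ℕ.∸ i))) + sum T (λ i → E′ * qo i) - ι n * K l T
              ≡⟨ cong (_- ι n * K l T) (cong₂ _+_ (trans (sum-*ˡ T 2ℚ _) (cong (2ℚ *_) (S-total T))) (trans (sum-*ˡ T E′ qo) (cong (E′ *_) (sym (Po-sum T))))) ⟩
            2ℚ * S₀ + E′ * Po T - ι n * K l T ∎
            where
            open ≡-Reasoning
            lemma : ∀ c q z n p → c * (q * (z - n * p)) ≡ c * (q * z) - n * (c * (q * p))
            lemma = solve-∀ ring
            lemma₂ : ∀ q t e → q * (2ℚ * t + e) ≡ 2ℚ * (q * t) + e * q
            lemma₂ = solve-∀ ring
          S₀≤ : 2ℚ * S₀ ≤ ι T * ι T + ι T + 2ℚ * (ι T * B)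
          S₀≤ = ≤-trans (*-monoˡ 2ℚ (nonNegative⁻¹ 2ℚ) (≤-trans (sum-mono T λ t r → Po-upper (suc t) (ℕₚ.≤-trans r p))
              (≡⇒≤ (trans (sum-+ T (λ t → ι (suc t)) _) (cong (sum T (λ t → ι (suc t)) +_) (sum-const T B))))))
            (≡⇒≤ (trans (*-distribˡ-+ 2ℚ (sum T (λ t → ι (suc t))) (ι T * B)) (cong (_+ 2ℚ * (ι T * B)) (gauss T))))
          -- Up to errors 2·S₀ is T², and the main formula gives -n·K ≤ n·τ - T². The quadratic
          -- terms cancel, so the total deficit is n·τ(l), small when l is light.
          upper : 2ℚ * S₀ + E′ * Po T - ι n * K l T ≤ ι n * τ l T + Ω
          upper = lemma (ι n) (2ℚ * S₀) E′ (Po T) (K l T) (τ l T) (ι T) (ι T*) B D S₀≤ 0≤E′ (Po-upper T p) (-≤abs (main T l∈ p)) (ι-mono p) 0≤B 0≤D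
            where
            lemma : ∀ n s e p k t x y b d → s ≤ x * x + x + 2ℚ * (x * b) → 0ℚ ≤ e → p ≤ x + b → - (d * (x + 1ℚ)) ≤ n * (t + k) - x * x → x ≤ y → 0ℚ ≤ b → 0ℚ ≤ d →
              s + e * p - n * k ≤ n * t + (y + 2ℚ * (b * y) + e * (y + b) + d * (y + 1ℚ))
            lemma n s e p k t x y b d h₁ h₂ h₃ h₄ h₅ h₆ h₇ = by (Δ h₁ ⊕ h₂ ⊗ Δ h₃ ⊕ Δ h₄ ⊕ Δ h₅ ⊕ nonNegative⁻¹ 2ℚ ⊗ (h₆ ⊗ Δ h₅) ⊕ h₂ ⊗ Δ h₅ ⊕ h₇ ⊗ Δ h₅)
              (solve (n ∷ s ∷ e ∷ p ∷ k ∷ t ∷ x ∷ y ∷ b ∷ d ∷ []) ring)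

        τ≤ : ∀ {l} T → l ∈1‥ n → T ℕ.≤ T* → τ l T ≤ ι T * P l T
        τ≤ {l} T l∈ p = ≤-trans (sum-mono T λ t r → *-monoʳ (q l t) (0≤q l∈ (ℕₚ.<-≤-trans r p)) (ι-mono (ℕₚ.<⇒≤ r))) (≡⇒≤ (sum-*ˡ T (ι T) (q l)))

        -- If r = g² is nearly full at scale 2h then g is light at scale h.
        square-light : ∀ {g r} h → g ∈1‥ n → r ∈1‥ n → c g g r ≡ 1ℚ → h ℕ.+ h ℕ.≤ T* →
          ι n * (P g h * P g h) ≤ ι (h ℕ.+ h) * (2ℚ * ι (h ℕ.+ h) - ι n * P r (h ℕ.+ h)) + ι (h ℕ.+ h) * (1ℚ + E′) + D * (ι (h ℕ.+ h) + 1ℚ)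
        square-light {g} {r} h g∈ r∈ c≡1 p = lemma (ι n) (P g h * P g h) (K r H) (τ r H) (P r H) (sum H (λ t → P r (suc t))) (ι H) D E′ (0≤ι n) K-lower (≤-abs (main H r∈ p)) (sum-by-parts (q r) H) sum-upper
          where
          H = h ℕ.+ h
          K-lower : P g h * P g h ≤ K r H
          K-lower = begin
            P g h * P g h                                  ≡⟨ sym (sum-*ʳ h (P g h) (q g)) ⟩
            sum h (λ i → q g i * P g h)                    ≤⟨ (sum-mono h λ i s → *-monoˡ (q g i) (0≤q g∈ (ℕₚ.<-≤-trans s (ℕₚ.≤-trans (ℕₚ.m≤m+n h h) p)))
                                                                (P-mono g∈ (ℕₚ.≤-trans (ℕₚ.≤-reflexive (sym (ℕₚ.m+n∸m≡n h h))) (ℕₚ.∸-monoʳ-≤ H (ℕₚ.<⇒≤ s))) (ℕₚ.≤-trans (ℕₚ.m∸n≤m H i) p))) ⟩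
            sum h (λ i → q g i * P g (H ℕ.∸ i))            ≤⟨ sum-≤ h H _ (ℕₚ.m≤m+n h h) (λ i s → 0≤q g∈ (ℕₚ.<-≤-trans s p) ⊗ 0≤P g∈ (ℕₚ.≤-trans (ℕₚ.m∸n≤m H i) p)) ⟩
            sum H (λ i → q g i * P g (H ℕ.∸ i))            ≤⟨ (sum-mono H λ i s → ≤-trans (≡⇒≤ (trans (sym (*-identityˡ _)) (cong (_* (q g i * P g (H ℕ.∸ i))) (sym c≡1))))
                                                                (≤-trans (Σ₁-term n g (λ w → c g w r * (q g i * P w (H ℕ.∸ i))) g∈ λ w t → 0≤c g w r ⊗ (0≤q g∈ (ℕₚ.<-≤-trans s p) ⊗ 0≤P t (ℕₚ.≤-trans (ℕₚ.m∸n≤m H i) p)))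
                                                                  (Σ₁-term n g (λ u → Σ₁ n λ w → c u w r * (q u i * P w (H ℕ.∸ i))) g∈ λ u u∈ → Σ₁-nonneg n λ w t → 0≤c u w r ⊗ (0≤q u∈ (ℕₚ.<-≤-trans s p) ⊗ 0≤P t (ℕₚ.≤-trans (ℕₚ.m∸n≤m H i) p))))) ⟩
            K r H ∎
            where open ≤-Reasoning
          -- By `growth` this sum is about H² at most, so summation by parts gives n·τ ≥ H·n·P - H².
          -- Then n·K ≤ H² - n·τ leaves H times the deficit 2H - n·P of r, and K is at least the
          -- square of the mass of g at half the scale.
          sum-upper : ι n * sum H (λ t → P r (suc t)) ≤ ι H * ι H + ι H + ι H * E′
          sum-upper = ≤-trans (≡⇒≤ (sym (sum-*ˡ H (ι n) _))) (≤-trans (sum-mono H λ t s → lemma₀ (ι n) (P r (suc t)) (ι (suc t)) E′ (growth r∈ ℕ.z≤n (ℕₚ.≤-trans s p)))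
            (≡⇒≤ (trans (sum-+ H (λ t → 2ℚ * ι (suc t)) _) (cong₂ _+_ (trans (sum-*ˡ H 2ℚ _) (gauss H)) (sum-const H E′)))))
            where
            lemma₀ : ∀ n a s e → n * (a - 0ℚ) ≤ 2ℚ * (s - 0ℚ) + e → n * a ≤ 2ℚ * s + e
            lemma₀ n a s e h = by (Δ h) (solve (n ∷ a ∷ s ∷ e ∷ []) ring)
          lemma : ∀ n g k t p s x d e → 0ℚ ≤ n → g ≤ k → n * (t + k) - x * x ≤ d * (x + 1ℚ) → t ≡ x * p - s → n * s ≤ x * x + x + x * e →
            n * g ≤ x * (2ℚ * x - n * p) + x * (1ℚ + e) + d * (x + 1ℚ)
          lemma n g k t p s x d e h₁ h₂ h₃ refl h₄ = by (h₁ ⊗ Δ h₂ ⊕ Δ h₃ ⊕ Δ h₄) (solve (n ∷ g ∷ k ∷ p ∷ s ∷ x ∷ d ∷ e ∷ []) ring)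

        module Conclusion (w : ℕ) (1≤w : 1 ℕ.≤ w) (8w≡T* : (w ℕ.+ w ℕ.+ (w ℕ.+ w)) ℕ.+ (w ℕ.+ w ℕ.+ (w ℕ.+ w)) ≡ T*)
          (η : ℚ) (1≤n : 1ℚ ≤ ι n) (0≤η : 0ℚ ≤ η) (small : 256ℚ * (ι n * ι n * ι n * η) ≤ 1ℚ)
          (Θ-small : (ι n * (ι n * (ι T* * B)) + ι n * Ω) * (v w * v w) ≤ η)
          (square-small : (ι (w ℕ.+ w ℕ.+ (w ℕ.+ w)) * (1ℚ + E′) + D * (ι (w ℕ.+ w ℕ.+ (w ℕ.+ w)) + 1ℚ)) * (v w * v w) ≤ η)
          (B-small : ι n * B * v w ≤ η)
          {a one r b g i : ℕ} (a∈ : a ∈1‥ n) (one∈ : one ∈1‥ n) (r∈ : r ∈1‥ n) (b∈ : b ∈1‥ n) (g∈ : g ∈1‥ n) (i∈ : i ∈1‥ n)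
          (one*a : c one a a ≡ 1ℚ) (r*b : c r b a ≡ 1ℚ) (b*r : c b r a ≡ 1ℚ) (g*g : c g g r ≡ 1ℚ) (r*i : c r i g ≡ 1ℚ) (i*g : c i g one ≡ 1ℚ)
          (a-empty : P a T* ≤ B) (r-heavy : ι w ≤ 2ℚ * (ι n * P r w)) where

          private
            -- Every relation halves the scale: a is used at 8w, the classes 1, r, b at 4w, g at 2w,
            -- and i and g once more at w, where r is known to be heavy.
            h = w ℕ.+ w
            H = h ℕ.+ h
            instance
              w≢0 : ℕ.NonZero w
              w≢0 = ℕ.>-nonZero 1≤w

            HH≤ : H ℕ.+ H ℕ.≤ T*
            HH≤ = ℕₚ.≤-reflexive 8w≡T*
            H≤ : H ℕ.≤ T*
            H≤ = ℕₚ.≤-trans (ℕₚ.m≤m+n H H) HH≤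
            h≤H : h ℕ.≤ H
            h≤H = ℕₚ.m≤m+n h h
            h≤ : h ℕ.≤ T*
            h≤ = ℕₚ.≤-trans h≤H H≤
            w≤h : w ℕ.≤ h
            w≤h = ℕₚ.m≤m+n w w
            w≤ : w ℕ.≤ T*
            w≤ = ℕₚ.≤-trans w≤h h≤

            -- Mass in units in which a class with its fair share has 1 at scale w, and a full class
            -- has 2 at scale w and 8 at scale 4w.
            x : ℕ → ℕ → ℚ
            x u t = ι n * P u t * v w

            ιh : ι h * v w ≡ 2ℚ
            ιh = trans (cong (_* v w) (ι-+ w w)) (trans (*-distribʳ-+ (v w) (ι w) (ι w)) (cong₂ _+_ (ι*v w) (ι*v w)))

            ιH : ι H * v w ≡ 4ℚ
            ιH = trans (cong (_* v w) (ι-+ h h)) (trans (*-distribʳ-+ (v w) (ι h) (ι h)) (cong₂ _+_ ιh ιh))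

            0≤x : ∀ {u t} → u ∈1‥ n → t ℕ.≤ T* → 0ℚ ≤ x u t
            0≤x u∈ p = 0≤ι n ⊗ 0≤P u∈ p ⊗ 0≤v w

            x-mono : ∀ {u t t′} → u ∈1‥ n → t ℕ.≤ t′ → t′ ℕ.≤ T* → x u t ≤ x u t′
            x-mono u∈ p p′ = *-monoʳ (v w) (0≤v w) (*-monoˡ (ι n) (0≤ι n) (P-mono u∈ p p′))

            scaled : ∀ N A y C z t Ω → A * (2ℚ * y - N * C) ≤ t + Ω → 0ℚ ≤ N → 0ℚ ≤ z → N * A * z * (2ℚ * (y * z) - N * C * z) ≤ (N * t + N * Ω) * (z * z)
            scaled N A y C z t Ω h₁ h₂ h₃ = by (h₂ ⊗ (h₃ ⊗ h₃) ⊗ Δ h₁) (solve (N ∷ A ∷ y ∷ C ∷ z ∷ t ∷ Ω ∷ []) ring)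

            a-light : ∀ {u w′} → u ∈1‥ n → w′ ∈1‥ n → c u w′ a ≡ 1ℚ → x u H * (8ℚ - x w′ H) ≤ η
            a-light {u} {w′} u∈ w∈ e = ≤-trans (subst (λ y → x u H * (2ℚ * y - x w′ H) ≤ (ι n * (ι n * (ι T* * B)) + ι n * Ω) * (v w * v w)) ιH
              (scaled (ι n) (P u H) (ι H) (P w′ H) (v w) (ι n * (ι T* * B)) Ω (≤-trans (light H H u∈ w∈ a∈ e HH≤) (+-monoˡ-≤ Ω (*-monoˡ (ι n) (0≤ι n)
                (subst (λ T → τ a T ≤ ι T* * B) (sym 8w≡T*) (≤-trans (τ≤ T* a∈ ℕₚ.≤-refl) (*-monoˡ (ι T*) (0≤ι T*) a-empty)))))) (0≤ι n) (0≤v w))) Θ-small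

            Ω-small : ι n * Ω * (v w * v w) ≤ η
            Ω-small = ≤-trans (*-monoʳ {ι n * Ω} {ι n * (ι n * (ι T* * B)) + ι n * Ω} (v w * v w) (0≤v w ⊗ 0≤v w) (by (0≤ι n ⊗ (0≤ι n ⊗ (0≤ι T* ⊗ 0≤B))) (lemma (ι n * (ι n * (ι T* * B))) (ι n * Ω)))) Θ-small
              where
              lemma : ∀ a b → a ≡ a + b - b
              lemma = solve-∀ ring

            class-light : ∀ {u w′ l} → u ∈1‥ n → w′ ∈1‥ n → l ∈1‥ n → c u w′ l ≡ 1ℚ → x u w * (2ℚ - x w′ w) ≤ 2ℚ * (ι n * x l h) + η
            class-light {u} {w′} {l} u∈ w∈ l∈ e = ≤-trans (subst (λ y → x u w * (2ℚ * y - x w′ w) ≤ (ι n * (ι n * (ι h * P l h)) + ι n * Ω) * (v w * v w)) (ι*v w)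
              (scaled (ι n) (P u w) (ι w) (P w′ w) (v w) (ι n * (ι h * P l h)) Ω (≤-trans (light w w u∈ w∈ l∈ e h≤) (+-monoˡ-≤ Ω (*-monoˡ (ι n) (0≤ι n) (τ≤ h l∈ h≤)))) (0≤ι n) (0≤v w)))
              (≤-trans (≡⇒≤ (lemma (ι n) (ι h) (P l h) Ω (v w))) (+-mono-≤ (≡⇒≤ (cong (_* (ι n * x l h)) ιh)) Ω-small))
              where
              lemma : ∀ n h p o z → (n * (n * (h * p)) + n * o) * (z * z) ≡ h * z * (n * (n * p * z)) + n * o * (z * z)
              lemma = solve-∀ ring

            g-square : x g h * x g h ≤ ι n * (4ℚ * (8ℚ - x r H) + η)
            g-square = ≤-trans (lemma (ι n) (P g h) (ι H) (P r H) (v w) (ι H * (1ℚ + E′)) (D * (ι H + 1ℚ)) (square-light h g∈ r∈ g*g H≤) (0≤ι n) (0≤v w))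
              (*-monoˡ (ι n) (0≤ι n) (+-mono-≤ (≡⇒≤ (cong (λ y → y * (2ℚ * y - x r H)) ιH)) square-small))
              where
              lemma : ∀ N g y p z s t → N * (g * g) ≤ y * (2ℚ * y - N * p) + s + t → 0ℚ ≤ N → 0ℚ ≤ z →
                N * g * z * (N * g * z) ≤ N * (y * z * (2ℚ * (y * z) - N * p * z) + (s + t) * (z * z))
              lemma N g y p z s t h₁ h₂ h₃ = by (h₂ ⊗ (h₃ ⊗ h₃) ⊗ Δ h₁) (solve (N ∷ g ∷ y ∷ p ∷ z ∷ s ∷ t ∷ []) ring)

            heavy : 1ℚ ≤ 2ℚ * x r w
            heavy = ≤-trans (≡⇒≤ (sym (ι*v w))) (≤-trans (*-monoʳ (v w) (0≤v w) r-heavy) (≡⇒≤ (*-assoc 2ℚ (ι n * P r w) (v w))))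

          absurd : ⊥
          absurd = numeric (ι n) η (x a H) (x one H) (x r H) (x r w) (x b H) (x g h) (x g w) (x i w) (x one h) 1≤n 0≤η small
            (0≤x one∈ H≤) (0≤x g∈ h≤) (0≤x r∈ H≤) (0≤x r∈ w≤)
            (≤-trans (*-monoʳ (v w) (0≤v w) (*-monoˡ (ι n) (0≤ι n) (≤-trans (P-mono a∈ H≤ ℕₚ.≤-refl) a-empty))) B-small)
            (x-mono one∈ h≤H H≤) (x-mono g∈ w≤h h≤) heavy (x-mono r∈ (ℕₚ.≤-trans w≤h h≤H) H≤)
            (a-light one∈ a∈ one*a) (a-light r∈ b∈ r*b) (a-light b∈ r∈ b*r) g-square (class-light r∈ i∈ g∈ r*i) (class-light i∈ g∈ one∈ i*g)

-- From sums over integers to dyadic masses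

module Dyadic where

  open import Data.Nat as ℕ using (ℕ; zero; suc)
  import Data.Nat.Properties as ℕₚ
  open import Data.Nat.DivMod using (m%n<n)
  open import Data.Nat.Divisibility using (_∣_; _∣?_; ∣m⇒∣m*n; ∣n⇒∣m*n)
  open import Data.Nat.Primality using (Prime; prime?)
  import Data.Integer as ℤ
  open import Data.Rational hiding (_÷_)
  open import Data.Rational.Properties
  open import Data.Product using (proj₁; proj₂)
  open import Data.Empty using (⊥-elim)
  open import Data.List using ([]; _∷_)
  open import Function using (_∘_)
  open import Relation.Nullary using (¬_; yes; no; Dec)
  open import Relation.Binary.PropositionalEquality
  open import Tactic.RingSolver using (solve; solve-∀)
  open Rationals
  open Sums
  open Convolution
  open Mangoldt
  open Residue
  open Selberg

  -- The range is 2^t < n ≤ 2^(t+1). The integer 1 lies in no block; for sums weighted by Λ it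
  -- contributes nothing, as Λ(1) = 0.
  block : ℕ → (ℕ → ℚ) → ℚ
  block t g = Σ₁ (2 ℕ.^ t) λ i → g (2 ℕ.^ t ℕ.+ i)

  Σ₁-blocks : ∀ T g → Σ₁ (2 ℕ.^ T) g ≡ g 1 + sum T (λ t → block t g)
  Σ₁-blocks zero    g = trans (Σ₁-suc 0 g) (trans (cong (_+ g 1) (Σ₁-0 g)) (+-comm 0ℚ (g 1)))
  Σ₁-blocks (suc T) g = trans (cong (λ y → Σ₁ y g) (2^suc T)) (trans (Σ₁-split (2 ℕ.^ T) (2 ℕ.^ T) g)
    (trans (cong (_+ block T g) (Σ₁-blocks T g)) (+-assoc (g 1) (sum T (λ t → block t g)) (block T g))))

  block-mono : ∀ t {g h} → (∀ n → 2 ℕ.^ t ℕ.≤ n → n ∈1‥ 2 ℕ.^ suc t → g n ≤ h n) → block t g ≤ block t h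
  block-mono t {g} {h} H = Σ₁-mono (2 ℕ.^ t) λ i p → H (2 ℕ.^ t ℕ.+ i) (ℕₚ.m≤m+n (2 ℕ.^ t) i)
    (ℕₚ.≤-trans (lo p) (ℕₚ.m≤n+m i (2 ℕ.^ t)) ﹐ ℕₚ.≤-trans (ℕₚ.+-monoʳ-≤ (2 ℕ.^ t) (hi p)) (ℕₚ.≤-reflexive (sym (2^suc t))))

  geometric : ∀ q J → 2 ℕ.≤ q → Σ₁ J (λ j → v (q ℕ.^ j)) ≤ 2ℚ * v q
  geometric q zero    2≤q = ≤-trans (≡⇒≤ (Σ₁-0 _)) (nonNegative⁻¹ 2ℚ ⊗ 0≤v q {{ℕ.>-nonZero (ℕₚ.<⇒≤ 2≤q)}})
  geometric q (suc J) 2≤q = by (Δ (go J) ⊕ 0≤v (q ℕ.^ suc J) {{ℕₚ.m^n≢0 q (suc J)}}) (lemma (Σ₁ (suc J) (λ j → v (q ℕ.^ j))) (v q) (v (q ℕ.^ suc J)))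
    where
    instance
      q≢0 : ℕ.NonZero q
      q≢0 = ℕ.>-nonZero (ℕₚ.<⇒≤ 2≤q)
    lemma : ∀ s a b → 2ℚ * a - b - s + b ≡ 2ℚ * a - s
    lemma = solve-∀ ring
    go : ∀ J → Σ₁ (suc J) (λ j → v (q ℕ.^ j)) ≤ 2ℚ * v q - v (q ℕ.^ suc J)
    go zero    = ≡⇒≤ (trans (Σ₁-suc 0 _) (trans (cong₂ _+_ (Σ₁-0 _) (cong v (ℕₚ.*-identityʳ q))) (trans (lemma₂ (v q)) (cong (λ z → 2ℚ * v q - v z) (sym (ℕₚ.*-identityʳ q))))))
      where
      lemma₂ : ∀ a → 0ℚ + a ≡ 2ℚ * a - a
      lemma₂ = solve-∀ ring
    go (suc J) = subst (_≤ 2ℚ * v q - v (q ℕ.^ suc (suc J))) (sym (Σ₁-suc (suc J) _))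
      (lemma₃ (Σ₁ (suc J) (λ j → v (q ℕ.^ j))) (v q) (v (q ℕ.^ suc J)) (v (q ℕ.^ suc (suc J))) (go J) (v-* q (q ℕ.^ suc J) {{q≢0}} {{ℕₚ.m^n≢0 q (suc J)}}) half (0≤v (q ℕ.^ suc J) {{ℕₚ.m^n≢0 q (suc J)}}))
      where
      half : 2ℚ * v q ≤ 1ℚ
      half = ≤-trans (*-monoʳ (v q) (0≤v q) (ι-mono 2≤q)) (≡⇒≤ (ι*v q))
      lemma₃ : ∀ s a b c → s ≤ 2ℚ * a - b → c ≡ a * b → 2ℚ * a ≤ 1ℚ → 0ℚ ≤ b → s + c ≤ 2ℚ * a - c
      lemma₃ s a b c h₁ refl h₂ h₃ = by (Δ h₁ ⊕ Δ h₂ ⊗ h₃) (solve (s ∷ a ∷ b ∷ []) ring)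

  module DyadicSums {X : ℕ} (1≤X : 1 ℕ.≤ X) (L : Log X) (k : ℕ) (pk : Prime k) where
    open Log L
    open LogLemmas L
    open vonMangoldt L
    open Dirichlet X
    open Mod k pk
    open Residues k pk
    open SelbergFormula L k pk

    mass : ℕ → ℕ → ℚ
    mass l n = e l n * (Λ n * v n)

    0≤Λv : ∀ n → 1 ℕ.≤ n → 0ℚ ≤ Λ n * v n
    0≤Λv n p = Λ-nonneg n ⊗ 0≤v n {{ℕ.>-nonZero p}}

    0≤mass : ∀ l n → 1 ℕ.≤ n → 0ℚ ≤ mass l n
    0≤mass l n p = 0≤e l n ⊗ 0≤Λv n p

    q : ℕ → ℕ → ℚ
    q l t = block t (mass l)

    c : ℕ → ℕ → ℕ → ℚ
    c u w l = e l (u ℕ.* w)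

    0≤q : ∀ l t → 0ℚ ≤ q l t
    0≤q l t = Σ₁-nonneg (2 ℕ.^ t) λ i p → 0≤mass l (2 ℕ.^ t ℕ.+ i) (ℕₚ.≤-trans (lo p) (ℕₚ.m≤n+m i (2 ℕ.^ t)))

    c-sum-l : ∀ {u w} → u ∈1‥ φk → w ∈1‥ φk → Σ₁ φk (λ l → c u w l) ≡ 1ℚ
    c-sum-l {u} {w} p r = trans (Σ₁-single φk ((u ℕ.* w) ℕ.% k) _ (class-of (∤-* (class-unit p) (class-unit r))) λ l _ ne → ⟦no⟧ ((u ℕ.* w) ℕ.% k ℕ.≟ l) (ne ∘ sym))
      (⟦yes⟧ ((u ℕ.* w) ℕ.% k ℕ.≟ (u ℕ.* w) ℕ.% k) refl)

    c-sum-w : ∀ {u l} → u ∈1‥ φk → l ∈1‥ φk → Σ₁ φk (λ w → c u w l) ≡ 1ℚ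
    c-sum-w {u} {l} p r = trans (Σ₁≡sum φk _) (trans (sym (+-identityˡ _)) (trans (cong (_+ sum φk (λ i → c u (suc i) l)) (sym zero-term))
      (trans (sym (sum-head φk (λ w → c u w l))) (trans (cong (λ m → sum m (λ w → c u w l)) sucφk) (count (class-unit p) r)))))
      where
      zero-term : c u 0 l ≡ 0ℚ
      zero-term = ⟦no⟧ ((u ℕ.* 0) ℕ.% k ℕ.≟ l) λ eq → ℕₚ.<⇒≢ (lo r) (trans (sym (trans (cong (ℕ._% k) (ℕₚ.*-zeroʳ u)) (small (ℕₚ.<-trans (ℕ.s≤s ℕ.z≤n) 1<k)))) eq)

    weighted-1 : ∀ (g : ℕ → ℚ) → Λ 1 * g 1 ≡ 0ℚ
    weighted-1 g = trans (cong (_* g 1) (Λ-1 1≤X)) (*-zeroˡ (g 1))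

    mass-sum : ∀ l T → Σ₁ (2 ℕ.^ T) (mass l) ≡ sum T (q l)
    mass-sum l T = trans (Σ₁-blocks T (mass l)) (trans (cong (_+ sum T (q l)) (trans (cong (e l 1 *_) (weighted-1 v)) (*-zeroʳ (e l 1)))) (+-identityˡ (sum T (q l))))

    e-total : ∀ n → Σ₁ φk (λ u → e u n) ≡ 1ℚ - e 0 n
    e-total n with n ℕ.% k in eq
    ... | zero  = trans (Σ₁-zero φk λ u p → ⟦no⟧ (0 ℕ.≟ u) (ℕₚ.<⇒≢ (lo p))) (sym (cong (λ z → 1ℚ - z) (⟦yes⟧ (0 ℕ.≟ 0) refl)))
    ... | suc m = trans (Σ₁-single φk (suc m) _ (ℕ.s≤s ℕ.z≤n ﹐ ℕₚ.≤-pred (ℕₚ.≤-trans (subst (ℕ._< k) eq (m%n<n n k)) (ℕₚ.≤-reflexive (sym sucφk)))) λ u _ ne → ⟦no⟧ (suc m ℕ.≟ u) (ne ∘ sym))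
                    (trans (⟦yes⟧ (suc m ℕ.≟ suc m) refl) (sym (cong (λ z → 1ℚ - z) (⟦no⟧ (suc m ℕ.≟ 0) λ ()))))

    private
      prime-powers : ∀ l y → Σ₁ y (mass l) ≡ Σ₁ X λ p → ⟦ prime? p ⟧ * (f p * Σ₁ X λ j → ⟦ p ℕ.^ j ℕ.≤? y ⟧ * (e l (p ℕ.^ j) * v (p ℕ.^ j)))
      prime-powers l y = trans (Σ₁-cong y λ n _ → lemma (e l n) (Λ n) (v n)) (sum-Λ y (λ n → e l n * v n))
        where
        lemma : ∀ a b c → a * (b * c) ≡ a * c * b
        lemma = solve-∀ ring

      ⟦⟧*≤ : ∀ {P : Set} (d : Dec P) {x y} → 0ℚ ≤ y → (P → x ≤ y) → ⟦ d ⟧ * x ≤ y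
      ⟦⟧*≤ d {x} {y} 0≤y h = ⟦⟧-case d (λ i → i * x ≤ y) (λ p → ≤-trans (≡⇒≤ (*-identityˡ x)) (h p)) (λ _ → ≤-trans (≡⇒≤ (*-zeroˡ x)) 0≤y)

      term≤ : ∀ {P : Set} (d : Dec P) l p j → Prime p → ⟦ d ⟧ * (e l (p ℕ.^ j) * v (p ℕ.^ j)) ≤ v (p ℕ.^ j)
      term≤ d l p j pp = ⟦⟧*≤ d 0≤ λ _ → ≤-trans (*-monoʳ (v (p ℕ.^ j)) 0≤ (⟦⟧≤1 ((p ℕ.^ j) ℕ.% k ℕ.≟ l))) (≡⇒≤ (*-identityˡ (v (p ℕ.^ j))))
        where
        0≤ : 0ℚ ≤ v (p ℕ.^ j)
        0≤ = 0≤v (p ℕ.^ j) {{ℕₚ.m^n≢0 p j {{ℕ.>-nonZero (prime≥1 pp)}}}}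

      f*v≤2 : ∀ n → n ∈1‥ X → f n * v n ≤ 2ℚ
      f*v≤2 n@(suc _) p = ≤-trans (*-monoʳ (v n) (0≤v n) (f-linear n p)) (≡⇒≤ (trans (*-assoc 2ℚ (ι n) (v n)) (cong (2ℚ *_) (ι*v n))))

      -- The only prime powers divisible by k are the powers of k. Their reciprocals sum to at most
      -- 2/k, and f(k) ≤ 2k.
      multiples : ∀ y → Σ₁ y (mass 0) ≤ ℤ.+ 4 / 1
      multiples y = ≤-trans (≡⇒≤ (prime-powers 0 y)) (≤-trans (Σ₁-mono X {g = λ p → ⟦ k ℕ.≟ p ⟧ * (f p * (2ℚ * v p))} λ p r →
          ⟦⟧*≤ (prime? p) (0≤⟦⟧ (k ℕ.≟ p) ⊗ (f-nonneg r ⊗ (nonNegative⁻¹ 2ℚ ⊗ 0≤v p {{ℕ.>-nonZero (lo r)}}))) (bound p r))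
        (≤-trans (≡⇒≤ (Σ₁-δ X k _ (ℕₚ.<⇒≤ 1<k))) (⟦⟧*≤ (k ℕ.≤? X) (nonNegative⁻¹ (ℤ.+ 4 / 1)) λ k≤X →
          lemma (f k) (v k) (f*v≤2 k (ℕₚ.<⇒≤ 1<k ﹐ k≤X)))))
        where
        lemma : ∀ a b → a * b ≤ 2ℚ → a * (2ℚ * b) ≤ ℤ.+ 4 / 1
        lemma a b h = by (nonNegative⁻¹ 2ℚ ⊗ Δ h) (solve (a ∷ b ∷ []) ring)
        bound : ∀ p → p ∈1‥ X → Prime p → f p * Σ₁ X (λ j → ⟦ p ℕ.^ j ℕ.≤? y ⟧ * (e 0 (p ℕ.^ j) * v (p ℕ.^ j))) ≤ ⟦ k ℕ.≟ p ⟧ * (f p * (2ℚ * v p))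
        bound p r pp = cases (k ℕ.≟ p)
         where
         cases : Dec (k ≡ p) → f p * Σ₁ X (λ j → ⟦ p ℕ.^ j ℕ.≤? y ⟧ * (e 0 (p ℕ.^ j) * v (p ℕ.^ j))) ≤ ⟦ k ℕ.≟ p ⟧ * (f p * (2ℚ * v p))
         cases (yes refl) = ≤-trans (*-monoˡ (f k) (f-nonneg r) (≤-trans (Σ₁-mono X λ j _ → term≤ (k ℕ.^ j ℕ.≤? y) 0 k j pp) (geometric k X (prime≥2 pp))))
                           (≡⇒≤ (trans (sym (*-identityˡ (f k * (2ℚ * v k)))) (cong (_* (f k * (2ℚ * v k))) (sym (⟦yes⟧ (k ℕ.≟ k) refl)))))
         cases (no ne)    = ≡⇒≤ (trans (cong (f p *_) (Σ₁-zero X λ j _ → trans (cong (λ z → ⟦ p ℕ.^ j ℕ.≤? y ⟧ * (z * v (p ℕ.^ j)))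
                             (⟦no⟧ ((p ℕ.^ j) ℕ.% k ℕ.≟ 0) λ eq → ne (∣-prime⇒≡ pk pp (prime∣^ j pk (%≡0⇒∣ eq))))) (lemma₂ ⟦ p ℕ.^ j ℕ.≤? y ⟧ (v (p ℕ.^ j)))))
                           (trans (*-zeroʳ (f p)) (sym (trans (cong (_* (f p * (2ℚ * v p))) (⟦no⟧ (k ℕ.≟ p) ne)) (*-zeroˡ (f p * (2ℚ * v p)))))))
          where
          lemma₂ : ∀ a b → a * (0ℚ * b) ≡ 0ℚ
          lemma₂ = solve-∀ ring

      -- The terms f(n)/n² telescope against (f(n) + 4)/n, whose value at 1 is the bound.
      sum-f-v² : ∀ Y → Y ℕ.≤ X → Σ₁ Y (λ n → f n * (v n * v n)) ≤ ℤ.+ 4 / 1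
      sum-f-v² zero    _ = ≤-trans (≡⇒≤ (Σ₁-0 _)) (nonNegative⁻¹ (ℤ.+ 4 / 1))
      sum-f-v² (suc Y) p = by (Δ (go Y p) ⊕ (f-nonneg (ℕ.s≤s ℕ.z≤n ﹐ p) ⊕ nonNegative⁻¹ (ℤ.+ 4 / 1)) ⊗ 0≤v (suc Y)) (lemma (Σ₁ (suc Y) (λ n → f n * (v n * v n))) (f (suc Y)) (v (suc Y)))
        where
        lemma : ∀ s a x → (ℤ.+ 4 / 1) - (a + (ℤ.+ 4 / 1)) * x - s + (a + (ℤ.+ 4 / 1)) * x ≡ (ℤ.+ 4 / 1) - s
        lemma = solve-∀ ring
        go : ∀ Y → suc Y ℕ.≤ X → Σ₁ (suc Y) (λ n → f n * (v n * v n)) ≤ (ℤ.+ 4 / 1) - (f (suc Y) + (ℤ.+ 4 / 1)) * v (suc Y)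
        go zero    p = ≡⇒≤ (trans (Σ₁-suc 0 _) (trans (cong₂ (λ s a → s + a * (v 1 * v 1)) (Σ₁-0 _) f-1) (trans (lemma₀ (v 1)) (sym (cong₂ (λ a b → (ℤ.+ 4 / 1) - (a + (ℤ.+ 4 / 1)) * b) f-1 v1)))))
          where
          lemma₀ : ∀ x → 0ℚ + 0ℚ * (x * x) ≡ 0ℚ
          lemma₀ = solve-∀ ring
        go (suc Y) p = subst (_≤ (ℤ.+ 4 / 1) - (f (suc n) + (ℤ.+ 4 / 1)) * v (suc n)) (sym (Σ₁-suc n _))
          (lemma₁ (Σ₁ n (λ n → f n * (v n * v n))) (f n) (f (suc n)) (v n) (v (suc n)) (go Y (ℕₚ.<⇒≤ p)) (f-step n (ℕ.s≤s ℕ.z≤n) p) (f-nonneg (ℕ.s≤s ℕ.z≤n ﹐ ℕₚ.<⇒≤ p)) (f-nonneg (ℕ.s≤s ℕ.z≤n ﹐ p))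
            (0≤v (suc n)) (0≤v n) (v-anti (ℕₚ.n≤1+n n)) (v≤1 n) (v-step n))
          where
          n = suc Y
          lemma₁ : ∀ s a b x z → s ≤ (ℤ.+ 4 / 1) - (a + (ℤ.+ 4 / 1)) * x → b - a ≤ 2ℚ * x → 0ℚ ≤ a → 0ℚ ≤ b → 0ℚ ≤ z → 0ℚ ≤ x → z ≤ x → x ≤ 1ℚ → x * z ≡ x - z →
            s + b * (z * z) ≤ (ℤ.+ 4 / 1) - (b + (ℤ.+ 4 / 1)) * z
          lemma₁ s a b x z h₁ h₂ h₀ h₃ h₄ h₅ h₆ h₇ h₈ = by
            (Δ h₁ ⊕ (h₀ ⊕ nonNegative⁻¹ (ℤ.+ 4 / 1)) ⊗ Δ (≡⇒≤ h₈) ⊕ h₄ ⊗ (h₃ ⊗ Δ h₆ ⊕ Δ h₂ ⊕ h₅ ⊗ (Δ h₂ ⊕ nonNegative⁻¹ 2ℚ ⊗ Δ h₇))) (solve (s ∷ a ∷ b ∷ x ∷ z ∷ []) ring)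

    -- Primes up to N contribute at most f(p)/p ≤ 2 each. Powers with exponent at least 2 contribute
    -- at most 2·f(p)/p² per prime, 8 in all. Primes from N to X do not occur in the class.
    sparse : ∀ a N T → 2 ℕ.^ T ℕ.≤ X → (∀ p → Prime p → N ℕ.≤ p → p ℕ.≤ X → p ℕ.% k ≢ a) → sum T (q a) ≤ 2ℚ * ι N + 8ℚ
    sparse a N T y≤X none = ≤-trans (≡⇒≤ (trans (sym (mass-sum a T)) (prime-powers a (2 ℕ.^ T)))) (≤-trans
        (Σ₁-mono X {g = λ p → ⟦ p ℕ.≤? N ⟧ * 2ℚ + 2ℚ * (f p * (v p * v p))} λ p r →
          ⟦⟧*≤ (prime? p) (0≤⟦⟧ (p ℕ.≤? N) ⊗ nonNegative⁻¹ 2ℚ ⊕ nonNegative⁻¹ 2ℚ ⊗ (f-nonneg r ⊗ (0≤v p {{ℕ.>-nonZero (lo r)}} ⊗ 0≤v p {{ℕ.>-nonZero (lo r)}}))) (bound p r))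
        (≤-trans (≡⇒≤ (Σ₁-+ X _ _)) (+-mono-≤ count-N (≤-trans (≡⇒≤ (Σ₁-*ˡ X 2ℚ _)) (*-monoˡ 2ℚ (nonNegative⁻¹ 2ℚ) (sum-f-v² X ℕₚ.≤-refl))))))
      where
      y = 2 ℕ.^ T
      count-N : Σ₁ X (λ p → ⟦ p ℕ.≤? N ⟧ * 2ℚ) ≤ 2ℚ * ι N
      count-N with N ℕ.≤? X
      ... | yes r = ≡⇒≤ (trans (Σ₁-restrict X N (λ _ → 2ℚ) r) (trans (Σ₁≡sum N _) (trans (sum-const N 2ℚ) (*-comm (ι N) 2ℚ))))
      ... | no r  = ≤-trans (Σ₁-mono X {g = λ _ → 2ℚ} λ p _ → ⟦⟧*≤ (p ℕ.≤? N) (nonNegative⁻¹ 2ℚ) λ _ → ≤-refl)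
                      (≤-trans (≡⇒≤ (trans (Σ₁≡sum X _) (trans (sum-const X 2ℚ) (*-comm (ι X) 2ℚ)))) (*-monoˡ 2ℚ (nonNegative⁻¹ 2ℚ) (ι-mono (ℕₚ.<⇒≤ (ℕₚ.≰⇒> r)))))
      bound : ∀ p → p ∈1‥ X → Prime p → f p * Σ₁ X (λ j → ⟦ p ℕ.^ j ℕ.≤? y ⟧ * (e a (p ℕ.^ j) * v (p ℕ.^ j))) ≤ ⟦ p ℕ.≤? N ⟧ * 2ℚ + 2ℚ * (f p * (v p * v p))
      bound p r pp = ≤-trans (*-monoˡ (f p) (f-nonneg r) (≤-trans (≡⇒≤ (trans (cong (λ m → Σ₁ m g) (sym (ℕₚ.suc-pred X {{ℕ.>-nonZero 1≤X}}))) (Σ₁-split 1 (ℕ.pred X) g)))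
          (+-mono-≤ first (≤-trans (Σ₁-mono (ℕ.pred X) {g = λ j → v p * v (p ℕ.^ j)} (λ j _ → ≤-trans (term≤ (p ℕ.^ suc j ℕ.≤? y) a p (suc j) pp) (≡⇒≤ (v-* p (p ℕ.^ j) {{p≢0}} {{ℕₚ.m^n≢0 p j {{p≢0}}}}))))
            (≤-trans (≡⇒≤ (Σ₁-*ˡ (ℕ.pred X) (v p) _)) (*-monoˡ (v p) (0≤v p {{p≢0}}) (geometric p (ℕ.pred X) (prime≥2 pp))))))))
          (≤-trans (≡⇒≤ (lemma (f p) ⟦ p ℕ.≤? N ⟧ (v p))) (+-monoˡ-≤ (2ℚ * (f p * (v p * v p))) (*-monoˡ ⟦ p ℕ.≤? N ⟧ (0≤⟦⟧ (p ℕ.≤? N)) (f*v≤2 p r))))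
        where
        p≢0 : ℕ.NonZero p
        p≢0 = ℕ.>-nonZero (lo r)
        g : ℕ → ℚ
        g j = ⟦ p ℕ.^ j ℕ.≤? y ⟧ * (e a (p ℕ.^ j) * v (p ℕ.^ j))
        lemma : ∀ a i x → a * (i * x + x * (2ℚ * x)) ≡ i * (a * x) + 2ℚ * (a * (x * x))
        lemma = solve-∀ ring
        first : Σ₁ 1 g ≤ ⟦ p ℕ.≤? N ⟧ * v p
        first = ≤-trans (≡⇒≤ (trans (Σ₁-suc 0 g) (trans (cong (_+ g 1) (Σ₁-0 g)) (trans (+-identityˡ (g 1)) (cong (λ z → ⟦ z ℕ.≤? y ⟧ * (e a z * v z)) (ℕₚ.*-identityʳ p))))))
          (⟦⟧*≤ (p ℕ.≤? y) (0≤⟦⟧ (p ℕ.≤? N) ⊗ 0≤v p {{p≢0}}) λ _ → *-monoʳ (v p) (0≤v p {{p≢0}}) (⟦⟧-≤ (p ℕ.% k ℕ.≟ a) (p ℕ.≤? N) λ eq → below eq))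
          where
          below : p ℕ.% k ≡ a → p ℕ.≤ N
          below eq with p ℕ.≤? N
          ... | yes s = s
          ... | no s  = ⊥-elim (none p pp (ℕₚ.<⇒≤ (ℕₚ.≰⇒> s)) (hi r) eq)

    module _ (T* : ℕ) (2^T*≤X : 2 ℕ.^ T* ℕ.≤ X) where

      6ℚ : ℚ
      6ℚ = ℤ.+ 6 / 1

      private
        module S = Tauberian.Scales φk q c T* 6ℚ (nonNegative⁻¹ 6ℚ) (λ {u} {i} _ _ → 0≤q u i) (λ u w l → 0≤e l (u ℕ.* w)) c-sum-l c-sum-w

      open S using (P; Po; qo; τ; K)

      2^≤X : ∀ {T} → T ℕ.≤ T* → 2 ℕ.^ T ℕ.≤ X
      2^≤X p = ℕₚ.≤-trans (ℕₚ.^-monoʳ-≤ 2 p) 2^T*≤X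

      private
        Po≡ : ∀ T → Po T ≡ M (2 ℕ.^ T) - Σ₁ (2 ℕ.^ T) (mass 0)
        Po≡ T = trans (Σ₁-cong φk λ u _ → sym (mass-sum u T)) (trans (Σ₁-swap φk (2 ℕ.^ T) mass) (trans (Σ₁-cong (2 ℕ.^ T) λ n _ →
          trans (Σ₁-*ʳ φk (Λ n * v n) (λ u → e u n)) (trans (cong (_* (Λ n * v n)) (e-total n)) (lemma (e 0 n) (Λ n * v n)))) (Σ₁-- (2 ℕ.^ T) _ (mass 0))))
          where
          lemma : ∀ a b → (1ℚ - a) * b ≡ b - a * b
          lemma = solve-∀ ring

      -- Mertens' bounds, less the powers of k, which belong to no unit class: the lower error is 2
      -- + 4, the upper one 6.
      total : ∀ T → T ℕ.≤ T* → ∣ Po T - ι T ∣ ≤ 6ℚ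
      total T p = subst (λ z → ∣ z - ι T ∣ ≤ 6ℚ) (sym (Po≡ T))
        (lemma (M (2 ℕ.^ T)) (Σ₁ (2 ℕ.^ T) (mass 0)) (ι T) (proj₁ (mertens T (2^≤X p))) (proj₂ (mertens T (2^≤X p))) (Σ₁-nonneg (2 ℕ.^ T) λ n r → 0≤mass 0 n (lo r)) (multiples (2 ℕ.^ T)))
        where
        lemma : ∀ m s t → t - 2ℚ ≤ m → m ≤ t + 6ℚ → 0ℚ ≤ s → s ≤ ℤ.+ 4 / 1 → ∣ m - s - t ∣ ≤ 6ℚ
        lemma m s t h₁ h₂ h₃ h₄ = abs≤ (by (Δ h₂ ⊕ h₃) (solve (m ∷ s ∷ t ∷ []) ring)) (by (Δ h₁ ⊕ Δ h₄) (solve (m ∷ s ∷ t ∷ []) ring))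

      private
        -- `R` and `N` are the true sums that `τ` and `K` replace. For 2^i ≤ a ≤ 2^(i+1) the
        -- quotient 2^T/a lies between 2^(T-i-1) and 2^(T-i), so `N` lies between `K′` and `K`,
        -- whose cutoffs differ by one scale.
        R N K′ : ℕ → ℕ → ℚ
        R l T = Σ₁ (2 ℕ.^ T) λ n → mass l n * f n
        N l T = Σ₁ (2 ℕ.^ T) λ n → (e l n * v n) * conv Λ Λ n
        K′ l T = sum T λ i → Σ₁ φk λ u → Σ₁ φk λ w → c u w l * (q u i * P w (T ℕ.∸ suc i))

        A≡ : ∀ l T → A l (2 ℕ.^ T) ≡ R l T + N l T
        A≡ l T = trans (Σ₁-cong (2 ℕ.^ T) λ n _ → lemma (e l n) (v n) (Λ n) (f n) (conv Λ Λ n)) (Σ₁-+ (2 ℕ.^ T) _ _)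
          where
          lemma : ∀ i x a b s → i * x * (a * b + s) ≡ i * (a * x) * b + i * x * s
          lemma = solve-∀ ring

        R-blocks : ∀ l T → R l T ≡ sum T (λ t → block t (λ n → mass l n * f n))
        R-blocks l T = trans (Σ₁-blocks T _) (trans (cong (_+ sum T (λ t → block t (λ n → mass l n * f n)))
          (trans (cong (λ z → e l 1 * z * f 1) (weighted-1 v)) (lemma (e l 1) (f 1)))) (+-identityˡ _))
          where
          lemma : ∀ a b → a * 0ℚ * b ≡ 0ℚ
          lemma = solve-∀ ring

        f-lower : ∀ {t n} → t ℕ.< T* → 2 ℕ.^ t ℕ.≤ n → n ∈1‥ 2 ℕ.^ suc t → ι t ≤ f n
        f-lower {t} p r s = ≤-trans (≡⇒≤ (sym (f-2^ t))) (f-≤ (ℕₚ.m^n>0 2 t) r (ℕₚ.≤-trans (hi s) (2^≤X p)))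

        f-upper : ∀ {t n} → t ℕ.< T* → n ∈1‥ 2 ℕ.^ suc t → f n ≤ 1ℚ + ι t
        f-upper {t} p s = ≤-trans (f-≤ (lo s) (hi s) (2^≤X p)) (≡⇒≤ (f-2^ (suc t)))

        τ≤R : ∀ l T → T ℕ.≤ T* → τ l T ≤ R l T
        τ≤R l T p = ≤-trans (sum-mono T λ t r → ≤-trans (≡⇒≤ (sym (Σ₁-*ˡ (2 ℕ.^ t) (ι t) _)))
            (block-mono t λ n s s′ → ≤-trans (*-monoʳ (mass l n) (0≤mass l n (lo s′)) (f-lower (ℕₚ.<-≤-trans r p) s s′)) (≡⇒≤ (*-comm (f n) (mass l n)))))
          (≡⇒≤ (sym (R-blocks l T)))

        R≤τ : ∀ l T → T ℕ.≤ T* → R l T ≤ P l T + τ l T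
        R≤τ l T p = ≤-trans (≡⇒≤ (R-blocks l T)) (≤-trans (sum-mono T λ t r → ≤-trans
            (block-mono t {h = λ n → (1ℚ + ι t) * mass l n} λ n _ s′ → ≤-trans (*-monoˡ (mass l n) (0≤mass l n (lo s′)) (f-upper (ℕₚ.<-≤-trans r p) s′)) (≡⇒≤ (*-comm (mass l n) (1ℚ + ι t))))
            (≡⇒≤ (trans (Σ₁-*ˡ (2 ℕ.^ t) (1ℚ + ι t) _) (lemma (ι t) (q l t)))))
          (≡⇒≤ (sum-+ T (q l) _)))
          where
          lemma : ∀ a b → (1ℚ + a) * b ≡ b + a * b
          lemma = solve-∀ ring

        e-product : ∀ a b {l} → l ∈1‥ φk → e l (a ℕ.* b) ≡ Σ₁ φk λ u → Σ₁ φk λ w → e u a * (e w b * c u w l)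
        e-product a b {l} l∈ = sym (cases (k ∣? a) (k ∣? b))
          where
          zero-e : ∀ {x} → k ∣ x → ∀ {u} → u ∈1‥ φk → e u x ≡ 0ℚ
          zero-e {x} d {u} u∈ = ⟦no⟧ (x ℕ.% k ℕ.≟ u) λ eq → ℕₚ.<⇒≢ (lo u∈) (trans (sym (∣⇒%≡0 d)) eq)
          cases : Dec (k ∣ a) → Dec (k ∣ b) → Σ₁ φk (λ u → Σ₁ φk λ w → e u a * (e w b * c u w l)) ≡ e l (a ℕ.* b)
          cases (yes d) _ = trans (Σ₁-zero φk λ u u∈ → Σ₁-zero φk λ w _ → trans (cong (_* (e w b * c u w l)) (zero-e d u∈)) (*-zeroˡ (e w b * c u w l)))
            (sym (zero-e (∣m⇒∣m*n b d) l∈))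
          cases _ (yes d) = trans (Σ₁-zero φk λ u _ → Σ₁-zero φk λ w w∈ → trans (cong (λ z → e u a * (z * c u w l)) (zero-e d w∈)) (lemma (e u a) (c u w l)))
            (sym (zero-e (∣n⇒∣m*n a d) l∈))
            where
            lemma : ∀ a b → a * (0ℚ * b) ≡ 0ℚ
            lemma = solve-∀ ring
          cases (no d) (no d′) = trans (Σ₁-cong φk λ u _ → Σ₁-*ˡ φk (e u a) _) (trans (Σ₁-δ φk (a ℕ.% k) _ (lo (class-of d))) (trans (in-range d _)
            (trans (Σ₁-δ φk (b ℕ.% k) _ (lo (class-of d′))) (trans (in-range d′ _) (cong (λ r → ⟦ r ℕ.≟ l ⟧) (*-cong {a ℕ.% k} {a} {b ℕ.% k} {b} (%≈ a) (%≈ b)))))))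
            where
            in-range : ∀ {x} → ¬ k ∣ x → ∀ z → ⟦ x ℕ.% k ℕ.≤? φk ⟧ * z ≡ z
            in-range {x} d z = trans (cong (_* z) (⟦yes⟧ (x ℕ.% k ℕ.≤? φk) (hi (class-of d)))) (*-identityˡ z)

        pair : ℕ → ℕ → ℕ → ℚ
        pair l a b = e l (a ℕ.* b) * (Λ b * v b)

        pair-sum : ∀ l a s → l ∈1‥ φk → Σ₁ (2 ℕ.^ s) (pair l a) ≡ Σ₁ φk λ u → Σ₁ φk λ w → e u a * (c u w l * P w s)
        pair-sum l a s l∈ = begin
          Σ₁ y (pair l a)
            ≡⟨ (Σ₁-cong y λ b _ → trans (cong (_* (Λ b * v b)) (e-product a b l∈)) (trans (sym (Σ₁-*ʳ φk (Λ b * v b) _)) (Σ₁-cong φk λ u _ →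
                  trans (sym (Σ₁-*ʳ φk (Λ b * v b) _)) (Σ₁-cong φk λ w _ → lemma (e u a) (e w b) (c u w l) (Λ b * v b))))) ⟩
          Σ₁ y (λ b → Σ₁ φk λ u → Σ₁ φk λ w → e u a * c u w l * mass w b)
            ≡⟨ trans (Σ₁-swap y φk _) (Σ₁-cong φk λ u _ → trans (Σ₁-swap y φk _) (Σ₁-cong φk λ w _ → trans (Σ₁-*ˡ y (e u a * c u w l) (mass w))
                 (trans (cong (e u a * c u w l *_) (mass-sum w s)) (*-assoc (e u a) (c u w l) (P w s))))) ⟩
          Σ₁ φk (λ u → Σ₁ φk λ w → e u a * (c u w l * P w s)) ∎
          where
          open ≡-Reasoning
          y = 2 ℕ.^ s
          lemma : ∀ a b c d → a * (b * c) * d ≡ a * c * (b * d)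
          lemma = solve-∀ ring

        N-blocks : ∀ l T → T ℕ.≤ T* → N l T ≡ sum T (λ i → block i (λ a → Λ a * v a * Σ₁ (2 ℕ.^ T ÷ a) (pair l a)))
        N-blocks l T p = trans (sum-conv′ (2 ℕ.^ T) (λ n → e l n * v n) Λ Λ (2^≤X p)) (trans (Σ₁-cong (2 ℕ.^ T) λ a r → trans (Σ₁-cong (2 ℕ.^ T ÷ a) λ b s →
            trans (cong (λ z → e l (a ℕ.* b) * z * (Λ a * Λ b)) (v-* a b {{ℕ.>-nonZero (lo r)}} {{ℕ.>-nonZero (lo s)}})) (lemma (e l (a ℕ.* b)) (v a) (v b) (Λ a) (Λ b)))
              (Σ₁-*ˡ (2 ℕ.^ T ÷ a) (Λ a * v a) _))
          (trans (Σ₁-blocks T _) (trans (cong (_+ sum T (λ i → block i (λ a → Λ a * v a * Σ₁ (2 ℕ.^ T ÷ a) (pair l a))))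
            (trans (cong (_* Σ₁ (2 ℕ.^ T ÷ 1) (pair l 1)) (weighted-1 v)) (*-zeroˡ (Σ₁ (2 ℕ.^ T ÷ 1) (pair l 1))))) (+-identityˡ _))))
          where
          lemma : ∀ i x z a b → i * (x * z) * (a * b) ≡ a * x * (i * (b * z))
          lemma = solve-∀ ring

        block-classes : ∀ l i s → l ∈1‥ φk → block i (λ a → Λ a * v a * Σ₁ (2 ℕ.^ s) (pair l a)) ≡ Σ₁ φk λ u → Σ₁ φk λ w → c u w l * (q u i * P w s)
        block-classes l i s l∈ = begin
          block i (λ a → Λ a * v a * Σ₁ (2 ℕ.^ s) (pair l a))
            ≡⟨ (Σ₁-cong (2 ℕ.^ i) λ j _ → let a = 2 ℕ.^ i ℕ.+ j in trans (cong (Λ a * v a *_) (pair-sum l a s l∈)) (trans (sym (Σ₁-*ˡ φk (Λ a * v a) _)) (Σ₁-cong φk λ u _ →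
                  trans (sym (Σ₁-*ˡ φk (Λ a * v a) _)) (Σ₁-cong φk λ w _ → lemma (Λ a * v a) (e u a) (c u w l * P w s))))) ⟩
          block i (λ a → Σ₁ φk λ u → Σ₁ φk λ w → (c u w l * P w s) * mass u a)
            ≡⟨ trans (Σ₁-swap (2 ℕ.^ i) φk _) (Σ₁-cong φk λ u _ → trans (Σ₁-swap (2 ℕ.^ i) φk _) (Σ₁-cong φk λ w _ → trans (Σ₁-*ˡ (2 ℕ.^ i) (c u w l * P w s) _)
                 (lemma₂ (c u w l) (P w s) (q u i)))) ⟩
          Σ₁ φk (λ u → Σ₁ φk λ w → c u w l * (q u i * P w s)) ∎
          where
          open ≡-Reasoning
          lemma : ∀ a b c → a * (b * c) ≡ c * (b * a)
          lemma = solve-∀ ring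
          lemma₂ : ∀ a b c → a * b * c ≡ a * (c * b)
          lemma₂ = solve-∀ ring

        0≤pair : ∀ l a b → 1 ℕ.≤ b → 0ℚ ≤ pair l a b
        0≤pair l a b p = 0≤e l (a ℕ.* b) ⊗ 0≤Λv b p

        split-2^ : ∀ {i T} → i ℕ.≤ T → 2 ℕ.^ T ≡ 2 ℕ.^ i ℕ.* 2 ℕ.^ (T ℕ.∸ i)
        split-2^ {i} {T} p = trans (cong (2 ℕ.^_) (sym (ℕₚ.m+[n∸m]≡n p))) (ℕₚ.^-distribˡ-+-* 2 i (T ℕ.∸ i))

        N≤K : ∀ l T → l ∈1‥ φk → T ℕ.≤ T* → N l T ≤ K l T
        N≤K l T l∈ p = ≤-trans (≡⇒≤ (N-blocks l T p)) (sum-mono T λ i r → ≤-trans (block-mono i λ a s s′ → *-monoˡ (Λ a * v a) (0≤Λv a (lo s′))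
            (Σ₁-≤ (2 ℕ.^ T ÷ a) (2 ℕ.^ (T ℕ.∸ i)) (pair l a) (÷-upper i a r s (lo s′)) λ b t → 0≤pair l a b (lo t))) (≡⇒≤ (block-classes l i (T ℕ.∸ i) l∈)))
          where
          ÷-upper : ∀ i a → i ℕ.< T → 2 ℕ.^ i ℕ.≤ a → 1 ℕ.≤ a → 2 ℕ.^ T ÷ a ℕ.≤ 2 ℕ.^ (T ℕ.∸ i)
          ÷-upper i a r s 1≤a = ℕₚ.*-cancelˡ-≤ (2 ℕ.^ i) {{ℕₚ.m^n≢0 2 i}} (ℕₚ.≤-trans (ℕₚ.*-monoˡ-≤ (2 ℕ.^ T ÷ a) s) (ℕₚ.≤-trans (÷-≤ (2 ℕ.^ T) a) (ℕₚ.≤-reflexive (split-2^ (ℕₚ.<⇒≤ r)))))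

        K′≤N : ∀ l T → l ∈1‥ φk → T ℕ.≤ T* → K′ l T ≤ N l T
        K′≤N l T l∈ p = ≤-trans (sum-mono T λ i r → ≤-trans (≡⇒≤ (sym (block-classes l i (T ℕ.∸ suc i) l∈))) (block-mono i λ a s s′ → *-monoˡ (Λ a * v a) (0≤Λv a (lo s′))
            (Σ₁-≤ (2 ℕ.^ (T ℕ.∸ suc i)) (2 ℕ.^ T ÷ a) (pair l a) (÷-lower i a r s′) λ b t → 0≤pair l a b (lo t)))) (≡⇒≤ (sym (N-blocks l T p)))
          where
          ÷-lower : ∀ i a → i ℕ.< T → a ∈1‥ 2 ℕ.^ suc i → 2 ℕ.^ (T ℕ.∸ suc i) ℕ.≤ 2 ℕ.^ T ÷ a
          ÷-lower i a r s = ÷-adjoint′ (2 ℕ.^ T) a (2 ℕ.^ (T ℕ.∸ suc i)) (lo s) (ℕₚ.≤-trans (ℕₚ.*-monoˡ-≤ (2 ℕ.^ (T ℕ.∸ suc i)) (hi s)) (ℕₚ.≤-reflexive (sym (split-2^ r))))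

      13ℚ : ℚ
      13ℚ = ℤ.+ 13 / 1

      private
        -- A block is a difference of two consecutive totals: 13 = 1 + 6 + 6.
        qo≤ : ∀ j → suc j ℕ.≤ T* → qo j ≤ 13ℚ
        qo≤ j p = lemma (Po j) (Po (suc j)) (qo j) (ι j) (trans (S.Po-sum total (suc j)) (cong (_+ qo j) (sym (S.Po-sum total j)))) (≤-abs (total (suc j) p)) (-≤abs (total j (ℕₚ.<⇒≤ p)))
          where
          lemma : ∀ a b x t → b ≡ a + x → b - (1ℚ + t) ≤ 6ℚ → - 6ℚ ≤ a - t → x ≤ 13ℚ
          lemma a b x t refl h₁ h₂ = by (Δ h₁ ⊕ Δ h₂) (solve (a ∷ x ∷ t ∷ []) ring)

        -- Lowering the cutoff by one scale removes one block of the second factor, at most 13 over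
        -- all classes. The gap is therefore linear in T, below the quadratic main term.
        K-gap : ∀ l T → l ∈1‥ φk → T ℕ.≤ T* → K l T - K′ l T ≤ 13ℚ * Po T
        K-gap l T l∈ p = begin
          K l T - K′ l T
            ≡⟨ trans (sym (sum-- T _ _)) (sum-cong T λ i r → trans (sym (Σ₁-- φk _ _)) (Σ₁-cong φk λ u _ → trans (sym (Σ₁-- φk _ _)) (Σ₁-cong φk λ w _ → difference i r u w))) ⟩
          sum T (λ i → Σ₁ φk λ u → Σ₁ φk λ w → c u w l * (q u i * q w (T ℕ.∸ suc i)))
            ≤⟨ (sum-mono T λ i r → Σ₁-mono φk λ u u∈ → ≤-trans (Σ₁-mono φk {g = λ w → q u i * q w (T ℕ.∸ suc i)} λ w w∈ →
                  ≤-trans (*-monoʳ (q u i * q w (T ℕ.∸ suc i)) (0≤q u i ⊗ 0≤q w (T ℕ.∸ suc i)) (⟦⟧≤1 ((u ℕ.* w) ℕ.% k ℕ.≟ l))) (≡⇒≤ (*-identityˡ (q u i * q w (T ℕ.∸ suc i)))))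
                (≤-trans (≡⇒≤ (Σ₁-*ˡ φk (q u i) _)) (*-monoˡ (q u i) (0≤q u i) (qo≤ (T ℕ.∸ suc i) (ℕₚ.≤-trans (ℕₚ.≤-reflexive (pred-∸ r)) (ℕₚ.≤-trans (ℕₚ.m∸n≤m T i) p)))))) ⟩
          sum T (λ i → Σ₁ φk λ u → q u i * 13ℚ)
            ≡⟨ trans (sum-cong T λ i _ → trans (Σ₁-*ʳ φk 13ℚ _) (*-comm (qo i) 13ℚ)) (trans (sum-*ˡ T 13ℚ qo) (cong (13ℚ *_) (sym (S.Po-sum total T)))) ⟩
          13ℚ * Po T ∎
          where
          open ≤-Reasoning
          pred-∸ : ∀ {i} → i ℕ.< T → suc (T ℕ.∸ suc i) ≡ T ℕ.∸ i
          pred-∸ {i} r = sym (ℕₚ.+-∸-assoc 1 r)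
          difference : ∀ i → i ℕ.< T → ∀ u w → c u w l * (q u i * P w (T ℕ.∸ i)) - c u w l * (q u i * P w (T ℕ.∸ suc i)) ≡ c u w l * (q u i * q w (T ℕ.∸ suc i))
          difference i r u w = trans (cong (λ z → c u w l * (q u i * P w z) - c u w l * (q u i * P w (T ℕ.∸ suc i))) (sym (pred-∸ r)))
            (lemma (c u w l) (q u i) (P w (T ℕ.∸ suc i)) (q w (T ℕ.∸ suc i)))
            where
            lemma : ∀ c a p x → c * (a * (p + x)) - c * (a * p) ≡ c * (a * x)
            lemma = solve-∀ ring

        close : ∀ l T → l ∈1‥ φk → T ℕ.≤ T* → ∣ (τ l T + K l T) - A l (2 ℕ.^ T) ∣ ≤ 13ℚ * (ι T + 6ℚ)
        close l T l∈ p = lemma (τ l T) (K l T) (A l (2 ℕ.^ T)) (R l T) (N l T) (K′ l T) (P l T) (Po T) (ι T) (A≡ l T) (τ≤R l T p) (R≤τ l T p) (N≤K l T l∈ p) (K′≤N l T l∈ p) (K-gap l T l∈ p)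
            (S.P≤Po total l∈ p) (S.0≤P total l∈ p) (S.Po-upper total T p)
          where
          lemma : ∀ t k a r n k′ x y z → a ≡ r + n → t ≤ r → r ≤ x + t → n ≤ k → k′ ≤ n → k - k′ ≤ 13ℚ * y → x ≤ y → 0ℚ ≤ x → y ≤ z + 6ℚ → ∣ t + k - a ∣ ≤ 13ℚ * (z + 6ℚ)
          lemma t k a r n k′ x y z refl h₁ h₂ h₃ h₄ h₅ h₆ h₇ h₈ = abs≤
            (by (Δ h₁ ⊕ Δ h₄ ⊕ Δ h₅ ⊕ nonNegative⁻¹ 13ℚ ⊗ Δ h₈) (solve (t ∷ k ∷ r ∷ n ∷ k′ ∷ y ∷ z ∷ []) ring))
            (by (Δ h₂ ⊕ Δ h₃ ⊕ Δ h₆ ⊕ nonNegative⁻¹ (ℤ.+ 12 / 1) ⊗ (h₇ ⊕ Δ h₆) ⊕ nonNegative⁻¹ 13ℚ ⊗ Δ h₈) (solve (t ∷ k ∷ r ∷ n ∷ x ∷ y ∷ z ∷ []) ring))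

      -- The first constant is that of `A-compare`. Passing between τ + K and A costs 13(T + 6) for
      -- each of the two classes, hence 156 = 2·13·6.
      compare : ∀ {l l′} T → l ∈1‥ φk → l′ ∈1‥ φk → T ℕ.≤ T* →
        ∣ (τ l T + K l T) - (τ l′ T + K l′ T) ∣ ≤ ((ι k + ι k) * 24ℚ + (ℤ.+ 156 / 1)) * (ι T + 1ℚ)
      compare {l} {l′} T l∈ l′∈ p = ≤-trans (≡⇒≤ (cong ∣_∣ (lemma (τ l T + K l T) (τ l′ T + K l′ T) (A l (2 ℕ.^ T)) (A l′ (2 ℕ.^ T)))))
        (≤-trans (abs+ (abs+ (close l T l∈ p) (subst (_≤ 13ℚ * (ι T + 6ℚ)) (sym (∣-p∣≡∣p∣ _)) (close l′ T l′∈ p))) (A-compare T l∈ l′∈ (2^≤X p)))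
          (lemma₂ (ι T) ((ι k + ι k) * 24ℚ) (0≤ι T)))
        where
        lemma : ∀ x y a b → x - y ≡ (x - a) + (- (y - b)) + (a - b)
        lemma = solve-∀ ring
        lemma₂ : ∀ t c → 0ℚ ≤ t → 13ℚ * (t + 6ℚ) + 13ℚ * (t + 6ℚ) + c * (t + 1ℚ) ≤ (c + (ℤ.+ 156 / 1)) * (t + 1ℚ)
        lemma₂ t c h = by (nonNegative⁻¹ (ℤ.+ 130 / 1) ⊗ h) (solve (t ∷ c ∷ []) ring)

-- Construction of a rational additive logarithm

module Logarithm where

  open import Data.Nat as ℕ using (ℕ; zero; suc)
  import Data.Nat.Properties as ℕₚ
  open import Data.Nat.Solver using (module +-*-Solver)
  open import Data.Nat.Primality using (Prime; prime[2])
  open import Data.Nat.Primality.Factorisation using (factorise; factorisationUnique; PrimeFactorisation; primeFactorisation[p])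
  open import Data.Nat.ListAction using (product)
  open import Data.Nat.ListAction.Properties using (product-++)
  import Data.Integer as ℤ
  open import Data.Rational hiding (_÷_)
  open import Data.Rational.Properties
  open import Data.Product using (_,_; _×_; proj₁; proj₂)
  open import Data.Empty using (⊥-elim)
  open import Data.List using (List; []; _∷_; _++_; length)
  open import Data.List.Relation.Unary.All as All using (All)
  open import Data.List.Relation.Unary.All.Properties using (++⁺)
  open import Data.List.Relation.Binary.Permutation.Propositional as Perm using (_↭_)
  open import Relation.Nullary using (yes; no)
  open import Relation.Binary.PropositionalEquality
  open import Tactic.RingSolver using (solve; solve-∀)
  open Rationals
  open Sums
  open Convolution
  open Mangoldt

  open PrimeFactorisation

  sum-grid : ∀ N m (g : ℕ → ℚ) → sum (N ℕ.* m) g ≡ sum N (λ i → sum m (λ s → g (i ℕ.* m ℕ.+ s)))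
  sum-grid zero    m g = refl
  sum-grid (suc N) m g = trans (cong (λ z → sum z g) (ℕₚ.+-comm m (N ℕ.* m))) (trans (sum-split (N ℕ.* m) m g) (cong (_+ sum m (λ s → g (N ℕ.* m ℕ.+ s))) (sum-grid N m g)))

  v-scale : ∀ m n → .{{ℕ.NonZero m}} → .{{ℕ.NonZero n}} → ι m * v (m ℕ.* n) ≡ v n
  v-scale m n = trans (cong (ι m *_) (v-* m n)) (trans (sym (*-assoc (ι m) (v m) (v n))) (trans (cong (_* v n) (ι*v m)) (*-identityˡ (v n))))

  reciprocals-upper : ∀ m n → .{{ℕ.NonZero m}} → .{{ℕ.NonZero n}} → sum m (λ s → v (m ℕ.* n ℕ.+ s)) ≤ v n
  reciprocals-upper m n = ≤-trans (sum-mono m {g = λ _ → v (m ℕ.* n)} λ s _ → v-anti {{ℕₚ.m*n≢0 m n}} (ℕₚ.m≤m+n (m ℕ.* n) s)) (≡⇒≤ (trans (sum-const m _) (v-scale m n)))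

  reciprocals-lower : ∀ m n → .{{ℕ.NonZero m}} → .{{ℕ.NonZero n}} → v (suc n) ≤ sum m (λ s → v (m ℕ.* n ℕ.+ s))
  reciprocals-lower m n = ≤-trans (≡⇒≤ (sym (trans (sum-const m _) (v-scale m (suc n))))) (sum-mono m {λ _ → v (m ℕ.* suc n)} λ s p →
    v-anti {{ℕ.>-nonZero (ℕₚ.≤-trans (ℕ.>-nonZero⁻¹ (m ℕ.* n) {{ℕₚ.m*n≢0 m n}}) (ℕₚ.m≤m+n (m ℕ.* n) s))}}
      (ℕₚ.≤-trans (ℕₚ.+-monoʳ-≤ (m ℕ.* n) (ℕₚ.<⇒≤ p)) (ℕₚ.≤-reflexive (trans (ℕₚ.+-comm (m ℕ.* n) m) (sym (ℕₚ.*-suc m n))))))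

  -- h n = Σ_{K ≤ j < nK} 1/j is log n up to 1/K, hence additive up to 1/K.
  module Approximation (K : ℕ) {{K≢0 : ℕ.NonZero K}} where

    h : ℕ → ℚ
    h n = sum (ℕ.pred n ℕ.* K) λ i → v (K ℕ.+ i)

    h-suc : ∀ n → .{{ℕ.NonZero n}} → h (suc n) ≡ h n + sum K (λ s → v (K ℕ.* n ℕ.+ s))
    h-suc (suc n) = trans (cong (λ z → sum z (λ i → v (K ℕ.+ i))) (ℕₚ.+-comm K (n ℕ.* K))) (trans (sum-split (n ℕ.* K) K _)
      (cong (h (suc n) +_) (sum-cong K λ s _ → cong v (trans (sym (ℕₚ.+-assoc K (n ℕ.* K) s)) (cong (ℕ._+ s) (ℕₚ.*-comm (suc n) K))))))

    h-upper : ∀ n → .{{ℕ.NonZero n}} → h (suc n) ≤ h n + v n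
    h-upper n = ≤-trans (≡⇒≤ (h-suc n)) (+-monoʳ-≤ (h n) (reciprocals-upper K n))

    h-lower : ∀ n → .{{ℕ.NonZero n}} → h n + v (suc n) ≤ h (suc n)
    h-lower n = ≤-trans (+-monoʳ-≤ (h n) (reciprocals-lower K n)) (≡⇒≤ (sym (h-suc n)))

    private
      -- The part of h(mn) from mK on, cut into runs of m consecutive terms. The run with index i
      -- lies between 1/(K+i+1) and 1/(K+i), so the whole imitates h(n) up to 1/K.
      shifted : ℕ → ℕ → ℚ
      shifted m n = sum (ℕ.pred n ℕ.* K) λ i → sum m λ s → v (m ℕ.* (K ℕ.+ i) ℕ.+ s)

      h-* : ∀ m n → .{{ℕ.NonZero m}} → .{{ℕ.NonZero n}} → h (m ℕ.* n) ≡ h m + shifted m n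
      h-* (suc m) (suc n) = trans (cong (λ z → sum z (λ i → v (K ℕ.+ i))) length-eq) (trans (sum-split (m ℕ.* K) (n ℕ.* K ℕ.* suc m) _)
        (cong (h (suc m) +_) (trans (sum-grid (n ℕ.* K) (suc m) _) (sum-cong (n ℕ.* K) λ i _ → sum-cong (suc m) λ s _ → cong v (index-eq i s)))))
        where
        open +-*-Solver renaming (solve to solveℕ)
        length-eq : (n ℕ.+ m ℕ.* suc n) ℕ.* K ≡ m ℕ.* K ℕ.+ n ℕ.* K ℕ.* suc m
        length-eq = solveℕ 3 (λ m n k → (n :+ m :* (con 1 :+ n)) :* k := m :* k :+ n :* k :* (con 1 :+ m)) refl m n K
        index-eq : ∀ i s → K ℕ.+ (m ℕ.* K ℕ.+ (i ℕ.* suc m ℕ.+ s)) ≡ suc m ℕ.* (K ℕ.+ i) ℕ.+ s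
        index-eq i s = solveℕ 4 (λ m k i s → k :+ (m :* k :+ (i :* (con 1 :+ m) :+ s)) := (con 1 :+ m) :* (k :+ i) :+ s) refl m K i s

      instance
        K+≢0 : ∀ {i} → ℕ.NonZero (K ℕ.+ i)
        K+≢0 {i} = ℕ.>-nonZero (ℕₚ.≤-trans (ℕ.>-nonZero⁻¹ K) (ℕₚ.m≤m+n K i))

      telescope : ∀ N → sum N (λ i → v (K ℕ.+ suc i)) ≡ sum N (λ i → v (K ℕ.+ i)) - v K + v (K ℕ.+ N)
      telescope zero    = sym (trans (cong (λ z → 0ℚ - v K + v z) (ℕₚ.+-identityʳ K)) (lemma (v K)))
        where
        lemma : ∀ a → 0ℚ - a + a ≡ 0ℚ
        lemma = solve-∀ ring
      telescope (suc N) = trans (cong (_+ v (K ℕ.+ suc N)) (telescope N)) (lemma (sum N (λ i → v (K ℕ.+ i))) (v K) (v (K ℕ.+ N)) (v (K ℕ.+ suc N)))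
        where
        lemma : ∀ s k a b → s - k + a + b ≡ s + a - k + b
        lemma = solve-∀ ring

    h-sub : ∀ m n → .{{ℕ.NonZero m}} → .{{ℕ.NonZero n}} → h (m ℕ.* n) ≤ h m + h n
    h-sub m n = ≤-trans (≡⇒≤ (h-* m n)) (+-monoʳ-≤ (h m) (sum-mono (ℕ.pred n ℕ.* K) λ i _ → reciprocals-upper m (K ℕ.+ i)))

    h-super : ∀ m n → .{{ℕ.NonZero m}} → .{{ℕ.NonZero n}} → h m + h n - v K ≤ h (m ℕ.* n)
    h-super m n = ≤-trans (lemma (h m) (h n) (v K) (v (K ℕ.+ N)) (sum N (λ i → v (K ℕ.+ suc i))) (telescope N) (0≤v (K ℕ.+ N)))
      (≤-trans (+-monoʳ-≤ (h m) (sum-mono N λ i _ → ≤-trans (≡⇒≤ (cong v (ℕₚ.+-suc K i))) (reciprocals-lower m (K ℕ.+ i)))) (≡⇒≤ (sym (h-* m n))))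
      where
      N = ℕ.pred n ℕ.* K
      lemma : ∀ a b k x s → s ≡ b - k + x → 0ℚ ≤ x → a + b - k ≤ a + s
      lemma a b k x s refl h = by h (solve (a ∷ b ∷ k ∷ x ∷ []) ring)

    S : List ℕ → ℚ
    S []       = 0ℚ
    S (q ∷ qs) = h q + S qs

    S-++ : ∀ ps qs → S (ps ++ qs) ≡ S ps + S qs
    S-++ []       qs = sym (+-identityˡ (S qs))
    S-++ (p ∷ ps) qs = trans (cong (h p +_) (S-++ ps qs)) (sym (+-assoc (h p) (S ps) (S qs)))

    S-↭ : ∀ {ps qs} → ps ↭ qs → S ps ≡ S qs
    S-↭ Perm.refl          = refl
    S-↭ (Perm.prep x r)    = cong (h x +_) (S-↭ r)
    S-↭ {ps = _ ∷ _ ∷ ps} {_ ∷ _ ∷ qs} (Perm.swap x y r) = trans (cong (λ z → h x + (h y + z)) (S-↭ r)) (lemma (h x) (h y) (S qs))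
      where
      lemma : ∀ a b c → a + (b + c) ≡ b + (a + c)
      lemma = solve-∀ ring
    S-↭ (Perm.trans r s)   = trans (S-↭ r) (S-↭ s)

    product≥1 : ∀ {qs} → All Prime qs → 1 ℕ.≤ product qs
    product≥1 All.[]         = ℕₚ.≤-refl
    product≥1 (p All.∷ ps) = 1≤* (prime≥1 p) (product≥1 ps)

    length≤product : ∀ {qs} → All Prime qs → length qs ℕ.≤ product qs
    length≤product All.[] = ℕ.z≤n
    length≤product {q ∷ qs} (p All.∷ ps) = ℕₚ.≤-trans (ℕₚ.+-mono-≤ (product≥1 ps) (length≤product ps))
      (ℕₚ.≤-trans (ℕₚ.≤-reflexive (cong (product qs ℕ.+_) (sym (ℕₚ.+-identityʳ (product qs))))) (ℕₚ.*-monoˡ-≤ (product qs) (prime≥2 p)))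

    -- Each multiplication by a prime changes the discrepancy by at most 1/K, the defect in
    -- additivity of `h`.
    S-near : ∀ {qs} → All Prime qs → ∣ S qs - h (product qs) ∣ ≤ ι (length qs) * v K
    S-near All.[] = ≡⇒≤ (sym (*-zeroˡ (v K)))
    S-near {q ∷ qs} (p All.∷ ps) = ≤-trans (≡⇒≤ (cong ∣_∣ (lemma (h q) (S qs) (h (product qs)) (h (q ℕ.* product qs)))))
      (≤-trans (abs+ (S-near ps) (abs≤ (lemma₂ (h q) (h (product qs)) (h (q ℕ.* product qs)) (v K) (h-super q (product qs) {{q≢0}} {{P≢0}}))
        (lemma₃ (h q) (h (product qs)) (h (q ℕ.* product qs)) (v K) (h-sub q (product qs) {{q≢0}} {{P≢0}}) (0≤v K)))) (≡⇒≤ (lemma₄ (ι (length qs)) (v K))))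
      where
      q≢0 : ℕ.NonZero q
      q≢0 = ℕ.>-nonZero (prime≥1 p)
      P≢0 : ℕ.NonZero (product qs)
      P≢0 = ℕ.>-nonZero (product≥1 ps)
      lemma : ∀ a s b c → a + s - c ≡ s - b + (a + b - c)
      lemma = solve-∀ ring
      lemma₂ : ∀ a b c k → a + b - k ≤ c → a + b - c ≤ k
      lemma₂ a b c k h = by (Δ h) (solve (a ∷ b ∷ c ∷ k ∷ []) ring)
      lemma₃ : ∀ a b c k → c ≤ a + b → 0ℚ ≤ k → - k ≤ a + b - c
      lemma₃ a b c k h h′ = by (Δ h ⊕ h′) (solve (a ∷ b ∷ c ∷ k ∷ []) ring)
      lemma₄ : ∀ a k → a * k + k ≡ (1ℚ + a) * k
      lemma₄ = solve-∀ ring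

    -- `h` made exactly completely additive: only its values at primes are kept and extended along
    -- the factorisation. Unique factorisation gives `g-*`.
    g : ℕ → ℚ
    g zero      = 0ℚ
    g n@(suc _) = S (factors (factorise n))

    g-* : ∀ m n → .{{ℕ.NonZero m}} → .{{ℕ.NonZero n}} → g (m ℕ.* n) ≡ g m + g n
    g-* m@(suc _) n@(suc _) = trans (S-↭ (factorisationUnique (factorise (m ℕ.* n)) both)) (S-++ (factors (factorise m)) (factors (factorise n)))
      where
      both : PrimeFactorisation (m ℕ.* n)
      both = record
        { factors         = factors (factorise m) ++ factors (factorise n)
        ; isFactorisation = trans (cong₂ ℕ._*_ (isFactorisation (factorise m)) (isFactorisation (factorise n))) (sym (product-++ (factors (factorise m)) (factors (factorise n))))
        ; factorsPrime    = ++⁺ (factorsPrime (factorise m)) (factorsPrime (factorise n))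
        }

    g-2 : g 2 ≡ h 2
    g-2 = trans (S-↭ (factorisationUnique (factorise 2) (primeFactorisation[p] prime[2]))) (+-identityʳ (h 2))

    g-near : ∀ n → .{{ℕ.NonZero n}} → ∣ g n - h n ∣ ≤ ι n * v K
    g-near n@(suc _) = ≤-trans (≡⇒≤ (cong (λ z → ∣ g n - h z ∣) (isFactorisation F))) (≤-trans (S-near (factorsPrime F))
      (*-monoʳ (v K) (0≤v K) (ι-mono (ℕₚ.≤-trans (length≤product (factorsPrime F)) (ℕₚ.≤-reflexive (sym (isFactorisation F)))))))
      where
      F = factorise n

    12ℚ 13ℚ 24ℚ : ℚ
    12ℚ = ℤ.+ 12 / 1
    13ℚ = ℤ.+ 13 / 1
    24ℚ = ℤ.+ 24 / 1

    -- By subadditivity 2·h(2) ≥ h(4) ≥ 1/2 + 1/3 + 1/4 = 13/12. With 12(g(n+1) - g(n)) ≤ 13/n this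
    -- makes the normalised increments at most 2/n: the constant 2 in `Log` is (13/12)/(13/24).
    h2-lower : 13ℚ ≤ 24ℚ * h 2
    h2-lower = lemma (h 2) (h 3) (h 4) (v 2) (v 3) (v 4) (≤-trans (≡⇒≤ (sym (+-identityˡ (v 2)))) (h-lower 1)) (h-lower 2) (h-lower 3) (h-sub 2 2) (ι*v 2) (ι*v 3) (ι*v 4)
      where
      lemma : ∀ a b c x y z → x ≤ a → a + y ≤ b → b + z ≤ c → c ≤ a + a → ι 2 * x ≡ 1ℚ → ι 3 * y ≡ 1ℚ → ι 4 * z ≡ 1ℚ → 13ℚ ≤ 24ℚ * a
      lemma a b c x y z h₁ h₂ h₃ h₄ h₅ h₆ h₇ = by (nonNegative⁻¹ 12ℚ ⊗ (Δ h₁ ⊕ Δ h₂ ⊕ Δ h₃ ⊕ Δ h₄) ⊕ nonNegative⁻¹ (ℤ.+ 6 / 1) ⊗ Δ (≡⇒≤ (sym h₅)) ⊕ nonNegative⁻¹ (ℤ.+ 4 / 1) ⊗ Δ (≡⇒≤ (sym h₆)) ⊕ nonNegative⁻¹ (ℤ.+ 3 / 1) ⊗ Δ (≡⇒≤ (sym h₇)))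
        (solve (a ∷ b ∷ c ∷ x ∷ y ∷ z ∷ []) ring)

    g2-pos : 0ℚ < g 2
    g2-pos with 0ℚ <? g 2
    ... | yes p = p
    ... | no p  = ⊥-elim (<-irrefl refl (<-≤-trans (positive⁻¹ 13ℚ) (≤-trans h2-lower (≤-trans (*-monoˡ 24ℚ (nonNegative⁻¹ 24ℚ) (subst (_≤ 0ℚ) g-2 (≮⇒≥ p))) (≡⇒≤ (*-zeroʳ 24ℚ))))))

    -- The error terms of g at n and n + 1 are absorbed as soon as K is of the order of n².
    g-increment : ∀ n → .{{ℕ.NonZero n}} → 12 ℕ.* (suc (n ℕ.+ n) ℕ.* suc n) ℕ.≤ K →
      g n ≤ g (suc n) × (12ℚ * (g (suc n) - g n) ≤ 13ℚ * v n)
    g-increment n p = lemma₁ (g n) (g (suc n)) (h n) (h (suc n)) (ι n) (v K) (v (suc n)) (h-lower n) (-≤abs (g-near (suc n))) (≤-abs (g-near n)) err₁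
      , lemma₂ (g n) (g (suc n)) (h n) (h (suc n)) (ι n) (v K) (v n) (h-upper n) (≤-abs (g-near (suc n))) (-≤abs (g-near n)) err₂
      where
      N = suc (n ℕ.+ n)
      lemma₁ : ∀ a b c d n k z → c + z ≤ d → - ((1ℚ + n) * k) ≤ b - d → a - c ≤ n * k → (1ℚ + (n + n)) * k ≤ z → a ≤ b
      lemma₁ a b c d n k z h₁ h₂ h₃ h₄ = by (Δ h₁ ⊕ Δ h₂ ⊕ Δ h₃ ⊕ Δ h₄) (solve (a ∷ b ∷ c ∷ d ∷ n ∷ k ∷ z ∷ []) ring)
      lemma₂ : ∀ a b c d n k x → d ≤ c + x → b - d ≤ (1ℚ + n) * k → - (n * k) ≤ a - c → 12ℚ * ((1ℚ + (n + n)) * k) ≤ x → 12ℚ * (b - a) ≤ 13ℚ * x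
      lemma₂ a b c d n k x h₁ h₂ h₃ h₄ = by (nonNegative⁻¹ 12ℚ ⊗ (Δ h₁ ⊕ Δ h₂ ⊕ Δ h₃) ⊕ Δ h₄) (solve (a ∷ b ∷ c ∷ d ∷ n ∷ k ∷ x ∷ []) ring)
      err : 12 ℕ.* (N ℕ.* suc n) ℕ.≤ K → 12ℚ * ((1ℚ + (ι n + ι n)) * v K) ≤ v (suc n)
      err p = ≤-trans (≤v (suc n) {12ℚ * ((1ℚ + (ι n + ι n)) * v K)} {1ℚ} (≤-trans (≡⇒≤ rearrange) (≤-trans (*-monoʳ (v K) (0≤v K) (ι-mono p)) (≡⇒≤ (ι*v K))))) (≡⇒≤ (*-identityˡ (v (suc n))))
        where
        lemma₃ : ∀ n k → (1ℚ + n) * (12ℚ * ((1ℚ + (n + n)) * k)) ≡ 12ℚ * ((1ℚ + (n + n)) * (1ℚ + n)) * k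
        lemma₃ = solve-∀ ring
        rearrange : ι (suc n) * (12ℚ * ((1ℚ + (ι n + ι n)) * v K)) ≡ ι (12 ℕ.* (N ℕ.* suc n)) * v K
        rearrange = trans (lemma₃ (ι n) (v K)) (cong (_* v K) (sym (trans (ι-* 12 (N ℕ.* suc n)) (cong (12ℚ *_) (trans (ι-* N (suc n)) (cong (λ z → (1ℚ + z) * ι (suc n)) (ι-+ n n)))))))
      err₂ : 12ℚ * ((1ℚ + (ι n + ι n)) * v K) ≤ v n
      err₂ = ≤-trans (err p) (v-anti (ℕₚ.n≤1+n n))
      err₁ : (1ℚ + (ι n + ι n)) * v K ≤ v (suc n)
      err₁ = ≤-trans (lemma₄ ((1ℚ + (ι n + ι n)) * v K) ((0≤1 ⊕ (0≤ι n ⊕ 0≤ι n)) ⊗ 0≤v K)) (err p)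
        where
        lemma₄ : ∀ a → 0ℚ ≤ a → a ≤ 12ℚ * a
        lemma₄ a h = by (nonNegative⁻¹ (ℤ.+ 11 / 1) ⊗ h) (solve (a ∷ []) ring)

  log : ∀ X → Log X
  log X = record
    { f      = λ n → g n * rc (g 2)
    ; f-*    = λ {m} {n} p q → trans (cong (_* rc (g 2)) (g-* m n {{ℕ.>-nonZero p}} {{ℕ.>-nonZero q}})) (*-distribʳ-+ (rc (g 2)) (g m) (g n))
    ; f-2    = rc-inv g2-pos
    ; f-mono = λ n p q → *-monoʳ (rc (g 2)) 0≤rc (proj₁ (g-increment n {{ℕ.>-nonZero p}} (large n q)))
    ; f-step = λ n p q → lemma (g n) (g (suc n)) (g 2) (rc (g 2)) (v n) (proj₂ (g-increment n {{ℕ.>-nonZero p}} (large n q)))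
                 (subst (λ z → 13ℚ ≤ 24ℚ * z) (sym g-2) h2-lower) (rc-inv g2-pos) 0≤rc (0≤v n {{ℕ.>-nonZero p}})
    }
    where
    -- `K` exceeds what `g-increment` requires at every n < X, and `suc` makes it visibly nonzero.
    open Approximation (suc (12 ℕ.* (suc (X ℕ.+ X) ℕ.* suc X)))
    0≤rc : 0ℚ ≤ rc (g 2)
    0≤rc = <⇒≤ (rc-pos g2-pos)
    large : ∀ n → n ℕ.< X → 12 ℕ.* (suc (n ℕ.+ n) ℕ.* suc n) ℕ.≤ suc (12 ℕ.* (suc (X ℕ.+ X) ℕ.* suc X))
    large n p = ℕₚ.m≤n⇒m≤1+n (ℕₚ.*-monoʳ-≤ 12 (ℕₚ.*-mono-≤ (ℕ.s≤s (ℕₚ.+-mono-≤ (ℕₚ.<⇒≤ p) (ℕₚ.<⇒≤ p))) (ℕ.s≤s (ℕₚ.<⇒≤ p))))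
    lemma : ∀ a b c r x → 12ℚ * (b - a) ≤ 13ℚ * x → 13ℚ ≤ 24ℚ * c → c * r ≡ 1ℚ → 0ℚ ≤ r → 0ℚ ≤ x → b * r - a * r ≤ 2ℚ * x
    lemma a b c r x h₁ h₂ h₃ h₄ h₅ = *-cancel 12ℚ (positive⁻¹ 12ℚ) (by (h₄ ⊗ Δ h₁ ⊕ h₄ ⊗ h₅ ⊗ Δ h₂ ⊕ nonNegative⁻¹ 24ℚ ⊗ (h₅ ⊗ Δ (≡⇒≤ h₃))) (solve (a ∷ b ∷ c ∷ r ∷ x ∷ []) ring))

-- The Legendre symbol by counting square roots

module Legendre where

  open import Data.Nat as ℕ using (ℕ; zero; suc)
  import Data.Nat.Properties as ℕₚ
  open import Data.Nat.DivMod using ([m+kn]%n≡m%n; m%n<n; m≡m%n+[m/n]*n)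
  open import Data.Nat.Divisibility using (_∣_; _∣?_; divides; ∣⇒≤; n∣m*n; ∣m⇒∣m*n; ∣n⇒∣m*n; ∣m+n∣m⇒∣n)
  open import Data.Nat.Primality using (Prime; prime[2]; euclidsLemma)
  open import Data.Nat.Solver using (module +-*-Solver)
  open import Data.Rational using (ℚ; 0ℚ; 1ℚ; _+_; _-_; _*_; -_; _≤_)
  import Data.Rational as ℚ
  open import Data.Rational.Properties
  open import Data.Product using (_,_; _×_; ∃)
  open import Data.Sum using (inj₁; inj₂; _⊎_)
  open import Data.Empty using (⊥; ⊥-elim)
  open import Data.List using ([]; _∷_)
  open import Relation.Nullary using (¬_; yes; no; Dec)
  open import Relation.Binary.PropositionalEquality
  open import Tactic.RingSolver using (solve; solve-∀)
  open Rationals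
  open Sums
  open Convolution
  open Residue
  open Selberg

  search : ∀ {P : ℕ → Set} → (∀ x → Dec (P x)) → ∀ n → (∃ λ x → x ∈1‥ n × P x) ⊎ (∀ x → x ∈1‥ n → ¬ P x)
  search P? zero = inj₂ λ x r _ → ℕₚ.<-irrefl refl (ℕₚ.≤-trans (lo r) (hi r))
  search P? (suc n) with P? (suc n)
  ... | yes p = inj₁ (suc n , (ℕ.s≤s ℕ.z≤n ﹐ ℕₚ.≤-refl) , p)
  ... | no p with search P? n
  ...   | inj₁ (x , r , px) = inj₁ (x , (lo r ﹐ ℕₚ.m≤n⇒m≤1+n (hi r)) , px)
  ...   | inj₂ h = inj₂ λ x r → case x r
    where
    case : ∀ x → x ∈1‥ suc n → ¬ _
    case x r px with x ℕ.≟ suc n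
    ... | yes refl = p px
    ... | no ne    = h x (lo r ﹐ ℕₚ.≤-pred (ℕₚ.≤∧≢⇒< (hi r) ne)) px

  sum-vanishing : ∀ n g → (∀ i → i ℕ.< n → g i ≤ 0ℚ) → 0ℚ ≤ sum n g → ∀ i → i ℕ.< n → 0ℚ ≤ g i
  sum-vanishing (suc n) g h s i p with i ℕ.≟ n
  ... | yes refl = lemma (sum n g) (g n) s (≤-trans (sum-mono n λ j q → h j (ℕₚ.m<n⇒m<1+n q)) (≡⇒≤ (sum-0 n)))
    where
    lemma : ∀ a b → 0ℚ ≤ a + b → a ≤ 0ℚ → 0ℚ ≤ b
    lemma a b h₁ h₂ = by (Δ h₁ ⊕ Δ h₂) (solve (a ∷ b ∷ []) ring)
  ... | no ne = sum-vanishing n g (λ j q → h j (ℕₚ.m<n⇒m<1+n q)) (lemma (sum n g) (g n) s (h n (ℕₚ.n<1+n n))) i (ℕₚ.≤∧≢⇒< (ℕₚ.≤-pred p) ne)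
    where
    lemma : ∀ a b → 0ℚ ≤ a + b → b ≤ 0ℚ → 0ℚ ≤ a
    lemma a b h₁ h₂ = by (Δ h₁ ⊕ Δ h₂) (solve (a ∷ b ∷ []) ring)

  module LegendreSymbol (k : ℕ) (pk : Prime k) (k≢2 : k ≢ 2) where
    open Mod k pk
    open Residues k pk

    roots : ℕ → ℚ
    roots a = Σ₁ φk λ x → ⟦ (x ℕ.* x) ℕ.% k ℕ.≟ a ℕ.% k ⟧

    -- The Legendre symbol: 1 + χ(a) is the number of solutions of x² ≡ a. The indicator accounts
    -- for the root 0, which the range of `roots` omits.
    χ : ℕ → ℚ
    χ a = roots a + ⟦ k ∣? a ⟧ - 1ℚ

    Square NonSquare : ℕ → Set
    Square a    = ∃ λ x → x ∈1‥ φk × x ℕ.* x ≈ a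
    NonSquare a = ∀ x → x ∈1‥ φk → ¬ x ℕ.* x ≈ a

    square? : ∀ a → Square a ⊎ NonSquare a
    square? a = search (λ x → (x ℕ.* x) ℕ.% k ℕ.≟ a ℕ.% k) φk

    ≈-∣ : ∀ {a b} → a ≈ b → k ∣ a → k ∣ b
    ≈-∣ p d = %≡0⇒∣ (trans (sym p) (∣⇒%≡0 d))

    χ-cong : ∀ {a b} → a ≈ b → χ a ≡ χ b
    χ-cong {a} {b} p = cong₂ (λ r i → r + i - 1ℚ) (Σ₁-cong φk λ x _ → cong (λ z → ⟦ (x ℕ.* x) ℕ.% k ℕ.≟ z ⟧) p) (⟦⟧-cong (k ∣? a) (k ∣? b) (≈-∣ p) (≈-∣ (sym p)))

    χ-zero : ∀ {a} → k ∣ a → χ a ≡ 0ℚ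
    χ-zero {a} d = cong₂ (λ r i → r + i - 1ℚ) (Σ₁-zero φk λ x r → ⟦no⟧ ((x ℕ.* x) ℕ.% k ℕ.≟ a ℕ.% k) λ eq → ∤-* (class-unit r) (class-unit r) (≈-∣ (sym eq) d)) (⟦yes⟧ (k ∣? a) d)

    χ-nonsquare : ∀ {a} → ¬ k ∣ a → NonSquare a → χ a ≡ - 1ℚ
    χ-nonsquare {a} d ns = cong₂ (λ r i → r + i - 1ℚ) (Σ₁-zero φk λ x r → ⟦no⟧ ((x ℕ.* x) ℕ.% k ℕ.≟ a ℕ.% k) (ns x r)) (⟦no⟧ (k ∣? a) d)

    private
      opposite : ∀ {x} → x ∈1‥ φk → k ℕ.∸ x ∈1‥ φk
      opposite {x} r = ℕₚ.m<n⇒0<n∸m (class< r) ﹐ ℕₚ.≤-pred (ℕₚ.≤-trans (ℕₚ.≤-trans (ℕ.s≤s (ℕₚ.∸-monoʳ-≤ k (lo r))) (ℕₚ.≤-reflexive (ℕₚ.suc-pred k))) (ℕₚ.≤-reflexive (sym sucφk)))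

      x+opp : ∀ {x} → x ∈1‥ φk → x ℕ.+ (k ℕ.∸ x) ≡ k
      x+opp r = ℕₚ.m+[n∸m]≡n (ℕₚ.<⇒≤ (class< r))

      sum-k⇒square : ∀ {x y} → x ℕ.+ y ≡ k → y ℕ.* y ≈ x ℕ.* x
      sum-k⇒square {x} {y} eq = trans (sym ([m+kn]%n≡m%n (y ℕ.* y) x k)) (trans (cong (ℕ._% k) (trans (cong (λ z → y ℕ.* y ℕ.+ x ℕ.* z) (sym eq)) (trans (identity x y) (cong (λ z → x ℕ.* x ℕ.+ y ℕ.* z) eq)))) ([m+kn]%n≡m%n (x ℕ.* x) y k))
        where
        open +-*-Solver renaming (solve to solveℕ)
        identity : ∀ x y → y ℕ.* y ℕ.+ x ℕ.* (x ℕ.+ y) ≡ x ℕ.* x ℕ.+ y ℕ.* (x ℕ.+ y)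
        identity = solveℕ 2 (λ x y → y :* y :+ x :* (x :+ y) := x :* x :+ y :* (x :+ y)) refl

      opp≢ : ∀ {x} → x ∈1‥ φk → x ≢ k ℕ.∸ x
      opp≢ {x} r eq = k≢2 (sym (∣-prime⇒≡ prime[2] pk (divides x (trans (sym (x+opp r)) (trans (cong (x ℕ.+_) (sym eq)) (trans (cong (x ℕ.+_) (sym (ℕₚ.+-identityʳ x))) (ℕₚ.*-comm 2 x)))))))

      square-roots : ∀ {x y} → x ∈1‥ φk → y ∈1‥ φk → x ℕ.≤ y → x ℕ.* x ≈ y ℕ.* y → x ≡ y ⊎ x ℕ.+ y ≡ k
      square-roots {x} {y} rx ry x≤y p with euclidsLemma (y ℕ.∸ x) (x ℕ.+ y) pk k∣
        where
        open +-*-Solver renaming (solve to solveℕ)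
        identity : ∀ x d → d ℕ.* (x ℕ.+ (x ℕ.+ d)) ℕ.+ x ℕ.* x ≡ (x ℕ.+ d) ℕ.* (x ℕ.+ d)
        identity = solveℕ 2 (λ x d → d :* (x :+ (x :+ d)) :+ x :* x := (x :+ d) :* (x :+ d)) refl
        D = (y ℕ.∸ x) ℕ.* (x ℕ.+ y)
        y²≡ : D ℕ.+ x ℕ.* x ≡ y ℕ.* y
        y²≡ = subst (λ z → (y ℕ.∸ x) ℕ.* (x ℕ.+ z) ℕ.+ x ℕ.* x ≡ z ℕ.* z) (ℕₚ.m+[n∸m]≡n x≤y) (identity x (y ℕ.∸ x))
        k∣ : k ∣ D
        k∣ = ∣m+n∣m⇒∣n {k} {x ℕ.* x ℕ./ k ℕ.* k} {D} (divides (y ℕ.* y ℕ./ k) eq) (n∣m*n (x ℕ.* x ℕ./ k))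
          where
          open ≡-Reasoning
          eq : x ℕ.* x ℕ./ k ℕ.* k ℕ.+ D ≡ y ℕ.* y ℕ./ k ℕ.* k
          eq = ℕₚ.+-cancelˡ-≡ (x ℕ.* x ℕ.% k) _ _ (begin
            x ℕ.* x ℕ.% k ℕ.+ (x ℕ.* x ℕ./ k ℕ.* k ℕ.+ D)   ≡⟨ sym (ℕₚ.+-assoc (x ℕ.* x ℕ.% k) _ D) ⟩
            x ℕ.* x ℕ.% k ℕ.+ x ℕ.* x ℕ./ k ℕ.* k ℕ.+ D     ≡⟨ cong (ℕ._+ D) (sym (m≡m%n+[m/n]*n (x ℕ.* x) k)) ⟩
            x ℕ.* x ℕ.+ D                                   ≡⟨ trans (ℕₚ.+-comm (x ℕ.* x) D) y²≡ ⟩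
            y ℕ.* y                                         ≡⟨ m≡m%n+[m/n]*n (y ℕ.* y) k ⟩
            y ℕ.* y ℕ.% k ℕ.+ y ℕ.* y ℕ./ k ℕ.* k           ≡⟨ cong (ℕ._+ y ℕ.* y ℕ./ k ℕ.* k) (sym p) ⟩
            x ℕ.* x ℕ.% k ℕ.+ y ℕ.* y ℕ./ k ℕ.* k ∎)
      ... | inj₁ d = inj₁ (ℕₚ.≤-antisym x≤y (ℕₚ.m∸n≡0⇒m≤n (none (y ℕ.∸ x) d (ℕₚ.≤-<-trans (ℕₚ.m∸n≤m y x) (class< ry)))))
        where
        none : ∀ d → k ∣ d → d ℕ.< k → d ≡ 0
        none zero    _ _ = refl
        none (suc d) e p = ⊥-elim (ℕₚ.<⇒≱ p (∣⇒≤ e))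
      ... | inj₂ (divides zero eq) = ⊥-elim (ℕₚ.<⇒≢ (ℕₚ.≤-trans (lo rx) (ℕₚ.m≤m+n x y)) (sym eq))
      ... | inj₂ (divides (suc zero) eq) = inj₂ (trans eq (ℕₚ.*-identityˡ k))
      ... | inj₂ (divides (suc (suc c)) eq) = ⊥-elim (ℕₚ.<⇒≱ (ℕₚ.+-mono-< (class< rx) (class< ry))
            (ℕₚ.≤-trans (ℕₚ.≤-trans (ℕₚ.m≤m+n (k ℕ.+ k) (c ℕ.* k)) (ℕₚ.≤-reflexive (ℕₚ.+-assoc k k (c ℕ.* k)))) (ℕₚ.≤-reflexive (sym eq))))

      all-roots : ∀ {x y} → x ∈1‥ φk → y ∈1‥ φk → x ℕ.* x ≈ y ℕ.* y → x ≡ y ⊎ k ℕ.∸ x ≡ y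
      all-roots {x} {y} rx ry p with ℕₚ.≤-total x y
      ... | inj₁ q with square-roots rx ry q p
      ...   | inj₁ e = inj₁ e
      ...   | inj₂ e = inj₂ (trans (cong (ℕ._∸ x) (sym e)) (ℕₚ.m+n∸m≡n x y))
      all-roots {x} {y} rx ry p | inj₂ q with square-roots ry rx q (sym p)
      ...   | inj₁ e = inj₁ (sym e)
      ...   | inj₂ e = inj₂ (trans (cong (ℕ._∸ x) (sym e)) (ℕₚ.m+n∸n≡m y x))

    square-unit : ∀ {a} → Square a → ¬ k ∣ a
    square-unit (x , r , p) d = ∤-* (class-unit r) (class-unit r) (≈-∣ (sym p) d)

    -- The roots are x and k - x and no others, as k divides a difference or a sum of two roots.
    -- They are distinct because k is odd.
    χ-square : ∀ {a} → Square a → χ a ≡ 1ℚ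
    χ-square {a} sq@(x , r , p) = trans (cong₂ (λ s i → s + i - 1ℚ) two (⟦no⟧ (k ∣? a) (square-unit sq))) refl
      where
      term : ∀ y → y ∈1‥ φk → ⟦ (y ℕ.* y) ℕ.% k ℕ.≟ a ℕ.% k ⟧ ≡ ⟦ x ℕ.≟ y ⟧ * 1ℚ + ⟦ k ℕ.∸ x ℕ.≟ y ⟧ * 1ℚ
      term y ry with x ℕ.≟ y in e₁ | k ℕ.∸ x ℕ.≟ y in e₂
      ... | yes refl | yes e = ⊥-elim (opp≢ r (sym e))
      ... | yes refl | no ne = trans (⟦yes⟧ ((x ℕ.* x) ℕ.% k ℕ.≟ a ℕ.% k) p) (sym (cong₂ (λ i j → i * 1ℚ + j * 1ℚ) (⟦yes⟧ (yes refl) refl) (⟦no⟧ (no ne) ne)))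
      ... | no ne | yes refl = trans (⟦yes⟧ (((k ℕ.∸ x) ℕ.* (k ℕ.∸ x)) ℕ.% k ℕ.≟ a ℕ.% k) (trans (sum-k⇒square {x} {k ℕ.∸ x} (x+opp r)) p))
                                 (sym (cong₂ (λ i j → i * 1ℚ + j * 1ℚ) (⟦no⟧ (no ne) ne) (⟦yes⟧ (yes refl) refl)))
      ... | no ne | no ne′ = trans (⟦no⟧ ((y ℕ.* y) ℕ.% k ℕ.≟ a ℕ.% k) λ eq → bad (all-roots r ry (trans p (sym eq))))
                                 (sym (cong₂ (λ i j → i * 1ℚ + j * 1ℚ) (⟦no⟧ (no ne) ne) (⟦no⟧ (no ne′) ne′)))
        where
        bad : x ≡ y ⊎ k ℕ.∸ x ≡ y → ⊥
        bad (inj₁ e) = ne e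
        bad (inj₂ e) = ne′ e
      one : ∀ {z} → z ∈1‥ φk → Σ₁ φk (λ y → ⟦ z ℕ.≟ y ⟧ * 1ℚ) ≡ 1ℚ
      one {z} rz = trans (Σ₁-δ φk z (λ _ → 1ℚ) (lo rz)) (cong (_* 1ℚ) (⟦yes⟧ (z ℕ.≤? φk) (hi rz)))
      two : roots a ≡ 2ℚ
      two = trans (Σ₁-cong φk term) (trans (Σ₁-+ φk _ _) (cong₂ _+_ (one r) (one (opposite r))))

    χ-1 : χ 1 ≡ 1ℚ
    χ-1 = χ-square (1 , (ℕₚ.≤-refl ﹐ ℕₚ.≤-pred (ℕₚ.≤-trans 1<k (ℕₚ.≤-reflexive (sym sucφk)))) , refl)

    data Value (a : ℕ) : Set where
      zero-value   : k ∣ a → χ a ≡ 0ℚ → Value a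
      square-value : Square a → χ a ≡ 1ℚ → Value a
      other-value  : ¬ k ∣ a → NonSquare a → χ a ≡ - 1ℚ → Value a

    χ-value : ∀ a → Value a
    χ-value a with k ∣? a | square? a
    ... | yes d | _       = zero-value d (χ-zero d)
    ... | no d  | inj₁ sq = square-value sq (χ-square sq)
    ... | no d  | inj₂ ns = other-value d ns (χ-nonsquare d ns)

    χ-bound : ∀ a → ℚ.∣ χ a ∣ ≤ 1ℚ
    χ-bound a with χ-value a
    ... | zero-value _ e    = subst (λ z → ℚ.∣ z ∣ ≤ 1ℚ) (sym e) (nonNegative⁻¹ 1ℚ)
    ... | square-value _ e  = subst (λ z → ℚ.∣ z ∣ ≤ 1ℚ) (sym e) ≤-refl
    ... | other-value _ _ e = subst (λ z → ℚ.∣ z ∣ ≤ 1ℚ) (sym e) ≤-refl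

    χ-periodic : ∀ i → χ (k ℕ.+ i) ≡ χ i
    χ-periodic i = χ-cong {k ℕ.+ i} {i} (trans (cong (ℕ._% k) (trans (ℕₚ.+-comm k i) (cong (i ℕ.+_) (sym (ℕₚ.*-identityˡ k))))) ([m+kn]%n≡m%n i 1 k))

    -- Count the pairs (x, b) with x² ≡ ab.
    χ-sum : ∀ a → ¬ k ∣ a → sum k (λ b → χ (a ℕ.* b)) ≡ 0ℚ
    χ-sum a d = trans (sum-- k _ _) (trans (cong₂ _-_ (trans (sum-+ k _ _) (cong₂ _+_ roots-sum zeros)) (trans (sum-const k 1ℚ) (*-identityʳ (ι k)))) (trans (cong (λ z → ι φk + 1ℚ - ι z) (sym sucφk)) (lemma (ι φk))))
      where
      lemma : ∀ a → a + 1ℚ - (1ℚ + a) ≡ 0ℚ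
      lemma = solve-∀ ring
      roots-sum : sum k (λ b → roots (a ℕ.* b)) ≡ ι φk
      roots-sum = trans (sum-cong k λ b _ → Σ₁≡sum φk _) (trans (sum-swap k φk (λ b x → ⟦ (suc x ℕ.* suc x) ℕ.% k ℕ.≟ (a ℕ.* b) ℕ.% k ⟧))
        (trans (sum-cong φk λ x p → trans (sum-cong k λ b _ → ⟦⟧-cong ((suc x ℕ.* suc x) ℕ.% k ℕ.≟ (a ℕ.* b) ℕ.% k) ((a ℕ.* b) ℕ.% k ℕ.≟ (suc x ℕ.* suc x) ℕ.% k) sym sym)
          (count d (class-of (∤-* (class-unit (in-range p)) (class-unit (in-range p)))))) (trans (sum-const φk 1ℚ) (*-identityʳ (ι φk)))))
        where
        in-range : ∀ {x} → x ℕ.< φk → suc x ∈1‥ φk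
        in-range p = ℕ.s≤s ℕ.z≤n ﹐ p
      zeros : sum k (λ b → ⟦ k ∣? a ℕ.* b ⟧) ≡ 1ℚ
      zeros = trans (sum-single k 0 _ (ℕₚ.<-trans (ℕ.s≤s ℕ.z≤n) 1<k) λ b p ne → ⟦no⟧ (k ∣? a ℕ.* b) (∤-* d (unit (ℕₚ.n≢0⇒n>0 ne) p)))
        (⟦yes⟧ (k ∣? a ℕ.* 0) (subst (k ∣_) (sym (ℕₚ.*-zeroʳ a)) (divides 0 refl)))

    private
      square-* : ∀ {a b} → Square a → Square b → Square (a ℕ.* b)
      square-* {a} {b} (x , r , p) (y , s , q) = (x ℕ.* y) ℕ.% k , class-of (∤-* (class-unit r) (class-unit s)) ,
        trans (*-cong {(x ℕ.* y) ℕ.% k} {x ℕ.* y} {(x ℕ.* y) ℕ.% k} {x ℕ.* y} (%≈ (x ℕ.* y)) (%≈ (x ℕ.* y))) (trans (cong (ℕ._% k) (identity x y)) (*-cong {x ℕ.* x} {a} {y ℕ.* y} {b} p q))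
        where
        open +-*-Solver renaming (solve to solveℕ)
        identity : ∀ x y → x ℕ.* y ℕ.* (x ℕ.* y) ≡ x ℕ.* x ℕ.* (y ℕ.* y)
        identity = solveℕ 2 (λ x y → x :* y :* (x :* y) := x :* x :* (y :* y)) refl

      square-cancel : ∀ {a b} → Square a → Square (a ℕ.* b) → Square b
      square-cancel {a} {b} (x , r , p) (y , s , q) with divide (class-unit r) y
      ... | z , z<k , xz≈y = z , (ℕₚ.n≢0⇒n>0 z≢0 ﹐ ℕₚ.≤-pred (ℕₚ.≤-trans z<k (ℕₚ.≤-reflexive (sym sucφk)))) ,
          cancel (z ℕ.* z) b (∤-* (class-unit r) (class-unit r)) (trans (cong (ℕ._% k) (identity x z)) (trans (*-cong {x ℕ.* z} {y} {x ℕ.* z} {y} xz≈y xz≈y) (trans q (*-congʳ b {a} {x ℕ.* x} (sym p)))))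
        where
        open +-*-Solver renaming (solve to solveℕ)
        identity : ∀ x z → x ℕ.* x ℕ.* (z ℕ.* z) ≡ x ℕ.* z ℕ.* (x ℕ.* z)
        identity = solveℕ 2 (λ x z → x :* x :* (z :* z) := x :* z :* (x :* z)) refl
        z≢0 : z ≢ 0
        z≢0 refl = class-unit s (≈-∣ {x ℕ.* 0} {y} xz≈y (subst (k ∣_) (sym (ℕₚ.*-zeroʳ x)) (divides 0 refl)))

      χ-*-square : ∀ {a} b → Square a → χ (a ℕ.* b) ≡ χ b
      χ-*-square {a} b sq with χ-value b
      ... | zero-value d e     = trans (χ-zero (∣n⇒∣m*n a d)) (sym e)
      ... | square-value sqb e = trans (χ-square (square-* sq sqb)) (sym e)
      ... | other-value d ns e = trans (χ-nonsquare (∤-* (square-unit sq) d) λ x r p → neg (square-cancel sq (x , r , p))) (sym e)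
        where
        neg : ¬ Square b
        neg (x , r , p) = ns x r p

      -- For a nonsquare unit a, the function b ↦ χ(ab) + χ(b) has sum zero over a period and no
      -- positive value: it vanishes at squares and multiples of k, and is at most 1 - 1 at
      -- nonsquares. So it vanishes identically, and χ(b) = -1 forces χ(ab) = 1.
      χ-*-nonsquare : ∀ {a b} → ¬ k ∣ a → NonSquare a → ¬ k ∣ b → NonSquare b → χ (a ℕ.* b) ≡ 1ℚ
      χ-*-nonsquare {a} {b} da nsa db nsb = trans (χ-cong {a ℕ.* b} {a ℕ.* (b ℕ.% k)} (*-congˡ a {b} {b ℕ.% k} (sym (%≈ b))))
          (≤-antisym (≤-abs (χ-bound (a ℕ.* (b ℕ.% k)))) (lemma (χ (a ℕ.* (b ℕ.% k))) (χ (b ℕ.% k)) (trans (χ-cong {b ℕ.% k} {b} (%≈ b)) (χ-nonsquare db nsb))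
            (sum-vanishing k (λ b → χ (a ℕ.* b) + χ b) nonpos (≡⇒≤ (sym total)) (b ℕ.% k) (m%n<n b k))))
        where
        lemma : ∀ x y → y ≡ - 1ℚ → 0ℚ ≤ x + y → 1ℚ ≤ x
        lemma x y refl h = by h (solve (x ∷ []) ring)
        total : sum k (λ b → χ (a ℕ.* b) + χ b) ≡ 0ℚ
        total = trans (sum-+ k _ χ) (cong₂ _+_ (χ-sum a da) (trans (sum-cong k λ b _ → χ-cong {b} {1 ℕ.* b} (cong (ℕ._% k) (sym (ℕₚ.*-identityˡ b)))) (χ-sum 1 (unit ℕₚ.≤-refl 1<k))))
        nonpos : ∀ b → b ℕ.< k → χ (a ℕ.* b) + χ b ≤ 0ℚ
        nonpos b _ with χ-value b
        ... | zero-value d e    = ≡⇒≤ (cong₂ _+_ (χ-zero (∣n⇒∣m*n a d)) e)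
        ... | square-value sq e = ≡⇒≤ (cong₂ _+_ (trans (χ-cong {a ℕ.* b} {b ℕ.* a} (cong (ℕ._% k) (ℕₚ.*-comm a b))) (trans (χ-*-square a sq) (χ-nonsquare da nsa))) e)
        ... | other-value _ _ e = subst (λ z → χ (a ℕ.* b) + z ≤ 0ℚ) (sym e) (lemma₂ (χ (a ℕ.* b)) (≤-abs (χ-bound (a ℕ.* b))))
          where
          lemma₂ : ∀ x → x ≤ 1ℚ → x - 1ℚ ≤ 0ℚ
          lemma₂ x h = by (Δ h) (solve (x ∷ []) ring)

    χ-* : ∀ a b → χ (a ℕ.* b) ≡ χ a * χ b
    χ-* a b with χ-value a | χ-value b
    ... | zero-value d e | _ = trans (χ-zero (∣m⇒∣m*n b d)) (sym (trans (cong (_* χ b) e) (*-zeroˡ (χ b))))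
    ... | square-value sq e | _ = trans (χ-*-square b sq) (sym (trans (cong (_* χ b) e) (*-identityˡ (χ b))))
    ... | other-value _ _ _ | zero-value d e = trans (χ-zero (∣n⇒∣m*n a d)) (sym (trans (cong (χ a *_) e) (*-zeroʳ (χ a))))
    ... | other-value _ _ _ | square-value sq e = trans (cong χ (ℕₚ.*-comm a b)) (trans (χ-*-square a sq) (sym (trans (cong (χ a *_) e) (*-identityʳ (χ a)))))
    ... | other-value da nsa e | other-value db nsb e′ = trans (χ-*-nonsquare da nsa db nsb) (sym (cong₂ _*_ e e′))

    χ-partial-from : ∀ m n → ℚ.∣ sum n (λ i → χ (m ℕ.+ i)) ∣ ≤ ι k + ι k
    χ-partial-from = Periodic.partial-from k χ χ-bound χ-periodic
      (trans (sum-cong k λ b _ → cong χ (sym (ℕₚ.*-identityˡ b))) (χ-sum 1 (unit ℕₚ.≤-refl 1<k)))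

-- Divisor sums of a quadratic character; Monsky's inequality

module LSeries where

  open import Data.Nat as ℕ using (ℕ; zero; suc)
  import Data.Nat.Properties as ℕₚ
  open import Data.Nat.Divisibility using (_∣_; _∣?_; divides; ∣-trans; ∣⇒≤; ∣n⇒∣m*n; *-cancelˡ-∣; *-monoʳ-∣; 1∣_)
  open import Data.Nat.Primality using (Prime; euclidsLemma; prime⇒irreducible)
  open import Data.Nat.Induction using (<-rec)
  open import Data.Nat.Coprimality using (Coprime; coprime-divisor)
  open import Data.Nat.Solver using (module +-*-Solver)
  open import Data.Rational using (ℚ; 0ℚ; 1ℚ; _+_; _-_; _*_; -_; _≤_; _<_)
  import Data.Rational as ℚ
  open import Data.Rational.Properties
  open import Data.Product using (_,_; _×_; ∃₂; proj₁; proj₂)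
  open import Data.Sum using (inj₁; inj₂; _⊎_)
  open import Data.Empty using (⊥-elim)
  open import Data.List using ([]; _∷_)
  open import Relation.Nullary using (¬_; yes; no; Dec)
  open import Relation.Binary.PropositionalEquality
  open import Tactic.RingSolver using (solve; solve-∀)
  open Rationals
  open Sums
  open Convolution
  open Mangoldt
  open Residue
  open Selberg
  open Legendre

  remove-prime : ∀ q → Prime q → ∀ n → 1 ℕ.≤ n → ∃₂ λ a m → q ℕ.^ a ℕ.* m ≡ n × 1 ℕ.≤ m × ¬ q ∣ m
  remove-prime q pq = <-rec _ step
    where
    step : ∀ n → (∀ {m} → m ℕ.< n → 1 ℕ.≤ m → ∃₂ λ a m′ → q ℕ.^ a ℕ.* m′ ≡ m × 1 ℕ.≤ m′ × ¬ q ∣ m′) → 1 ℕ.≤ n → ∃₂ λ a m → q ℕ.^ a ℕ.* m ≡ n × 1 ℕ.≤ m × ¬ q ∣ m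
    step n IH p with q ∣? n
    ... | no d = 0 , n , ℕₚ.*-identityˡ n , p , d
    ... | yes (divides zero refl) = ⊥-elim (ℕₚ.<-irrefl refl p)
    ... | yes (divides m@(suc _) refl) with IH (ℕₚ.m<m*n m q (prime≥2 pq)) (ℕ.s≤s ℕ.z≤n)
    ...   | a , m′ , e , p′ , d = suc a , m′ , trans (ℕₚ.*-assoc q (q ℕ.^ a) m′) (trans (cong (q ℕ.*_) e) (ℕₚ.*-comm q m)) , p′ , d

  private
    ∤-power-coprime : ∀ {q d m} a → Prime q → ¬ q ∣ d → d ∣ q ℕ.^ a ℕ.* m → d ∣ m
    ∤-power-coprime {q} {d} {m} zero    pq ¬q d∣ = subst (d ∣_) (ℕₚ.*-identityˡ m) d∣
    ∤-power-coprime {q} {d} {m} (suc a) pq ¬q d∣ = ∤-power-coprime a pq ¬q (coprime-divisor d⊥q (subst (d ∣_) (ℕₚ.*-assoc q (q ℕ.^ a) m) d∣))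
      where
      d⊥q : Coprime d q
      d⊥q {i} (e , e′) with prime⇒irreducible pq e′
      ... | inj₁ eq   = eq
      ... | inj₂ refl = ⊥-elim (¬q e)

  module DivisorSums (χ : ℕ → ℚ) (χ-1 : χ 1 ≡ 1ℚ) (χ-* : ∀ a b → χ (a ℕ.* b) ≡ χ a * χ b)
                     (χ-values : ∀ a → χ a ≡ 0ℚ ⊎ χ a ≡ 1ℚ ⊎ χ a ≡ - 1ℚ) where

    -- The convolution 1 * χ, whose Dirichlet series is ζ(s)·L(s, χ).
    ρ : ℕ → ℚ
    ρ n = Σ₁ n λ d → ⟦ d ∣? n ⟧ * χ d

    ρ-1 : ρ 1 ≡ 1ℚ
    ρ-1 = trans (Σ₁-suc 0 _) (trans (cong₂ _+_ (Σ₁-0 _) (cong₂ _*_ (⟦yes⟧ (1 ∣? 1) (1∣ 1)) χ-1)) refl)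

    private
      coprime-part : ∀ q n → ℚ
      coprime-part q n = Σ₁ n λ d → ⟦ d ∣? n ⟧ * (χ d - ⟦ q ∣? d ⟧ * χ d)

      ρ-split : ∀ {q m} → Prime q → ρ (q ℕ.* m) ≡ coprime-part q (q ℕ.* m) + χ q * ρ m
      ρ-split {q} {m} pq = trans (Σ₁-cong (q ℕ.* m) λ d _ → lemma ⟦ d ∣? q ℕ.* m ⟧ ⟦ q ∣? d ⟧ (χ d)) (trans (Σ₁-+ (q ℕ.* m) _ _) (cong (coprime-part q (q ℕ.* m) +_)
          (trans (Σ₁-multiples q m (λ d → ⟦ d ∣? q ℕ.* m ⟧ * χ d) (prime≥1 pq)) (trans (Σ₁-cong m λ y _ → trans (cong₂ _*_ (⟦⟧-cong (q ℕ.* y ∣? q ℕ.* m) (y ∣? m) (*-cancelˡ-∣ q {{ℕ.>-nonZero (prime≥1 pq)}}) (*-monoʳ-∣ q)) (χ-* q y))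
            (lemma₂ ⟦ y ∣? m ⟧ (χ q) (χ y))) (Σ₁-*ˡ m (χ q) _)))))
        where
        lemma : ∀ i j x → i * x ≡ i * (x - j * x) + j * (i * x)
        lemma = solve-∀ ring
        lemma₂ : ∀ i a b → i * (a * b) ≡ a * (i * b)
        lemma₂ = solve-∀ ring

      coprime-part-power : ∀ {q m} a → Prime q → 1 ℕ.≤ m → ¬ q ∣ m → coprime-part q (q ℕ.^ a ℕ.* m) ≡ ρ m
      coprime-part-power {q} {m} a pq 1≤m ¬q = trans (Σ₁-cong n λ d r → term d (q ∣? d)) (Σ₁-extend n m _ m≤n λ d r m<d →
          trans (cong (_* χ d) (⟦no⟧ (d ∣? m) λ e → ℕₚ.<⇒≱ m<d (∣⇒≤ {{ℕ.>-nonZero 1≤m}} e))) (*-zeroˡ (χ d)))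
        where
        n = q ℕ.^ a ℕ.* m
        m≤n : m ℕ.≤ n
        m≤n = ℕₚ.m≤n*m m (q ℕ.^ a) {{ℕₚ.m^n≢0 q a {{ℕ.>-nonZero (prime≥1 pq)}}}}
        lemma₁ : ∀ i x → i * (x - 1ℚ * x) ≡ 0ℚ * x
        lemma₁ = solve-∀ ring
        lemma₂ : ∀ i x → i * (x - 0ℚ * x) ≡ i * x
        lemma₂ = solve-∀ ring
        term : ∀ d → Dec (q ∣ d) → ⟦ d ∣? n ⟧ * (χ d - ⟦ q ∣? d ⟧ * χ d) ≡ ⟦ d ∣? m ⟧ * χ d
        term d (yes e) = trans (cong (λ z → ⟦ d ∣? n ⟧ * (χ d - z * χ d)) (⟦yes⟧ (q ∣? d) e)) (trans (lemma₁ ⟦ d ∣? n ⟧ (χ d)) (cong (_* χ d) (sym (⟦no⟧ (d ∣? m) λ e′ → ¬q (∣-trans e e′)))))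
        term d (no e)  = trans (cong (λ z → ⟦ d ∣? n ⟧ * (χ d - z * χ d)) (⟦no⟧ (q ∣? d) e)) (trans (lemma₂ ⟦ d ∣? n ⟧ (χ d))
          (cong (_* χ d) (⟦⟧-cong (d ∣? n) (d ∣? m) (∤-power-coprime a pq e) (∣n⇒∣m*n (q ℕ.^ a)))))

      -- ρ(qᵃ) = 1 + x + … + xᵃ with x = χ(q).
      C : ℚ → ℕ → ℚ
      C x zero    = 1ℚ
      C x (suc a) = 1ℚ + x * C x a

      -- Divisors of q^(a+1)·m that are prime to q are the divisors of m; the others are q times the
      -- divisors of q^a·m. This is the recursion of `C`.
      ρ-power : ∀ {q m} a → Prime q → 1 ℕ.≤ m → ¬ q ∣ m → ρ (q ℕ.^ a ℕ.* m) ≡ C (χ q) a * ρ m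
      ρ-power {q} {m} zero    pq 1≤m ¬q = trans (cong ρ (ℕₚ.*-identityˡ m)) (sym (*-identityˡ (ρ m)))
      ρ-power {q} {m} (suc a) pq 1≤m ¬q = trans (cong ρ (ℕₚ.*-assoc q (q ℕ.^ a) m)) (trans (ρ-split {q} {q ℕ.^ a ℕ.* m} pq)
          (trans (cong₂ (λ x y → x + χ q * y) (trans (cong (coprime-part q) (sym (ℕₚ.*-assoc q (q ℕ.^ a) m))) (coprime-part-power (suc a) pq 1≤m ¬q)) (ρ-power a pq 1≤m ¬q)) (lemma (χ q) (C (χ q) a) (ρ m))))
        where
        lemma : ∀ x c r → r + x * (c * r) ≡ (1ℚ + x * c) * r
        lemma = solve-∀ ring

      C-0 : ∀ a → C 0ℚ a ≡ 1ℚ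
      C-0 zero    = refl
      C-0 (suc a) = trans (cong (1ℚ +_) (*-zeroˡ (C 0ℚ a))) refl

      C-1 : ∀ a → 1ℚ ≤ C 1ℚ a
      C-1 zero    = ≤-refl
      C-1 (suc a) = lemma (C 1ℚ a) (C-1 a)
        where
        lemma : ∀ c → 1ℚ ≤ c → 1ℚ ≤ 1ℚ + 1ℚ * c
        lemma c h = by (0≤1 ⊕ Δ h) (solve (c ∷ []) ring)

      C-even : ∀ b → C (- 1ℚ) (b ℕ.+ b) ≡ 1ℚ
      C-even zero    = refl
      C-even (suc b) = trans (cong (λ z → C (- 1ℚ) (suc z)) (ℕₚ.+-suc b b)) (trans (cong (λ z → 1ℚ + - 1ℚ * (1ℚ + - 1ℚ * z)) (C-even b)) refl)

      C-nonneg : ∀ {x} → x ≡ 0ℚ ⊎ x ≡ 1ℚ ⊎ x ≡ - 1ℚ → ∀ a → 0ℚ ≤ C x a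
      C-nonneg (inj₁ refl)        a = ≤-trans 0≤1 (≡⇒≤ (sym (C-0 a)))
      C-nonneg (inj₂ (inj₁ refl)) a = ≤-trans 0≤1 (C-1 a)
      C-nonneg (inj₂ (inj₂ refl)) a = proj₁ (go a)
        where
        lemma : ∀ c → c ≤ 1ℚ → 0ℚ ≤ 1ℚ + - 1ℚ * c
        lemma c h = by (Δ h) (solve (c ∷ []) ring)
        lemma₂ : ∀ c → 0ℚ ≤ c → 1ℚ + - 1ℚ * c ≤ 1ℚ
        lemma₂ c h = by h (solve (c ∷ []) ring)
        go : ∀ a → 0ℚ ≤ C (- 1ℚ) a × C (- 1ℚ) a ≤ 1ℚ
        go zero    = 0≤1 , ≤-refl
        go (suc a) = lemma (C (- 1ℚ) a) (proj₂ (go a)) , lemma₂ (C (- 1ℚ) a) (proj₁ (go a))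

      C-square : ∀ {x} → x ≡ 0ℚ ⊎ x ≡ 1ℚ ⊎ x ≡ - 1ℚ → ∀ b → 1ℚ ≤ C x (b ℕ.+ b)
      C-square (inj₁ refl)        b = ≡⇒≤ (sym (C-0 (b ℕ.+ b)))
      C-square (inj₂ (inj₁ refl)) b = C-1 (b ℕ.+ b)
      C-square (inj₂ (inj₂ refl)) b = ≡⇒≤ (sym (C-even b))

      decrease : ∀ {q a m n} → Prime q → q ∣ n → q ℕ.^ a ℕ.* m ≡ n → 1 ℕ.≤ m → ¬ q ∣ m → m ℕ.< n
      decrease {q} {zero}  {m} pq d refl 1≤m ¬q = ⊥-elim (¬q (subst (q ∣_) (ℕₚ.*-identityˡ m) d))
      decrease {q} {suc a} {m} pq d refl 1≤m ¬q = ℕₚ.<-≤-trans (ℕₚ.m<m*n m (q ℕ.^ suc a) {{ℕ.>-nonZero 1≤m}} (ℕₚ.<-≤-trans (prime≥2 pq) (ℕₚ.m≤m*n q (q ℕ.^ a) {{ℕₚ.m^n≢0 q a {{ℕ.>-nonZero (prime≥1 pq)}}}})))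
        (ℕₚ.≤-reflexive (ℕₚ.*-comm m (q ℕ.^ suc a)))

    ρ-nonneg : ∀ n → 1 ℕ.≤ n → 0ℚ ≤ ρ n
    ρ-nonneg = <-rec _ step
      where
      step : ∀ n → (∀ {m} → m ℕ.< n → 1 ℕ.≤ m → 0ℚ ≤ ρ m) → 1 ℕ.≤ n → 0ℚ ≤ ρ n
      step (suc zero)      IH p = ≤-trans 0≤1 (≡⇒≤ (sym ρ-1))
      step n@(suc (suc _)) IH p with prime-factor n (ℕ.s≤s (ℕ.s≤s ℕ.z≤n))
      ... | q , pq , d with remove-prime q pq n p
      ...   | a , m , e , 1≤m , ¬q = ≤-trans (C-nonneg (χ-values q) a ⊗ IH (decrease {a = a} pq d e 1≤m ¬q) 1≤m) (≡⇒≤ (sym (trans (cong ρ (sym e)) (ρ-power a pq 1≤m ¬q))))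

    -- In a square every prime has an even exponent, and then the local factor 1 + x + ... + x^(2a)
    -- is at least 1 for each of x = 0, 1, -1.
    ρ-square : ∀ n → 1 ℕ.≤ n → 1ℚ ≤ ρ (n ℕ.* n)
    ρ-square = <-rec _ step
      where
      open +-*-Solver renaming (solve to solveℕ)
      step : ∀ n → (∀ {m} → m ℕ.< n → 1 ℕ.≤ m → 1ℚ ≤ ρ (m ℕ.* m)) → 1 ℕ.≤ n → 1ℚ ≤ ρ (n ℕ.* n)
      step (suc zero)      IH p = ≡⇒≤ (sym ρ-1)
      step n@(suc (suc _)) IH p with prime-factor n (ℕ.s≤s (ℕ.s≤s ℕ.z≤n))
      ... | q , pq , d with remove-prime q pq n p
      ...   | a , m , e , 1≤m , ¬q = ≤-trans (*-mono 0≤1 (ρ-nonneg (m ℕ.* m) (1≤* 1≤m 1≤m)) (C-square (χ-values q) a) (IH (decrease {a = a} pq d e 1≤m ¬q) 1≤m))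
              (≡⇒≤ (sym (trans (cong ρ (sym square-eq)) (ρ-power (a ℕ.+ a) pq (1≤* 1≤m 1≤m) ¬q²))))
        where
        ¬q² : ¬ q ∣ m ℕ.* m
        ¬q² d with euclidsLemma m m pq d
        ... | inj₁ x = ¬q x
        ... | inj₂ x = ¬q x
        square-eq : q ℕ.^ (a ℕ.+ a) ℕ.* (m ℕ.* m) ≡ n ℕ.* n
        square-eq = trans (cong (ℕ._* (m ℕ.* m)) (ℕₚ.^-distribˡ-+-* q a a)) (trans (solveℕ 2 (λ x m → x :* x :* (m :* m) := (x :* m) :* (x :* m)) refl (q ℕ.^ a) m) (cong₂ ℕ._*_ e e))

  -- Monsky's proof that L(1, χ) ≠ 0: with S d = 1 + t + … + t^(d-1), the numbers 1/d − t^d/S(d) decrease,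
  -- while (1 − t) Σ ρ(n) tⁿ = Σ χ(d) t^d/S(d) is large because ρ is at least 1 on squares.
  module Monsky (s : ℚ) (0<s : 0ℚ < s) (s≤1 : s ≤ 1ℚ) where

    -- Chosen as a square so that the square root in the AM-GM inequality stays rational.
    t : ℚ
    t = s * s

    0≤s : 0ℚ ≤ s
    0≤s = <⇒≤ 0<s

    0≤t : 0ℚ ≤ t
    0≤t = 0≤s ⊗ 0≤s

    t≤1 : t ≤ 1ℚ
    t≤1 = *-mono 0≤s 0≤1 s≤1 s≤1

    ^≤1 : ∀ {x} n → 0ℚ ≤ x → x ≤ 1ℚ → x ^ n ≤ 1ℚ
    ^≤1 zero    p q = ≤-refl
    ^≤1 (suc n) p q = *-mono p 0≤1 q (^≤1 n p q)

    ^-anti : ∀ {x m n} → 0ℚ ≤ x → x ≤ 1ℚ → m ℕ.≤ n → x ^ n ≤ x ^ m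
    ^-anti {x} {m} {n} p q r = subst (λ z → x ^ z ≤ x ^ m) (ℕₚ.m+[n∸m]≡n r) (≤-trans (≡⇒≤ (^-+ x m (n ℕ.∸ m)))
      (≤-trans (*-monoˡ (x ^ m) (^-nonneg m p) (^≤1 (n ℕ.∸ m) p q)) (≡⇒≤ (*-identityʳ (x ^ m)))))

    t^ : ∀ n → t ^ n ≡ s ^ n * s ^ n
    t^ zero    = refl
    t^ (suc n) = trans (cong (t *_) (t^ n)) (lemma s (s ^ n))
      where
      lemma : ∀ a b → a * a * (b * b) ≡ a * b * (a * b)
      lemma = solve-∀ ring

    S : ℕ → ℚ
    S n = sum n (t ^_)

    S-step : ∀ n → S (suc n) ≡ 1ℚ + t * S n
    S-step n = trans (sum-head n (t ^_)) (cong (1ℚ +_) (sum-*ˡ n t (t ^_)))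

    S-geometric : ∀ n → (1ℚ - t) * S n ≡ 1ℚ - t ^ n
    S-geometric n = trans (lemma t (S n)) (trans (cong (λ z → 1ℚ + S n - z) (sym (S-step n))) (lemma₂ (S n) (t ^ n)))
      where
      lemma : ∀ t a → (1ℚ - t) * a ≡ 1ℚ + a - (1ℚ + t * a)
      lemma = solve-∀ ring
      lemma₂ : ∀ a b → 1ℚ + a - (a + b) ≡ 1ℚ - b
      lemma₂ = solve-∀ ring

    1≤S : ∀ n → .{{ℕ.NonZero n}} → 1ℚ ≤ S n
    1≤S (suc n) = ≤-trans (by (0≤t ⊗ sum-nonneg n λ i _ → ^-nonneg i 0≤t) (lemma (t * S n))) (≡⇒≤ (sym (S-step n)))
      where
      lemma : ∀ a → a ≡ 1ℚ + a - 1ℚ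
      lemma = solve-∀ ring

    0<S : ∀ n → .{{ℕ.NonZero n}} → 0ℚ < S n
    0<S n = <-≤-trans 0<1 (1≤S n)

    -- AM–GM applied to the geometric progression.
    S-lower : ∀ n → ι n * s ^ n ≤ s * S n
    S-lower zero          = ≡⇒≤ (sym (*-zeroʳ s))
    S-lower (suc zero)    = ≡⇒≤ (lemma s)
      where
      lemma : ∀ s → (1ℚ + 0ℚ) * (s * 1ℚ) ≡ s * (0ℚ + 1ℚ)
      lemma = solve-∀ ring
    S-lower (suc (suc n)) = ≤-trans (lemma (ι n) s (s ^ n) (S n) 0≤s (S-lower n) (0≤² (1ℚ - s * s ^ n)))
        (≡⇒≤ (cong (s *_) (sym (trans (S-step (suc n)) (cong (λ z → 1ℚ + t * (S n + z)) (t^ n))))))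
      where
      lemma : ∀ n s x a → 0ℚ ≤ s → n * x ≤ s * a → 0ℚ ≤ (1ℚ - s * x) * (1ℚ - s * x) → (1ℚ + (1ℚ + n)) * (s * (s * x)) ≤ s * (1ℚ + s * s * (a + x * x))
      lemma n s x a h₁ h₂ h₃ = by (h₁ ⊗ h₁ ⊗ Δ h₂ ⊕ h₁ ⊗ h₃) (solve (n ∷ s ∷ x ∷ a ∷ []) ring)

    g b : ℕ → ℚ
    g d = t ^ d * rc (S d)
    b d = v d - g d

    private
      -- The product of the AM-GM bounds at n and n + 1: on the left s^n·s^(n+1) = s·t^n, on the
      -- right s² appears, and one factor s ≤ 1 is given away.
      key : ∀ n → ι n * ι (suc n) * t ^ n ≤ S n * S (suc n)
      key n = ≤-trans (*-cancel s 0<s (≤-trans (≡⇒≤ (trans (cong (λ z → s * (ι n * ι (suc n) * z)) (t^ n)) (lemma s (ι n) (ι (suc n)) (s ^ n))))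
          (≤-trans (*-mono (0≤ι n ⊗ ^-nonneg n 0≤s) (0≤s ⊗ sum-nonneg (suc n) λ i _ → ^-nonneg i 0≤t) (S-lower n) (S-lower (suc n))) (≡⇒≤ (lemma₂ s (S n) (S (suc n)))))))
        (≤-trans (*-monoʳ (S n * S (suc n)) (sum-nonneg n (λ i _ → ^-nonneg i 0≤t) ⊗ sum-nonneg (suc n) (λ i _ → ^-nonneg i 0≤t)) s≤1) (≡⇒≤ (*-identityˡ (S n * S (suc n)))))
        where
        lemma : ∀ s a b x → s * (a * b * (x * x)) ≡ a * x * (b * (s * x))
        lemma = solve-∀ ring
        lemma₂ : ∀ s a b → s * a * (s * b) ≡ s * (s * (a * b))
        lemma₂ = solve-∀ ring

      g-step : ∀ n → .{{ℕ.NonZero n}} → g n - g (suc n) ≡ t ^ n * (rc (S n) * rc (S (suc n)))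
      g-step n = begin
        t ^ n * y - t * t ^ n * y′                                      ≡⟨ lemma t (t ^ n) y y′ ⟩
        t ^ n * y * 1ℚ - t * t ^ n * y′ * 1ℚ                            ≡⟨ sym (cong₂ (λ a b → t ^ n * y * a - t * t ^ n * y′ * b) (rc-inv (0<S (suc n))) (rc-inv (0<S n))) ⟩
        t ^ n * y * (S (suc n) * y′) - t * t ^ n * y′ * (S n * y)       ≡⟨ cong (λ z → t ^ n * y * (z * y′) - t * t ^ n * y′ * (S n * y)) (S-step n) ⟩
        t ^ n * y * ((1ℚ + t * S n) * y′) - t * t ^ n * y′ * (S n * y)  ≡⟨ lemma₂ t (t ^ n) y y′ (S n) ⟩
        t ^ n * (y * y′) ∎
        where
        open ≡-Reasoning
        y = rc (S n)
        y′ = rc (S (suc n))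
        lemma : ∀ t x y z → x * y - t * x * z ≡ x * y * 1ℚ - t * x * z * 1ℚ
        lemma = solve-∀ ring
        lemma₂ : ∀ t x y z a → x * y * ((1ℚ + t * a) * z) - t * x * z * (a * y) ≡ x * (y * z)
        lemma₂ = solve-∀ ring

      g-small : ∀ n → .{{ℕ.NonZero n}} → t ^ n * (rc (S n) * rc (S (suc n))) ≤ v n * v (suc n)
      g-small n = begin
        t ^ n * (y * y′)                                               ≡⟨ lemma (t ^ n) (y * y′) ⟩
        1ℚ * 1ℚ * (t ^ n * (y * y′))                                   ≡⟨ sym (cong₂ (λ a b → a * b * (t ^ n * (y * y′))) (ι*v n) (ι*v (suc n))) ⟩
        ι n * v n * (ι (suc n) * v (suc n)) * (t ^ n * (y * y′))       ≡⟨ lemma₂ (ι n) (v n) (ι (suc n)) (v (suc n)) (t ^ n) (y * y′) ⟩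
        ι n * ι (suc n) * t ^ n * (v n * v (suc n) * (y * y′))         ≤⟨ *-monoʳ (v n * v (suc n) * (y * y′)) (0≤v n ⊗ 0≤v (suc n) ⊗ (<⇒≤ (rc-pos (0<S n)) ⊗ <⇒≤ (rc-pos (0<S (suc n))))) (key n) ⟩
        S n * S (suc n) * (v n * v (suc n) * (y * y′))                 ≡⟨ lemma₃ (S n) (S (suc n)) (v n * v (suc n)) y y′ ⟩
        S n * y * (S (suc n) * y′) * (v n * v (suc n))                 ≡⟨ cong₂ (λ a b → a * b * (v n * v (suc n))) (rc-inv (0<S n)) (rc-inv (0<S (suc n))) ⟩
        1ℚ * 1ℚ * (v n * v (suc n))                                    ≡⟨ sym (lemma (v n) (v (suc n))) ⟩
        v n * v (suc n) ∎
        where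
        open ≤-Reasoning
        y = rc (S n)
        y′ = rc (S (suc n))
        lemma : ∀ a b → a * b ≡ 1ℚ * 1ℚ * (a * b)
        lemma = solve-∀ ring
        lemma₂ : ∀ a b c d e f → a * b * (c * d) * (e * f) ≡ a * c * e * (b * d * f)
        lemma₂ = solve-∀ ring
        lemma₃ : ∀ a b x y z → a * b * (x * (y * z)) ≡ a * y * (b * z) * x
        lemma₃ = solve-∀ ring

    -- Both parts of `b` have explicit decrements, 1/(n(n+1)) and t^n/(S(n)·S(n+1)); `key` says that
    -- the first is at least the second.
    b-decreasing : ∀ n → .{{ℕ.NonZero n}} → b (suc n) ≤ b n
    b-decreasing n = lemma (v n) (v (suc n)) (g n) (g (suc n)) (v n * v (suc n)) (t ^ n * (rc (S n) * rc (S (suc n)))) (v-step n) (g-step n) (g-small n)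
      where
      lemma : ∀ x z a c p q → p ≡ x - z → a - c ≡ q → q ≤ p → z - c ≤ x - a
      lemma x z a c p q refl refl h = by (Δ h) (solve (x ∷ z ∷ a ∷ c ∷ []) ring)

    b-nonneg : ∀ n → .{{ℕ.NonZero n}} → 0ℚ ≤ b n
    b-nonneg n = Δ (≤-trans (≤v n {g n} {1ℚ} (begin
      ι n * (t ^ n * rc (S n))     ≡⟨ sym (*-assoc (ι n) (t ^ n) (rc (S n))) ⟩
      ι n * t ^ n * rc (S n)       ≤⟨ *-monoʳ (rc (S n)) (<⇒≤ (rc-pos (0<S n))) nt≤S ⟩
      S n * rc (S n)               ≡⟨ rc-inv (0<S n) ⟩
      1ℚ ∎)) (≡⇒≤ (*-identityˡ (v n))))
      where
      open ≤-Reasoning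
      nt≤S : ι n * t ^ n ≤ S n
      nt≤S = ≤-trans (≡⇒≤ (sym (sum-const n (t ^ n)))) (sum-mono n λ i p → ^-anti 0≤t t≤1 (ℕₚ.<⇒≤ p))

    b-1 : b 1 ≡ 1ℚ - t
    b-1 = trans (cong₂ _-_ v1 (trans (cong (t * 1ℚ *_) (sym (rc-unique {0ℚ + 1ℚ} {1ℚ} 0<1 refl))) (lemma t))) refl
      where
      lemma : ∀ t → t * 1ℚ * 1ℚ ≡ t
      lemma = solve-∀ ring

    -- A finite geometric series with ratio t^d; (1 - t)·S(d) = 1 - t^d turns its denominator into
    -- S(d).
    truncated : ∀ d E → .{{ℕ.NonZero d}} → (1ℚ - t) * Σ₁ E (λ e → t ^ (d ℕ.* e)) ≡ g d - t ^ (d ℕ.* suc E) * rc (S d)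
    truncated d E = begin
      (1ℚ - t) * G                                        ≡⟨ lemma (1ℚ - t) G ⟩
      1ℚ * ((1ℚ - t) * G)                                 ≡⟨ sym (cong (_* ((1ℚ - t) * G)) (rc-inv (0<S d))) ⟩
      S d * rc (S d) * ((1ℚ - t) * G)                     ≡⟨ lemma₂ (S d) (rc (S d)) (1ℚ - t) G ⟩
      (1ℚ - t) * S d * G * rc (S d)                       ≡⟨ cong (λ z → z * G * rc (S d)) (S-geometric d) ⟩
      (1ℚ - t ^ d) * G * rc (S d)                         ≡⟨ cong (_* rc (S d)) (telescope E) ⟩
      (t ^ d - t ^ (d ℕ.* suc E)) * rc (S d)              ≡⟨ lemma₃ (t ^ d) (t ^ (d ℕ.* suc E)) (rc (S d)) ⟩
      g d - t ^ (d ℕ.* suc E) * rc (S d) ∎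
      where
      open ≡-Reasoning
      G = Σ₁ E (λ e → t ^ (d ℕ.* e))
      lemma : ∀ a b → a * b ≡ 1ℚ * (a * b)
      lemma = solve-∀ ring
      lemma₂ : ∀ a b c d → a * b * (c * d) ≡ c * a * d * b
      lemma₂ = solve-∀ ring
      lemma₃ : ∀ a b c → (a - b) * c ≡ a * c - b * c
      lemma₃ = solve-∀ ring
      telescope : ∀ E → (1ℚ - t ^ d) * Σ₁ E (λ e → t ^ (d ℕ.* e)) ≡ t ^ d - t ^ (d ℕ.* suc E)
      telescope zero    = trans (cong ((1ℚ - t ^ d) *_) (Σ₁-0 _)) (trans (*-zeroʳ (1ℚ - t ^ d)) (sym (trans (cong (λ z → t ^ d - t ^ z) (ℕₚ.*-identityʳ d)) (+-inverseʳ (t ^ d)))))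
      telescope (suc E) = trans (cong ((1ℚ - t ^ d) *_) (Σ₁-suc E _)) (trans (*-distribˡ-+ (1ℚ - t ^ d) (Σ₁ E (λ e → t ^ (d ℕ.* e))) (t ^ (d ℕ.* suc E)))
        (trans (cong (_+ (1ℚ - t ^ d) * t ^ (d ℕ.* suc E)) (telescope E)) (trans (lemma₄ (t ^ d) (t ^ (d ℕ.* suc E))) (cong (λ z → t ^ d - z) (trans (sym (^-+ t d (d ℕ.* suc E))) (cong (t ^_) (sym (ℕₚ.*-suc d (suc E)))))))))
        where
        lemma₄ : ∀ a b → a - b + (1ℚ - a) * b ≡ a - a * b
        lemma₄ = solve-∀ ring

    truncation-error : ∀ d E M → .{{ℕ.NonZero d}} → M ℕ.≤ d ℕ.* suc E → ℚ.∣ t ^ (d ℕ.* suc E) * rc (S d) ∣ ≤ t ^ M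
    truncation-error d E M p = ≤-trans (abs* (≡⇒≤ (0≤p⇒∣p∣≡p (^-nonneg (d ℕ.* suc E) 0≤t))) (≡⇒≤ (0≤p⇒∣p∣≡p 0≤y)))
      (≤-trans (*-mono (^-nonneg (d ℕ.* suc E) 0≤t) 0≤1 (^-anti 0≤t t≤1 p) y≤1) (≡⇒≤ (*-identityʳ (t ^ M))))
      where
      0≤y : 0ℚ ≤ rc (S d)
      0≤y = <⇒≤ (rc-pos (0<S d))
      y≤1 : rc (S d) ≤ 1ℚ
      y≤1 = ≤-trans (≡⇒≤ (sym (*-identityˡ (rc (S d))))) (≤-trans (*-monoʳ (rc (S d)) 0≤y (1≤S d)) (≡⇒≤ (rc-inv (0<S d))))

-- A lower bound for L(1, χ) and a heavy square class

module Density where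

  open import Data.Nat as ℕ using (ℕ; zero; suc)
  import Data.Nat.Properties as ℕₚ
  open import Data.Nat.Divisibility using (_∣_; _∣?_; ∣⇒≤)
  open import Data.Nat.Primality using (Prime)
  import Data.Integer as ℤ
  open import Data.Rational using (ℚ; 0ℚ; 1ℚ; ½; _+_; _-_; _*_; -_; _≤_; _<_; _/_; _≤?_)
  import Data.Rational as ℚ
  open import Data.Rational.Properties hiding (_≤?_)
  open import Data.Product using (_×_; ∃)
  open import Data.Sum using (inj₁; inj₂; _⊎_)
  open import Data.Empty using (⊥-elim)
  open import Data.List using ([]; _∷_)
  open import Relation.Nullary using (yes; no; Dec)
  open import Relation.Binary.PropositionalEquality hiding (J)
  open import Tactic.RingSolver using (solve; solve-∀)
  open Rationals
  open Sums
  open Convolution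
  open Mangoldt
  open Residue
  open Selberg
  open Legendre
  open LSeries
  open Dyadic

  bernoulli : ∀ δ n → 0ℚ ≤ δ → δ ≤ 1ℚ → 1ℚ - ι n * δ ≤ (1ℚ - δ) ^ n
  bernoulli δ zero    p q = ≡⇒≤ (lemma δ)
    where
    lemma : ∀ δ → 1ℚ - 0ℚ * δ ≡ 1ℚ
    lemma = solve-∀ ring
  bernoulli δ (suc n) p q = ≤-trans (lemma δ (ι n) p (0≤ι n)) (*-monoˡ (1ℚ - δ) (Δ q) (bernoulli δ n p q))
    where
    lemma : ∀ δ n → 0ℚ ≤ δ → 0ℚ ≤ n → 1ℚ - (1ℚ + n) * δ ≤ (1ℚ - δ) * (1ℚ - n * δ)
    lemma δ n h₁ h₂ = by (h₂ ⊗ (h₁ ⊗ h₁)) (solve (δ ∷ n ∷ []) ring)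

  power-decay : ∀ δ n → 0ℚ ≤ δ → δ ≤ 1ℚ → (1ℚ - δ) ^ n * (1ℚ + ι n * δ) ≤ 1ℚ
  power-decay δ zero    p q = ≡⇒≤ (lemma δ)
    where
    lemma : ∀ δ → 1ℚ * (1ℚ + 0ℚ * δ) ≡ 1ℚ
    lemma = solve-∀ ring
  power-decay δ (suc n) p q = ≤-trans (lemma δ (ι n) ((1ℚ - δ) ^ n) p (0≤ι n) (^-nonneg n (Δ q))) (power-decay δ n p q)
    where
    lemma : ∀ δ n x → 0ℚ ≤ δ → 0ℚ ≤ n → 0ℚ ≤ x → (1ℚ - δ) * x * (1ℚ + (1ℚ + n) * δ) ≤ x * (1ℚ + n * δ)
    lemma δ n x h₁ h₂ h₃ = by (h₃ ⊗ ((h₂ ⊕ 0≤1) ⊗ (h₁ ⊗ h₁))) (solve (δ ∷ n ∷ x ∷ []) ring)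

  module QuadraticL (k : ℕ) (pk : Prime k) (k≢2 : k ≢ 2) where
    open Mod k pk
    open Residues k pk
    open LegendreSymbol k pk k≢2

    χ-values : ∀ a → χ a ≡ 0ℚ ⊎ χ a ≡ 1ℚ ⊎ χ a ≡ - 1ℚ
    χ-values a with χ-value a
    ... | zero-value _ e    = inj₁ e
    ... | square-value _ e  = inj₂ (inj₁ e)
    ... | other-value _ _ e = inj₂ (inj₂ e)

    open DivisorSums χ χ-1 χ-* χ-values

    2k : ℚ
    2k = ι k + ι k

    0≤2k : 0ℚ ≤ 2k
    0≤2k = 0≤ι k ⊕ 0≤ι k

    L : ℕ → ℚ
    L y = Σ₁ y λ n → χ n * v n

    module _ (s : ℚ) (0<s : 0ℚ < s) (s≤1 : s ≤ 1ℚ) (M : ℕ) where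
      open Monsky s 0<s s≤1
      open Dirichlet M

      A : ℚ
      A = Σ₁ M λ n → t ^ n * ρ n

      private
        ρ≡conv : ∀ n → n ∈1‥ M → ρ n ≡ conv χ 𝟏 n
        ρ≡conv n p = sym (trans (conv-comm χ 𝟏 n) (trans (conv-𝟏 χ n p) (Σ₁-extend M n _ (hi p) λ d _ n<d →
          trans (cong (_* χ d) (⟦no⟧ (d ∣? n) λ e → ℕₚ.<⇒≱ n<d (∣⇒≤ {{ℕ.>-nonZero (lo p)}} e))) (*-zeroˡ (χ d)))))

        err : ℕ → ℚ
        err d = t ^ (d ℕ.* suc (M ÷ d)) * rc (S d)

        -- The Lambert rearrangement: expand ρ = χ * 1 and sum over the multiples of each d, a
        -- geometric series cut off at M.
        A-expand : (1ℚ - t) * A ≡ Σ₁ M (λ d → χ d * g d) - Σ₁ M (λ d → χ d * err d)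
        A-expand = begin
          (1ℚ - t) * A
            ≡⟨ cong ((1ℚ - t) *_) (trans (Σ₁-cong M λ n p → cong (t ^ n *_) (ρ≡conv n p)) (sum-conv′ M (t ^_) χ 𝟏 ℕₚ.≤-refl)) ⟩
          (1ℚ - t) * Σ₁ M (λ d → Σ₁ (M ÷ d) λ e → t ^ (d ℕ.* e) * (χ d * 1ℚ))
            ≡⟨ trans (sym (Σ₁-*ˡ M (1ℚ - t) _)) (Σ₁-cong M λ d p → trans (cong ((1ℚ - t) *_) (Σ₁-*ʳ (M ÷ d) (χ d * 1ℚ) _))
                 (trans (lemma (1ℚ - t) (Σ₁ (M ÷ d) λ e → t ^ (d ℕ.* e)) (χ d)) (trans (cong (χ d *_) (truncated d (M ÷ d) {{ℕ.>-nonZero (lo p)}})) (lemma₂ (χ d) (g d) (err d))))) ⟩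
          Σ₁ M (λ d → χ d * g d - χ d * err d)
            ≡⟨ Σ₁-- M _ _ ⟩
          Σ₁ M (λ d → χ d * g d) - Σ₁ M (λ d → χ d * err d) ∎
          where
          open ≡-Reasoning
          lemma : ∀ a b c → a * (b * (c * 1ℚ)) ≡ c * (a * b)
          lemma = solve-∀ ring
          lemma₂ : ∀ a b c → a * (b - c) ≡ a * b - a * c
          lemma₂ = solve-∀ ring

        err-bound : ℚ.∣ Σ₁ M (λ d → χ d * err d) ∣ ≤ ι M * t ^ M
        err-bound = ≤-trans (Σ₁-abs M {g = λ _ → 1ℚ * t ^ M} λ d p → abs* (χ-bound d) (truncation-error d (M ÷ d) M {{ℕ.>-nonZero (lo p)}} (ℕₚ.<⇒≤ (÷-> M d (lo p)))))
          (≡⇒≤ (trans (Σ₁≡sum M _) (trans (sum-const M (1ℚ * t ^ M)) (cong (ι M *_) (*-identityˡ (t ^ M))))))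

        -- As `b` decreases and is nonnegative, it serves as its own potential. Its first value 1 -
        -- t is the same factor that multiplies A, so the comparison is with A - 2k.
        b-bound : ℚ.∣ Σ₁ M (λ d → χ d * b d) ∣ ≤ 2k * (1ℚ - t)
        b-bound = subst (λ z → ℚ.∣ Σ₁ M (λ d → χ d * b d) ∣ ≤ 2k * z) b-1 (Σ₁-abel M χ b b 2k 0≤2k (b-nonneg 1) (χ-partial-from 1)
          (λ { m@(suc _) _ _ → step m }) (λ { m@(suc _) _ → ≡⇒≤ (0≤p⇒∣p∣≡p (b-nonneg m)) }))
          where
          step : ∀ m → .{{ℕ.NonZero m}} → ℚ.∣ b (suc m) - b m ∣ ≤ b m - b (suc m)
          step m = lemma (b (suc m)) (b m) (b-decreasing m)
            where
            lemma : ∀ a c → a ≤ c → ℚ.∣ a - c ∣ ≤ c - a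
            lemma a c h = abs≤ (by (Δ h ⊕ Δ h) (solve (a ∷ c ∷ []) ring)) (≡⇒≤ (solve (a ∷ c ∷ []) ring))

      L-lower : (1ℚ - t) * (A - 2k) - ι M * t ^ M ≤ L M
      L-lower = lemma (1ℚ - t) A 2k (ι M * t ^ M) (L M) (Σ₁ M (λ d → χ d * b d)) (Σ₁ M (λ d → χ d * g d)) (Σ₁ M (λ d → χ d * err d)) split A-expand (-≤abs b-bound) (-≤abs err-bound)
        where
        split : L M ≡ Σ₁ M (λ d → χ d * b d) + Σ₁ M (λ d → χ d * g d)
        split = trans (Σ₁-cong M λ d _ → lemma₀ (χ d) (v d) (g d)) (Σ₁-+ M _ _)
          where
          lemma₀ : ∀ a b c → a * b ≡ a * (b - c) + a * c
          lemma₀ = solve-∀ ring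
        lemma : ∀ x a k m l β γ ε → l ≡ β + γ → x * a ≡ γ - ε → - (k * x) ≤ β → - m ≤ ε → x * (a - k) - m ≤ l
        lemma x a k m l β γ ε refl h₁ h₂ h₃ = by (Δ h₂ ⊕ Δ h₃ ⊕ Δ (≡⇒≤ h₁)) (solve (x ∷ a ∷ k ∷ m ∷ β ∷ γ ∷ ε ∷ []) ring)

      -- Only the squares up to J² are kept; each has ρ ≥ 1 and weight at least t^(J²).
      A-lower : ∀ J → J ℕ.* J ℕ.≤ M → ι J * t ^ (J ℕ.* J) ≤ A
      A-lower J p = ≤-trans (go J ℕₚ.≤-refl) (Σ₁-≤ (J ℕ.* J) M _ p λ n r → nonneg n (lo r))
        where
        nonneg : ∀ n → 1 ℕ.≤ n → 0ℚ ≤ t ^ n * ρ n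
        nonneg n r = ^-nonneg n 0≤t ⊗ ρ-nonneg n r
        go : ∀ i → i ℕ.≤ J → ι i * t ^ (J ℕ.* J) ≤ Σ₁ (i ℕ.* i) (λ n → t ^ n * ρ n)
        go zero    q = ≡⇒≤ (trans (*-zeroˡ (t ^ (J ℕ.* J))) (sym (Σ₁-0 _)))
        go (suc i) q = ≤-trans (≡⇒≤ (lemma (ι i) (t ^ (J ℕ.* J)))) (≤-trans (+-mono-≤ (≤-trans (go i (ℕₚ.<⇒≤ q)) (Σ₁-≤ (i ℕ.* i) (i ℕ.+ i ℕ.* suc i) _ (ℕₚ.≤-trans (ℕₚ.*-monoʳ-≤ i (ℕₚ.n≤1+n i)) (ℕₚ.m≤n+m (i ℕ.* suc i) i)) λ n r → nonneg n (lo r)))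
              (≤-trans (≡⇒≤ (sym (*-identityʳ (t ^ (J ℕ.* J))))) (*-mono (^-nonneg (J ℕ.* J) 0≤t) (≤-trans 0≤1 one) (^-anti 0≤t t≤1 (ℕₚ.*-mono-≤ q q)) one)))
            (≡⇒≤ (sym (Σ₁-suc (i ℕ.+ i ℕ.* suc i) _))))
          where
          one : 1ℚ ≤ ρ (suc i ℕ.* suc i)
          one = ρ-square (suc i) (ℕ.s≤s ℕ.z≤n)
          lemma : ∀ a b → (1ℚ + a) * b ≡ a * b + b
          lemma = solve-∀ ring

    -- With s = 1 - 1/Q, Bernoulli gives t^(J²) ≥ 1 - 2J²/Q = 1/2. Then A ≥ J/2 = 2k + 2, so A - 2k
    -- ≥ 2; since 1 - t ≥ δ, a remainder of at most δ still leaves L(M) ≥ δ.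
    J Q : ℕ
    J = 4 ℕ.* suc k
    Q = 4 ℕ.* (J ℕ.* J)

    instance
      Q≢0 : ℕ.NonZero Q
      Q≢0 = ℕ.>-nonZero (1≤* {4} (ℕ.s≤s ℕ.z≤n) (1≤* {J} (ℕ.s≤s ℕ.z≤n) (ℕ.s≤s ℕ.z≤n)))

    δ : ℚ
    δ = v Q

    0≤δ : 0ℚ ≤ δ
    0≤δ = 0≤v Q

    private
      2δ≤1 : 2ℚ * δ ≤ 1ℚ
      2δ≤1 = ≤-trans (*-monoʳ δ 0≤δ (ι-mono {2} {Q} (ℕₚ.≤-trans (ℕ.s≤s (ℕ.s≤s ℕ.z≤n)) (ℕₚ.m≤m*n 4 (J ℕ.* J))))) (≡⇒≤ (ι*v Q))

      δ≤1 : δ ≤ 1ℚ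
      δ≤1 = v≤1 Q

      s : ℚ
      s = 1ℚ - δ

      0<s : 0ℚ < s
      0<s = <-≤-trans (positive⁻¹ ½) (lemma δ 2δ≤1)
        where
        lemma : ∀ d → 2ℚ * d ≤ 1ℚ → ½ ≤ 1ℚ - d
        lemma d h = by (nonNegative⁻¹ ½ ⊗ Δ h) (solve (d ∷ []) ring)

      s≤1 : s ≤ 1ℚ
      s≤1 = lemma δ 0≤δ
        where
        lemma : ∀ d → 0ℚ ≤ d → 1ℚ - d ≤ 1ℚ
        lemma d h = by h (solve (d ∷ []) ring)

      open Monsky s 0<s s≤1 using (t; t^)

      t-power : 1ℚ ≤ 2ℚ * t ^ (J ℕ.* J)
      t-power = lemma δ (ι (J ℕ.* J)) (ι Q) (s ^ (JJ ℕ.+ JJ)) (t ^ JJ) (≤-trans (≡⇒≤ (cong (λ z → 1ℚ - z * δ) (sym (ι-+ JJ JJ)))) (bernoulli δ (JJ ℕ.+ JJ) 0≤δ δ≤1)) (trans (t^ JJ) (sym (^-+ s JJ JJ))) (ι-* 4 JJ) (ι*v Q)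
        where
        JJ = J ℕ.* J
        lemma : ∀ d j q x y → 1ℚ - (j + j) * d ≤ x → y ≡ x → q ≡ (ℤ.+ 4 / 1) * j → q * d ≡ 1ℚ → 1ℚ ≤ 2ℚ * y
        lemma d j q x y h refl refl e = by (nonNegative⁻¹ 2ℚ ⊗ Δ h ⊕ Δ (≡⇒≤ e)) (solve (d ∷ j ∷ x ∷ []) ring)

      -- From s^M·(1 + Mδ) ≤ 1 one gets (Mδ·s^M)² ≤ 1, that is M·t^M ≤ 1/(Mδ²). This is at most δ
      -- once M ≥ Q³.
      tail : ∀ M → 1 ℕ.≤ M → Q ℕ.* (Q ℕ.* Q) ℕ.≤ M → ι M * t ^ M ≤ δ
      tail M@(suc _) 1≤M p = *-cancel (ι M * (δ * δ)) (*-pos (0<ι M) (*-pos (0<v Q) (0<v Q)))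
        (≤-trans (≤-trans (≡⇒≤ (trans (cong (λ z → ι M * (δ * δ) * (ι M * z)) (t^ M)) (lemma (ι M) δ (s ^ M))))
          (≤-trans (*-mono 0≤x 0≤1 x≤1 x≤1) ≤-refl)) (≤-trans big (≡⇒≤ (lemma₃ (ι M) δ))))
        where
        x = s ^ M * (ι M * δ)
        0≤x : 0ℚ ≤ x
        0≤x = ^-nonneg M (<⇒≤ 0<s) ⊗ (0≤ι M ⊗ 0≤δ)
        x≤1 : x ≤ 1ℚ
        x≤1 = ≤-trans (lemma₂ (s ^ M) (ι M * δ) (^-nonneg M (<⇒≤ 0<s))) (power-decay δ M 0≤δ δ≤1)
          where
          lemma₂ : ∀ a b → 0ℚ ≤ a → a * b ≤ a * (1ℚ + b)
          lemma₂ a b h = by h (solve (a ∷ b ∷ []) ring)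
        lemma : ∀ m d x → m * (d * d) * (m * (x * x)) ≡ x * (m * d) * (x * (m * d))
        lemma = solve-∀ ring
        lemma₃ : ∀ m d → m * (d * d * d) ≡ m * (d * d) * d
        lemma₃ = solve-∀ ring
        big : 1ℚ * 1ℚ ≤ ι M * (δ * δ * δ)
        big = ≤-trans (≡⇒≤ (sym (trans (cong (_* (δ * δ * δ)) (trans (ι-* Q (Q ℕ.* Q)) (cong (ι Q *_) (ι-* Q Q)))) (trans (lemma₄ (ι Q) δ) (cong (λ z → z * (z * z)) (ι*v Q))))))
          (*-monoʳ (δ * δ * δ) (0≤δ ⊗ 0≤δ ⊗ 0≤δ) (ι-mono p))
          where
          lemma₄ : ∀ q d → q * (q * q) * (d * d * d) ≡ q * d * (q * d * (q * d))
          lemma₄ = solve-∀ ring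

    L-positive : ∀ M → 1 ℕ.≤ M → J ℕ.* J ℕ.≤ M → Q ℕ.* (Q ℕ.* Q) ℕ.≤ M → δ ≤ L M
    L-positive M 1≤M p q = ≤-trans (lemma δ (A s 0<s s≤1 M) (ι k) (ι J) (t ^ (J ℕ.* J)) (ι M * t ^ M) (A-lower s 0<s s≤1 M J p) t-power (ι-* 4 (suc k)) (tail M 1≤M q) 0≤δ δ≤1 (0≤ι J)) (L-lower s 0<s s≤1 M)
      where
      lemma : ∀ d a k j x m → j * x ≤ a → 1ℚ ≤ 2ℚ * x → j ≡ (ℤ.+ 4 / 1) * (1ℚ + k) → m ≤ d → 0ℚ ≤ d → d ≤ 1ℚ → 0ℚ ≤ j →
        d ≤ (1ℚ - (1ℚ - d) * (1ℚ - d)) * (a - (k + k)) - m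
      lemma d a k j x m h₁ h₂ refl h₄ h₅ h₆ h₇ = by
        (Δ h₄ ⊕ (h₅ ⊗ (0≤1 ⊕ Δ h₆)) ⊗ (Δ h₁ ⊕ h₇ ⊗ (nonNegative⁻¹ ½ ⊗ Δ h₂)) ⊕ nonNegative⁻¹ 2ℚ ⊗ (h₅ ⊗ Δ h₆)) (solve (d ∷ a ∷ k ∷ x ∷ m ∷ []) ring)

    module PrimeSums {X : ℕ} (1≤X : 1 ℕ.≤ X) (Lg : Log X) where
      open Log Lg
      open LogLemmas Lg
      open vonMangoldt Lg
      open Dirichlet X hiding (δ)
      open DyadicSums 1≤X Lg k pk

      Ξ : ℕ → ℚ
      Ξ y = Σ₁ y λ n → χ n * (Λ n * v n)

      private
        f-sum : ∀ y → y ℕ.≤ X → ℚ.∣ Σ₁ y (λ n → χ n * (f n * v n)) ∣ ≤ 2k * (ℤ.+ 4 / 1)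
        f-sum y p = subst (λ z → ℚ.∣ Σ₁ y (λ n → χ n * (f n * v n)) ∣ ≤ 2k * z) pot1 (Σ₁-abel y χ (λ n → f n * v n) pot 2k 0≤2k (≤-trans (nonNegative⁻¹ (ℤ.+ 4 / 1)) (≡⇒≤ (sym pot1))) (χ-partial-from 1)
            (λ { m@(suc _) 1≤m m<y → potential¹ (f m) (f (suc m)) (v m) (v (suc m)) (f-nonneg (1≤m ﹐ ℕₚ.≤-trans (ℕₚ.<⇒≤ m<y) p)) (f-step m 1≤m (ℕₚ.<-≤-trans m<y p)) (0≤v (suc m)) (0≤v m) (v-anti (ℕₚ.n≤1+n m)) (v-step m) })
            (λ { m@(suc _) m∈ → dominate (f m) (v m) (f-nonneg (lo m∈ ﹐ ℕₚ.≤-trans (hi m∈) p)) (0≤v m) }))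
          where
          pot : ℕ → ℚ
          pot m = (f m + (ℤ.+ 4 / 1)) * v m
          pot1 : pot 1 ≡ ℤ.+ 4 / 1
          pot1 = cong₂ (λ a b → (a + (ℤ.+ 4 / 1)) * b) f-1 v1
          dominate : ∀ a x → 0ℚ ≤ a → 0ℚ ≤ x → ℚ.∣ a * x ∣ ≤ (a + (ℤ.+ 4 / 1)) * x
          dominate a x h₁ h₂ = abs≤ (by (nonNegative⁻¹ (ℤ.+ 4 / 1) ⊗ h₂) (solve (a ∷ x ∷ []) ring)) (by (nonNegative⁻¹ 2ℚ ⊗ (h₁ ⊗ h₂) ⊕ nonNegative⁻¹ (ℤ.+ 4 / 1) ⊗ h₂) (solve (a ∷ x ∷ []) ring))

        f-sum-expand : ∀ y → y ℕ.≤ X → Σ₁ y (λ n → χ n * (f n * v n)) ≡ Σ₁ y λ a → χ a * (Λ a * v a) * L (y ÷ a)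
        f-sum-expand y p = trans (Σ₁-cong y λ n r → trans (cong (λ z → χ n * (z * v n)) (trans (sym (conv-𝟏-Λ n (lo r ﹐ ℕₚ.≤-trans (hi r) p))) (conv-comm 𝟏 Λ n))) (lemma (χ n) (conv Λ 𝟏 n) (v n)))
          (trans (sum-conv′ y (λ n → χ n * v n) Λ 𝟏 p) (Σ₁-cong y λ a r → trans (Σ₁-cong (y ÷ a) λ b r′ → trans (cong₂ (λ x z → x * z * (Λ a * 1ℚ)) (χ-* a b) (v-* a b {{ℕ.>-nonZero (lo r)}} {{ℕ.>-nonZero (lo r′)}}))
            (lemma₂ (χ a) (χ b) (v a) (v b) (Λ a))) (Σ₁-*ˡ (y ÷ a) (χ a * (Λ a * v a)) _)))
          where
          lemma : ∀ a b c → a * (b * c) ≡ a * c * b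
          lemma = solve-∀ ring
          lemma₂ : ∀ a b x z l → a * b * (x * z) * (l * 1ℚ) ≡ a * (l * x) * (b * z)
          lemma₂ = solve-∀ ring

        L-tail : ∀ Y n → ℚ.∣ L (Y ℕ.+ n) - L Y ∣ ≤ 2k * v (suc Y)
        L-tail Y zero    = ≤-trans (≡⇒≤ (cong ℚ.∣_∣ (trans (cong (λ z → L z - L Y) (ℕₚ.+-identityʳ Y)) (+-inverseʳ (L Y))))) (0≤2k ⊗ 0≤v (suc Y))
        L-tail Y (suc n) = ≤-trans (≡⇒≤ (cong ℚ.∣_∣ (trans (cong (_- L Y) (Σ₁-split Y (suc n) _)) (trans (lemma (L Y) (Σ₁ (suc n) (λ i → χ (Y ℕ.+ i) * v (Y ℕ.+ i))))
            (trans (Σ₁≡sum (suc n) _) (sum-cong (suc n) λ i _ → cong (λ z → χ z * v z) (ℕₚ.+-suc Y i)))))))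
          (subst (λ z → ℚ.∣ sum (suc n) (λ i → χ (suc Y ℕ.+ i) * v (suc Y ℕ.+ i)) ∣ ≤ 2k * v z) (cong suc (ℕₚ.+-identityʳ Y))
            (abel n (λ i → χ (suc Y ℕ.+ i)) w w 2k 0≤2k (λ i _ → χ-partial-from (suc Y) i) (λ i _ → step i) (≡⇒≤ (0≤p⇒∣p∣≡p (0≤v (suc Y ℕ.+ n))))))
          where
          w : ℕ → ℚ
          w i = v (suc Y ℕ.+ i)
          lemma : ∀ a b → a + b - a ≡ b
          lemma = solve-∀ ring
          step : ∀ i → ℚ.∣ w (suc i) - w i ∣ ≤ w i - w (suc i)
          step i = lemma₂ (w (suc i)) (w i) (v-anti (ℕₚ.+-monoʳ-≤ (suc Y) (ℕₚ.n≤1+n i)))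
            where
            lemma₂ : ∀ a c → a ≤ c → ℚ.∣ a - c ∣ ≤ c - a
            lemma₂ a c h = abs≤ (by (Δ h ⊕ Δ h) (solve (a ∷ c ∷ []) ring)) (≡⇒≤ (solve (a ∷ c ∷ []) ring))

        L-near : ∀ y a → a ∈1‥ y → ℚ.∣ L y - L (y ÷ a) ∣ ≤ 2k * (ι a * v y)
        L-near zero      a r = ⊥-elim (ℕₚ.<-irrefl refl (ℕₚ.≤-trans (lo r) (hi r)))
        L-near y@(suc _) a r = ≤-trans (subst (λ z → ℚ.∣ L z - L (y ÷ a) ∣ ≤ 2k * v (suc (y ÷ a))) (ℕₚ.m+[n∸m]≡n (÷-≤y y a (lo r))) (L-tail (y ÷ a) (y ℕ.∸ y ÷ a)))
          (*-monoˡ 2k 0≤2k (≤-trans (≡⇒≤ (sym (*-identityˡ (v (suc (y ÷ a)))))) (v≤ (suc (y ÷ a)) {ι a * v y} {1ℚ} (≤-trans (≡⇒≤ (sym (ι*v y)))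
            (≤-trans (*-monoʳ (v y) (0≤v y) (≤-trans (ι-mono (ℕₚ.<⇒≤ (÷-> y a (lo r)))) (≡⇒≤ (ι-* a (suc (y ÷ a)))))) (≡⇒≤ (lemma (ι a) (ι (suc (y ÷ a))) (v y))))))))
          where
          lemma : ∀ a b c → a * b * c ≡ b * (a * c)
          lemma = solve-∀ ring

        -- Write f = Λ * 1 in the bounded sum Σ χ(n)f(n)/n, so that L(y ÷ a) appears. Replacing it
        -- by L(y) costs 2k·a/y for each a, which sums to 2k·ψ(y)/y ≤ 6·2k; with the 4 of `f-sum`
        -- this makes 10.
        L*Ξ : ∀ w → 2 ℕ.^ w ℕ.≤ X → ℚ.∣ L (2 ℕ.^ w) * Ξ (2 ℕ.^ w) ∣ ≤ 2k * (ℤ.+ 10 / 1)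
        L*Ξ w p = ≤-trans (≡⇒≤ (cong ℚ.∣_∣ split)) (≤-trans (abs+ (f-sum y p) rest) (≡⇒≤ (lemma₁ 2k)))
          where
          y = 2 ℕ.^ w
          instance
            y≢0 : ℕ.NonZero y
            y≢0 = ℕₚ.m^n≢0 2 w
          D : ℕ → ℚ
          D a = χ a * (Λ a * v a) * (L y - L (y ÷ a))
          lemma₁ : ∀ c → c * (ℤ.+ 4 / 1) + c * (ℤ.+ 6 / 1) ≡ c * (ℤ.+ 10 / 1)
          lemma₁ = solve-∀ ring
          lemma₂ : ∀ a x z → x * a ≡ a * z + a * (x - z)
          lemma₂ = solve-∀ ring
          split : L y * Ξ y ≡ Σ₁ y (λ n → χ n * (f n * v n)) + Σ₁ y D
          split = trans (sym (Σ₁-*ˡ y (L y) _)) (trans (Σ₁-cong y λ a _ → lemma₂ (χ a * (Λ a * v a)) (L y) (L (y ÷ a))) (trans (Σ₁-+ y _ _) (cong (_+ Σ₁ y D) (sym (f-sum-expand y p)))))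
          rest : ℚ.∣ Σ₁ y D ∣ ≤ 2k * (ℤ.+ 6 / 1)
          rest = ≤-trans (Σ₁-abs y {g = λ a → Λ a * (2k * v y)} λ a r → ≤-trans (abs* (abs* (χ-bound a) (≡⇒≤ (0≤p⇒∣p∣≡p (0≤Λv a (lo r))))) (L-near y a r))
              (≡⇒≤ (trans (lemma₃ (Λ a) (v a) (ι a) 2k (v y)) (trans (cong (λ z → Λ a * (2k * v y) * z) (ι*v a {{ℕ.>-nonZero (lo r)}})) (*-identityʳ (Λ a * (2k * v y)))))))
            (≤-trans (≡⇒≤ (Σ₁-*ʳ y (2k * v y) Λ)) (≤-trans (*-monoʳ (2k * v y) (0≤2k ⊗ 0≤v y) (chebyshev w p)) (≡⇒≤ (trans (lemma₄ (ι y) 2k (v y)) (trans (cong (2k * (ℤ.+ 6 / 1) *_) (ι*v y)) (*-identityʳ (2k * (ℤ.+ 6 / 1))))))))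
            where
            lemma₃ : ∀ l x a c z → 1ℚ * (l * x) * (c * (a * z)) ≡ l * (c * z) * (a * x)
            lemma₃ = solve-∀ ring
            lemma₄ : ∀ y c z → (ℤ.+ 6 / 1) * y * (c * z) ≡ c * (ℤ.+ 6 / 1) * (y * z)
            lemma₄ = solve-∀ ring

      CΞ : ℚ
      CΞ = 2k * (ℤ.+ 10 / 1) * ι Q

      Ξ-bound : ∀ w → 2 ℕ.^ w ℕ.≤ X → Q ℕ.* (Q ℕ.* Q) ℕ.≤ 2 ℕ.^ w → - CΞ ≤ Ξ (2 ℕ.^ w)
      Ξ-bound w p q = lemma (L y) (Ξ y) δ (ι Q) (2k * (ℤ.+ 10 / 1)) (L-positive y (ℕₚ.m^n>0 2 w) JJ≤ q) (-≤abs (L*Ξ w p)) (ι*v Q) (0≤ι Q) 0≤δ (0≤2k ⊗ nonNegative⁻¹ (ℤ.+ 10 / 1))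
        where
        y = 2 ℕ.^ w
        JJ≤ : J ℕ.* J ℕ.≤ y
        JJ≤ = ℕₚ.≤-trans (ℕₚ.m≤n*m (J ℕ.* J) 4) (ℕₚ.≤-trans (ℕₚ.m≤m*n Q (Q ℕ.* Q) {{ℕₚ.m*n≢0 Q Q}}) q)
        lemma : ∀ l x d q c → d ≤ l → - c ≤ l * x → q * d ≡ 1ℚ → 0ℚ ≤ q → 0ℚ ≤ d → 0ℚ ≤ c → - (c * q) ≤ x
        lemma l x d q c h₁ h₂ h₃ h₄ h₅ h₆ with ≤-total 0ℚ x
        ... | inj₁ p = ≤-trans (by (h₆ ⊗ h₄) (solve (c ∷ q ∷ []) ring)) p
        ... | inj₂ p = by (h₄ ⊗ (Δ h₂ ⊕ Δ h₁ ⊗ Δ p) ⊕ Δ p ⊗ Δ (≡⇒≤ (sym h₃))) (solve (l ∷ x ∷ d ∷ q ∷ c ∷ []) ring)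

      private
        Ξ-classes : ∀ w → Σ₁ φk (λ u → χ u * sum w (q u)) ≡ Ξ (2 ℕ.^ w)
        Ξ-classes w = trans (Σ₁-cong φk λ u _ → trans (cong (χ u *_) (sym (mass-sum u w))) (sym (Σ₁-*ˡ (2 ℕ.^ w) (χ u) _))) (trans (Σ₁-swap φk (2 ℕ.^ w) _) (Σ₁-cong (2 ℕ.^ w) λ n _ →
            trans (Σ₁-cong φk λ u _ → lemma (χ u) (e u n) (Λ n * v n)) (trans (Σ₁-*ʳ φk (Λ n * v n) (λ u → e u n * χ u)) (cong (_* (Λ n * v n)) (pick n (k ∣? n))))))
          where
          lemma : ∀ a b c → a * (b * c) ≡ b * a * c
          lemma = solve-∀ ring
          pick : ∀ n → Dec (k ∣ n) → Σ₁ φk (λ u → e u n * χ u) ≡ χ n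
          pick n (yes d) = trans (Σ₁-zero φk λ u r → trans (cong (_* χ u) (⟦no⟧ (n ℕ.% k ℕ.≟ u) λ eq → ℕₚ.<⇒≢ (lo r) (trans (sym (∣⇒%≡0 d)) eq))) (*-zeroˡ (χ u))) (sym (χ-zero d))
          pick n (no d)  = trans (Σ₁-δ φk (n ℕ.% k) χ (lo (class-of d))) (trans (cong (_* χ (n ℕ.% k)) (⟦yes⟧ (n ℕ.% k ℕ.≤? φk) (hi (class-of d)))) (trans (*-identityˡ (χ (n ℕ.% k))) (χ-cong {n ℕ.% k} {n} (%≈ n))))

        -- A class u is hit by 1 + χ(u) values of x, so the excess of the squares over the total is
        -- Σ χ(u)P(u), which is `Ξ`.
        squares-total : ∀ w → Σ₁ φk (λ x → sum w (q ((x ℕ.* x) ℕ.% k))) ≡ Σ₁ φk (λ u → sum w (q u)) + Ξ (2 ℕ.^ w)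
        squares-total w = begin
          Σ₁ φk (λ x → P ((x ℕ.* x) ℕ.% k))
            ≡⟨ (Σ₁-cong φk λ x r → sym (trans (Σ₁-δ φk ((x ℕ.* x) ℕ.% k) P (lo (sq r))) (trans (cong (_* P ((x ℕ.* x) ℕ.% k)) (⟦yes⟧ ((x ℕ.* x) ℕ.% k ℕ.≤? φk) (hi (sq r)))) (*-identityˡ (P ((x ℕ.* x) ℕ.% k)))))) ⟩
          Σ₁ φk (λ x → Σ₁ φk λ u → ⟦ (x ℕ.* x) ℕ.% k ℕ.≟ u ⟧ * P u)
            ≡⟨ Σ₁-swap φk φk _ ⟩
          Σ₁ φk (λ u → Σ₁ φk λ x → ⟦ (x ℕ.* x) ℕ.% k ℕ.≟ u ⟧ * P u)
            ≡⟨ (Σ₁-cong φk λ u r → trans (Σ₁-*ʳ φk (P u) _) (trans (cong (_* P u) (trans (Σ₁-cong φk λ x _ → cong (λ z → ⟦ (x ℕ.* x) ℕ.% k ℕ.≟ z ⟧) (sym (small (class< r)))) (roots-χ u r))) (lemma (χ u) (P u)))) ⟩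
          Σ₁ φk (λ u → P u + χ u * P u)
            ≡⟨ trans (Σ₁-+ φk _ _) (cong (Σ₁ φk P +_) (Ξ-classes w)) ⟩
          Σ₁ φk P + Ξ (2 ℕ.^ w) ∎
          where
          open ≡-Reasoning
          P : ℕ → ℚ
          P u = sum w (q u)
          sq : ∀ {x} → x ∈1‥ φk → (x ℕ.* x) ℕ.% k ∈1‥ φk
          sq r = class-of (∤-* (class-unit r) (class-unit r))
          lemma : ∀ a b → (1ℚ + a) * b ≡ b + a * b
          lemma = solve-∀ ring
          roots-χ : ∀ u → u ∈1‥ φk → roots u ≡ 1ℚ + χ u
          roots-χ u r = trans (lemma₂ (roots u)) (cong (λ z → 1ℚ + (roots u + z - 1ℚ)) (sym (⟦no⟧ (k ∣? u) (class-unit r))))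
            where
            lemma₂ : ∀ a → a ≡ 1ℚ + (a + 0ℚ - 1ℚ)
            lemma₂ = solve-∀ ring

      -- The average of the masses over all squares is at least (w - 6 - CΞ)/n, so some square
      -- reaches the slightly smaller bound with 7; the difference supplies the contradiction when
      -- the search fails.
      heavy-square : ∀ w → 2 ℕ.^ w ℕ.≤ X → Q ℕ.* (Q ℕ.* Q) ℕ.≤ 2 ℕ.^ w → ι w - (ℤ.+ 6 / 1) ≤ Σ₁ φk (λ u → sum w (q u)) →
        ∃ λ g → g ∈1‥ φk × ι w - (ℤ.+ 7 / 1) - CΞ ≤ ι φk * sum w (q ((g ℕ.* g) ℕ.% k))
      heavy-square w p r total with search (λ g → ι w - (ℤ.+ 7 / 1) - CΞ ≤? ι φk * sum w (q ((g ℕ.* g) ℕ.% k))) φk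
      ... | inj₁ found = found
      ... | inj₂ none  = ⊥-elim (<-irrefl refl (<-≤-trans (0<ι φk {{φk≢0}}) (lemma (ι φk) Z (ι w) CΞ (Σ₁ φk (λ u → sum w (q u))) (Ξ (2 ℕ.^ w)) total (Ξ-bound w p r) (squares-total w) each (0≤ι φk))))
        where
        φk≢0 : ℕ.NonZero φk
        φk≢0 = ℕ.>-nonZero (ℕₚ.≤-pred (ℕₚ.≤-trans 1<k (ℕₚ.≤-reflexive (sym sucφk))))
        Z : ℚ
        Z = Σ₁ φk (λ x → sum w (q ((x ℕ.* x) ℕ.% k)))
        each : ι φk * Z ≤ ι φk * (ι w - (ℤ.+ 7 / 1) - CΞ)
        each = ≤-trans (≡⇒≤ (sym (Σ₁-*ˡ φk (ι φk) _))) (≤-trans (Σ₁-mono φk {g = λ _ → ι w - (ℤ.+ 7 / 1) - CΞ} λ x s → <⇒≤ (≰⇒> (none x s))) (≡⇒≤ (trans (Σ₁≡sum φk _) (sum-const φk (ι w - (ℤ.+ 7 / 1) - CΞ)))))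
        lemma : ∀ n z w c s x → w - (ℤ.+ 6 / 1) ≤ s → - c ≤ x → z ≡ s + x → n * z ≤ n * (w - (ℤ.+ 7 / 1) - c) → 0ℚ ≤ n → n ≤ 0ℚ
        lemma n z w c s x h₁ h₂ refl h₃ h₄ = by (h₄ ⊗ Δ h₁ ⊕ h₄ ⊗ Δ h₂ ⊕ Δ h₃) (solve (n ∷ w ∷ c ∷ s ∷ x ∷ []) ring)

-- Choice of parameters and primes in every unit class

module Progressions where

  open import Data.Nat as ℕ using (ℕ; zero; suc)
  import Data.Nat.Properties as ℕₚ
  open import Data.Nat.Divisibility using (_∣_)
  open import Data.Nat.Primality using (Prime; prime?)
  open import Data.Nat.Solver using (module +-*-Solver)
  import Data.Integer as ℤ
  import Data.Integer.Properties as ℤₚ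
  import Data.Rational.Unnormalised as ℚᵘ
  import Data.Rational.Unnormalised.Properties as ℚᵘₚ
  open import Data.Rational using (ℚ; mkℚ; 0ℚ; 1ℚ; _+_; _-_; _*_; -_; _≤_; _<_; _/_; ∣_∣; toℚᵘ)
  open import Data.Rational.Properties
  open import Data.Product using (_,_; _×_; ∃; proj₁; proj₂)
  open import Data.Sum using (inj₁; inj₂; _⊎_)
  open import Data.Empty using (⊥; ⊥-elim)
  open import Data.List using ([]; _∷_)
  open import Relation.Nullary using (¬_)
  open import Relation.Nullary.Decidable using (_×-dec_)
  open import Relation.Binary.PropositionalEquality
  open import Tactic.RingSolver using (solve; solve-∀)
  open Rationals
  open Sums
  open Convolution
  open Mangoldt
  open Residue
  open Selberg
  open Legendre
  open Logarithm
  open Dyadic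
  open Density

  archimedean : ∀ r → ∃ λ m → r ≤ ι m
  archimedean r@(mkℚ p d _) = ℤ.∣ p ∣ , toℚᵘ-cancel-≤ (ℚᵘₚ.≤-respʳ-≃ (ℚᵘₚ.≃-sym (ι-ᵘ ℤ.∣ p ∣)) (ℚᵘ.*≤* (ℤₚ.≤-trans (ℤₚ.≤-reflexive (ℤₚ.*-identityʳ p)) (≤-multiple p))))
    where
    ι-ᵘ : ∀ n → toℚᵘ (ι n) ℚᵘ.≃ ℚᵘ.mkℚᵘ (ℤ.+ n) 0
    ι-ᵘ zero    = ℚᵘₚ.≃-refl
    ι-ᵘ (suc n) = ℚᵘₚ.≃-trans (toℚᵘ-homo-+ 1ℚ (ι n)) (ℚᵘₚ.≃-trans (ℚᵘₚ.+-congʳ (toℚᵘ 1ℚ) (ι-ᵘ n))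
      (ℚᵘ.*≡* (cong (ℤ._* ℤ.+ 1) (cong (λ z → ℤ.+ 1 ℤ.+ z) (ℤₚ.*-identityʳ (ℤ.+ n))))))
    ≤-multiple : ∀ p → p ℤ.≤ ℤ.+ ℤ.∣ p ∣ ℤ.* ℤ.+ suc d
    ≤-multiple (ℤ.+ n)      = ℤₚ.≤-trans (ℤ.+≤+ (ℕₚ.m≤m*n n (suc d))) (ℤₚ.≤-reflexive (ℤₚ.pos-* n (suc d)))
    ≤-multiple (ℤ.-[1+ n ]) = ℤₚ.≤-trans ℤ.-≤+ (ℤₚ.≤-reflexive (ℤₚ.pos-* (suc n) (suc d)))

  dominate : ∀ r₁ r₂ b → ∃ λ m → 1 ℕ.≤ m × (r₁ ≤ ι m) × (r₂ ≤ ι m) × b ℕ.≤ m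
  dominate r₁ r₂ b = combine (archimedean r₁) (archimedean r₂)
    where
    combine : (∃ λ m → r₁ ≤ ι m) → (∃ λ m → r₂ ≤ ι m) → ∃ λ m → 1 ℕ.≤ m × (r₁ ≤ ι m) × (r₂ ≤ ι m) × b ℕ.≤ m
    combine (m₁ , p₁) (m₂ , p₂) = suc (m₁ ℕ.+ (m₂ ℕ.+ b)) , ℕ.s≤s ℕ.z≤n
      , ≤-trans p₁ (ι-mono (ℕₚ.m≤n⇒m≤1+n (ℕₚ.m≤m+n m₁ (m₂ ℕ.+ b))))
      , ≤-trans p₂ (ι-mono (ℕₚ.m≤n⇒m≤1+n (ℕₚ.≤-trans (ℕₚ.m≤m+n m₂ b) (ℕₚ.m≤n+m (m₂ ℕ.+ b) m₁))))
      , ℕₚ.m≤n⇒m≤1+n (ℕₚ.≤-trans (ℕₚ.m≤n+m b m₂) (ℕₚ.m≤n+m (m₂ ℕ.+ b) m₁))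

  -- W, E and Ω are the error terms W, E′ and Ω of Tauberian, with x = M, y = 1/M and T* = M²; they are bounded by powers of x.
  module Sizes (x y n B D : ℚ) (xy : x * y ≡ 1ℚ) (1≤x : 1ℚ ≤ x) (0≤y : 0ℚ ≤ y) (0≤n : 0ℚ ≤ n) (0≤B : 0ℚ ≤ B) (0≤D : 0ℚ ≤ D) where

    4ℚ 64ℚ : ℚ
    4ℚ  = ℤ.+ 4 / 1
    64ℚ = ℤ.+ 64 / 1

    T W E Ω E₁ Ω₀ C η : ℚ
    T  = x * x
    W  = 2ℚ * (D * (T + 1ℚ)) + T
    E  = W * y + n * (x + B)
    Ω  = T + 2ℚ * (B * T) + E * (T + B) + D * (T + 1ℚ)
    E₁ = 4ℚ * D + 1ℚ + n + n * B
    Ω₀ = 1ℚ + 2ℚ * B + E₁ * (1ℚ + B) + 2ℚ * D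
    -- `C` majorises the coefficients needed for the three smallness conditions. As z = 8y² enters
    -- squared and x³·y⁴ = y, a bound C·x³ turns into 64·C·y.
    C  = n * (n * B) + n * Ω₀ + (1ℚ + E₁ + 2ℚ * D) + n * B
    η  = 64ℚ * (C * y)

    0≤x : 0ℚ ≤ x
    0≤x = ≤-trans 0≤1 1≤x

    0≤E₁ : 0ℚ ≤ E₁
    0≤E₁ = nonNegative⁻¹ 4ℚ ⊗ 0≤D ⊕ 0≤1 ⊕ 0≤n ⊕ 0≤n ⊗ 0≤B

    0≤Ω₀ : 0ℚ ≤ Ω₀
    0≤Ω₀ = 0≤1 ⊕ nonNegative⁻¹ 2ℚ ⊗ 0≤B ⊕ 0≤E₁ ⊗ (0≤1 ⊕ 0≤B) ⊕ nonNegative⁻¹ 2ℚ ⊗ 0≤D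

    0≤C : 0ℚ ≤ C
    0≤C = 0≤n ⊗ (0≤n ⊗ 0≤B) ⊕ 0≤n ⊗ 0≤Ω₀ ⊕ (0≤1 ⊕ 0≤E₁ ⊕ nonNegative⁻¹ 2ℚ ⊗ 0≤D) ⊕ 0≤n ⊗ 0≤B

    0≤η : 0ℚ ≤ η
    0≤η = nonNegative⁻¹ 64ℚ ⊗ (0≤C ⊗ 0≤y)

    E≤ : E ≤ E₁ * x
    E≤ = lemma x y n B D xy 1≤x 0≤x 0≤y 0≤n 0≤B 0≤D
      where
      lemma : ∀ x y n B D → x * y ≡ 1ℚ → 1ℚ ≤ x → 0ℚ ≤ x → 0ℚ ≤ y → 0ℚ ≤ n → 0ℚ ≤ B → 0ℚ ≤ D →
        (2ℚ * (D * (x * x + 1ℚ)) + x * x) * y + n * (x + B) ≤ (4ℚ * D + 1ℚ + n + n * B) * x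
      lemma x y n B D e h₁ h₀ h₂ h₃ h₄ h₅ = by
        ((nonNegative⁻¹ 4ℚ ⊗ h₅ ⊕ 0≤1) ⊗ (h₀ ⊗ Δ (≡⇒≤ e)) ⊕ h₃ ⊗ h₄ ⊗ Δ h₁ ⊕ nonNegative⁻¹ 2ℚ ⊗ (h₅ ⊗ h₂) ⊗ (Δ h₁ ⊗ (h₀ ⊕ 0≤1))) (solve (x ∷ y ∷ n ∷ B ∷ D ∷ []) ring)

    x³ : ℚ
    x³ = x * (x * x)

    Ω≤ : Ω ≤ Ω₀ * x³
    Ω≤ = lemma x B D E E₁ E≤ 1≤x 0≤x 0≤B 0≤D 0≤E₁
      where
      lemma : ∀ x B D E E₁ → E ≤ E₁ * x → 1ℚ ≤ x → 0ℚ ≤ x → 0ℚ ≤ B → 0ℚ ≤ D → 0ℚ ≤ E₁ →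
        x * x + 2ℚ * (B * (x * x)) + E * (x * x + B) + D * (x * x + 1ℚ) ≤ (1ℚ + 2ℚ * B + E₁ * (1ℚ + B) + 2ℚ * D) * (x * (x * x))
      lemma x B D E E₁ h₁ h₂ h₀ h₃ h₄ h₅ = by
        ((0≤1 ⊕ nonNegative⁻¹ 2ℚ ⊗ h₃) ⊗ (h₀ ⊗ h₀ ⊗ Δ h₂) ⊕ Δ h₁ ⊗ (h₀ ⊗ h₀ ⊕ h₃) ⊕ h₅ ⊗ h₃ ⊗ (h₀ ⊗ (Δ h₂ ⊗ (h₀ ⊕ 0≤1)))
          ⊕ h₄ ⊗ (h₀ ⊗ h₀ ⊗ Δ h₂ ⊕ Δ h₂ ⊗ (h₀ ⊗ h₀ ⊕ h₀ ⊕ 0≤1))) (solve (x ∷ B ∷ D ∷ E ∷ E₁ ∷ []) ring)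

    module _ (z w₄ : ℚ) (z≡ : z ≡ (ℤ.+ 8 / 1) * (y * y)) (0≤w₄ : 0ℚ ≤ w₄) (w₄≤ : w₄ ≤ x * x) where

      private
        cubes : ∀ a → a ≤ C → a * x³ * (z * z) ≤ η
        cubes a h = ≤-trans (*-monoʳ (z * z) 0≤zz (*-monoʳ x³ (0≤x ⊗ (0≤x ⊗ 0≤x)) h)) (≡⇒≤ (trans (cong (λ z → C * x³ * (z * z)) z≡) (trans (lemma C x y) (trans (cong (λ e → 64ℚ * (C * y) * (e * (e * e))) xy) (*-identityʳ η)))))
          where
          0≤zz : 0ℚ ≤ z * z
          0≤zz = 0≤² z
          lemma : ∀ c x y → c * (x * (x * x)) * ((ℤ.+ 8 / 1) * (y * y) * ((ℤ.+ 8 / 1) * (y * y))) ≡ 64ℚ * (c * y) * (x * y * (x * y * (x * y)))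
          lemma = solve-∀ ring

        scale : ∀ {a b} → a ≤ b * x³ → b ≤ C → a * (z * z) ≤ η
        scale {a} {b} h h′ = ≤-trans (*-monoʳ (z * z) (0≤² z) h) (cubes b h′)

      Θ-small : (n * (n * (T * B)) + n * Ω) * (z * z) ≤ η
      Θ-small = scale {b = n * (n * B) + n * Ω₀} (lemma x n B Ω Ω₀ Ω≤ 1≤x 0≤x 0≤n 0≤B) (by ((0≤1 ⊕ 0≤E₁ ⊕ nonNegative⁻¹ 2ℚ ⊗ 0≤D) ⊕ 0≤n ⊗ 0≤B) (lemma₂ (n * (n * B) + n * Ω₀) (1ℚ + E₁ + 2ℚ * D) (n * B)))
        where
        lemma : ∀ x n B Ω Ω₀ → Ω ≤ Ω₀ * (x * (x * x)) → 1ℚ ≤ x → 0ℚ ≤ x → 0ℚ ≤ n → 0ℚ ≤ B → n * (n * (x * x * B)) + n * Ω ≤ (n * (n * B) + n * Ω₀) * (x * (x * x))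
        lemma x n B Ω Ω₀ h₁ h₂ h₀ h₃ h₄ = by (h₃ ⊗ Δ h₁ ⊕ h₃ ⊗ (h₃ ⊗ h₄) ⊗ (h₀ ⊗ h₀ ⊗ Δ h₂)) (solve (x ∷ n ∷ B ∷ Ω ∷ Ω₀ ∷ []) ring)
        lemma₂ : ∀ a b c → b + c ≡ a + b + c - a
        lemma₂ = solve-∀ ring

      square-small : (w₄ * (1ℚ + E) + D * (w₄ + 1ℚ)) * (z * z) ≤ η
      square-small = scale {b = 1ℚ + E₁ + 2ℚ * D} (lemma x w₄ D E E₁ E≤ 1≤x 0≤x w₄≤ 0≤D 0≤w₄ 0≤E₁) (by (0≤n ⊗ (0≤n ⊗ 0≤B) ⊕ 0≤n ⊗ 0≤Ω₀ ⊕ 0≤n ⊗ 0≤B) (lemma₂ (n * (n * B) + n * Ω₀) (1ℚ + E₁ + 2ℚ * D) (n * B)))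
        where
        lemma : ∀ x w D E E₁ → E ≤ E₁ * x → 1ℚ ≤ x → 0ℚ ≤ x → w ≤ x * x → 0ℚ ≤ D → 0ℚ ≤ w → 0ℚ ≤ E₁ → w * (1ℚ + E) + D * (w + 1ℚ) ≤ (1ℚ + E₁ + 2ℚ * D) * (x * (x * x))
        lemma x w D E E₁ h₁ h₂ h₀ h₃ h₄ h₅ h₆ = by (h₅ ⊗ Δ h₁ ⊕ (0≤1 ⊕ h₆ ⊗ h₀ ⊕ h₄) ⊗ Δ h₃ ⊕ (0≤1 ⊕ h₄) ⊗ (h₀ ⊗ h₀ ⊗ Δ h₂) ⊕ h₄ ⊗ (Δ h₂ ⊗ (h₀ ⊗ h₀ ⊕ h₀ ⊕ 0≤1)))
          (solve (x ∷ w ∷ D ∷ E ∷ E₁ ∷ []) ring)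
        lemma₂ : ∀ a b c → a + c ≡ a + b + c - b
        lemma₂ = solve-∀ ring

      B-small : n * B * z ≤ η
      B-small = ≤-trans (≡⇒≤ (cong (n * B *_) z≡)) (lemma x y (n * B) C xy 1≤x 0≤y (0≤n ⊗ 0≤B) nB≤C)
        where
        lemma₂ : ∀ a b c → a + b ≡ a + b + c - c
        lemma₂ = solve-∀ ring
        nB≤C : n * B ≤ C
        nB≤C = by (0≤n ⊗ (0≤n ⊗ 0≤B) ⊕ 0≤n ⊗ 0≤Ω₀ ⊕ (0≤1 ⊕ 0≤E₁ ⊕ nonNegative⁻¹ 2ℚ ⊗ 0≤D)) (lemma₂ (n * (n * B) + n * Ω₀) (1ℚ + E₁ + 2ℚ * D) (n * B))
        lemma : ∀ x y b c → x * y ≡ 1ℚ → 1ℚ ≤ x → 0ℚ ≤ y → 0ℚ ≤ b → b ≤ c → b * ((ℤ.+ 8 / 1) * (y * y)) ≤ 64ℚ * (c * y)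
        lemma x y b c e h₁ h₂ h₃ h₄ = by (nonNegative⁻¹ 64ℚ ⊗ (Δ h₄ ⊗ h₂) ⊕ nonNegative⁻¹ (ℤ.+ 56 / 1) ⊗ (h₃ ⊗ h₂) ⊕ nonNegative⁻¹ (ℤ.+ 8 / 1) ⊗ (h₃ ⊗ h₂ ⊗ (Δ (≡⇒≤ e) ⊕ Δ h₁ ⊗ h₂))) (solve (x ∷ y ∷ b ∷ c ∷ []) ring)

    small : ∀ c → c * (n * n * n * (64ℚ * C)) ≤ x → c * (n * n * n * η) ≤ 1ℚ
    small c h = ≤-trans (≡⇒≤ (lemma c (n * n * n) 64ℚ C y)) (≤-trans (*-monoʳ y 0≤y h) (≡⇒≤ xy))
      where
      lemma : ∀ c n a b y → c * (n * (a * (b * y))) ≡ c * (n * (a * b)) * y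
      lemma = solve-∀ ring

  module Dirichlet-AP (k : ℕ) (pk : Prime k) (k≢2 : k ≢ 2) where
    open Mod k pk
    open Residues k pk

    class-divide : ∀ {u l} → u ∈1‥ φk → l ∈1‥ φk → ∃ λ w → w ∈1‥ φk × (u ℕ.* w) ℕ.% k ≡ l
    class-divide {u} {l} u∈ l∈ = from (divide (class-unit u∈) l)
     where
     from : (∃ λ w → w ℕ.< k × u ℕ.* w ≈ l) → ∃ λ w → w ∈1‥ φk × (u ℕ.* w) ℕ.% k ≡ l
     from (w , w<k , uw≈l) = w , (ℕₚ.n≢0⇒n>0 w≢0 ﹐ ℕₚ.≤-pred (ℕₚ.≤-trans w<k (ℕₚ.≤-reflexive (sym sucφk)))) , uw≡l
      where
      uw≡l : (u ℕ.* w) ℕ.% k ≡ l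
      uw≡l = trans uw≈l (small (class< l∈))
      w≢0 : w ≢ 0
      w≢0 refl = ℕₚ.<⇒≢ (lo l∈) (trans (sym (trans (cong (ℕ._% k) (ℕₚ.*-zeroʳ u)) (small (ℕₚ.<-trans (ℕ.s≤s ℕ.z≤n) 1<k)))) uw≡l)

    n : ℚ
    n = ι φk

    module _ (N : ℕ) where

      -- One constant for three purposes: it exceeds the 6 of `total`, the constant of `compare` and
      -- the bound 2N + 8 of `sparse`. `D` is the constant that `main-each` produces from it.
      B D : ℚ
      B = (ι k + ι k) * 24ℚ + (ℤ.+ 156 / 1) + (2ℚ * ι N + 8ℚ)
      D = 2ℚ * B + B * B + n * B

      0≤B : 0ℚ ≤ B
      0≤B = (0≤ι k ⊕ 0≤ι k) ⊗ nonNegative⁻¹ 24ℚ ⊕ nonNegative⁻¹ (ℤ.+ 156 / 1) ⊕ (nonNegative⁻¹ 2ℚ ⊗ 0≤ι N ⊕ nonNegative⁻¹ 8ℚ)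

      0≤D : 0ℚ ≤ D
      0≤D = nonNegative⁻¹ 2ℚ ⊗ 0≤B ⊕ 0≤B ⊗ 0≤B ⊕ 0≤ι φk ⊗ 0≤B

      6≤B : ℤ.+ 6 / 1 ≤ B
      6≤B = by ((0≤ι k ⊕ 0≤ι k) ⊗ nonNegative⁻¹ 24ℚ ⊕ nonNegative⁻¹ (ℤ.+ 150 / 1) ⊕ (nonNegative⁻¹ 2ℚ ⊗ 0≤ι N ⊕ nonNegative⁻¹ 8ℚ)) (lemma ((ι k + ι k) * 24ℚ) (2ℚ * ι N + 8ℚ))
        where
        lemma : ∀ a b → a + (ℤ.+ 150 / 1) + b ≡ a + (ℤ.+ 156 / 1) + b - (ℤ.+ 6 / 1)
        lemma = solve-∀ ring

      open QuadraticL k pk k≢2 using (Q; 2k)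

      CΞ : ℚ
      CΞ = 2k * (ℤ.+ 10 / 1) * ι Q

      E₁ Ω₀ C : ℚ
      E₁ = (ℤ.+ 4 / 1) * D + 1ℚ + n + n * B
      Ω₀ = 1ℚ + 2ℚ * B + E₁ * (1ℚ + B) + 2ℚ * D
      C  = n * (n * B) + n * Ω₀ + (1ℚ + E₁ + 2ℚ * D) + n * B

      -- The first bound gives 256n³η ≤ 1, the second w - 7 - CΞ ≥ w/2, so that the square class is
      -- heavy, and the third 2^w ≥ Q³, which the lower bound for `Ξ` requires.
      size : ∃ λ m → 1 ℕ.≤ m × ((ℤ.+ 256 / 1) * (n * n * n * ((ℤ.+ 64 / 1) * C)) ≤ ι m) × ((ℤ.+ 14 / 1) + 2ℚ * CΞ ≤ ι m) × Q ℕ.* (Q ℕ.* Q) ℕ.≤ m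
      size = dominate ((ℤ.+ 256 / 1) * (n * n * n * ((ℤ.+ 64 / 1) * C))) ((ℤ.+ 14 / 1) + 2ℚ * CΞ) (Q ℕ.* (Q ℕ.* Q))

      module _ {a : ℕ} (a∈ : a ∈1‥ φk) (m : ℕ) (1≤m : 1 ℕ.≤ m)
        (big₁ : (ℤ.+ 256 / 1) * (n * n * n * ((ℤ.+ 64 / 1) * C)) ≤ ι m) (big₂ : (ℤ.+ 14 / 1) + 2ℚ * CΞ ≤ ι m) (big₃ : Q ℕ.* (Q ℕ.* Q) ℕ.≤ m) where

        -- T* must be a square for the error terms and divisible by 8 for the three halvings; M = 4m
        -- gives T* = 16m² and w = 2m².
        M T* w X : ℕ
        M  = 4 ℕ.* m
        T* = M ℕ.* M
        w  = 2 ℕ.* (m ℕ.* m)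
        X  = 2 ℕ.^ T*

        1≤X : 1 ℕ.≤ X
        1≤X = ℕₚ.m^n>0 2 T*

        open DyadicSums 1≤X (log X) k pk

        private
          instance
            m≢0 : ℕ.NonZero m
            m≢0 = ℕ.>-nonZero 1≤m

          1≤M : 1 ℕ.≤ M
          1≤M = 1≤* {4} (ℕ.s≤s ℕ.z≤n) 1≤m

          instance
            M≢0 : ℕ.NonZero M
            M≢0 = ℕ.>-nonZero 1≤M

          m≤w : m ℕ.≤ w
          m≤w = ℕₚ.≤-trans (ℕₚ.m≤m*n m m) (ℕₚ.m≤n*m (m ℕ.* m) 2)

          1≤w : 1 ℕ.≤ w
          1≤w = ℕₚ.≤-trans 1≤m m≤w

          instance
            w≢0 : ℕ.NonZero w
            w≢0 = ℕ.>-nonZero 1≤w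

          8w≡T* : (w ℕ.+ w ℕ.+ (w ℕ.+ w)) ℕ.+ (w ℕ.+ w ℕ.+ (w ℕ.+ w)) ≡ T*
          8w≡T* = solveℕ 1 (λ m → let w = con 2 :* (m :* m) in (w :+ w :+ (w :+ w)) :+ (w :+ w :+ (w :+ w)) := (con 4 :* m) :* (con 4 :* m)) refl m
            where open +-*-Solver renaming (solve to solveℕ)

          4w≤T* : w ℕ.+ w ℕ.+ (w ℕ.+ w) ℕ.≤ T*
          4w≤T* = ℕₚ.≤-trans (ℕₚ.m≤m+n _ _) (ℕₚ.≤-reflexive 8w≡T*)

          w≤T* : w ℕ.≤ T*
          w≤T* = ℕₚ.≤-trans (ℕₚ.≤-trans (ℕₚ.m≤m+n w w) (ℕₚ.m≤m+n _ _)) 4w≤T*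

          M≤T* : M ℕ.≤ T*
          M≤T* = ℕₚ.m≤m*n M M

          x y z : ℚ
          x = ι M
          y = v M
          z = v w

          z≡ : z ≡ (ℤ.+ 8 / 1) * (y * y)
          z≡ = sym (rc-unique (0<ι w) (begin
            ι w * ((ℤ.+ 8 / 1) * (y * y))        ≡⟨ lemma (ι w) (y * y) ⟩
            ι w * (ℤ.+ 8 / 1) * (y * y)          ≡⟨ cong (_* (y * y)) (sym (trans (cong ι w*8) (ι-* w 8))) ⟩
            ι T* * (y * y)                       ≡⟨ cong (_* (y * y)) (ι-* M M) ⟩
            x * x * (y * y)                      ≡⟨ lemma₂ x y ⟩
            x * y * (x * y)                      ≡⟨ cong₂ _*_ (ι*v M) (ι*v M) ⟩
            1ℚ * 1ℚ ∎))
            where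
            open ≡-Reasoning
            lemma : ∀ a b → a * ((ℤ.+ 8 / 1) * b) ≡ a * (ℤ.+ 8 / 1) * b
            lemma = solve-∀ ring
            lemma₂ : ∀ a b → a * a * (b * b) ≡ a * b * (a * b)
            lemma₂ = solve-∀ ring
            w*8 : T* ≡ w ℕ.* 8
            w*8 = solveℕ 1 (λ m → (con 4 :* m) :* (con 4 :* m) := con 2 :* (m :* m) :* con 8) refl m
              where open +-*-Solver renaming (solve to solveℕ)

          1≤x : 1ℚ ≤ x
          1≤x = ι-mono {1} 1≤M

          w₄ : ℕ
          w₄ = w ℕ.+ w ℕ.+ (w ℕ.+ w)

          module Sz = Sizes x y n B D (ι*v M) 1≤x (0≤v M) (0≤ι φk) 0≤B 0≤D

          module Sc = Tauberian.Scales φk q c T* B 0≤B (λ {u} {i} _ _ → 0≤q u i) (λ u w l → 0≤e l (u ℕ.* w)) c-sum-l c-sum-w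

          total′ : ∀ T → T ℕ.≤ T* → ∣ Sc.Po T - ι T ∣ ≤ B
          total′ T p = ≤-trans (total T* ℕₚ.≤-refl T p) 6≤B

          compare′ : ∀ {l l′} T → l ∈1‥ φk → l′ ∈1‥ φk → T ℕ.≤ T* → ∣ (Sc.τ l T + Sc.K l T) - (Sc.τ l′ T + Sc.K l′ T) ∣ ≤ B * (ι T + 1ℚ)
          compare′ T l∈ l′∈ p = ≤-trans (compare T* ℕₚ.≤-refl T l∈ l′∈ p) (*-monoʳ {(ι k + ι k) * 24ℚ + (ℤ.+ 156 / 1)} {B} (ι T + 1ℚ) (0≤ι T ⊕ 0≤1)
            (by (nonNegative⁻¹ 2ℚ ⊗ 0≤ι N ⊕ nonNegative⁻¹ 8ℚ) (lemma ((ι k + ι k) * 24ℚ + (ℤ.+ 156 / 1)) (2ℚ * ι N + 8ℚ))))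
            where
            lemma : ∀ a b → b ≡ a + b - a
            lemma = solve-∀ ring

          module Mn = Sc.Main total′ D 0≤D (λ T l∈ p → Sc.main-each total′ compare′ T l∈ p) M 1≤M M≤T*

          -- The estimates are polynomial in x = ι M, while the Tauberian error terms mention
          -- `ι T*`; this transports between the two.
          toT : (F : ℚ → Set) → F (x * x) → F (ι T*)
          toT F = subst F (sym (ι-* M M))

        no-primes-absurd : (∀ p → Prime p → N ℕ.≤ p → p ℕ.≤ X → p ℕ.% k ≢ a) → ⊥
        no-primes-absurd none = conclude (QuadraticL.PrimeSums.heavy-square k pk k≢2 1≤X (log X) w (ℕₚ.^-monoʳ-≤ 2 w≤T*) Q≤ (lemma (Sc.Po w) (ι w) (-≤abs (total T* ℕₚ.≤-refl w w≤T*))))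
         where
         Q≤ : Q ℕ.* (Q ℕ.* Q) ℕ.≤ 2 ℕ.^ w
         Q≤ = ℕₚ.≤-trans big₃ (ℕₚ.≤-trans m≤w (ℕₚ.<⇒≤ (n<r^n 2 w ℕₚ.≤-refl)))
         lemma : ∀ a b → - (ℤ.+ 6 / 1) ≤ a - b → b - (ℤ.+ 6 / 1) ≤ a
         lemma a b h = by (Δ h) (solve (a ∷ b ∷ []) ring)
         conclude : (∃ λ g → g ∈1‥ φk × ι w - (ℤ.+ 7 / 1) - CΞ ≤ n * sum w (q ((g ℕ.* g) ℕ.% k))) → ⊥
         conclude (g , g∈ , heavy) = Mn.Conclusion.absurd w 1≤w 8w≡T* Sz.η (ι-mono {1} (ℕₚ.≤-trans (lo a∈) (hi a∈))) Sz.0≤η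
              (Sz.small (ℤ.+ 256 / 1) (≤-trans big₁ (ι-mono (ℕₚ.m≤n*m m 4))))
              (toT (λ T → (n * (n * (T * B)) + n * (T + 2ℚ * (B * T) + ((2ℚ * (D * (T + 1ℚ)) + T) * y + n * (x + B)) * (T + B) + D * (T + 1ℚ))) * (z * z) ≤ Sz.η) (Sz.Θ-small z (ι w₄) z≡ (0≤ι w₄) w₄≤))
              (toT (λ T → (ι w₄ * (1ℚ + ((2ℚ * (D * (T + 1ℚ)) + T) * y + n * (x + B))) + D * (ι w₄ + 1ℚ)) * (z * z) ≤ Sz.η) (Sz.square-small z (ι w₄) z≡ (0≤ι w₄) w₄≤))
              (Sz.B-small z (ι w₄) z≡ (0≤ι w₄) w₄≤)
              a∈ one∈ r∈ (proj₁ (proj₂ b)) g∈ (proj₁ (proj₂ i))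
              (is-product one a (trans (cong (ℕ._% k) (ℕₚ.*-identityˡ a)) (small (class< a∈))))
              (is-product r (proj₁ b) (proj₂ (proj₂ b)))
              (is-product (proj₁ b) r (trans (cong (ℕ._% k) (ℕₚ.*-comm (proj₁ b) r)) (proj₂ (proj₂ b))))
              (is-product g g refl)
              (is-product r (proj₁ i) (proj₂ (proj₂ i)))
              (is-product (proj₁ i) g inverse-g)
              (≤-trans (sparse a N T* ℕₚ.≤-refl none) (by ((0≤ι k ⊕ 0≤ι k) ⊗ nonNegative⁻¹ 24ℚ ⊕ nonNegative⁻¹ (ℤ.+ 156 / 1)) (lemma₂ ((ι k + ι k) * 24ℚ + (ℤ.+ 156 / 1)) (2ℚ * ι N + 8ℚ))))
              (lemma₃ (ι w) CΞ (n * sum w (q r)) heavy (≤-trans big₂ (ι-mono m≤w)))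
          where
          w₄≤ : ι w₄ ≤ x * x
          w₄≤ = ≤-trans (ι-mono 4w≤T*) (≡⇒≤ (ι-* M M))
          lemma₂ : ∀ a b → a ≡ a + b - b
          lemma₂ = solve-∀ ring
          lemma₃ : ∀ w c p → w - (ℤ.+ 7 / 1) - c ≤ p → (ℤ.+ 14 / 1) + 2ℚ * c ≤ w → w ≤ 2ℚ * p
          lemma₃ w c p h₁ h₂ = by (nonNegative⁻¹ 2ℚ ⊗ Δ h₁ ⊕ Δ h₂) (solve (w ∷ c ∷ p ∷ []) ring)
          is-product : ∀ u w {l} → (u ℕ.* w) ℕ.% k ≡ l → c u w l ≡ 1ℚ
          is-product u w {l} = ⟦yes⟧ ((u ℕ.* w) ℕ.% k ℕ.≟ l)
          one : ℕ
          one = 1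
          one∈ : one ∈1‥ φk
          one∈ = ℕₚ.≤-refl ﹐ ℕₚ.≤-trans (lo a∈) (hi a∈)
          r : ℕ
          r = (g ℕ.* g) ℕ.% k
          r∈ : r ∈1‥ φk
          r∈ = class-of (∤-* (class-unit g∈) (class-unit g∈))
          b : ∃ λ b → b ∈1‥ φk × (r ℕ.* b) ℕ.% k ≡ a
          b = class-divide r∈ a∈
          i : ∃ λ i → i ∈1‥ φk × (r ℕ.* i) ℕ.% k ≡ g
          i = class-divide r∈ g∈
          inverse-g : (proj₁ i ℕ.* g) ℕ.% k ≡ 1
          -- The class i was defined by r·i ≡ g with r ≡ g². Hence g·(i·g) ≡ g·1, and g cancels.
          inverse-g = trans (cancel {g} (proj₁ i ℕ.* g) 1 (class-unit g∈) (trans (cong (ℕ._% k) (identity g (proj₁ i))) (trans (*-congʳ (proj₁ i) {g ℕ.* g} {r} (sym (%≈ (g ℕ.* g))))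
              (trans (proj₂ (proj₂ i)) (trans (sym (small (class< g∈))) (cong (ℕ._% k) (sym (ℕₚ.*-identityʳ g)))))))) 1%k
            where
            open +-*-Solver renaming (solve to solveℕ)
            identity : ∀ g i → g ℕ.* (i ℕ.* g) ≡ g ℕ.* g ℕ.* i
            identity = solveℕ 2 (λ g i → g :* (i :* g) := g :* g :* i) refl

      -- Being prime, at least N and in the class is decidable below the explicit bound `X`, so
      -- refuting the absence of such primes produces one.
      primes-in-class : ∀ {a} → a ∈1‥ φk → ∃ λ p → Prime p × N ℕ.≤ p × p ℕ.% k ≡ a
      primes-in-class {a} a∈ = from size
        where
        from : (∃ λ m → 1 ℕ.≤ m × ((ℤ.+ 256 / 1) * (n * n * n * ((ℤ.+ 64 / 1) * C)) ≤ ι m) × ((ℤ.+ 14 / 1) + 2ℚ * CΞ ≤ ι m) × Q ℕ.* (Q ℕ.* Q) ℕ.≤ m) → ∃ λ p → Prime p × N ℕ.≤ p × p ℕ.% k ≡ a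
        from (m , 1≤m , big₁ , big₂ , big₃) = finish (search (λ p → prime? p ×-dec ((N ℕ.≤? p) ×-dec (p ℕ.% k ℕ.≟ a))) (X a∈ m 1≤m big₁ big₂ big₃))
          where
          finish : (∃ λ p → p ∈1‥ X a∈ m 1≤m big₁ big₂ big₃ × (Prime p × N ℕ.≤ p × p ℕ.% k ≡ a)) ⊎ (∀ p → p ∈1‥ X a∈ m 1≤m big₁ big₂ big₃ → ¬ (Prime p × N ℕ.≤ p × p ℕ.% k ≡ a)) → ∃ λ p → Prime p × N ℕ.≤ p × p ℕ.% k ≡ a
          finish (inj₁ (p , _ , found)) = p , found
          finish (inj₂ none) = ⊥-elim (no-primes-absurd a∈ m 1≤m big₁ big₂ big₃ λ p pp N≤p p≤X e → none p (prime≥1 pp ﹐ p≤X) (pp , N≤p , e))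

-- Totient values of the form 2q

module Totient where

  open import Data.Nat as ℕ using (ℕ; zero; suc; _∸_)
  import Data.Nat.Properties as ℕₚ
  open import Data.Nat.Divisibility using (_∣_; _∣?_; divides; ∣-trans; ∣⇒≤; n∣m*n; m∣m*n; ∣-refl; ∣1⇒≡1; ∣m⇒∣m*n; ∣n⇒∣m*n; ∣m+n∣m⇒∣n; ∣m∣n⇒∣m+n)
  open import Data.Nat.Primality using (Prime; euclidsLemma; prime⇒irreducible; prime[2])
  open import Data.Nat.GCD using (gcd)
  open import Data.Nat.Coprimality using (Coprime; gcd≡1⇒coprime; coprime⇒gcd≡1; coprime-divisor)
  open import Data.Nat.Induction using (<-rec)
  open import Data.Rational using (ℚ; 0ℚ; 1ℚ; _+_; _-_; _*_)
  open import Data.Rational.Properties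
  open import Data.Product using (_,_)
  open import Data.Sum using (inj₁; inj₂; _⊎_)
  open import Data.Empty using (⊥; ⊥-elim)
  open import Data.List using ([]; _∷_; _++_; _∷ʳ_; length; filter; map; upTo)
  open import Data.List.Properties using (upTo-∷ʳ; map-++; filter-++; length-++)
  open import Function using (_∘_)
  open import Relation.Nullary using (¬_; yes; no; Dec)
  open import Relation.Binary.PropositionalEquality
  open import Tactic.RingSolver using (solve-∀)
  open import Defs
  open Rationals
  open Sums
  open Convolution
  open Mangoldt using (prime≥1; prime≥2)

  -- The bridge from the list in the definition of `φ` to rational sums. The list is split at its
  -- last element because `Σ₁` grows at that end.
  count-Σ₁ : ∀ {P : ℕ → Set} (P? : ∀ x → Dec (P x)) n → ι (length (filter P? (map suc (upTo n)))) ≡ Σ₁ n (λ x → ⟦ P? x ⟧)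
  count-Σ₁ P? zero    = sym (Σ₁-0 _)
  count-Σ₁ P? (suc n) = trans (cong ι (begin
      length (filter P? (map suc (upTo (suc n))))                            ≡⟨ cong (λ xs → length (filter P? (map suc xs))) (sym (upTo-∷ʳ n)) ⟩
      length (filter P? (map suc (upTo n ∷ʳ n)))                             ≡⟨ cong (length ∘ filter P?) (map-++ suc (upTo n) (n ∷ [])) ⟩
      length (filter P? (map suc (upTo n) ++ suc n ∷ []))                    ≡⟨ cong length (filter-++ P? (map suc (upTo n)) (suc n ∷ [])) ⟩
      length (filter P? (map suc (upTo n)) ++ filter P? (suc n ∷ []))        ≡⟨ length-++ (filter P? (map suc (upTo n))) ⟩
      length (filter P? (map suc (upTo n))) ℕ.+ length (filter P? (suc n ∷ [])) ∎))
    (trans (ι-+ (length (filter P? (map suc (upTo n)))) _) (trans (cong₂ _+_ (count-Σ₁ P? n) single) (sym (Σ₁-suc n _))))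
    where
    open ≡-Reasoning
    single : ι (length (filter P? (suc n ∷ []))) ≡ ⟦ P? (suc n) ⟧
    single with P? (suc n) in eq
    ... | yes p = sym (⟦yes⟧ (yes p) p)
    ... | no p  = sym (⟦no⟧ (no p) p)

  cop : ℕ → ℕ → ℚ
  cop n x = ⟦ gcd x n ℕ.≟ 1 ⟧

  ι-φ : ∀ n → ι (φ n) ≡ Σ₁ n (cop n)
  ι-φ n = count-Σ₁ (λ x → gcd x n ℕ.≟ 1) n

  private
    to : ∀ {x n} → gcd x n ≡ 1 → Coprime x n
    to {x} {n} = gcd≡1⇒coprime {x} {n}

    from : ∀ {x n} → Coprime x n → gcd x n ≡ 1
    from = coprime⇒gcd≡1

    coprime-shift : ∀ {x m} → Coprime x m → Coprime (m ℕ.+ x) m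
    coprime-shift c (d , d′) = c (∣m+n∣m⇒∣n d d′ , d′)

    coprime-unshift : ∀ {x m} → Coprime (m ℕ.+ x) m → Coprime x m
    coprime-unshift c (d , d′) = c (∣m∣n⇒∣m+n d′ d , d′)

    periodic : ∀ m x → cop m (m ℕ.+ x) ≡ cop m x
    periodic m x = ⟦⟧-cong (gcd (m ℕ.+ x) m ℕ.≟ 1) (gcd x m ℕ.≟ 1) (λ e → from (coprime-unshift (to {m ℕ.+ x} e))) (λ e → from (coprime-shift (to {x} e)))

    sum-periods : ∀ r m → Σ₁ (r ℕ.* m) (cop m) ≡ ι r * ι (φ m)
    sum-periods zero    m = trans (Σ₁-0 _) (sym (*-zeroˡ (ι (φ m))))
    sum-periods (suc r) m = trans (Σ₁-split m (r ℕ.* m) (cop m)) (trans (cong₂ _+_ (sym (ι-φ m)) (trans (Σ₁-cong (r ℕ.* m) λ x _ → periodic m x) (sum-periods r m))) (lemma (ι r) (ι (φ m))))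
      where
      lemma : ∀ a b → b + a * b ≡ (1ℚ + a) * b
      lemma = solve-∀ ring

    coprime-*ˡ : ∀ {x r m} → Coprime x (r ℕ.* m) → Coprime x m
    coprime-*ˡ {r = r} c (d , d′) = c (d , ∣n⇒∣m*n r d′)

    coprime-prime-* : ∀ {x r m} → Prime r → ¬ r ∣ x → Coprime x m → Coprime x (r ℕ.* m)
    coprime-prime-* {x} {r} {m} pr ¬d c {i} (d , d′) = c (d , coprime-divisor i⊥r d′)
      where
      i⊥r : Coprime i r
      i⊥r (e , e′) with prime⇒irreducible pr e′
      ... | inj₁ eq   = eq
      ... | inj₂ refl = ⊥-elim (¬d (∣-trans e d))

    prime∤ : ∀ {r x n} → Prime r → Coprime x n → r ∣ n → ¬ r ∣ x
    prime∤ pr c d d′ = ℕₚ.<⇒≢ (prime≥2 pr) (sym (c (d′ , d)))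

  -- If r divides m, coprimality to r·m and to m coincide, and the range 1, ..., rm consists of r
  -- periods of the latter.
  φ-∣ : ∀ {r m} → Prime r → r ∣ m → φ (r ℕ.* m) ≡ r ℕ.* φ m
  φ-∣ {r} {m} pr d = ι-injective (trans (ι-φ (r ℕ.* m)) (trans (Σ₁-cong (r ℕ.* m) λ x _ →
      ⟦⟧-cong (gcd x (r ℕ.* m) ℕ.≟ 1) (gcd x m ℕ.≟ 1) (λ e → from (coprime-*ˡ {x} {r} (to {x} e))) (λ e → from (coprime-prime-* pr (prime∤ pr (to {x} e) d) (to {x} e))))
    (trans (sum-periods r m) (sym (ι-* r (φ m))))))

  -- Among the r·φ(m) integers up to rm that are coprime to m, those divisible by r are r·y with y
  -- coprime to m; there are φ(m) of them to remove.
  φ-∤ : ∀ {r m} → Prime r → ¬ r ∣ m → φ (r ℕ.* m) ≡ (r ∸ 1) ℕ.* φ m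
  φ-∤ {r} {m} pr ¬d = ι-injective (trans (ι-φ (r ℕ.* m)) (trans (Σ₁-cong (r ℕ.* m) λ x _ → pointwise x) (trans (Σ₁-- (r ℕ.* m) _ _)
    (trans (cong₂ _-_ (sum-periods r m) (trans (Σ₁-multiples r m (cop m) (prime≥1 pr)) (trans (Σ₁-cong m λ y _ → multiple y) (sym (ι-φ m))))) finish))))
    where
    multiple : ∀ y → cop m (r ℕ.* y) ≡ cop m y
    multiple y = ⟦⟧-cong (gcd (r ℕ.* y) m ℕ.≟ 1) (gcd y m ℕ.≟ 1)
      (λ e → from {y} λ { (d , d′) → to {r ℕ.* y} e (∣n⇒∣m*n r d , d′) })
      (λ e → from {r ℕ.* y} λ { {i} (d , d′) → to {y} e (coprime-divisor {i} {r} {y} (λ { (e₁ , e₂) → case e₁ e₂ d′ }) d , d′) })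
      where
      case : ∀ {j i} → j ∣ i → j ∣ r → i ∣ m → j ≡ 1
      case e₁ e₂ d′ with prime⇒irreducible pr e₂
      ... | inj₁ eq   = eq
      ... | inj₂ refl = ⊥-elim (¬d (∣-trans e₁ d′))
    lemma₀ : ∀ a → a ≡ a - 0ℚ * a
    lemma₀ = solve-∀ ring
    lemma₁ : ∀ a → 0ℚ ≡ a - 1ℚ * a
    lemma₁ = solve-∀ ring
    pointwise : ∀ x → cop (r ℕ.* m) x ≡ cop m x - ⟦ r ∣? x ⟧ * cop m x
    pointwise x = cases (r ∣? x)
      where
      cases : Dec (r ∣ x) → cop (r ℕ.* m) x ≡ cop m x - ⟦ r ∣? x ⟧ * cop m x
      cases (no d)  = trans (⟦⟧-cong (gcd x (r ℕ.* m) ℕ.≟ 1) (gcd x m ℕ.≟ 1) (λ e → from (coprime-*ˡ {x} {r} (to {x} e))) (λ e → from (coprime-prime-* pr d (to {x} e))))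
        (trans (lemma₀ (cop m x)) (cong (λ z → cop m x - z * cop m x) (sym (⟦no⟧ (r ∣? x) d))))
      cases (yes d) = trans (⟦no⟧ (gcd x (r ℕ.* m) ℕ.≟ 1) λ e → prime∤ pr (to {x} e) (m∣m*n m) d)
        (trans (lemma₁ (cop m x)) (cong (λ z → cop m x - z * cop m x) (sym (⟦yes⟧ (r ∣? x) d))))
    finish : ι r * ι (φ m) - ι (φ m) ≡ ι ((r ∸ 1) ℕ.* φ m)
    finish = trans (cong (λ z → ι z * ι (φ m) - ι (φ m)) (sym (ℕₚ.m+[n∸m]≡n (prime≥1 pr)))) (trans (lemma (ι (r ∸ 1)) (ι (φ m))) (sym (ι-* (r ∸ 1) (φ m))))
      where
      lemma : ∀ a b → (1ℚ + a) * b - b ≡ a * b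
      lemma = solve-∀ ring

  odd-prime : ∀ {r} → Prime r → r ≢ 2 → 2 ∣ r ∸ 1
  odd-prime {suc r} pr ne with 2 ∣? r
  ... | yes d = d
  ... | no d  = ⊥-elim (ne (sym (∣-prime⇒≡ prime[2] pr (even-suc r d))))
    where
    even-suc : ∀ r → ¬ 2 ∣ r → 2 ∣ suc r
    even-suc zero          d = ⊥-elim (d (divides 0 refl))
    even-suc (suc zero)    d = ∣-refl
    even-suc (suc (suc r)) d = ∣m∣n⇒∣m+n {2} {2} ∣-refl (even-suc r λ d′ → d (∣m∣n⇒∣m+n {2} {2} ∣-refl d′))

  private
    record Split (n : ℕ) : Set where
      field
        r m : ℕ
        pr  : Prime r
        eq  : r ℕ.* m ≡ n
        1≤m : 1 ℕ.≤ m
        m<n : m ℕ.< n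

    split : ∀ n → 2 ℕ.≤ n → Split n
    split n 2≤n with prime-factor n 2≤n
    ... | r , pr , divides zero refl = ⊥-elim (ℕₚ.<⇒≱ 2≤n ℕ.z≤n)
    ... | r , pr , divides m@(suc _) e = record
      { r = r ; m = m ; pr = pr ; eq = trans (ℕₚ.*-comm r m) (sym e) ; 1≤m = ℕ.s≤s ℕ.z≤n
      ; m<n = ℕₚ.<-≤-trans (ℕₚ.m<m*n m r (prime≥2 pr)) (ℕₚ.≤-reflexive (sym e)) }

    -- Splitting one factor r off m leaves r or r - 1 as a factor of φ(m). Below this excludes φ(m)
    -- = 1 for odd r and φ(m) = 2 for r ≥ 4.
    pred∣φ : ∀ {r m} → Prime r → r ∣ m → r ∸ 1 ∣ φ m ⊎ r ∣ φ m
    pred∣φ {r} pr (divides m refl) with r ∣? m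
    ... | yes d = inj₂ (subst (r ∣_) (sym (trans (cong φ (ℕₚ.*-comm m r)) (φ-∣ pr d))) (m∣m*n (φ m)))
    ... | no d  = inj₁ (subst (r ∸ 1 ∣_) (sym (trans (cong φ (ℕₚ.*-comm m r)) (φ-∤ pr d))) (m∣m*n (φ m)))

  -- An odd prime factor r contributes the even number r - 1. Consequently an odd prime is never a
  -- value of φ.
  φ-parity : ∀ n → 1 ℕ.≤ n → φ n ≡ 1 ⊎ 2 ∣ φ n
  φ-parity = <-rec _ step
    where
    step : ∀ n → (∀ {m} → m ℕ.< n → 1 ℕ.≤ m → φ m ≡ 1 ⊎ 2 ∣ φ m) → 1 ℕ.≤ n → φ n ≡ 1 ⊎ 2 ∣ φ n
    step (suc zero)      IH _ = inj₁ refl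
    step n@(suc (suc _)) IH _ with split n (ℕ.s≤s (ℕ.s≤s ℕ.z≤n))
    ... | record { r = r ; m = m ; pr = pr ; eq = eq ; 1≤m = 1≤m ; m<n = m<n } with r ∣? m | r ℕ.≟ 2 | IH m<n 1≤m
    ...   | yes d | _        | inj₂ e = inj₂ (subst (2 ∣_) (trans (sym (φ-∣ pr d)) (cong φ eq)) (∣n⇒∣m*n r e))
    ...   | yes d | yes refl | inj₁ _ = inj₂ (subst (2 ∣_) (trans (sym (φ-∣ pr d)) (cong φ eq)) (m∣m*n (φ m)))
    ...   | yes d | no ne    | inj₁ e = ⊥-elim (contra (pred∣φ pr d))
      where
      contra : r ∸ 1 ∣ φ m ⊎ r ∣ φ m → ⊥
      contra (inj₁ x) = ne (trans (sym (ℕₚ.m+[n∸m]≡n (prime≥1 pr))) (cong suc (∣1⇒≡1 (subst (r ∸ 1 ∣_) e x))))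
      contra (inj₂ x) = ℕₚ.<⇒≢ (prime≥2 pr) (sym (∣1⇒≡1 (subst (r ∣_) e x)))
    ...   | no d  | yes refl | IHm = subst (λ z → z ≡ 1 ⊎ 2 ∣ z) (trans (sym (ℕₚ.*-identityˡ (φ m))) (trans (sym (φ-∤ pr d)) (cong φ eq))) IHm
    ...   | no d  | no ne    | _ = inj₂ (subst (2 ∣_) (trans (sym (φ-∤ pr d)) (cong φ eq)) (∣m⇒∣m*n (φ m) (odd-prime pr ne)))

  -- Induction on n = r·m with r prime. For r = 2, either φ(m) = q, against parity, or φ(m) = 2q
  -- with m smaller. For odd r dividing m, r·φ(m) = 2q forces r = q and φ(m) = 2, but r - 1 or r
  -- divides φ(m) and r ≥ 4. For odd r not dividing m, ((r - 1)/2)·φ(m) = q: either φ(m) = q again,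
  -- or r = 2q + 1 would be prime.
  2q∉φ : ∀ {q} → Prime q → 4 ℕ.≤ q → ¬ Prime (2 ℕ.* q ℕ.+ 1) → ∀ n → 1 ℕ.≤ n → φ n ≢ 2 ℕ.* q
  2q∉φ {q} pq 4≤q ¬p = <-rec _ step
    where
    q≢2 : q ≢ 2
    q≢2 refl = ℕₚ.<⇒≱ (ℕ.s≤s (ℕ.s≤s (ℕ.s≤s ℕ.z≤n))) 4≤q
    φ≢q : ∀ m → 1 ℕ.≤ m → φ m ≢ q
    φ≢q m 1≤m e with φ-parity m 1≤m
    ... | inj₁ e′ = ℕₚ.<⇒≢ (prime≥2 pq) (trans (sym e′) e)
    ... | inj₂ d  = q≢2 (sym (∣-prime⇒≡ prime[2] pq (subst (2 ∣_) e d)))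
    step : ∀ n → (∀ {m} → m ℕ.< n → 1 ℕ.≤ m → φ m ≢ 2 ℕ.* q) → 1 ℕ.≤ n → φ n ≢ 2 ℕ.* q
    step (suc zero)      IH _ e = ℕₚ.<⇒≢ (prime≥2 pq) (sym (∣1⇒≡1 (subst (q ∣_) (sym e) (n∣m*n 2))))
    step n@(suc (suc _)) IH _ e with split n (ℕ.s≤s (ℕ.s≤s ℕ.z≤n))
    ... | record { r = r ; m = m ; pr = pr ; eq = eq ; 1≤m = 1≤m ; m<n = m<n } with r ∣? m | r ℕ.≟ 2
    ...   | yes d | yes refl = φ≢q m 1≤m (ℕₚ.*-cancelˡ-≡ (φ m) q 2 (trans (sym (φ-∣ pr d)) (trans (cong φ eq) e)))
    ...   | no d  | yes refl = IH m<n 1≤m (trans (sym (ℕₚ.*-identityˡ (φ m))) (trans (sym (φ-∤ pr d)) (trans (cong φ eq) e)))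
    ...   | yes d | no ne    = contra (pred∣φ pr d)
      where
      e₁ : r ℕ.* φ m ≡ 2 ℕ.* q
      e₁ = trans (sym (φ-∣ pr d)) (trans (cong φ eq) e)
      r≡q : r ≡ q
      r≡q with euclidsLemma 2 q pr (subst (r ∣_) e₁ (m∣m*n (φ m)))
      ... | inj₁ x = ⊥-elim (ne (∣-prime⇒≡ pr prime[2] x))
      ... | inj₂ x = ∣-prime⇒≡ pr pq x
      φm≡2 : φ m ≡ 2
      φm≡2 = ℕₚ.*-cancelˡ-≡ (φ m) 2 q {{ℕ.>-nonZero (prime≥1 pq)}} (trans (cong (ℕ._* φ m) (sym r≡q)) (trans e₁ (ℕₚ.*-comm 2 q)))
      4≤r : 4 ℕ.≤ r
      4≤r = subst (4 ℕ.≤_) (sym r≡q) 4≤q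
      contra : r ∸ 1 ∣ φ m ⊎ r ∣ φ m → ⊥
      contra (inj₁ x) = ℕₚ.<⇒≱ (ℕₚ.∸-monoˡ-≤ 1 4≤r) (∣⇒≤ (subst (r ∸ 1 ∣_) φm≡2 x))
      contra (inj₂ x) = ℕₚ.<⇒≱ (ℕₚ.≤-trans (ℕₚ.n≤1+n 3) 4≤r) (∣⇒≤ (subst (r ∣_) φm≡2 x))
    ...   | no d  | no ne with odd-prime pr ne
    ...     | divides s es = cases (prime⇒irreducible pq (divides (φ m) (trans (sym e₂) (ℕₚ.*-comm s (φ m)))))
      where
      e₂ : s ℕ.* φ m ≡ q
      e₂ = ℕₚ.*-cancelˡ-≡ (s ℕ.* φ m) q 2 (trans (sym (ℕₚ.*-assoc 2 s (φ m))) (trans (cong (ℕ._* φ m) (trans (ℕₚ.*-comm 2 s) (sym es))) (trans (sym (φ-∤ pr d)) (trans (cong φ eq) e))))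
      cases : s ≡ 1 ⊎ s ≡ q → ⊥
      cases (inj₁ refl) = φ≢q m 1≤m (trans (sym (ℕₚ.*-identityˡ (φ m))) e₂)
      cases (inj₂ refl) = ¬p (subst Prime (trans (sym (ℕₚ.m+[n∸m]≡n (prime≥1 pr))) (trans (cong suc (trans es (ℕₚ.*-comm s 2))) (ℕₚ.+-comm 1 (2 ℕ.* s)))) pr)

-- Primes q congruent to (p - 1)/2 modulo p

module Witness where

  open import Data.Nat
  open import Data.Nat.Properties
  open import Data.Nat.DivMod using (m≡m%n+[m/n]*n)
  open import Data.Nat.Divisibility
  open import Data.Nat.Primality using (Prime)
  open import Data.Nat.Solver using (module +-*-Solver)
  open import Data.Product using (_,_; _×_; ∃; ∃-syntax)
  open import Data.Empty using (⊥-elim)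
  open import Relation.Nullary using (¬_)
  open import Relation.Binary.PropositionalEquality
  open import Defs
  open Sums
  open Convolution
  open Mangoldt
  open Residue
  open Selberg
  open Totient
  open Progressions

  -- S(p) is taken to be the set of all q with the required properties, so that only its infinitude
  -- remains to be shown.
  Witnesses : ℕ → ℕ → Set
  Witnesses p q = Prime q × ¬ InImageφ (2 * q) × p ∣ (2 * q + 1)

  module _ (p : ℕ) (pp : Prime p) (p≢2 : p ≢ 2) where
    open Mod p pp
    open Residues p pp
    open Dirichlet-AP p pp p≢2

    half-class : ∀ {a} → p ∸ 1 ≡ a * 2 → a ∈1‥ φk
    half-class {zero}  e = ⊥-elim (<⇒≱ (prime≥2 pp) (m∸n≡0⇒m≤n e))
    half-class {suc a} e = s≤s z≤n ﹐ ≤-trans (m≤m*n (suc a) 2) (≤-reflexive (sym (trans (sym pred≡) e)))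
      where
      pred≡ : p ∸ 1 ≡ φk
      pred≡ = cong (_∸ 1) (sym sucφk)

    p∣2q+1 : ∀ {a q} → p ∸ 1 ≡ a * 2 → q % p ≡ a → p ∣ 2 * q + 1
    p∣2q+1 {a} {q} e eq = divides (1 + 2 * c) (begin
      2 * q + 1                  ≡⟨ cong (λ z → 2 * z + 1) (trans (m≡m%n+[m/n]*n q p) (cong (_+ c * p) eq)) ⟩
      2 * (a + c * p) + 1        ≡⟨ solve 3 (λ a c p → con 2 :* (a :+ c :* p) :+ con 1 := (con 1 :+ a :* con 2) :+ con 2 :* c :* p) refl a c p ⟩
      (1 + a * 2) + 2 * c * p    ≡⟨ cong (_+ 2 * c * p) (trans (cong suc (sym e)) (m+[n∸m]≡n (prime≥1 pp))) ⟩
      (1 + 2 * c) * p ∎)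
      where
      open ≡-Reasoning
      open +-*-Solver
      c = q / p

    witness : ∀ {q} → Prime q → p ≤ q → 4 ≤ q → p ∣ 2 * q + 1 → Witnesses p q
    witness {q} pq p≤q 4≤q d = pq , (λ { (n , 1≤n , e) → 2q∉φ pq 4≤q composite n 1≤n e }) , d
      where
      -- If 2q + 1 were prime, its prime divisor p would equal it, but p ≤ q < 2q + 1.
      composite : ¬ Prime (2 * q + 1)
      composite pr = <⇒≢ (≤-<-trans p≤q (≤-<-trans (m≤n*m q 2) (≤-reflexive (sym (+-comm (2 * q) 1))))) (∣-prime⇒≡ pp pr d)

    infinitely-many : ∀ N → ∃[ q ] (N ≤ q × Witnesses p q)
    infinitely-many N = from (odd-prime pp p≢2)
      where
      from : 2 ∣ p ∸ 1 → ∃[ q ] (N ≤ q × Witnesses p q)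
      -- The bound N + (p + 4) secures at once q ≥ N, q ≥ p for compositeness and q ≥ 4 for the
      -- totient argument.
      from (divides a e) = build (primes-in-class (N + (p + 4)) (half-class e))
        where
        build : (∃ λ q → Prime q × N + (p + 4) ≤ q × q % p ≡ a) → ∃[ q ] (N ≤ q × Witnesses p q)
        build (q , pq , N≤q , eq) = q , ≤-trans (m≤m+n N (p + 4)) N≤q
          , witness pq (≤-trans (≤-trans (m≤m+n p 4) (m≤n+m (p + 4) N)) N≤q) (≤-trans (≤-trans (m≤n+m 4 p) (m≤n+m (p + 4) N)) N≤q) (p∣2q+1 e eq)

open import Defs
open import Data.Nat using (ℕ; _+_; _*_; _≤_)
open import Data.Nat.Primality using (Prime)
open import Data.Nat.Divisibility using (_∣_)
open import Data.Product using (Σ; ∃-syntax; _×_)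
open import Relation.Nullary using (¬_)
open import Relation.Binary.PropositionalEquality using (_≢_)

theorem3 : (p : ℕ) → Prime p → p ≢ 2 →
    Σ (ℕ → Set) λ S →
    ((q : ℕ) → S q → Prime q × ¬ InImageφ (2 * q) × p ∣ (2 * q + 1))
    × ((N : ℕ) → ∃[ q ] (N ≤ q × S q))
theorem3 p pp p≢2 = Witnesses p , (λ _ s → s) , infinitely-many p pp p≢2
  where
  open import Data.Product using (_,_)
  open Witness using (Witnesses; infinitely-many)
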